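{- Let $d\ge1$ and $n\ge1$ be integers and let $a_1,\ldots,a_{2d}$ be integers with $\gcd(a_i,n)=1$ for all $i$ and $\sum_{i=1}^{2d}a_i/n\in\mathbb{Z}$ (i.e. $\mathbb{C}^{2d}/\mu_n$ of type $(a_1/n,\ldots,a_{2d}/n)$ is an isolated Gorenstein cyclic quotient singularity). Then the following are equivalent: (1) the minimal log-discrepancy of $(a_1/n,\ldots,a_{2d}/n)$ is at least $d$, i.e. $\sum_{i=1}^{2d}\{ta_i/n\}\ge d$ for all $t=1,\ldots,n-1$; (2) after reordering the $a_i$, one has $a_{2i-1}\equiv -a_{2i}\pmod n$ for all $i=1,\ldots,d$.
   Context: The cyclic quotient singularity of type $(a_1/n,\ldots,a_m/n)$ is $\mathbb{C}^m/\mu_n$ where $\zeta\in\mu_n$ acts by $(x_1,\ldots,x_m)\mapsto(\zeta^{a_1}x_1,\ldots,\zeta^{a_m}x_m)$. Its minimal log-discrepancy is $\min\{\sum_{i=1}^m\{ta_i/n\}: t=1,\ldots,n-1\}$, where $\{x\}=x-\lfloor x\rfloor$. It is isolated iff $\gcd(a_i,n)=1$ for all $i$, and Gorenstein iff $\sum_i a_i/n\in\mathbb{Z}$. -}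

module Defs where

open import Data.Nat as ℕ using (ℕ; NonZero)
open import Data.Integer as ℤ using (ℤ; +_)
open import Data.Integer.Divisibility using () renaming (_∣_ to _∣ℤ_)
open import Data.Nat.Coprimality using (Coprime)
open import Data.Rational as ℚ using (ℚ; _/_; floor)
open import Data.Fin using (Fin; toℕ)
open import Data.Fin.Permutation using (Permutation′; _⟨$⟩ʳ_)
open import Data.List using (List; map; sum; upTo; allFin)
open import Data.Product using (∃; _×_)

-- fractional part {x} = x - ⌊x⌋  (stdlib's fracPart truncates toward 0, so we define it)
frac : ℚ → ℚ
frac p = p ℚ.- (floor p / 1)

sumFin : (m : ℕ) → (Fin m → ℚ) → ℚ
sumFin m f = Data.List.foldr ℚ._+_ ℚ.0ℚ (map f (allFin m))

fracSum : (m n : ℕ) .{{_ : NonZero n}} → (Fin m → ℤ) → ℕ → ℚ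
fracSum m n a t = sumFin m (λ i → frac (((+ t) ℤ.* a i) / n))

MLD≥ : (m n : ℕ) .{{_ : NonZero n}} → (Fin m → ℤ) → ℕ → Set
MLD≥ m n a d = (t : ℕ) → 1 ℕ.≤ t → t ℕ.< n → (+ d) / 1 ℚ.≤ fracSum m n a t

Isolated : (m n : ℕ) → (Fin m → ℤ) → Set
Isolated m n a = (i : Fin m) → Coprime (ℤ.∣ a i ∣) n

sumℤ : (m : ℕ) → (Fin m → ℤ) → ℤ
sumℤ m f = Data.List.foldr ℤ._+_ (+ 0) (map f (allFin m))

Gorenstein : (m n : ℕ) → (Fin m → ℤ) → Set
Gorenstein m n a = (+ n) ∣ℤ sumℤ m a

-- after reordering by σ, a_{σ(2i)} ≡ - a_{σ(2i+1)} (mod n); positions 2i, 2i+1 (0-based)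
-- in Fin (d * 2) are  combine i 0  and  combine i 1.
PairsUp : (d n : ℕ) → (Fin (d ℕ.* 2) → ℤ) → Set
PairsUp d n a = ∃ λ (σ : Permutation′ (d ℕ.* 2)) → (i : Fin d) →
  (+ n) ∣ℤ (a (σ ⟨$⟩ʳ Data.Fin.combine i Data.Fin.zero)
            ℤ.+ a (σ ⟨$⟩ʳ Data.Fin.combine i (Data.Fin.suc Data.Fin.zero)))

{-# OPTIONS --safe #-}
module Submission where

-- Reflecting t ↦ n − t shows that a minimal log-discrepancy of at least d forces ∑ᵢ {t aᵢ/n} = d for
-- all t ≢ 0.  Expanding the sawtooth in cotangents turns these relations into ∑ v_g(m)/m = 0 for every
-- unit g, where v_g(m) counts the i with aᵢ m ≡ g minus those with aᵢ m ≡ −g.  To stay inside ℚ, the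
-- cotangent is replaced by the symmetric partial sums of ∑_j 1/(a + nj), for which Eisenstein's addition
-- law holds up to null sequences: sum 1/pq + 1/qr + 1/rp = 0 (p + q + r = 0) over a hexagon.
-- The vanishing says that L(1,χ) = 0 for some odd χ mod n, unless v_g(1) = 0 for all g.  It is refuted
-- for all χ at once: ζ(s)² L(s,χ) L(s,χ̄) = ζ(2s) ∑_r |∑_{k∣r} χ(k)|² r^{-s} has nonnegative coefficients,
-- and those at squares make its smoothed partial sums up to X of order at least √X, whereas the
-- vanishing bounds them by a power of log X.  Hence g and −g occur equally often among the aᵢ, which pairs
-- the weights up.

-- Each analytic object has a rational substitute. The number (π/n)² becomes a bounded sequence
-- `qₙ`, produced by the corners that the hexagon leaves out of the square. Sine and cosine of the
-- double angle are rational in the cotangent and `qₙ`, so the expansion of the sawtooth needs only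
-- polynomial identities and null sequences. Characters give way to the functions v_g, which the
-- units permute: their Gram matrix is invariant under scaling by units, and this is all that
-- positivity takes from orthogonality. The hard point is the power of log X. As v_g is periodic
-- with mean 0, a vanishing series has partial sums O(1/N), which removes the main term from the
-- Riesz means of the coefficients of ζ(s)L(s,χ) and leaves O(s log s). Two such means must then be
-- multiplied so that the weight depends on the product uv alone. Summing over j a ramp in u times
-- the weight v²(N - jv) in v gives a multiple of (X - uv)³ plus a term of lower order in R,
-- provided that R = N/X is divisible by every v ≤ X.

open import Defs
import Data.Nat
open import Data.Nat as ℕ using (ℕ; zero; suc; z≤n; s≤s)
import Data.Nat.Properties as ℕₚ
import Data.Nat.DivMod as ℕ
import Data.Nat.Solver
open import Data.Nat.Divisibility as ℕ∣ using (_∣_; _∣?_)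
open import Data.Nat.GCD as GCD using (gcd)
open import Data.Nat.Coprimality as Cop using (Coprime; coprime?)
open import Data.Integer as ℤ using (ℤ)
import Data.Integer.Properties as ℤₚ
import Data.Integer.DivMod as ℤD
import Data.Integer.Divisibility as ℤ∣
import Data.Integer.Divisibility.Signed as ℤ∣ₛ
import Data.Integer.Solver
open import Data.Rational as ℚ using (ℚ; 0ℚ; 1ℚ; _+_; _*_; _-_; -_; _≤_; _<_; ∣_∣)
open import Data.Rational.Properties as ℚₚ using (≤-refl; ≤-trans; ≤-reflexive)
open import Data.Rational.Solver using (module +-*-Solver)
import Data.Rational.Unnormalised as ℚᵘ
import Data.Rational.Unnormalised.Properties as ℚᵘₚ
open import Data.Fin using (Fin; zero; suc; combine; punchIn)
import Data.Fin.Properties as Finₚ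
open import Data.Fin.Permutation as Perm using (Permutation′; _⟨$⟩ʳ_)
import Data.List as List
import Data.List.Properties as Listₚ
open import Data.Product using (∃; _×_; _,_; proj₁; proj₂)
open import Data.Sum using (_⊎_; inj₁; inj₂)
open import Data.Empty using (⊥; ⊥-elim)
open import Function using (_∘_; _$_)
open import Relation.Nullary using (¬_; Dec; yes; no)
open import Relation.Binary.PropositionalEquality
open import Algebra.Properties.CommutativeMonoid.Sum ℚₚ.+-0-commutativeMonoid using (sum; sum-permute; sum-remove)
open Data.Nat.Solver.+-*-Solver using () renaming (solve to solveℕ; _:+_ to _⊹_; _:*_ to _⊠_; _:=_ to _≜_; con to κℕ)
open Data.Integer.Solver.+-*-Solver using () renaming (solve to solveℤ; _:+_ to _⊞_; _:*_ to _⊡_; :-_ to ⊟_; _:=_ to _≐_; con to κℤ)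
open +-*-Solver using (solve; _:+_; _:*_; _:-_; :-_; _:=_; con)

-- Ordered field

0≤-diff : ∀ {p q} → p ≤ q → 0ℚ ≤ q - p
0≤-diff {p} {q} p≤q = subst (_≤ q - p) (ℚₚ.+-inverseʳ p) (ℚₚ.+-monoˡ-≤ (- p) p≤q)

≤-by : ∀ {p q} r → 0ℚ ≤ r → q ≡ p + r → p ≤ q
≤-by {p} {q} r 0≤r q≡p+r = subst₂ _≤_ (ℚₚ.+-identityʳ p) (sym q≡p+r) (ℚₚ.+-monoʳ-≤ p 0≤r)

0≤+ : ∀ {p q} → 0ℚ ≤ p → 0ℚ ≤ q → 0ℚ ≤ p + q
0≤+ {p} {q} 0≤p 0≤q = subst (_≤ p + q) (ℚₚ.+-identityˡ 0ℚ) (ℚₚ.+-mono-≤ 0≤p 0≤q)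

*-monoˡ : ∀ {p q r} → 0ℚ ≤ r → p ≤ q → r * p ≤ r * q
*-monoˡ {r = r} 0≤r p≤q = ℚₚ.*-monoˡ-≤-nonNeg r {{ℚ.nonNegative 0≤r}} p≤q

*-monoʳ : ∀ {p q r} → 0ℚ ≤ r → p ≤ q → p * r ≤ q * r
*-monoʳ {r = r} 0≤r p≤q = ℚₚ.*-monoʳ-≤-nonNeg r {{ℚ.nonNegative 0≤r}} p≤q

0≤* : ∀ {p q} → 0ℚ ≤ p → 0ℚ ≤ q → 0ℚ ≤ p * q
0≤* {p} {q} 0≤p 0≤q = subst (_≤ p * q) (ℚₚ.*-zeroʳ p) (*-monoˡ 0≤p 0≤q)

*-mono : ∀ {p q r s} → 0ℚ ≤ p → 0ℚ ≤ s → p ≤ q → r ≤ s → p * r ≤ q * s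
*-mono 0≤p 0≤s p≤q r≤s = ≤-trans (*-monoˡ 0≤p r≤s) (*-monoʳ 0≤s p≤q)

*0 : ∀ p {q} → q ≡ 0ℚ → p * q ≡ 0ℚ
*0 p q≡0 = trans (cong (p *_) q≡0) (ℚₚ.*-zeroʳ p)

0* : ∀ {p} q → p ≡ 0ℚ → p * q ≡ 0ℚ
0* q p≡0 = trans (cong (_* q) p≡0) (ℚₚ.*-zeroˡ q)

0≤1 : 0ℚ ≤ 1ℚ
0≤1 = ℚₚ.nonNegative⁻¹ 1ℚ

0<1 : 0ℚ < 1ℚ
0<1 = ℚₚ.positive⁻¹ 1ℚ

1≰0 : ¬ 1ℚ ≤ 0ℚ
1≰0 1≤0 = ℚₚ.<-irrefl refl (ℚₚ.<-≤-trans 0<1 1≤0)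

p≤∣p∣ : ∀ p → p ≤ ∣ p ∣
p≤∣p∣ p with ℚₚ.≤-total 0ℚ p
... | inj₁ 0≤p = ≤-reflexive (sym (ℚₚ.0≤p⇒∣p∣≡p 0≤p))
... | inj₂ p≤0 = ≤-trans p≤0 (ℚₚ.0≤∣p∣ p)

∣∣≤ : ∀ {p q} → p ≤ q → - p ≤ q → ∣ p ∣ ≤ q
∣∣≤ {p} p≤q -p≤q with ℚₚ.∣p∣≡p∨∣p∣≡-p p
... | inj₁ e = subst (_≤ _) (sym e) p≤q
... | inj₂ e = subst (_≤ _) (sym e) -p≤q

0≤p² : ∀ p → 0ℚ ≤ p * p
0≤p² p with ℚₚ.≤-total 0ℚ p
... | inj₁ 0≤p = 0≤* 0≤p 0≤p
... | inj₂ p≤0 = subst (0ℚ ≤_) (solve 1 (λ x → (:- x) :* (:- x) := x :* x) refl p) (0≤* 0≤-p 0≤-p)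
  where 0≤-p = subst (_≤ - p) refl (ℚₚ.neg-antimono-≤ p≤0)

∣*∣≤ : ∀ {p q P Q} → ∣ p ∣ ≤ P → ∣ q ∣ ≤ Q → ∣ p * q ∣ ≤ P * Q
∣*∣≤ {p} {q} p≤P q≤Q = subst (_≤ _) (sym (ℚₚ.∣p*q∣≡∣p∣*∣q∣ p q))
  (*-mono (ℚₚ.0≤∣p∣ p) (≤-trans (ℚₚ.0≤∣p∣ q) q≤Q) p≤P q≤Q)

∣+∣≤ : ∀ {p q P Q} → ∣ p ∣ ≤ P → ∣ q ∣ ≤ Q → ∣ p + q ∣ ≤ P + Q
∣+∣≤ {p} {q} p≤P q≤Q = ≤-trans (ℚₚ.∣p+q∣≤∣p∣+∣q∣ p q) (ℚₚ.+-mono-≤ p≤P q≤Q)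

∣-∣≤ : ∀ {p q P Q} → ∣ p ∣ ≤ P → ∣ q ∣ ≤ Q → ∣ p - q ∣ ≤ P + Q
∣-∣≤ {p} {q} p≤P q≤Q = ≤-trans (ℚₚ.∣p-q∣≤∣p∣+∣q∣ p q) (ℚₚ.+-mono-≤ p≤P q≤Q)

opaque
  -- Totalised by the value 0 at 0, so that `rcp` and `P` are defined for all arguments and
  -- nonvanishing is asked for only where an identity uses it.
  inv : ℚ → ℚ
  inv p with p ℚₚ.≟ 0ℚ
  ... | yes _   = 0ℚ
  ... | no  p≢0 = ℚ.1/_ p {{ℚ.≢-nonZero p≢0}}

  *-inv : ∀ {p} → p ≢ 0ℚ → p * inv p ≡ 1ℚ
  *-inv {p} p≢0 with p ℚₚ.≟ 0ℚ
  ... | yes p≡0 = ⊥-elim (p≢0 p≡0)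
  ... | no  p≢0 = ℚₚ.*-inverseʳ p {{ℚ.≢-nonZero p≢0}}

  inv-pos : ∀ {p} → 0ℚ < p → 0ℚ < inv p
  inv-pos {p} 0<p with p ℚₚ.≟ 0ℚ
  ... | yes p≡0 = ⊥-elim (ℚₚ.<⇒≢ 0<p (sym p≡0))
  ... | no  p≢0 = ℚₚ.positive⁻¹ _ {{ℚₚ.1/pos⇒pos p {{ℚ.positive 0<p}}}}

  inv-0 : inv 0ℚ ≡ 0ℚ
  inv-0 = refl

<⇒≢0 : ∀ {p} → 0ℚ < p → p ≢ 0ℚ
<⇒≢0 0<p p≡0 = ℚₚ.<⇒≢ 0<p (sym p≡0)

*-cancelˡ : ∀ {p q r} → 0ℚ < r → r * p ≤ r * q → p ≤ q
*-cancelˡ {r = r} 0<r = ℚₚ.*-cancelˡ-≤-pos r {{ℚ.positive 0<r}}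

inv-unique : ∀ {p q} → p * q ≡ 1ℚ → q ≡ inv p
inv-unique {p} {q} pq≡1 = begin
  q                ≡⟨ sym (ℚₚ.*-identityʳ q) ⟩
  q * 1ℚ           ≡⟨ cong (q *_) (sym (*-inv p≢0)) ⟩
  q * (p * inv p)  ≡⟨ solve 3 (λ p q i → q :* (p :* i) := (p :* q) :* i) refl p q (inv p) ⟩
  p * q * inv p    ≡⟨ cong (_* inv p) pq≡1 ⟩
  1ℚ * inv p       ≡⟨ ℚₚ.*-identityˡ (inv p) ⟩
  inv p            ∎
  where
  open ≡-Reasoning
  p≢0 : p ≢ 0ℚ
  p≢0 p≡0 = ℚₚ.1≢0 (trans (sym pq≡1) (trans (cong (_* q) p≡0) (ℚₚ.*-zeroˡ q)))

-- Natural numbers in ℚ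

-- Defined by recursion so that `ι (suc n)` unfolds to `1ℚ + ι n`, which lets the ring solver read
-- successors as polynomials in `ι n`.
ι : ℕ → ℚ
ι zero    = 0ℚ
ι (suc n) = 1ℚ + ι n

ι-+ : ∀ m n → ι (m ℕ.+ n) ≡ ι m + ι n
ι-+ zero    n = sym (ℚₚ.+-identityˡ (ι n))
ι-+ (suc m) n = trans (cong (1ℚ +_) (ι-+ m n)) (sym (ℚₚ.+-assoc 1ℚ (ι m) (ι n)))

ι-* : ∀ m n → ι (m ℕ.* n) ≡ ι m * ι n
ι-* zero    n = sym (ℚₚ.*-zeroˡ (ι n))
ι-* (suc m) n = trans (ι-+ n (m ℕ.* n)) (trans (cong (ι n +_) (ι-* m n))
  (solve 2 (λ x y → y :+ x :* y := (con 1ℚ :+ x) :* y) refl (ι m) (ι n)))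

ι-∸ : ∀ {m n} → n ℕ.≤ m → ι (m ℕ.∸ n) ≡ ι m - ι n
ι-∸ {m} {n} n≤m = begin
  ι (m ℕ.∸ n)                ≡⟨ solve 2 (λ x y → x := (x :+ y) :- y) refl (ι (m ℕ.∸ n)) (ι n) ⟩
  ι (m ℕ.∸ n) + ι n - ι n    ≡⟨ cong (_- ι n) (sym (ι-+ (m ℕ.∸ n) n)) ⟩
  ι (m ℕ.∸ n ℕ.+ n) - ι n    ≡⟨ cong (λ x → ι x - ι n) (ℕₚ.m∸n+n≡m n≤m) ⟩
  ι m - ι n                  ∎
  where open ≡-Reasoning

0≤ι : ∀ n → 0ℚ ≤ ι n
0≤ι zero    = ≤-refl
0≤ι (suc n) = 0≤+ 0≤1 (0≤ι n)

ι-mono : ∀ {m n} → m ℕ.≤ n → ι m ≤ ι n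
ι-mono {n = n} z≤n = 0≤ι n
ι-mono (s≤s m≤n) = ℚₚ.+-monoʳ-≤ 1ℚ (ι-mono m≤n)

1≤ι : ∀ {n} → 1 ℕ.≤ n → 1ℚ ≤ ι n
1≤ι {n} 1≤n = subst (_≤ ι n) (ℚₚ.+-identityʳ 1ℚ) (ι-mono 1≤n)

0<ι : ∀ {n} → 1 ℕ.≤ n → 0ℚ < ι n
0<ι 1≤n = ℚₚ.<-≤-trans 0<1 (1≤ι 1≤n)

ι-cancel : ∀ {m n} → ι m ≤ ι n → m ℕ.≤ n
ι-cancel {m} {n} ιm≤ιn with m ℕ.≤? n
... | yes m≤n = m≤n
... | no  m≰n = ⊥-elim (1≰0 (≤-trans (subst (1ℚ ≤_) (ι-∸ {m} {n} (ℕₚ.<⇒≤ n<m)) (1≤ι (ℕₚ.m<n⇒0<n∸m n<m)))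
                  (≤-by {ι m - ι n} (ι n - ι m) (0≤-diff ιm≤ιn)
                    (solve 2 (λ x y → con 0ℚ := (x :- y) :+ (y :- x)) refl (ι m) (ι n)))))
  where n<m = ℕₚ.≰⇒> m≰n

-- Finite sums

∑ : ℕ → (ℕ → ℚ) → ℚ
∑ zero    f = 0ℚ
∑ (suc n) f = ∑ n f + f n

∑-cong : ∀ n {f g : ℕ → ℚ} → (∀ i → i ℕ.< n → f i ≡ g i) → ∑ n f ≡ ∑ n g
∑-cong zero    f≡g = refl
∑-cong (suc n) f≡g = cong₂ _+_ (∑-cong n λ i i<n → f≡g i (ℕₚ.m<n⇒m<1+n i<n)) (f≡g n (ℕₚ.n<1+n n))

∑-ext : ∀ n {f g : ℕ → ℚ} → (∀ i → f i ≡ g i) → ∑ n f ≡ ∑ n g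
∑-ext n f≡g = ∑-cong n λ i _ → f≡g i

∑-zero : ∀ n {f : ℕ → ℚ} → (∀ i → i ℕ.< n → f i ≡ 0ℚ) → ∑ n f ≡ 0ℚ
∑-zero zero    f≡0 = refl
∑-zero (suc n) f≡0 = trans (cong₂ _+_ (∑-zero n λ i i<n → f≡0 i (ℕₚ.m<n⇒m<1+n i<n)) (f≡0 n (ℕₚ.n<1+n n))) (ℚₚ.+-identityˡ 0ℚ)

∑-+ : ∀ n f g → ∑ n (λ i → f i + g i) ≡ ∑ n f + ∑ n g
∑-+ zero    f g = sym (ℚₚ.+-identityˡ 0ℚ)
∑-+ (suc n) f g = trans (cong (_+ (f n + g n)) (∑-+ n f g))
  (solve 4 (λ a b c d → (a :+ b) :+ (c :+ d) := (a :+ c) :+ (b :+ d)) refl (∑ n f) (∑ n g) (f n) (g n))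

∑-*ˡ : ∀ n c f → ∑ n (λ i → c * f i) ≡ c * ∑ n f
∑-*ˡ zero    c f = sym (ℚₚ.*-zeroʳ c)
∑-*ˡ (suc n) c f = trans (cong (_+ c * f n) (∑-*ˡ n c f)) (sym (ℚₚ.*-distribˡ-+ c (∑ n f) (f n)))

∑-*ʳ : ∀ n c f → ∑ n (λ i → f i * c) ≡ ∑ n f * c
∑-*ʳ n c f = trans (∑-ext n λ i → ℚₚ.*-comm (f i) c) (trans (∑-*ˡ n c f) (ℚₚ.*-comm c (∑ n f)))

∑-neg : ∀ n f → ∑ n (λ i → - f i) ≡ - ∑ n f
∑-neg zero    f = refl
∑-neg (suc n) f = trans (cong (_+ - f n) (∑-neg n f)) (sym (ℚₚ.neg-distrib-+ (∑ n f) (f n)))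

∑-- : ∀ n f g → ∑ n (λ i → f i - g i) ≡ ∑ n f - ∑ n g
∑-- n f g = trans (∑-+ n f (λ i → - g i)) (cong (∑ n f +_) (∑-neg n g))

∑-const : ∀ n c → ∑ n (λ _ → c) ≡ ι n * c
∑-const zero    c = sym (ℚₚ.*-zeroˡ c)
∑-const (suc n) c = trans (cong (_+ c) (∑-const n c)) (solve 2 (λ x c → x :* c :+ c := (con 1ℚ :+ x) :* c) refl (ι n) c)

∑-swap : ∀ m n (f : ℕ → ℕ → ℚ) → ∑ m (λ i → ∑ n (f i)) ≡ ∑ n (λ j → ∑ m (λ i → f i j))
∑-swap zero    n f = sym (∑-zero n λ _ _ → refl)
∑-swap (suc m) n f = trans (cong (_+ ∑ n (f m)) (∑-swap m n f)) (sym (∑-+ n (λ j → ∑ m (λ i → f i j)) (f m)))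

∑-mono : ∀ n {f g : ℕ → ℚ} → (∀ i → i ℕ.< n → f i ≤ g i) → ∑ n f ≤ ∑ n g
∑-mono zero    f≤g = ≤-refl
∑-mono (suc n) f≤g = ℚₚ.+-mono-≤ (∑-mono n λ i i<n → f≤g i (ℕₚ.m<n⇒m<1+n i<n)) (f≤g n (ℕₚ.n<1+n n))

0≤∑ : ∀ n {f : ℕ → ℚ} → (∀ i → i ℕ.< n → 0ℚ ≤ f i) → 0ℚ ≤ ∑ n f
0≤∑ n {f} 0≤f = subst (_≤ ∑ n f) (∑-zero n λ _ _ → refl) (∑-mono n 0≤f)

∣∑∣≤ : ∀ n {f g : ℕ → ℚ} → (∀ i → i ℕ.< n → ∣ f i ∣ ≤ g i) → ∣ ∑ n f ∣ ≤ ∑ n g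
∣∑∣≤ zero    f≤g = ≤-refl
∣∑∣≤ (suc n) f≤g = ∣+∣≤ (∣∑∣≤ n λ i i<n → f≤g i (ℕₚ.m<n⇒m<1+n i<n)) (f≤g n (ℕₚ.n<1+n n))

∑-split : ∀ m n f → ∑ (m ℕ.+ n) f ≡ ∑ m f + ∑ n (λ i → f (m ℕ.+ i))
∑-split m zero    f = trans (cong (λ k → ∑ k f) (ℕₚ.+-identityʳ m)) (sym (ℚₚ.+-identityʳ (∑ m f)))
∑-split m (suc n) f = trans (cong (λ k → ∑ k f) (ℕₚ.+-suc m n)) (trans (cong (_+ f (m ℕ.+ n)) (∑-split m n f))
  (ℚₚ.+-assoc (∑ m f) _ _))

∑-head : ∀ n f → ∑ (suc n) f ≡ f 0 + ∑ n (f ∘ suc)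
∑-head n f = trans (∑-split 1 n f) (cong (_+ ∑ n (f ∘ suc)) (ℚₚ.+-identityˡ (f 0)))

term≤∑ : ∀ n {f : ℕ → ℚ} → (∀ i → i ℕ.< n → 0ℚ ≤ f i) → ∀ i → i ℕ.< n → f i ≤ ∑ n f
term≤∑ (suc n) {f} 0≤f i i<1+n with i ℕ.≟ n
... | yes refl = ≤-by (∑ n f) (0≤∑ n λ j j<n → 0≤f j (ℕₚ.m<n⇒m<1+n j<n)) (ℚₚ.+-comm (∑ n f) (f n))
... | no  i≢n  = ≤-trans (term≤∑ n (λ j j<n → 0≤f j (ℕₚ.m<n⇒m<1+n j<n)) i (ℕₚ.≤∧≢⇒< (ℕₚ.≤-pred i<1+n) i≢n))
                   (≤-by (f n) (0≤f n (ℕₚ.n<1+n n)) refl)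

∑-mono-len : ∀ {m n} {f : ℕ → ℚ} → (∀ i → 0ℚ ≤ f i) → m ℕ.≤ n → ∑ m f ≤ ∑ n f
∑-mono-len {m} {n} {f} 0≤f m≤n = ≤-by (∑ (n ℕ.∸ m) (λ i → f (m ℕ.+ i))) (0≤∑ (n ℕ.∸ m) λ i _ → 0≤f (m ℕ.+ i))
  (trans (cong (λ k → ∑ k f) (sym (ℕₚ.m+[n∸m]≡n m≤n))) (∑-split m (n ℕ.∸ m) f))

-- Summation by parts

∑-abel : ∀ n (f w : ℕ → ℚ) → ∑ n (λ i → f i * w i) ≡ ∑ n f * w n + ∑ n (λ i → ∑ (suc i) f * (w i - w (suc i)))
∑-abel zero    f w = trans (sym (ℚₚ.*-zeroˡ (w 0))) (sym (ℚₚ.+-identityʳ (0ℚ * w 0)))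
∑-abel (suc n) f w = trans (cong (_+ f n * w n) (∑-abel n f w))
  (solve 5 (λ F u v s x → (F :* u :+ s) :+ x :* u := (F :+ x) :* v :+ (s :+ (F :+ x) :* (u :- v))) refl
    (∑ n f) (w n) (w (suc n)) (∑ n (λ i → ∑ (suc i) f * (w i - w (suc i)))) (f n))

-- The cancellation in `f` is used only through its bounded partial sums; the price is the total
-- variation of `w`.
∣∑-abel∣≤ : ∀ n (f w : ℕ → ℚ) C → (∀ i → ∣ ∑ i f ∣ ≤ C) →
            ∣ ∑ n (λ i → f i * w i) ∣ ≤ C * (∣ w n ∣ + ∑ n (λ i → ∣ w i - w (suc i) ∣))
∣∑-abel∣≤ n f w C bd = subst₂ (λ x y → ∣ x ∣ ≤ y) (sym (∑-abel n f w))
  (trans (cong (C * ∣ w n ∣ +_) (∑-*ˡ n C (λ i → ∣ w i - w (suc i) ∣))) (sym (ℚₚ.*-distribˡ-+ C _ _)))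
  (∣+∣≤ (∣*∣≤ (bd n) ≤-refl) (∣∑∣≤ n λ i _ → ∣*∣≤ {∑ (suc i) f} (bd (suc i)) ≤-refl))

-- Indicators

𝟙 : ∀ {P : Set} → Dec P → ℚ
𝟙 (yes _) = 1ℚ
𝟙 (no  _) = 0ℚ

𝟙-yes : ∀ {P : Set} (d : Dec P) → P → 𝟙 d ≡ 1ℚ
𝟙-yes (yes _) p = refl
𝟙-yes (no ¬p) p = ⊥-elim (¬p p)

𝟙-no : ∀ {P : Set} (d : Dec P) → ¬ P → 𝟙 d ≡ 0ℚ
𝟙-no (yes p) ¬p = ⊥-elim (¬p p)
𝟙-no (no _)  ¬p = refl

𝟙-⇔ : ∀ {P Q : Set} (d : Dec P) (e : Dec Q) → (P → Q) → (Q → P) → 𝟙 d ≡ 𝟙 e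
𝟙-⇔ (yes p) e f g = sym (𝟙-yes e (f p))
𝟙-⇔ (no ¬p) e f g = sym (𝟙-no e (¬p ∘ g))

𝟙-× : ∀ {P Q R : Set} (d : Dec P) (e : Dec Q) (r : Dec R) → (P → Q → R) → (R → P × Q) → 𝟙 d * 𝟙 e ≡ 𝟙 r
𝟙-× (yes p) (yes q) r f g = trans (ℚₚ.*-identityˡ 1ℚ) (sym (𝟙-yes r (f p q)))
𝟙-× (yes p) (no ¬q) r f g = trans (ℚₚ.*-zeroʳ 1ℚ) (sym (𝟙-no r (¬q ∘ proj₂ ∘ g)))
𝟙-× (no ¬p) e       r f g = trans (ℚₚ.*-zeroˡ (𝟙 e)) (sym (𝟙-no r (¬p ∘ proj₁ ∘ g)))

0≤𝟙 : ∀ {P : Set} (d : Dec P) → 0ℚ ≤ 𝟙 d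
0≤𝟙 (yes _) = 0≤1
0≤𝟙 (no _)  = ≤-refl

𝟙≤1 : ∀ {P : Set} (d : Dec P) → 𝟙 d ≤ 1ℚ
𝟙≤1 (yes _) = ≤-refl
𝟙≤1 (no _)  = 0≤1

∑-pick : ∀ n {P : ℕ → Set} (P? : ∀ i → Dec (P i)) (f : ℕ → ℚ) x → x ℕ.< n → P x → (∀ i → i ℕ.< n → P i → i ≡ x) →
         ∑ n (λ i → 𝟙 (P? i) * f i) ≡ f x
∑-pick (suc n) P? f x x<1+n Px unique with x ℕ.≟ n
... | yes refl = trans (cong₂ _+_
        (∑-zero n λ i i<n → trans (cong (_* f i) (𝟙-no (P? i) λ Pi → ℕₚ.<⇒≢ i<n (unique i (ℕₚ.m<n⇒m<1+n i<n) Pi))) (ℚₚ.*-zeroˡ (f i)))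
        (trans (cong (_* f n) (𝟙-yes (P? n) Px)) (ℚₚ.*-identityˡ (f n)))) (ℚₚ.+-identityˡ (f n))
... | no x≢n = trans (cong₂ _+_
        (∑-pick n P? f x (ℕₚ.≤∧≢⇒< (ℕₚ.≤-pred x<1+n) x≢n) Px λ i i<n → unique i (ℕₚ.m<n⇒m<1+n i<n))
        (trans (cong (_* f n) (𝟙-no (P? n) λ Pn → x≢n (sym (unique n (ℕₚ.n<1+n n) Pn)))) (ℚₚ.*-zeroˡ (f n)))) (ℚₚ.+-identityʳ (f x))

∑-pick-none : ∀ n {P : ℕ → Set} (P? : ∀ i → Dec (P i)) (f : ℕ → ℚ) → (∀ i → i ℕ.< n → ¬ P i) → ∑ n (λ i → 𝟙 (P? i) * f i) ≡ 0ℚ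
∑-pick-none n P? f none = ∑-zero n λ i i<n → trans (cong (_* f i) (𝟙-no (P? i) (none i i<n))) (ℚₚ.*-zeroˡ (f i))

-- Reciprocals and harmonic sums

opaque
  rcp : ℕ → ℚ
  rcp k = inv (ι k)

  rcp-unique : ∀ {k p} → ι k * p ≡ 1ℚ → p ≡ rcp k
  rcp-unique {k} {p} = inv-unique {ι k}

  ι*rcp : ∀ {k} → 1 ℕ.≤ k → ι k * rcp k ≡ 1ℚ
  ι*rcp 1≤k = *-inv (<⇒≢0 (0<ι 1≤k))

  0≤rcp : ∀ k → 0ℚ ≤ rcp k
  0≤rcp zero    = ≤-reflexive (sym inv-0)
  0≤rcp (suc k) = ℚₚ.<⇒≤ (inv-pos (0<ι {suc k} (s≤s z≤n)))

∣rcp∣ : ∀ k → ∣ rcp k ∣ ≡ rcp k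
∣rcp∣ k = ℚₚ.0≤p⇒∣p∣≡p (0≤rcp k)

∣ι∣ : ∀ k → ∣ ι k ∣ ≡ ι k
∣ι∣ k = ℚₚ.0≤p⇒∣p∣≡p (0≤ι k)

≤-*rcp : ∀ {k p q} → 1 ℕ.≤ k → ι k * p ≤ q → p ≤ q * rcp k
≤-*rcp {k} {p} {q} 1≤k kp≤q = subst (_≤ q * rcp k) eq (*-monoʳ (0≤rcp k) kp≤q)
  where
  eq : ι k * p * rcp k ≡ p
  eq = trans (solve 3 (λ k p r → k :* p :* r := (k :* r) :* p) refl (ι k) p (rcp k))
         (trans (cong (_* p) (ι*rcp 1≤k)) (ℚₚ.*-identityˡ p))

*rcp-≤ : ∀ {k p q} → 1 ℕ.≤ k → p ≤ ι k * q → p * rcp k ≤ q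
*rcp-≤ {k} {p} {q} 1≤k p≤kq = subst (p * rcp k ≤_) eq (*-monoʳ (0≤rcp k) p≤kq)
  where
  eq : ι k * q * rcp k ≡ q
  eq = trans (solve 3 (λ k p r → k :* p :* r := (k :* r) :* p) refl (ι k) q (rcp k))
         (trans (cong (_* q) (ι*rcp 1≤k)) (ℚₚ.*-identityˡ q))

rcp-anti : ∀ {m n} → 1 ℕ.≤ m → m ℕ.≤ n → rcp n ≤ rcp m
rcp-anti {m} {n} 1≤m m≤n = subst₂ _≤_ (ℚₚ.*-identityˡ (rcp n)) refl
  (*rcp-≤ (ℕₚ.≤-trans 1≤m m≤n) (subst (_≤ ι n * rcp m) (ι*rcp 1≤m) (*-monoʳ (0≤rcp m) (ι-mono m≤n))))

rcp-* : ∀ m n → 1 ℕ.≤ m → 1 ℕ.≤ n → rcp (m ℕ.* n) ≡ rcp m * rcp n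
rcp-* m n 1≤m 1≤n = sym (rcp-unique {m ℕ.* n} (begin
  ι (m ℕ.* n) * (rcp m * rcp n)    ≡⟨ cong (_* (rcp m * rcp n)) (ι-* m n) ⟩
  ι m * ι n * (rcp m * rcp n)      ≡⟨ solve 4 (λ a b c d → a :* b :* (c :* d) := (a :* c) :* (b :* d)) refl (ι m) (ι n) (rcp m) (rcp n) ⟩
  ι m * rcp m * (ι n * rcp n)      ≡⟨ cong₂ _*_ (ι*rcp 1≤m) (ι*rcp 1≤n) ⟩
  1ℚ * 1ℚ                          ≡⟨ ℚₚ.*-identityˡ 1ℚ ⟩
  1ℚ                               ∎))
  where open ≡-Reasoning

H : ℕ → ℚ
H n = ∑ n (rcp ∘ suc)

0≤H : ∀ n → 0ℚ ≤ H n
0≤H n = 0≤∑ n λ i _ → 0≤rcp (suc i)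

-- Each of the `m` new terms is at most `rcp m`, so a doubling costs at most 1. Iterated along
-- powers of two, this stands in for the logarithm.
H-double : ∀ m → H (m ℕ.+ m) ≤ H m + 1ℚ
H-double zero    = ≤-by 1ℚ 0≤1 refl
H-double (suc m) = subst (_≤ H (suc m) + 1ℚ) (sym (∑-split (suc m) (suc m) (rcp ∘ suc)))
  (ℚₚ.+-monoʳ-≤ (H (suc m)) (subst (∑ (suc m) (λ i → rcp (suc (suc m ℕ.+ i))) ≤_)
    (trans (∑-const (suc m) (rcp (suc m))) (ι*rcp {suc m} (s≤s z≤n)))
    (∑-mono (suc m) λ i _ → rcp-anti (s≤s z≤n) (ℕₚ.≤-trans (ℕₚ.m≤m+n (suc m) i) (ℕₚ.n≤1+n _)))))

H-dyadic : ∀ i R → H (2 ℕ.^ i ℕ.* R) ≤ H R + ι i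
H-dyadic zero    R = ≤-reflexive (trans (cong H (ℕₚ.+-identityʳ R)) (sym (ℚₚ.+-identityʳ (H R))))
H-dyadic (suc i) R = ≤-trans (subst (λ k → H k ≤ H m + 1ℚ) eq (H-double m))
  (≤-trans (ℚₚ.+-monoˡ-≤ 1ℚ (H-dyadic i R))
    (≤-reflexive (solve 2 (λ h x → (h :+ x) :+ con 1ℚ := h :+ (con 1ℚ :+ x)) refl (H R) (ι i))))
  where
  m = 2 ℕ.^ i ℕ.* R
  eq : m ℕ.+ m ≡ 2 ℕ.* 2 ℕ.^ i ℕ.* R
  eq = trans (cong (m ℕ.+_) (sym (ℕₚ.+-identityʳ m))) (sym (ℕₚ.*-assoc 2 (2 ℕ.^ i) R))

-- The Archimedean property

toℚᵘ-ι : ∀ m → ℚ.toℚᵘ (ι m) ℚᵘ.≃ ℚᵘ.mkℚᵘ (ℤ.+ m) 0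
toℚᵘ-ι zero    = ℚᵘ.*≡* refl
toℚᵘ-ι (suc m) = ℚᵘₚ.≃-trans (ℚₚ.toℚᵘ-homo-+ 1ℚ (ι m)) (ℚᵘₚ.≃-trans (ℚᵘₚ.+-congʳ (ℚ.toℚᵘ 1ℚ) (toℚᵘ-ι m))
  (ℚᵘ.*≡* (cong (λ x → (ℤ.+ 1 ℤ.+ x) ℤ.* ℤ.+ 1) (ℤₚ.*-identityʳ (ℤ.+ m)))))

archimedean : ∀ q → ∃ λ m → q ≤ ι m
archimedean q = ℤ.∣ z ∣ , ℚₚ.toℚᵘ-cancel-≤ (ℚᵘₚ.≤-respʳ-≃ (ℚᵘₚ.≃-sym (toℚᵘ-ι ℤ.∣ z ∣)) (ℚᵘ.*≤* le))
  where
  z = ℚ.↥ q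
  i≤∣i∣ : ∀ i → i ℤ.≤ ℤ.+ ℤ.∣ i ∣
  i≤∣i∣ (ℤ.+ m)      = ℤₚ.≤-refl
  i≤∣i∣ (ℤ.-[1+ m ]) = ℤ.-≤+
  le : ℚᵘ.↥ (ℚ.toℚᵘ q) ℤ.* ℤ.+ 1 ℤ.≤ ℤ.+ ℤ.∣ z ∣ ℤ.* ℚᵘ.↧ (ℚ.toℚᵘ q)
  le = subst₂ ℤ._≤_ (trans (sym (ℚₚ.↥ᵘ-toℚᵘ q)) (sym (ℤₚ.*-identityʳ _)))
         (trans (ℤₚ.pos-* ℤ.∣ z ∣ (ℚ.↧ₙ q)) (cong (ℤ.+ ℤ.∣ z ∣ ℤ.*_) (sym (ℚₚ.↧ᵘ-toℚᵘ q))))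
         (ℤₚ.≤-trans (i≤∣i∣ z) (ℤ.+≤+ (ℕₚ.m≤m*n ℤ.∣ z ∣ (ℚ.↧ₙ q))))

-- A multiple by an integer beyond `M * inv x` would exceed `M`. Passages to the limit are made in
-- this form, with `x` the fixed quantity that is squeezed to 0.
ι*-bounded⇒≤0 : ∀ {x} M → (∀ p → ι (suc p) * x ≤ M) → x ≤ 0ℚ
ι*-bounded⇒≤0 {x} M bd with x ℚₚ.≤? 0ℚ
... | yes x≤0 = x≤0
... | no  x≰0 with archimedean (M * inv x)
... | p , M/x≤p = ≤-by {x} (M - (1ℚ + ι p) * x + x * (ι p - M * inv x)) (0≤+ (0≤-diff (bd p)) (0≤* (ℚₚ.<⇒≤ 0<x) (0≤-diff M/x≤p)))
      (sym (trans (solve 4 (λ x m p i → x :+ (m :- (con 1ℚ :+ p) :* x :+ x :* (p :- m :* i)) := m :- m :* (x :* i)) refl x M (ι p) (inv x))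
        (trans (cong (λ y → M - M * y) (*-inv (<⇒≢0 0<x))) (solve 1 (λ m → m :- m :* con 1ℚ := con 0ℚ) refl M))))
  where 0<x = ℚₚ.≰⇒> x≰0

-- Riesz means of the convolution of lam and b

module Riesz (lam : ℕ → ℚ) (σ C₁ : ℚ) (0≤σ : 0ℚ ≤ σ)
             (lam-count : ∀ y → ∣ ∑ y (lam ∘ suc) - (σ + σ) * ι y ∣ ≤ C₁) where

  private
    C : ℚ
    C = C₁ + (σ + σ)

  0≤C₁ : 0ℚ ≤ C₁
  0≤C₁ = ≤-trans (ℚₚ.0≤∣p∣ _) (lam-count 0)

  0≤C : 0ℚ ≤ C
  0≤C = 0≤+ 0≤C₁ (0≤+ 0≤σ 0≤σ)

  -- A Riesz mean: the sum of lam(l)(y - lW) over lW ≤ y. Truncated subtraction is the cut-off, so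
  -- every `Z` with y ≤ ZW gives the same value.
  conv : ℕ → ℕ → ℕ → ℚ
  conv Z W y = ∑ Z (λ l → lam (suc l) * ι (y ℕ.∸ suc l ℕ.* W))

  -- The subtracted term σy²/W is the integral of 2σ(y - uW) over 0 ≤ u ≤ y/W, where 2σ is the
  -- density of `lam`.
  Ê : ℕ → ℕ → ℕ → ℚ
  Ê Z W y = conv Z W y - σ * (ι y * ι y) * rcp W

  ι-∸-step : ∀ y m → ι (suc y ℕ.∸ m) - ι (y ℕ.∸ m) ≡ 𝟙 (m ℕ.≤? y)
  ι-∸-step y m with m ℕ.≤? y
  ... | yes m≤y = trans (cong (λ x → ι x - ι (y ℕ.∸ m)) (ℕₚ.+-∸-assoc 1 m≤y))
                    (solve 1 (λ x → (con 1ℚ :+ x) :- x := con 1ℚ) refl (ι (y ℕ.∸ m)))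
  ... | no  m≰y = cong₂ (λ u v → ι u - ι v) (ℕₚ.m≤n⇒m∸n≡0 (ℕₚ.≰⇒> m≰y)) (ℕₚ.m≤n⇒m∸n≡0 (ℕₚ.<⇒≤ (ℕₚ.≰⇒> m≰y)))

  ∑-below : ∀ Z Q (f : ℕ → ℚ) → Q ℕ.≤ Z → ∑ Z (λ l → f l * 𝟙 (l ℕ.<? Q)) ≡ ∑ Q f
  ∑-below Z Q f Q≤Z = begin
    ∑ Z g                                               ≡⟨ cong (λ k → ∑ k g) (sym (ℕₚ.m+[n∸m]≡n Q≤Z)) ⟩
    ∑ (Q ℕ.+ (Z ℕ.∸ Q)) g                               ≡⟨ ∑-split Q (Z ℕ.∸ Q) g ⟩
    ∑ Q g + ∑ (Z ℕ.∸ Q) (λ i → g (Q ℕ.+ i))             ≡⟨ cong₂ _+_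
      (∑-cong Q λ i i<Q → trans (cong (f i *_) (𝟙-yes (i ℕ.<? Q) i<Q)) (ℚₚ.*-identityʳ (f i)))
      (∑-zero (Z ℕ.∸ Q) λ i _ → trans (cong (f (Q ℕ.+ i) *_) (𝟙-no (Q ℕ.+ i ℕ.<? Q) (ℕₚ.≤⇒≯ (ℕₚ.m≤m+n Q i)))) (ℚₚ.*-zeroʳ (f (Q ℕ.+ i)))) ⟩
    ∑ Q f + 0ℚ                                          ≡⟨ ℚₚ.+-identityʳ (∑ Q f) ⟩
    ∑ Q f                                               ∎
    where
    open ≡-Reasoning
    g : ℕ → ℚ
    g l = f l * 𝟙 (l ℕ.<? Q)

  conv-step : ∀ Z W y .{{_ : ℕ.NonZero W}} → y ℕ./ W ℕ.≤ Z → conv Z W (suc y) - conv Z W y ≡ ∑ (y ℕ./ W) (lam ∘ suc)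
  conv-step Z W y Q≤Z = begin
    conv Z W (suc y) - conv Z W y  ≡⟨ sym (∑-- Z _ _) ⟩
    ∑ Z (λ l → lam (suc l) * ι (suc y ℕ.∸ suc l ℕ.* W) - lam (suc l) * ι (y ℕ.∸ suc l ℕ.* W))
      ≡⟨ ∑-ext Z (λ l → trans (solve 3 (λ a b c → a :* b :- a :* c := a :* (b :- c)) refl
           (lam (suc l)) (ι (suc y ℕ.∸ suc l ℕ.* W)) (ι (y ℕ.∸ suc l ℕ.* W)))
           (cong (lam (suc l) *_) (trans (ι-∸-step y (suc l ℕ.* W))
             (𝟙-⇔ (suc l ℕ.* W ℕ.≤? y) (l ℕ.<? y ℕ./ W)
               (λ le → subst (ℕ._≤ y ℕ./ W) (ℕ.m*n/n≡m (suc l) W) (ℕ./-monoˡ-≤ W le))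
               (λ lt → ℕₚ.≤-trans (ℕₚ.*-monoˡ-≤ W lt) (ℕ.m/n*n≤m y W)))))) ⟩
    ∑ Z (λ l → lam (suc l) * 𝟙 (l ℕ.<? y ℕ./ W))     ≡⟨ ∑-below Z (y ℕ./ W) (lam ∘ suc) Q≤Z ⟩
    ∑ (y ℕ./ W) (lam ∘ suc)                          ∎
    where open ≡-Reasoning

  -- Raising `y` by 1 turns the mean into the plain count of `lam` up to y/W, whose error is `C₁`;
  -- the remaining 2σ pays for rounding y/W down.
  Ê-step : ∀ Z W y → 1 ℕ.≤ W → y ℕ.≤ Z ℕ.* W → ∣ Ê Z W (suc y) - Ê Z W y ∣ ≤ C
  Ê-step Z W@(suc _) y 1≤W y≤ZW = subst (λ x → ∣ x ∣ ≤ C) (sym eq) (∣-∣≤ (lam-count Q) small)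
    where
    Q = y ℕ./ W
    m = y ℕ.% W
    t = (ι m + ι m + 1ℚ) * rcp W
    Q≤Z : Q ℕ.≤ Z
    Q≤Z = subst (Q ℕ.≤_) (ℕ.m*n/n≡m Z W) (ℕ./-monoˡ-≤ W y≤ZW)
    ιy : ι y ≡ ι m + ι Q * ι W
    ιy = trans (cong ι (ℕ.m≡m%n+[m/n]*n y W)) (trans (ι-+ m (Q ℕ.* W)) (cong (ι m +_) (ι-* Q W)))
    open ≡-Reasoning
    eq : Ê Z W (suc y) - Ê Z W y ≡ (∑ Q (lam ∘ suc) - (σ + σ) * ι Q) - σ * t
    eq = begin
      Ê Z W (suc y) - Ê Z W y
        ≡⟨ solve 5 (λ a b s y r → (a :- s :* ((con 1ℚ :+ y) :* (con 1ℚ :+ y)) :* r) :- (b :- s :* (y :* y) :* r)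
                     := (a :- b) :- s :* ((y :+ y :+ con 1ℚ) :* r)) refl
             (conv Z W (suc y)) (conv Z W y) σ (ι y) (rcp W) ⟩
      (conv Z W (suc y) - conv Z W y) - σ * ((ι y + ι y + 1ℚ) * rcp W)
        ≡⟨ cong₂ (λ u v → u - σ * ((v + v + 1ℚ) * rcp W)) (conv-step Z W y Q≤Z) ιy ⟩
      ∑ Q (lam ∘ suc) - σ * ((ι m + ι Q * ι W + (ι m + ι Q * ι W) + 1ℚ) * rcp W)
        ≡⟨ solve 6 (λ L s m q w r → L :- s :* ((m :+ q :* w :+ (m :+ q :* w) :+ con 1ℚ) :* r)
             := (L :- (s :+ s) :* (q :* (w :* r))) :- s :* ((m :+ m :+ con 1ℚ) :* r)) refl
             (∑ Q (lam ∘ suc)) σ (ι m) (ι Q) (ι W) (rcp W) ⟩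
      (∑ Q (lam ∘ suc) - (σ + σ) * (ι Q * (ι W * rcp W))) - σ * t
        ≡⟨ cong (λ u → (∑ Q (lam ∘ suc) - (σ + σ) * u) - σ * t) (trans (cong (ι Q *_) (ι*rcp 1≤W)) (ℚₚ.*-identityʳ (ι Q))) ⟩
      (∑ Q (lam ∘ suc) - (σ + σ) * ι Q) - σ * t ∎
    0≤t : 0ℚ ≤ t
    0≤t = 0≤* (0≤+ (0≤+ (0≤ι m) (0≤ι m)) 0≤1) (0≤rcp W)
    t≤2 : t ≤ 1ℚ + 1ℚ
    t≤2 = *rcp-≤ {W} 1≤W (≤-by {ι m + ι m + 1ℚ} (1ℚ + (ι W - ι (suc m)) + (ι W - ι (suc m)))
      (0≤+ (0≤+ 0≤1 m<W) m<W)
      (solve 2 (λ w m → w :* (con 1ℚ :+ con 1ℚ) := (m :+ m :+ con 1ℚ) :+ (con 1ℚ :+ (w :- (con 1ℚ :+ m)) :+ (w :- (con 1ℚ :+ m)))) refl (ι W) (ι m)))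
      where m<W = 0≤-diff (ι-mono (ℕ.m%n<n y W))
    small : ∣ σ * t ∣ ≤ σ + σ
    small = subst (_≤ σ + σ) (sym (ℚₚ.0≤p⇒∣p∣≡p (0≤* 0≤σ 0≤t)))
      (≤-trans (*-monoˡ 0≤σ t≤2) (≤-reflexive (solve 1 (λ s → s :* (con 1ℚ :+ con 1ℚ) := s :+ s) refl σ)))

  Ê-lip : ∀ Z W y d → 1 ℕ.≤ W → y ℕ.+ d ℕ.≤ Z ℕ.* W → ∣ Ê Z W (y ℕ.+ d) - Ê Z W y ∣ ≤ ι d * C
  Ê-lip Z W y zero    1≤W le = ≤-reflexive (trans (cong (λ k → ∣ Ê Z W k - Ê Z W y ∣) (ℕₚ.+-identityʳ y))
    (trans (cong ∣_∣ (ℚₚ.+-inverseʳ (Ê Z W y))) (sym (ℚₚ.*-zeroˡ C))))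
  Ê-lip Z W y (suc d) 1≤W le = subst₂ (λ u v → ∣ u ∣ ≤ v)
    (trans (solve 3 (λ a b c → (a :- b) :+ (b :- c) := a :- c) refl (Ê Z W (suc (y ℕ.+ d))) (Ê Z W (y ℕ.+ d)) (Ê Z W y))
      (cong (λ k → Ê Z W k - Ê Z W y) (sym (ℕₚ.+-suc y d))))
    (solve 2 (λ c d → c :+ d :* c := (con 1ℚ :+ d) :* c) refl C (ι d))
    (∣+∣≤ (Ê-step Z W (y ℕ.+ d) 1≤W le′) (Ê-lip Z W y d 1≤W le′))
    where
    le′ : y ℕ.+ d ℕ.≤ Z ℕ.* W
    le′ = ℕₚ.≤-trans (ℕₚ.+-monoʳ-≤ y (ℕₚ.n≤1+n d)) le

  Ê-0 : ∀ Z W → Ê Z W 0 ≡ 0ℚ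
  Ê-0 Z W = trans (cong₂ _-_ (∑-zero Z λ l _ → trans (cong (λ k → lam (suc l) * ι k) (ℕₚ.0∸n≡0 (suc l ℕ.* W))) (ℚₚ.*-zeroʳ (lam (suc l))))
    (solve 2 (λ s r → s :* (con 0ℚ :* con 0ℚ) :* r := con 0ℚ) refl σ (rcp W))) refl

  ∣Ê∣ : ∀ Z W y → 1 ℕ.≤ W → y ℕ.≤ Z ℕ.* W → ∣ Ê Z W y ∣ ≤ ι y * C
  ∣Ê∣ Z W y 1≤W le = subst (λ u → ∣ u ∣ ≤ ι y * C)
    (trans (cong (λ x → Ê Z W y - x) (Ê-0 Z W)) (ℚₚ.+-identityʳ (Ê Z W y))) (Ê-lip Z W 0 y 1≤W le)

  f : ℕ → ℕ → ℕ → ℚ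
  f Z s k = conv Z k s - σ * (ι s * ι s) * rcp k

  -- The positive part is homogeneous. Scaling brings values of `f` at different `k` to one common
  -- modulus, where the Lipschitz bound can compare them.
  f-scale : ∀ Z s k m → 1 ℕ.≤ k → 1 ℕ.≤ m → ι m * f Z s k ≡ Ê Z (k ℕ.* m) (s ℕ.* m)
  f-scale Z s k m 1≤k 1≤m = begin
    ι m * f Z s k
      ≡⟨ solve 5 (λ m c s y r → m :* (c :- s :* (y :* y) :* r) := m :* c :- s :* (m :* y :* y :* r)) refl
           (ι m) (conv Z k s) σ (ι s) (rcp k) ⟩
    ι m * conv Z k s - σ * (ι m * ι s * ι s * rcp k)
      ≡⟨ cong₂ (λ u v → u - σ * v) e₁ e₂ ⟩
    conv Z (k ℕ.* m) (s ℕ.* m) - σ * (ι (s ℕ.* m) * ι (s ℕ.* m) * rcp (k ℕ.* m))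
      ≡⟨ solve 4 (λ c s y r → c :- s :* (y :* r) := c :- s :* y :* r) refl (conv Z (k ℕ.* m) (s ℕ.* m)) σ (ι (s ℕ.* m) * ι (s ℕ.* m)) (rcp (k ℕ.* m)) ⟩
    Ê Z (k ℕ.* m) (s ℕ.* m) ∎
    where
    open ≡-Reasoning
    e₁ : ι m * conv Z k s ≡ conv Z (k ℕ.* m) (s ℕ.* m)
    e₁ = trans (sym (∑-*ˡ Z (ι m) _)) (∑-ext Z λ l → trans
      (solve 3 (λ m a x → m :* (a :* x) := a :* (x :* m)) refl (ι m) (lam (suc l)) (ι (s ℕ.∸ suc l ℕ.* k)))
      (cong (lam (suc l) *_) (trans (sym (ι-* (s ℕ.∸ suc l ℕ.* k) m))
        (cong ι (trans (ℕₚ.*-distribʳ-∸ m s (suc l ℕ.* k)) (cong (s ℕ.* m ℕ.∸_) (ℕₚ.*-assoc (suc l) k m)))))))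
    e₂ : ι m * ι s * ι s * rcp k ≡ ι (s ℕ.* m) * ι (s ℕ.* m) * rcp (k ℕ.* m)
    e₂ = sym (begin
      ι (s ℕ.* m) * ι (s ℕ.* m) * rcp (k ℕ.* m)
        ≡⟨ cong₂ (λ u v → u * u * v) (ι-* s m) (rcp-* k m 1≤k 1≤m) ⟩
      ι s * ι m * (ι s * ι m) * (rcp k * rcp m)
        ≡⟨ solve 4 (λ s m k r → s :* m :* (s :* m) :* (k :* r) := m :* s :* s :* k :* (m :* r)) refl (ι s) (ι m) (rcp k) (rcp m) ⟩
      ι m * ι s * ι s * rcp k * (ι m * rcp m)
        ≡⟨ trans (cong (ι m * ι s * ι s * rcp k *_) (ι*rcp 1≤m)) (ℚₚ.*-identityʳ _) ⟩
      ι m * ι s * ι s * rcp k ∎)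

  f-bound : ∀ Z s k → 1 ℕ.≤ k → s ℕ.≤ Z → ∣ f Z s k ∣ ≤ ι s * C
  f-bound Z s k 1≤k s≤Z = subst (λ u → ∣ u ∣ ≤ ι s * C)
    (trans (cong₂ (Ê Z) (ℕₚ.*-identityʳ k) (ℕₚ.*-identityʳ s)) refl)
    (subst (λ u → ∣ Ê Z (k ℕ.* 1) (s ℕ.* 1) ∣ ≤ ι u * C) (ℕₚ.*-identityʳ s)
      (∣Ê∣ Z (k ℕ.* 1) (s ℕ.* 1) (subst (1 ℕ.≤_) (sym (ℕₚ.*-identityʳ k)) 1≤k)
        (subst₂ (λ u v → u ℕ.≤ Z ℕ.* v) (sym (ℕₚ.*-identityʳ s)) (sym (ℕₚ.*-identityʳ k))
          (ℕₚ.≤-trans s≤Z (ℕₚ.m≤m*n Z k {{ℕ.>-nonZero 1≤k}})))))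

  -- At the common modulus k(k + 1) the two values sit at the points s(k + 1) and sk, which are only
  -- `s` apart. The factor `rcp (suc k)` gained over `f-bound` makes the variation in `k`
  -- logarithmic.
  f-diff : ∀ Z s k → 1 ℕ.≤ k → s ℕ.≤ Z → ∣ f Z s k - f Z s (suc k) ∣ ≤ ι s * (C + C) * rcp (suc k)
  f-diff Z s k 1≤k s≤Z = ≤-*rcp {suc k} (s≤s z≤n) (*-cancelˡ (0<ι 1≤k) (subst₂ _≤_ e₁ e₂ big))
    where
    k′ = suc k
    W = k ℕ.* k′
    A = Ê Z W (s ℕ.* k′)
    B = Ê Z W (s ℕ.* k)
    1≤W : 1 ℕ.≤ W
    1≤W = ℕₚ.*-mono-≤ 1≤k (s≤s {n = k} z≤n)
    bnd : s ℕ.* k′ ℕ.≤ Z ℕ.* W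
    bnd = ℕₚ.≤-trans (ℕₚ.*-monoˡ-≤ k′ (ℕₚ.≤-trans s≤Z (ℕₚ.m≤m*n Z k {{ℕ.>-nonZero 1≤k}}))) (ℕₚ.≤-reflexive (ℕₚ.*-assoc Z k k′))
    sk′ : s ℕ.* k′ ≡ s ℕ.* k ℕ.+ s
    sk′ = trans (ℕₚ.*-suc s k) (ℕₚ.+-comm s (s ℕ.* k))
    lip : ∣ A - B ∣ ≤ ι s * C
    lip = subst (λ y → ∣ Ê Z W y - B ∣ ≤ ι s * C) (sym sk′) (Ê-lip Z W (s ℕ.* k) s 1≤W (subst (ℕ._≤ Z ℕ.* W) sk′ bnd))
    big : ∣ ι k * (A - B) - B ∣ ≤ ι k * (ι s * C) + ι (s ℕ.* k) * C
    big = ∣-∣≤ (∣*∣≤ {ι k} (≤-reflexive (∣ι∣ k)) lip)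
               (∣Ê∣ Z W (s ℕ.* k) 1≤W (ℕₚ.≤-trans (ℕₚ.*-monoʳ-≤ s (ℕₚ.n≤1+n k)) bnd))
    open ≡-Reasoning
    e₁ : ∣ ι k * (A - B) - B ∣ ≡ ι k * (ι k′ * ∣ f Z s k - f Z s k′ ∣)
    e₁ = begin
      ∣ ι k * (A - B) - B ∣
        ≡⟨ cong ∣_∣ (solve 3 (λ k a b → k :* (a :- b) :- b := k :* a :- (con 1ℚ :+ k) :* b) refl (ι k) A B) ⟩
      ∣ ι k * A - ι k′ * B ∣
        ≡⟨ cong₂ (λ u v → ∣ ι k * u - ι k′ * v ∣) (sym (f-scale Z s k k′ 1≤k (s≤s z≤n)))
             (trans (cong (λ w → Ê Z w (s ℕ.* k)) (ℕₚ.*-comm k k′)) (sym (f-scale Z s k′ k (s≤s z≤n) 1≤k))) ⟩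
      ∣ ι k * (ι k′ * f Z s k) - ι k′ * (ι k * f Z s k′) ∣
        ≡⟨ cong ∣_∣ (solve 4 (λ k l a b → k :* (l :* a) :- l :* (k :* b) := k :* (l :* (a :- b))) refl (ι k) (ι k′) (f Z s k) (f Z s k′)) ⟩
      ∣ ι k * (ι k′ * (f Z s k - f Z s k′)) ∣
        ≡⟨ trans (ℚₚ.∣p*q∣≡∣p∣*∣q∣ (ι k) _) (cong₂ _*_ (∣ι∣ k) (trans (ℚₚ.∣p*q∣≡∣p∣*∣q∣ (ι k′) _) (cong (_* ∣ f Z s k - f Z s k′ ∣) (∣ι∣ k′)))) ⟩
      ι k * (ι k′ * ∣ f Z s k - f Z s k′ ∣) ∎
    e₂ : ι k * (ι s * C) + ι (s ℕ.* k) * C ≡ ι k * (ι s * (C + C))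
    e₂ = trans (cong (λ u → ι k * (ι s * C) + u * C) (ι-* s k))
      (solve 3 (λ k s c → k :* (s :* c) :+ s :* k :* c := k :* (s :* (c :+ c))) refl (ι k) (ι s) C)

  module _ (b : ℕ → ℚ) (C₂ C₃ : ℚ) (b-sum : ∀ i → ∣ ∑ i (b ∘ suc) ∣ ≤ C₂)
           (b-log : ∀ i → ι i * ∣ ∑ i (λ m → b (suc m) * rcp (suc m)) ∣ ≤ C₃) where

    T : ℕ → ℕ → ℚ
    T Z s = ∑ Z (λ k → ∑ Z (λ l → b (suc k) * lam (suc l) * ι (s ℕ.∸ suc k ℕ.* suc l)))

    K : ℚ → ℚ
    K h = σ * C₃ + C₂ * (C + (C + C) * h)

    -- The vanishing of the series enters here: the main term σs² ∑ b(k)/k would be quadratic in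
    -- `s`, but `b-log` and s ≤ Z leave σ C₃ s. The error terms `f` are summed by parts, at the cost
    -- of the harmonic sum `h`.
    T-bound : ∀ Z s h → s ℕ.≤ Z → H Z ≤ h → ∣ T Z s ∣ ≤ ι s * K h
    T-bound Z s h s≤Z HZ≤h = subst (λ u → ∣ u ∣ ≤ ι s * K h) (sym eq)
      (≤-trans (∣+∣≤ first second) (≤-reflexive (solve 6 (λ s σ c₃ c₂ c h → s :* (σ :* c₃) :+ c₂ :* (s :* c :+ s :* (c :+ c) :* h) := s :* (σ :* c₃ :+ c₂ :* (c :+ (c :+ c) :* h))) refl (ι s) σ C₃ C₂ C h)))
      where
      B = ∑ Z (λ m → b (suc m) * rcp (suc m))
      F = ∑ Z (λ k → b (suc k) * f Z s (suc k))
      0≤C₂ : 0ℚ ≤ C₂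
      0≤C₂ = b-sum 0
      open ≡-Reasoning
      eq : T Z s ≡ σ * (ι s * ι s) * B + F
      eq = begin
        T Z s
          ≡⟨ ∑-ext Z (λ k → trans (∑-ext Z λ l → trans (ℚₚ.*-assoc (b (suc k)) (lam (suc l)) _)
               (cong (λ u → b (suc k) * (lam (suc l) * ι (s ℕ.∸ u))) (ℕₚ.*-comm (suc k) (suc l))))
               (trans (∑-*ˡ Z (b (suc k)) _)
                 (solve 5 (λ b c σ s r → b :* c := σ :* s :* (b :* r) :+ b :* (c :- σ :* s :* r)) refl
                   (b (suc k)) (conv Z (suc k) s) σ (ι s * ι s) (rcp (suc k))))) ⟩
        ∑ Z (λ k → σ * (ι s * ι s) * (b (suc k) * rcp (suc k)) + b (suc k) * f Z s (suc k))
          ≡⟨ ∑-+ Z _ _ ⟩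
        ∑ Z (λ k → σ * (ι s * ι s) * (b (suc k) * rcp (suc k))) + F
          ≡⟨ cong (_+ F) (∑-*ˡ Z (σ * (ι s * ι s)) _) ⟩
        σ * (ι s * ι s) * B + F ∎
      first : ∣ σ * (ι s * ι s) * B ∣ ≤ ι s * (σ * C₃)
      first = subst (_≤ ι s * (σ * C₃))
        (trans (solve 3 (λ σ s b → s :* (σ :* (s :* b)) := σ :* (s :* s) :* b) refl σ (ι s) ∣ B ∣)
          (trans (cong (_* ∣ B ∣) (sym (ℚₚ.0≤p⇒∣p∣≡p (0≤* 0≤σ (0≤p² (ι s)))))) (sym (ℚₚ.∣p*q∣≡∣p∣*∣q∣ (σ * (ι s * ι s)) B))))
        (*-monoˡ (0≤ι s) (*-monoˡ 0≤σ (≤-trans (*-monoʳ (ℚₚ.0≤∣p∣ B) (ι-mono s≤Z)) (b-log Z))))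
      second : ∣ F ∣ ≤ C₂ * (ι s * C + ι s * (C + C) * h)
      second = ≤-trans (∣∑-abel∣≤ Z (b ∘ suc) (f Z s ∘ suc) C₂ b-sum)
        (*-monoˡ 0≤C₂ (ℚₚ.+-mono-≤ (f-bound Z s (suc Z) (s≤s z≤n) s≤Z)
          (≤-trans (∑-mono Z λ i _ → f-diff Z s (suc i) (s≤s z≤n) s≤Z)
            (subst (_≤ ι s * (C + C) * h) (sym (∑-*ˡ Z (ι s * (C + C)) (λ i → rcp (suc (suc i)))))
              (*-monoˡ (0≤* (0≤ι s) (0≤+ 0≤C 0≤C))
                (≤-trans (∑-mono Z λ i _ → rcp-anti (s≤s z≤n) (ℕₚ.n≤1+n (suc i))) HZ≤h))))))

-- Sums over pairs, sorted by their greatest common divisor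

opaque
  ∑₁ : ℕ → (ℕ → ℚ) → ℚ
  ∑₁ Z f = ∑ Z (f ∘ suc)

  ∑₁-ext : ∀ Z {f g : ℕ → ℚ} → (∀ k → 1 ℕ.≤ k → k ℕ.≤ Z → f k ≡ g k) → ∑₁ Z f ≡ ∑₁ Z g
  ∑₁-ext Z f≡g = ∑-cong Z λ i i<Z → f≡g (suc i) (s≤s z≤n) i<Z

  ∑₁-zero : ∀ Z {f : ℕ → ℚ} → (∀ k → 1 ℕ.≤ k → k ℕ.≤ Z → f k ≡ 0ℚ) → ∑₁ Z f ≡ 0ℚ
  ∑₁-zero Z f≡0 = ∑-zero Z λ i i<Z → f≡0 (suc i) (s≤s z≤n) i<Z

  ∑₁-*ˡ : ∀ Z c (f : ℕ → ℚ) → ∑₁ Z (λ k → c * f k) ≡ c * ∑₁ Z f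
  ∑₁-*ˡ Z c f = ∑-*ˡ Z c (f ∘ suc)

  ∑₁-*ʳ : ∀ Z c (f : ℕ → ℚ) → ∑₁ Z (λ k → f k * c) ≡ ∑₁ Z f * c
  ∑₁-*ʳ Z c f = ∑-*ʳ Z c (f ∘ suc)

  ∑₁-swap : ∀ m n (f : ℕ → ℕ → ℚ) → ∑₁ m (λ i → ∑₁ n (f i)) ≡ ∑₁ n (λ j → ∑₁ m (λ i → f i j))
  ∑₁-swap m n f = ∑-swap m n (λ i j → f (suc i) (suc j))

  ∑₁-pick : ∀ Z {P : ℕ → Set} (P? : ∀ i → Dec (P i)) (f : ℕ → ℚ) x → 1 ℕ.≤ x → x ℕ.≤ Z → P x →
            (∀ i → P i → i ≡ x) → ∑₁ Z (λ i → 𝟙 (P? i) * f i) ≡ f x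
  ∑₁-pick Z P? f (suc x) _ x≤Z Px unique =
    ∑-pick Z (P? ∘ suc) (f ∘ suc) x x≤Z Px (λ i _ Pi → ℕₚ.suc-injective (unique (suc i) Pi))

  ∑₁-pick-none : ∀ Z {P : ℕ → Set} (P? : ∀ i → Dec (P i)) (f : ℕ → ℚ) →
                 (∀ i → 1 ℕ.≤ i → i ℕ.≤ Z → ¬ P i) → ∑₁ Z (λ i → 𝟙 (P? i) * f i) ≡ 0ℚ
  ∑₁-pick-none Z P? f none = ∑-pick-none Z (P? ∘ suc) (f ∘ suc) (λ i i<Z → none (suc i) (s≤s z≤n) i<Z)

  ∑₁-∑-swap : ∀ m n (f : ℕ → ℕ → ℚ) → ∑₁ m (λ i → ∑ n (f i)) ≡ ∑ n (λ j → ∑₁ m (λ i → f i j))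
  ∑₁-∑-swap m n f = ∑-swap m n (λ i → f (suc i))

  ∑₁-mono : ∀ Z {f g : ℕ → ℚ} → (∀ k → 1 ℕ.≤ k → k ℕ.≤ Z → f k ≤ g k) → ∑₁ Z f ≤ ∑₁ Z g
  ∑₁-mono Z f≤g = ∑-mono Z λ i i<Z → f≤g (suc i) (s≤s z≤n) i<Z

  ∣∑₁∣≤ : ∀ Z {f g : ℕ → ℚ} → (∀ k → 1 ℕ.≤ k → k ℕ.≤ Z → ∣ f k ∣ ≤ g k) → ∣ ∑₁ Z f ∣ ≤ ∑₁ Z g
  ∣∑₁∣≤ Z f≤g = ∣∑∣≤ Z λ i i<Z → f≤g (suc i) (s≤s z≤n) i<Z

  first≤∑₁ : ∀ Z {f : ℕ → ℚ} → 1 ℕ.≤ Z → (∀ k → 0ℚ ≤ f k) → f 1 ≤ ∑₁ Z f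
  first≤∑₁ Z 1≤Z 0≤f = term≤∑ Z (λ i _ → 0≤f (suc i)) 0 1≤Z

  ∑₁-∑ : ∀ Z (f : ℕ → ℚ) → ∑₁ Z f ≡ ∑ Z (f ∘ suc)
  ∑₁-∑ Z f = refl

m≤d*m : ∀ {d} m → 1 ℕ.≤ d → m ℕ.≤ d ℕ.* m
m≤d*m {d} m 1≤d = ℕₚ.m≤n*m m d {{ℕ.>-nonZero 1≤d}}

-- Because `h` vanishes beyond `Z`, both sums may run up to the same `Z`, and no range of the form
-- Z/d has to be carried along.
∑₁-multiples : ∀ Z d (h : ℕ → ℚ) → 1 ℕ.≤ d → (∀ k → Z ℕ.< k → h k ≡ 0ℚ) →
               ∑₁ Z (λ κ → h (d ℕ.* κ)) ≡ ∑₁ Z (λ k → 𝟙 (d ∣? k) * h k)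
∑₁-multiples Z d h 1≤d h≡0 = sym (begin
  ∑₁ Z (λ k → 𝟙 (d ∣? k) * h k)                                ≡⟨ ∑₁-ext Z expand ⟩
  ∑₁ Z (λ k → ∑₁ Z (λ κ → 𝟙 (d ℕ.* κ ℕ.≟ k) * h k))            ≡⟨ ∑₁-swap Z Z _ ⟩
  ∑₁ Z (λ κ → ∑₁ Z (λ k → 𝟙 (d ℕ.* κ ℕ.≟ k) * h k))            ≡⟨ ∑₁-ext Z collapse ⟩
  ∑₁ Z (λ κ → h (d ℕ.* κ))                                     ∎)
  where
  open ≡-Reasoning
  instance _ = ℕ.>-nonZero 1≤d
  expand : ∀ k → 1 ℕ.≤ k → k ℕ.≤ Z → 𝟙 (d ∣? k) * h k ≡ ∑₁ Z (λ κ → 𝟙 (d ℕ.* κ ℕ.≟ k) * h k)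
  expand k 1≤k k≤Z with d ∣? k
  ... | yes (ℕ∣.divides κ k≡κd) = trans (ℚₚ.*-identityˡ (h k))
        (sym (∑₁-pick Z (λ κ → d ℕ.* κ ℕ.≟ k) (λ _ → h k) κ 1≤κ (ℕₚ.≤-trans (subst (κ ℕ.≤_) dκ≡k (m≤d*m κ 1≤d)) k≤Z) dκ≡k
          (λ i di≡k → ℕₚ.*-cancelˡ-≡ i κ d (trans di≡k (sym dκ≡k)))))
    where
    dκ≡k : d ℕ.* κ ≡ k
    dκ≡k = trans (ℕₚ.*-comm d κ) (sym k≡κd)
    1≤κ : 1 ℕ.≤ κ
    1≤κ = ℕₚ.n≢0⇒n>0 λ κ≡0 → ℕₚ.<⇒≢ 1≤k (sym (trans (sym dκ≡k) (trans (cong (d ℕ.*_) κ≡0) (ℕₚ.*-zeroʳ d))))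
  ... | no d∤k = trans (ℚₚ.*-zeroˡ (h k)) (sym (∑₁-pick-none Z (λ κ → d ℕ.* κ ℕ.≟ k) (λ _ → h k)
          (λ κ _ _ dκ≡k → d∤k (ℕ∣.divides κ (trans (sym dκ≡k) (ℕₚ.*-comm d κ))))))
  collapse : ∀ κ → 1 ℕ.≤ κ → κ ℕ.≤ Z → ∑₁ Z (λ k → 𝟙 (d ℕ.* κ ℕ.≟ k) * h k) ≡ h (d ℕ.* κ)
  collapse κ 1≤κ κ≤Z with d ℕ.* κ ℕ.≤? Z
  ... | yes dκ≤Z = ∑₁-pick Z (λ k → d ℕ.* κ ℕ.≟ k) h (d ℕ.* κ) (ℕₚ.≤-trans 1≤κ (m≤d*m κ 1≤d)) dκ≤Z refl (λ _ → sym)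
  ... | no  dκ≰Z = trans (∑₁-pick-none Z (λ k → d ℕ.* κ ℕ.≟ k) h (λ k _ k≤Z dκ≡k → dκ≰Z (subst (ℕ._≤ Z) (sym dκ≡k) k≤Z)))
                     (sym (h≡0 (d ℕ.* κ) (ℕₚ.≰⇒> dκ≰Z)))

-- Every pair is its gcd times a coprime pair in exactly one way; the two support conditions make
-- the full ranges on the right harmless.
∑₁-gcd : ∀ Z (F : ℕ → ℕ → ℚ) →
  (∀ k k′ → Z ℕ.< k → 1 ℕ.≤ k′ → F k k′ ≡ 0ℚ) → (∀ k k′ → 1 ℕ.≤ k → Z ℕ.< k′ → F k k′ ≡ 0ℚ) →
  ∑₁ Z (λ k → ∑₁ Z (F k)) ≡
  ∑₁ Z (λ d → ∑₁ Z (λ κ → ∑₁ Z (λ κ′ → 𝟙 (gcd κ κ′ ℕ.≟ 1) * F (d ℕ.* κ) (d ℕ.* κ′))))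
∑₁-gcd Z F supp supp′ = sym (begin
  ∑₁ Z (λ d → ∑₁ Z (λ κ → ∑₁ Z (λ κ′ → 𝟙 (gcd κ κ′ ℕ.≟ 1) * F (d ℕ.* κ) (d ℕ.* κ′))))
    ≡⟨ ∑₁-ext Z (λ d 1≤d _ → fixed d 1≤d) ⟩
  ∑₁ Z (λ d → ∑₁ Z (λ k → ∑₁ Z (λ k′ → 𝟙 (gcd k k′ ℕ.≟ d) * F k k′)))
    ≡⟨ ∑₁-swap Z Z _ ⟩
  ∑₁ Z (λ k → ∑₁ Z (λ d → ∑₁ Z (λ k′ → 𝟙 (gcd k k′ ℕ.≟ d) * F k k′)))
    ≡⟨ ∑₁-ext Z (λ k _ _ → ∑₁-swap Z Z _) ⟩
  ∑₁ Z (λ k → ∑₁ Z (λ k′ → ∑₁ Z (λ d → 𝟙 (gcd k k′ ℕ.≟ d) * F k k′)))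
    ≡⟨ ∑₁-ext Z (λ k 1≤k k≤Z → ∑₁-ext Z (λ k′ 1≤k′ _ →
         ∑₁-pick Z (λ d → gcd k k′ ℕ.≟ d) (λ _ → F k k′) (gcd k k′)
           (ℕₚ.n≢0⇒n>0 λ g≡0 → ℕₚ.<⇒≢ 1≤k (sym (GCD.gcd[m,n]≡0⇒m≡0 {k} {k′} g≡0)))
           (ℕₚ.≤-trans (ℕ∣.∣⇒≤ {{ℕ.>-nonZero 1≤k}} (GCD.gcd[m,n]∣m k k′)) k≤Z) refl (λ _ → sym))) ⟩
  ∑₁ Z (λ k → ∑₁ Z (F k)) ∎)
  where
  open ≡-Reasoning
  fixed : ∀ d → 1 ℕ.≤ d →
    ∑₁ Z (λ κ → ∑₁ Z (λ κ′ → 𝟙 (gcd κ κ′ ℕ.≟ 1) * F (d ℕ.* κ) (d ℕ.* κ′))) ≡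
    ∑₁ Z (λ k → ∑₁ Z (λ k′ → 𝟙 (gcd k k′ ℕ.≟ d) * F k k′))
  fixed d 1≤d = begin
    ∑₁ Z (λ κ → ∑₁ Z (λ κ′ → 𝟙 (gcd κ κ′ ℕ.≟ 1) * F (d ℕ.* κ) (d ℕ.* κ′)))
      ≡⟨ ∑₁-ext Z (λ κ _ _ → ∑₁-ext Z (λ κ′ _ _ → cong (_* F (d ℕ.* κ) (d ℕ.* κ′))
           (𝟙-⇔ (gcd κ κ′ ℕ.≟ 1) (gcd (d ℕ.* κ) (d ℕ.* κ′) ℕ.≟ d)
             (λ e → trans (sym (GCD.c*gcd[m,n]≡gcd[cm,cn] d κ κ′)) (trans (cong (d ℕ.*_) e) (ℕₚ.*-identityʳ d)))
             (λ e → ℕₚ.*-cancelˡ-≡ (gcd κ κ′) 1 d {{ℕ.>-nonZero 1≤d}}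
                (trans (GCD.c*gcd[m,n]≡gcd[cm,cn] d κ κ′) (trans e (sym (ℕₚ.*-identityʳ d)))))))) ⟩
    ∑₁ Z (λ κ → ∑₁ Z (λ κ′ → G (d ℕ.* κ) (d ℕ.* κ′)))
      ≡⟨ ∑₁-ext Z (λ κ 1≤κ _ → ∑₁-multiples Z d (G (d ℕ.* κ)) 1≤d
           (λ k′ Z<k′ → *0 (𝟙 (gcd (d ℕ.* κ) k′ ℕ.≟ d)) (supp′ (d ℕ.* κ) k′ (ℕₚ.≤-trans 1≤κ (m≤d*m κ 1≤d)) Z<k′))) ⟩
    ∑₁ Z (λ κ → ∑₁ Z (λ k′ → 𝟙 (d ∣? k′) * G (d ℕ.* κ) k′))
      ≡⟨ ∑₁-multiples Z d (λ k → ∑₁ Z (λ k′ → 𝟙 (d ∣? k′) * G k k′)) 1≤d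
           (λ k Z<k → ∑₁-zero Z λ i 1≤i _ → trans (cong (𝟙 (d ∣? i) *_)
              (trans (cong (𝟙 (gcd k i ℕ.≟ d) *_) (supp k i Z<k 1≤i)) (ℚₚ.*-zeroʳ (𝟙 (gcd k i ℕ.≟ d))))) (ℚₚ.*-zeroʳ (𝟙 (d ∣? i)))) ⟩
    ∑₁ Z (λ k → 𝟙 (d ∣? k) * ∑₁ Z (λ k′ → 𝟙 (d ∣? k′) * G k k′))
      ≡⟨ ∑₁-ext Z (λ k _ _ → trans (sym (∑₁-*ˡ Z (𝟙 (d ∣? k)) _)) (∑₁-ext Z λ k′ _ _ → begin
           𝟙 (d ∣? k) * (𝟙 (d ∣? k′) * (𝟙 (gcd k k′ ℕ.≟ d) * F k k′))
             ≡⟨ solve 4 (λ a b c f → a :* (b :* (c :* f)) := (a :* (b :* c)) :* f) refl (𝟙 (d ∣? k)) (𝟙 (d ∣? k′)) (𝟙 (gcd k k′ ℕ.≟ d)) (F k k′) ⟩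
           𝟙 (d ∣? k) * (𝟙 (d ∣? k′) * 𝟙 (gcd k k′ ℕ.≟ d)) * F k k′
             ≡⟨ cong (λ u → 𝟙 (d ∣? k) * u * F k k′) (𝟙-× (d ∣? k′) (gcd k k′ ℕ.≟ d) (gcd k k′ ℕ.≟ d) (λ _ e → e)
                  (λ e → subst (_∣ k′) e (GCD.gcd[m,n]∣n k k′) , e)) ⟩
           𝟙 (d ∣? k) * 𝟙 (gcd k k′ ℕ.≟ d) * F k k′
             ≡⟨ cong (_* F k k′) (𝟙-× (d ∣? k) (gcd k k′ ℕ.≟ d) (gcd k k′ ℕ.≟ d) (λ _ e → e)
                  (λ e → subst (_∣ k) e (GCD.gcd[m,n]∣m k k′) , e)) ⟩
           𝟙 (gcd k k′ ℕ.≟ d) * F k k′ ∎)) ⟩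
    ∑₁ Z (λ k → ∑₁ Z (λ k′ → 𝟙 (gcd k k′ ℕ.≟ d) * F k k′)) ∎
    where
    G : ℕ → ℕ → ℚ
    G k k′ = 𝟙 (gcd k k′ ℕ.≟ d) * F k k′

-- The identity ζ(s)² L(s,χ) L(s,χ̄) = ζ(2s) ∑ |∑_{k∣r} χ(k)|² r^{-s} in weighted form, with the
-- characters replaced by a family b of functions whose Gram matrix E is invariant under scaling.
module RankinSelberg (lam : ℕ → ℚ) (g : ℕ) (b : ℕ → ℕ → ℚ)
  (lam-0≤ : ∀ m → 0ℚ ≤ lam m) (lam-1 : lam 1 ≡ 1ℚ)
  (lam-* : ∀ m n → lam (m ℕ.* n) ≡ lam m * lam n) (lam-idem : ∀ m → lam m * lam m ≡ lam m)
  (b-lam : ∀ i m → b i m * lam m ≡ b i m) where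

  E : ℕ → ℕ → ℚ
  E k k′ = ∑ g (λ i → b i k * b i k′)

  E-lam : ∀ k k′ → E k k′ * (lam k * lam k′) ≡ E k k′
  E-lam k k′ = trans (sym (∑-*ʳ g (lam k * lam k′) _)) (∑-ext g λ i → trans
    (solve 4 (λ a b c d → a :* b :* (c :* d) := (a :* c) :* (b :* d)) refl (b i k) (b i k′) (lam k) (lam k′))
    (cong₂ _*_ (b-lam i k) (b-lam i k′)))

  module _ (E-scale : ∀ d k k′ → E (d ℕ.* k) (d ℕ.* k′) ≡ lam d * E k k′)
           (Z : ℕ) (1≤Z : 1 ℕ.≤ Z) (w : ℕ → ℚ) (w-0≤ : ∀ m → 0ℚ ≤ w m) (w-supp : ∀ m → Z ℕ.< m → w m ≡ 0ℚ) where

    -- The two zeta factors folded into the weight, so that only the pair (k, k′) remains visible.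
    Y : ℕ → ℚ
    Y x = ∑₁ Z (λ l → ∑₁ Z (λ l′ → lam l * lam l′ * w (x ℕ.* (l ℕ.* l′))))

    N : ℕ → ℚ
    N r = ∑₁ Z (λ k → ∑₁ Z (λ k′ → 𝟙 (k ∣? r) * 𝟙 (k′ ∣? r) * E k k′))

    private
      large : ∀ k m → Z ℕ.< k → 1 ℕ.≤ m → w (k ℕ.* m) ≡ 0ℚ
      large k m Z<k 1≤m = w-supp (k ℕ.* m) (ℕₚ.<-≤-trans Z<k (ℕₚ.m≤m*n k m {{ℕ.>-nonZero 1≤m}}))

      Y-large : ∀ x → Z ℕ.< x → Y x ≡ 0ℚ
      Y-large x Z<x = ∑₁-zero Z λ i 1≤i _ → ∑₁-zero Z λ j 1≤j _ →
        trans (cong (lam i * lam j *_) (large x (i ℕ.* j) Z<x (ℕₚ.*-mono-≤ 1≤i 1≤j))) (ℚₚ.*-zeroʳ (lam i * lam j))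

      -- The meeting point of the two sides. On the left q is the gcd of k and k′; on the right q²
      -- stands for ζ(2s), and the coprime pair comes from two divisors of r.
      common : ℕ → ℚ
      common q = ∑₁ Z (λ κ → ∑₁ Z (λ κ′ → 𝟙 (gcd κ κ′ ℕ.≟ 1) * (E κ κ′ * Y (q ℕ.* q ℕ.* (κ ℕ.* κ′)))))

      open ≡-Reasoning

      lhs : ∑₁ Z (λ k → ∑₁ Z (λ k′ → E k k′ * Y (k ℕ.* k′))) ≡ ∑₁ Z (λ q → lam q * common q)
      lhs = begin
        ∑₁ Z (λ k → ∑₁ Z (λ k′ → E k k′ * Y (k ℕ.* k′)))
          ≡⟨ ∑₁-gcd Z _
               (λ k k′ Z<k 1≤k′ → trans (cong (E k k′ *_) (Y-large (k ℕ.* k′) (ℕₚ.<-≤-trans Z<k (ℕₚ.m≤m*n k k′ {{ℕ.>-nonZero 1≤k′}})))) (ℚₚ.*-zeroʳ (E k k′)))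
               (λ k k′ 1≤k Z<k′ → trans (cong (E k k′ *_) (Y-large (k ℕ.* k′) (ℕₚ.<-≤-trans Z<k′ (m≤d*m k′ 1≤k)))) (ℚₚ.*-zeroʳ (E k k′))) ⟩
        ∑₁ Z (λ q → ∑₁ Z (λ κ → ∑₁ Z (λ κ′ → 𝟙 (gcd κ κ′ ℕ.≟ 1) * (E (q ℕ.* κ) (q ℕ.* κ′) * Y (q ℕ.* κ ℕ.* (q ℕ.* κ′))))))
          ≡⟨ ∑₁-ext Z (λ q _ _ → trans (∑₁-ext Z λ κ _ _ → trans (∑₁-ext Z λ κ′ _ _ → trans
               (cong₂ (λ u v → 𝟙 (gcd κ κ′ ℕ.≟ 1) * (u * Y v)) (E-scale q κ κ′)
                 (solveℕ 3 (λ q k l → q ⊠ k ⊠ (q ⊠ l) ≜ q ⊠ q ⊠ (k ⊠ l)) refl q κ κ′))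
               (solve 4 (λ i l e y → i :* (l :* e :* y) := l :* (i :* (e :* y))) refl
                 (𝟙 (gcd κ κ′ ℕ.≟ 1)) (lam q) (E κ κ′) (Y (q ℕ.* q ℕ.* (κ ℕ.* κ′)))))
               (∑₁-*ˡ Z (lam q) _)) (∑₁-*ˡ Z (lam q) _)) ⟩
        ∑₁ Z (λ q → lam q * common q) ∎

      R : ℕ → ℕ → ℚ
      R q m = ∑₁ Z (λ r → 𝟙 (m ∣? r) * (lam r * w (q ℕ.* q ℕ.* r)))

      R-multiples : ∀ q m → 1 ℕ.≤ q → 1 ℕ.≤ m → R q m ≡ ∑₁ Z (λ y → lam (m ℕ.* y) * w (q ℕ.* q ℕ.* (m ℕ.* y)))
      R-multiples q m 1≤q 1≤m = sym (∑₁-multiples Z m (λ r → lam r * w (q ℕ.* q ℕ.* r)) 1≤m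
        λ r Z<r → *0 (lam r) (w-supp _ (ℕₚ.<-≤-trans Z<r (m≤d*m r (ℕₚ.*-mono-≤ 1≤q 1≤q)))))

      R₂ : ℕ → ℕ → ℕ → ℚ
      R₂ q k k′ = ∑₁ Z (λ r → 𝟙 (k ∣? r) * 𝟙 (k′ ∣? r) * (lam r * w (q ℕ.* q ℕ.* r)))

      R₂-coprime : ∀ q d κ κ′ → 1 ℕ.≤ d → gcd κ κ′ ≡ 1 → R₂ q (d ℕ.* κ) (d ℕ.* κ′) ≡ R q (d ℕ.* (κ ℕ.* κ′))
      R₂-coprime q d κ κ′ 1≤d cop = ∑₁-ext Z λ r _ _ → cong (_* (lam r * w (q ℕ.* q ℕ.* r)))
        (𝟙-× (d ℕ.* κ ∣? r) (d ℕ.* κ′ ∣? r) (d ℕ.* (κ ℕ.* κ′) ∣? r) both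
          (λ div → ℕ∣.∣-trans (ℕ∣.*-monoʳ-∣ d (ℕ∣.m∣m*n κ′)) div , ℕ∣.∣-trans (ℕ∣.*-monoʳ-∣ d (ℕ∣.n∣m*n κ)) div))
        where
        both : ∀ {r} → d ℕ.* κ ∣ r → d ℕ.* κ′ ∣ r → d ℕ.* (κ ℕ.* κ′) ∣ r
        both (ℕ∣.divides x r≡) (ℕ∣.divides y r≡′) with
          Cop.coprime-divisor {κ′} {κ} {x} (Cop.sym (Cop.gcd≡1⇒coprime cop))
            (ℕ∣.divides y (ℕₚ.*-cancelˡ-≡ (κ ℕ.* x) (y ℕ.* κ′) d {{ℕ.>-nonZero 1≤d}}
              (trans (solveℕ 3 (λ d k x → d ⊠ (k ⊠ x) ≜ x ⊠ (d ⊠ k)) refl d κ x)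
                (trans (sym r≡) (trans r≡′ (solveℕ 3 (λ d k y → y ⊠ (d ⊠ k) ≜ d ⊠ (y ⊠ k)) refl d κ′ y))))))
        ... | ℕ∣.divides z x≡ = ℕ∣.divides z (trans r≡ (trans (cong (ℕ._* (d ℕ.* κ)) x≡)
              (solveℕ 4 (λ z l d k → z ⊠ l ⊠ (d ⊠ k) ≜ z ⊠ (d ⊠ (k ⊠ l))) refl z κ′ d κ)))

      -- For coprime κ and κ′ the numbers dκ and dκ′ both divide r exactly when r = dκκ′y. The pair
      -- (d, y) then takes over the role of (l, l′) in `Y`.
      rhs-inner : ∀ q → 1 ℕ.≤ q → ∑₁ Z (λ r → lam r * w (q ℕ.* q ℕ.* r) * N r) ≡ common q
      rhs-inner q 1≤q = begin
        ∑₁ Z (λ r → lam r * w (q ℕ.* q ℕ.* r) * N r)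
          ≡⟨ ∑₁-ext Z (λ r _ _ → trans (sym (∑₁-*ˡ Z (c r) _)) (∑₁-ext Z λ k _ _ → sym (∑₁-*ˡ Z (c r) _))) ⟩
        ∑₁ Z (λ r → ∑₁ Z (λ k → ∑₁ Z (λ k′ → c r * (𝟙 (k ∣? r) * 𝟙 (k′ ∣? r) * E k k′))))
          ≡⟨ ∑₁-swap Z Z _ ⟩
        ∑₁ Z (λ k → ∑₁ Z (λ r → ∑₁ Z (λ k′ → c r * (𝟙 (k ∣? r) * 𝟙 (k′ ∣? r) * E k k′))))
          ≡⟨ ∑₁-ext Z (λ k _ _ → trans (∑₁-swap Z Z _) (∑₁-ext Z λ k′ _ _ → trans
               (∑₁-ext Z λ r _ _ → solve 4 (λ c i j e → c :* (i :* j :* e) := e :* (i :* j :* c)) refl (c r) (𝟙 (k ∣? r)) (𝟙 (k′ ∣? r)) (E k k′))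
               (∑₁-*ˡ Z (E k k′) _))) ⟩
        ∑₁ Z (λ k → ∑₁ Z (λ k′ → E k k′ * R₂ q k k′))
          ≡⟨ ∑₁-gcd Z _ (λ k k′ Z<k _ → trans (cong (E k k′ *_) (∑₁-zero Z λ i 1≤i i≤Z → kill {k} {k′} i 1≤i (inj₁ (ℕₚ.≤-<-trans i≤Z Z<k)))) (ℚₚ.*-zeroʳ (E k k′)))
                        (λ k k′ _ Z<k′ → trans (cong (E k k′ *_) (∑₁-zero Z λ i 1≤i i≤Z → kill {k} {k′} i 1≤i (inj₂ (ℕₚ.≤-<-trans i≤Z Z<k′)))) (ℚₚ.*-zeroʳ (E k k′))) ⟩
        ∑₁ Z (λ d → ∑₁ Z (λ κ → ∑₁ Z (λ κ′ → 𝟙 (gcd κ κ′ ℕ.≟ 1) * (E (d ℕ.* κ) (d ℕ.* κ′) * R₂ q (d ℕ.* κ) (d ℕ.* κ′)))))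
          ≡⟨ ∑₁-ext Z (λ d 1≤d _ → ∑₁-ext Z λ κ 1≤κ _ → ∑₁-ext Z λ κ′ 1≤κ′ _ → reduce d κ κ′ 1≤d 1≤κ 1≤κ′) ⟩
        ∑₁ Z (λ d → ∑₁ Z (λ κ → ∑₁ Z (λ κ′ → 𝟙 (gcd κ κ′ ℕ.≟ 1) * (E κ κ′ * V κ κ′ d))))
          ≡⟨ ∑₁-swap Z Z _ ⟩
        ∑₁ Z (λ κ → ∑₁ Z (λ d → ∑₁ Z (λ κ′ → 𝟙 (gcd κ κ′ ℕ.≟ 1) * (E κ κ′ * V κ κ′ d))))
          ≡⟨ ∑₁-ext Z (λ κ _ _ → trans (∑₁-swap Z Z _) (∑₁-ext Z λ κ′ _ _ → trans (∑₁-*ˡ Z (𝟙 (gcd κ κ′ ℕ.≟ 1)) _)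
               (cong (𝟙 (gcd κ κ′ ℕ.≟ 1) *_) (∑₁-*ˡ Z (E κ κ′) _)))) ⟩
        common q ∎
        where
        c : ℕ → ℚ
        c r = lam r * w (q ℕ.* q ℕ.* r)
        V : ℕ → ℕ → ℕ → ℚ
        V κ κ′ d = ∑₁ Z (λ y → lam d * lam y * w (q ℕ.* q ℕ.* (κ ℕ.* κ′) ℕ.* (d ℕ.* y)))
        kill : ∀ {k k′} r → 1 ℕ.≤ r → (r ℕ.< k ⊎ r ℕ.< k′) → 𝟙 (k ∣? r) * 𝟙 (k′ ∣? r) * c r ≡ 0ℚ
        kill {k} {k′} r 1≤r (inj₁ r<k) = trans (cong (λ u → u * 𝟙 (k′ ∣? r) * c r) (𝟙-no (k ∣? r) (ℕ∣.>⇒∤ {{ℕ.>-nonZero 1≤r}} r<k)))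
          (solve 2 (λ i c → con 0ℚ :* i :* c := con 0ℚ) refl (𝟙 (k′ ∣? r)) (c r))
        kill {k} {k′} r 1≤r (inj₂ r<k) = trans (cong (λ u → 𝟙 (k ∣? r) * u * c r) (𝟙-no (k′ ∣? r) (ℕ∣.>⇒∤ {{ℕ.>-nonZero 1≤r}} r<k)))
          (solve 2 (λ i c → i :* con 0ℚ :* c := con 0ℚ) refl (𝟙 (k ∣? r)) (c r))
        reduce : ∀ d κ κ′ → 1 ℕ.≤ d → 1 ℕ.≤ κ → 1 ℕ.≤ κ′ →
          𝟙 (gcd κ κ′ ℕ.≟ 1) * (E (d ℕ.* κ) (d ℕ.* κ′) * R₂ q (d ℕ.* κ) (d ℕ.* κ′)) ≡ 𝟙 (gcd κ κ′ ℕ.≟ 1) * (E κ κ′ * V κ κ′ d)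
        reduce d κ κ′ 1≤d 1≤κ 1≤κ′ with gcd κ κ′ ℕ.≟ 1
        ... | no _ = trans (ℚₚ.*-zeroˡ (E (d ℕ.* κ) (d ℕ.* κ′) * R₂ q (d ℕ.* κ) (d ℕ.* κ′))) (sym (ℚₚ.*-zeroˡ (E κ κ′ * V κ κ′ d)))
        ... | yes cop = cong (1ℚ *_) (begin
          E (d ℕ.* κ) (d ℕ.* κ′) * R₂ q (d ℕ.* κ) (d ℕ.* κ′)
            ≡⟨ cong₂ _*_ (trans (E-scale d κ κ′) (cong (lam d *_) (sym (E-lam κ κ′))))
                 (trans (R₂-coprime q d κ κ′ 1≤d cop) (R-multiples q (d ℕ.* (κ ℕ.* κ′)) 1≤q (ℕₚ.*-mono-≤ 1≤d (ℕₚ.*-mono-≤ 1≤κ 1≤κ′)))) ⟩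
          lam d * (E κ κ′ * (lam κ * lam κ′)) * S
            ≡⟨ solve 5 (λ d e k l s → d :* (e :* (k :* l)) :* s := e :* ((d :* (k :* l)) :* s)) refl (lam d) (E κ κ′) (lam κ) (lam κ′) S ⟩
          E κ κ′ * (lam d * (lam κ * lam κ′) * S)
            ≡⟨ cong (E κ κ′ *_) (trans (sym (∑₁-*ˡ Z (lam d * (lam κ * lam κ′)) _)) (∑₁-ext Z λ y _ _ → term y)) ⟩
          E κ κ′ * ∑₁ Z (λ y → lam κ * lam κ′ * (lam d * lam y * w (q ℕ.* q ℕ.* (κ ℕ.* κ′) ℕ.* (d ℕ.* y))))
            ≡⟨ cong (E κ κ′ *_) (∑₁-*ˡ Z (lam κ * lam κ′) _) ⟩
          E κ κ′ * (lam κ * lam κ′ * V κ κ′ d)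
            ≡⟨ trans (sym (ℚₚ.*-assoc (E κ κ′) _ _)) (cong (_* V κ κ′ d) (E-lam κ κ′)) ⟩
          E κ κ′ * V κ κ′ d ∎)
          where
          S = ∑₁ Z (λ y → lam (d ℕ.* (κ ℕ.* κ′) ℕ.* y) * w (q ℕ.* q ℕ.* (d ℕ.* (κ ℕ.* κ′) ℕ.* y)))
          term : ∀ y → lam d * (lam κ * lam κ′) * (lam (d ℕ.* (κ ℕ.* κ′) ℕ.* y) * w (q ℕ.* q ℕ.* (d ℕ.* (κ ℕ.* κ′) ℕ.* y))) ≡
                       lam κ * lam κ′ * (lam d * lam y * w (q ℕ.* q ℕ.* (κ ℕ.* κ′) ℕ.* (d ℕ.* y)))
          term y = begin
            lam d * (lam κ * lam κ′) * (lam (d ℕ.* (κ ℕ.* κ′) ℕ.* y) * w (q ℕ.* q ℕ.* (d ℕ.* (κ ℕ.* κ′) ℕ.* y)))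
              ≡⟨ cong₂ (λ u v → lam d * (lam κ * lam κ′) * (u * w v))
                   (trans (lam-* (d ℕ.* (κ ℕ.* κ′)) y) (cong (_* lam y) (trans (lam-* d (κ ℕ.* κ′)) (cong (lam d *_) (lam-* κ κ′)))))
                   (solveℕ 4 (λ q d k y → q ⊠ q ⊠ (d ⊠ k ⊠ y) ≜ q ⊠ q ⊠ k ⊠ (d ⊠ y)) refl q d (κ ℕ.* κ′) y) ⟩
            lam d * (lam κ * lam κ′) * (lam d * (lam κ * lam κ′) * lam y * x)
              ≡⟨ solve 5 (λ d k l y x → d :* (k :* l) :* (d :* (k :* l) :* y :* x) := (k :* k) :* (l :* l) :* ((d :* d) :* y :* x)) refl
                   (lam d) (lam κ) (lam κ′) (lam y) x ⟩
            lam κ * lam κ * (lam κ′ * lam κ′) * (lam d * lam d * lam y * x)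
              ≡⟨ cong₂ _*_ (cong₂ _*_ (lam-idem κ) (lam-idem κ′)) (cong (λ u → u * lam y * x) (lam-idem d)) ⟩
            lam κ * lam κ′ * (lam d * lam y * x) ∎
            where
            x = w (q ℕ.* q ℕ.* (κ ℕ.* κ′) ℕ.* (d ℕ.* y))

      N-square : ∀ r → N r ≡ ∑ g (λ i → ∑₁ Z (λ k → 𝟙 (k ∣? r) * b i k) * ∑₁ Z (λ k → 𝟙 (k ∣? r) * b i k))
      N-square r = begin
        N r
          ≡⟨ ∑₁-ext Z (λ k _ _ → ∑₁-ext Z λ k′ _ _ → trans (sym (∑-*ˡ g (𝟙 (k ∣? r) * 𝟙 (k′ ∣? r)) _))
               (∑-ext g λ i → solve 4 (λ a b c d → a :* b :* (c :* d) := (a :* c) :* (b :* d)) refl (𝟙 (k ∣? r)) (𝟙 (k′ ∣? r)) (b i k) (b i k′))) ⟩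
        ∑₁ Z (λ k → ∑₁ Z (λ k′ → ∑ g (λ i → v i k * v i k′)))
          ≡⟨ trans (∑₁-ext Z λ k _ _ → ∑₁-∑-swap Z g (λ k′ i → v i k * v i k′))
               (∑₁-∑-swap Z g (λ k i → ∑₁ Z (λ k′ → v i k * v i k′))) ⟩
        ∑ g (λ i → ∑₁ Z (λ k → ∑₁ Z (λ k′ → v i k * v i k′)))
          ≡⟨ ∑-ext g (λ i → trans (∑₁-ext Z λ k _ _ → ∑₁-*ˡ Z (v i k) (v i)) (∑₁-*ʳ Z (∑₁ Z (v i)) (v i))) ⟩
        ∑ g (λ i → ∑₁ Z (v i) * ∑₁ Z (v i)) ∎
        where
        v : ℕ → ℕ → ℚ
        v i k = 𝟙 (k ∣? r) * b i k

    0≤N : ∀ r → 0ℚ ≤ N r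
    0≤N r = subst (0ℚ ≤_) (sym (N-square r)) (0≤∑ g λ i _ → 0≤p² (∑₁ Z (λ k → 𝟙 (k ∣? r) * b i k)))

    N-1 : N 1 ≡ E 1 1
    N-1 = trans (N-square 1) (∑-ext g λ i → cong₂ _*_ (pick i) (pick i))
      where
      pick : ∀ i → ∑₁ Z (λ k → 𝟙 (k ∣? 1) * b i k) ≡ b i 1
      pick i = ∑₁-pick Z (_∣? 1) (b i) 1 (s≤s z≤n) 1≤Z (ℕ∣.∣-refl) (λ _ → ℕ∣.∣1⇒≡1)

    rankinSelberg : ∑₁ Z (λ k → ∑₁ Z (λ k′ → E k k′ * Y (k ℕ.* k′))) ≡
                    ∑₁ Z (λ q → lam q * ∑₁ Z (λ r → lam r * w (q ℕ.* q ℕ.* r) * N r))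
    rankinSelberg = trans lhs (∑₁-ext Z λ q 1≤q _ → cong (lam q *_) (sym (rhs-inner q 1≤q)))

    -- All terms are nonnegative by `0≤N`; only r = 1 is kept for each q.
    rankinSelberg-≥ : ∑₁ Z (λ q → lam q * w (q ℕ.* q)) * E 1 1 ≤ ∑₁ Z (λ k → ∑₁ Z (λ k′ → E k k′ * Y (k ℕ.* k′)))
    rankinSelberg-≥ = subst₂ _≤_ (∑₁-*ʳ Z (E 1 1) (λ q → lam q * w (q ℕ.* q))) (sym rankinSelberg) (∑₁-mono Z λ q _ _ → bound q)
      where
      bound : ∀ q → lam q * w (q ℕ.* q) * E 1 1 ≤ lam q * ∑₁ Z (λ r → lam r * w (q ℕ.* q ℕ.* r) * N r)
      bound q = subst (_≤ lam q * ∑₁ Z term) eq (*-monoˡ (lam-0≤ q)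
        (first≤∑₁ Z 1≤Z (λ r → 0≤* (0≤* (lam-0≤ r) (w-0≤ (q ℕ.* q ℕ.* r))) (0≤N r))))
        where
        term : ℕ → ℚ
        term r = lam r * w (q ℕ.* q ℕ.* r) * N r
        eq : lam q * term 1 ≡ lam q * w (q ℕ.* q) * E 1 1
        eq = trans (cong₂ (λ u v → lam q * (u * w (q ℕ.* q ℕ.* 1) * v)) lam-1 N-1)
          (trans (cong (λ m → lam q * (1ℚ * w m * E 1 1)) (ℕₚ.*-identityʳ (q ℕ.* q)))
            (solve 3 (λ l w e → l :* (con 1ℚ :* w :* e) := l :* w :* e) refl (lam q) (w (q ℕ.* q)) (E 1 1)))

-- Elementary sums

Δ² : (ℕ → ℚ) → ℕ → ℚ
Δ² η t = η (suc (suc t)) - (η (suc t) + η (suc t)) + η t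

∑-Δ² : ∀ (η : ℕ → ℚ) v e → ∑ (v ℕ.+ e) (λ t → Δ² η t * ι (suc t ℕ.∸ v)) ≡
       ι e * η (suc (v ℕ.+ e)) - (1ℚ + ι e) * η (v ℕ.+ e) + η v
∑-Δ² η v zero = begin
  ∑ (v ℕ.+ 0) term                                        ≡⟨ ∑-zero (v ℕ.+ 0) (λ t t<v → *0 (Δ² η t) (cong ι (ℕₚ.m≤n⇒m∸n≡0 (subst (suc t ℕ.≤_) (ℕₚ.+-identityʳ v) t<v)))) ⟩
  0ℚ                                                      ≡⟨ solve 2 (λ x y → con 0ℚ := con 0ℚ :* x :- (con 1ℚ :+ con 0ℚ) :* y :+ y) refl (η (suc (v ℕ.+ 0))) (η v) ⟩
  0ℚ * η (suc (v ℕ.+ 0)) - (1ℚ + 0ℚ) * η v + η v          ≡⟨ cong (λ m → 0ℚ * η (suc (v ℕ.+ 0)) - (1ℚ + 0ℚ) * η m + η v) (sym (ℕₚ.+-identityʳ v)) ⟩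
  0ℚ * η (suc (v ℕ.+ 0)) - (1ℚ + 0ℚ) * η (v ℕ.+ 0) + η v  ∎
  where
  open ≡-Reasoning
  term : ℕ → ℚ
  term t = Δ² η t * ι (suc t ℕ.∸ v)
∑-Δ² η v (suc e) = subst (λ m → ∑ m term ≡ ι (suc e) * η (suc m) - (1ℚ + ι (suc e)) * η m + η v) (sym (ℕₚ.+-suc v e)) (begin
  ∑ (v ℕ.+ e) term + term (v ℕ.+ e)
    ≡⟨ cong₂ _+_ (∑-Δ² η v e) (cong (λ m → Δ² η (v ℕ.+ e) * ι m) (trans (cong (ℕ._∸ v) (sym (ℕₚ.+-suc v e))) (ℕₚ.m+n∸m≡n v (suc e)))) ⟩
  ι e * η (suc s) - (1ℚ + ι e) * η s + η v + Δ² η s * (1ℚ + ι e)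
    ≡⟨ solve 5 (λ e a b c v → e :* b :- (con 1ℚ :+ e) :* a :+ v :+ (c :- (b :+ b) :+ a) :* (con 1ℚ :+ e)
         := (con 1ℚ :+ e) :* c :- (con 1ℚ :+ (con 1ℚ :+ e)) :* b :+ v) refl (ι e) (η s) (η (suc s)) (η (suc (suc s))) (η v) ⟩
  (1ℚ + ι e) * η (suc (suc s)) - (1ℚ + (1ℚ + ι e)) * η (suc s) + η v ∎)
  where
  open ≡-Reasoning
  s = v ℕ.+ e
  term : ℕ → ℚ
  term t = Δ² η t * ι (suc t ℕ.∸ v)

-- A discrete Taylor formula: second differences against ramps recover a finitely supported
-- function. It transfers bounds for ramps to any weight whose second differences are controlled.
reproduce : ∀ (η : ℕ → ℚ) S v → (∀ m → S ℕ.≤ m → η m ≡ 0ℚ) → ∑ S (λ t → Δ² η t * ι (suc t ℕ.∸ v)) ≡ η v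
reproduce η S v η≡0 with v ℕ.≤? S
... | no  v≰S = trans (∑-zero S λ t t<S → *0 (Δ² η t) (cong ι (ℕₚ.m≤n⇒m∸n≡0 (ℕₚ.≤-trans t<S (ℕₚ.<⇒≤ (ℕₚ.≰⇒> v≰S))))))
                  (sym (η≡0 v (ℕₚ.<⇒≤ (ℕₚ.≰⇒> v≰S))))
... | yes v≤S = begin
  ∑ S (λ t → Δ² η t * ι (suc t ℕ.∸ v))             ≡⟨ cong (λ m → ∑ m (λ t → Δ² η t * ι (suc t ℕ.∸ v))) (sym S≡) ⟩
  ∑ (v ℕ.+ e) (λ t → Δ² η t * ι (suc t ℕ.∸ v))     ≡⟨ ∑-Δ² η v e ⟩
  ι e * η (suc (v ℕ.+ e)) - (1ℚ + ι e) * η (v ℕ.+ e) + η v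
    ≡⟨ cong₂ (λ x y → ι e * x - (1ℚ + ι e) * y + η v) (η≡0 _ (ℕₚ.≤-trans (ℕₚ.≤-reflexive (sym S≡)) (ℕₚ.n≤1+n _))) (η≡0 _ (ℕₚ.≤-reflexive (sym S≡))) ⟩
  ι e * 0ℚ - (1ℚ + ι e) * 0ℚ + η v                 ≡⟨ solve 2 (λ e v → e :* con 0ℚ :- (con 1ℚ :+ e) :* con 0ℚ :+ v := v) refl (ι e) (η v) ⟩
  η v                                              ∎
  where
  open ≡-Reasoning
  e = S ℕ.∸ v
  S≡ : v ℕ.+ e ≡ S
  S≡ = ℕₚ.m+[n∸m]≡n v≤S

6ℚ : ℚ
6ℚ = ι 6

∑-parabola : ∀ e (d : ℚ) → 6ℚ * ∑ e (λ i → ι (suc i) * (d - ι (suc i))) ≡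
             (d + d + d) * (ι e * (1ℚ + ι e)) - ι e * (1ℚ + ι e) * (ι e + ι e + 1ℚ)
∑-parabola zero    d = solve 1 (λ d → con 6ℚ :* con 0ℚ := (d :+ d :+ d) :* (con 0ℚ :* (con 1ℚ :+ con 0ℚ)) :- con 0ℚ :* (con 1ℚ :+ con 0ℚ) :* (con 0ℚ :+ con 0ℚ :+ con 1ℚ)) refl d
∑-parabola (suc e) d = trans (ℚₚ.*-distribˡ-+ 6ℚ (∑ e _) _) (trans (cong (_+ 6ℚ * (ι (suc e) * (d - ι (suc e)))) (∑-parabola e d))
  (solve 2 (λ e d → (d :+ d :+ d) :* (e :* (con 1ℚ :+ e)) :- e :* (con 1ℚ :+ e) :* (e :+ e :+ con 1ℚ) :+ con 6ℚ :* ((con 1ℚ :+ e) :* (d :- (con 1ℚ :+ e)))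
     := (d :+ d :+ d) :* ((con 1ℚ :+ e) :* (con 1ℚ :+ (con 1ℚ :+ e))) :- (con 1ℚ :+ e) :* (con 1ℚ :+ (con 1ℚ :+ e)) :* ((con 1ℚ :+ e) :+ (con 1ℚ :+ e) :+ con 1ℚ)) refl (ι e) d))

-- The convolution of two ramps at distance D is (D³ - D)/6; the factor 6 clears the denominator.
∑-triangle : ∀ N a B → B ℕ.≤ N → 6ℚ * ∑₁ N (λ j → ι (j ℕ.∸ a) * ι (B ℕ.∸ j)) ≡
             ι (B ℕ.∸ a) * ι (B ℕ.∸ a) * ι (B ℕ.∸ a) - ι (B ℕ.∸ a)
∑-triangle N a B B≤N with a ℕ.≤? B
... | no a≰B = trans (*0 6ℚ (∑₁-zero N zeros))
      (sym (cong (λ m → ι m * ι m * ι m - ι m) (ℕₚ.m≤n⇒m∸n≡0 (ℕₚ.<⇒≤ (ℕₚ.≰⇒> a≰B)))))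
  where
  zeros : ∀ j → 1 ℕ.≤ j → j ℕ.≤ N → ι (j ℕ.∸ a) * ι (B ℕ.∸ j) ≡ 0ℚ
  zeros j _ _ with j ℕ.≤? a
  ... | yes j≤a = 0* (ι (B ℕ.∸ j)) (cong ι (ℕₚ.m≤n⇒m∸n≡0 j≤a))
  ... | no  j≰a = *0 (ι (j ℕ.∸ a)) (cong ι (ℕₚ.m≤n⇒m∸n≡0 (ℕₚ.≤-trans (ℕₚ.<⇒≤ (ℕₚ.≰⇒> a≰B)) (ℕₚ.<⇒≤ (ℕₚ.≰⇒> j≰a)))))
... | yes a≤B = begin
  6ℚ * ∑₁ N (λ j → ι (j ℕ.∸ a) * ι (B ℕ.∸ j))  ≡⟨ cong (6ℚ *_) (trans (∑₁-∑ N _) (trans (cong (λ m → ∑ m f) (sym N≡)) (trans (∑-split a (d ℕ.+ r) f) (cong (∑ a f +_) (∑-split d r _))))) ⟩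
  6ℚ * (∑ a f + (∑ d (λ i → f (a ℕ.+ i)) + ∑ r (λ i → f (a ℕ.+ (d ℕ.+ i)))))
    ≡⟨ cong (6ℚ *_) (cong₂ _+_ low (cong₂ _+_ (∑-cong d mid) high)) ⟩
  6ℚ * (0ℚ + (∑ d (λ i → ι (suc i) * (ι d - ι (suc i))) + 0ℚ))
    ≡⟨ solve 1 (λ x → con 6ℚ :* (con 0ℚ :+ (x :+ con 0ℚ)) := con 6ℚ :* x) refl (∑ d (λ i → ι (suc i) * (ι d - ι (suc i)))) ⟩
  6ℚ * ∑ d (λ i → ι (suc i) * (ι d - ι (suc i)))
    ≡⟨ ∑-parabola d (ι d) ⟩
  (ι d + ι d + ι d) * (ι d * (1ℚ + ι d)) - ι d * (1ℚ + ι d) * (ι d + ι d + 1ℚ)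
    ≡⟨ solve 1 (λ d → (d :+ d :+ d) :* (d :* (con 1ℚ :+ d)) :- d :* (con 1ℚ :+ d) :* (d :+ d :+ con 1ℚ) := d :* d :* d :- d) refl (ι d) ⟩
  ι d * ι d * ι d - ι d ∎
  where
  open ≡-Reasoning
  d = B ℕ.∸ a
  r = N ℕ.∸ B
  f : ℕ → ℚ
  f t = ι (suc t ℕ.∸ a) * ι (B ℕ.∸ suc t)
  a+d≡B : a ℕ.+ d ≡ B
  a+d≡B = ℕₚ.m+[n∸m]≡n a≤B
  N≡ : a ℕ.+ (d ℕ.+ r) ≡ N
  N≡ = trans (sym (ℕₚ.+-assoc a d r)) (trans (cong (ℕ._+ r) a+d≡B) (ℕₚ.m+[n∸m]≡n B≤N))
  low : ∑ a f ≡ 0ℚ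
  low = ∑-zero a λ t t<a → 0* (ι (B ℕ.∸ suc t)) (cong ι (ℕₚ.m≤n⇒m∸n≡0 t<a))
  high : ∑ r (λ i → f (a ℕ.+ (d ℕ.+ i))) ≡ 0ℚ
  high = ∑-zero r λ i _ → *0 (ι (suc (a ℕ.+ (d ℕ.+ i)) ℕ.∸ a)) (cong ι (ℕₚ.m≤n⇒m∸n≡0
    (ℕₚ.≤-trans (ℕₚ.≤-reflexive (sym a+d≡B)) (ℕₚ.≤-trans (ℕₚ.m≤m+n (a ℕ.+ d) i) (ℕₚ.≤-trans (ℕₚ.≤-reflexive (ℕₚ.+-assoc a d i)) (ℕₚ.n≤1+n _))))))
  mid : ∀ i → i ℕ.< d → f (a ℕ.+ i) ≡ ι (suc i) * (ι d - ι (suc i))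
  mid i i<d = cong₂ _*_ (cong ι (trans (cong (ℕ._∸ a) (sym (ℕₚ.+-suc a i))) (ℕₚ.m+n∸m≡n a (suc i))))
    (trans (cong ι (trans (cong₂ ℕ._∸_ (sym a+d≡B) (sym (ℕₚ.+-suc a i))) (ℕₚ.[m+n]∸[m+o]≡n∸o a d (suc i)))) (ι-∸ i<d))

-- The sum over `j` merges a weight in `u` and a weight in `v` into functions of the product uv,
-- apart from the factor v² in the correction. Divisibility of `R` by `v` allows RX - jv to be
-- written as v(B - j) with an integer B, so `∑-triangle` applies exactly; its linear part becomes
-- the term with a single factor `R`.
kernel : ∀ R X u v → 1 ℕ.≤ u → 1 ℕ.≤ v → (v ℕ.≤ X → v ∣ R) →
  6ℚ * ∑₁ (R ℕ.* X) (λ j → ι (j ℕ.∸ u ℕ.* R) * (ι v * ι v * ι (R ℕ.* X ℕ.∸ j ℕ.* v))) ≡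
  ι R * ι R * ι R * (ι (X ℕ.∸ u ℕ.* v) * ι (X ℕ.∸ u ℕ.* v) * ι (X ℕ.∸ u ℕ.* v)) - ι R * (ι v * ι v * ι (X ℕ.∸ u ℕ.* v))
kernel R X u v 1≤u 1≤v v∣R with v ℕ.≤? X
-- For v > X both sides vanish: a `j` beyond uR is at least `R`, hence jv ≥ RX.
... | no v≰X = trans (*0 6ℚ (∑₁-zero (R ℕ.* X) zeros))
      (sym (trans (cong (λ m → ι R * ι R * ι R * (ι m * ι m * ι m) - ι R * (ι v * ι v * ι m)) (ℕₚ.m≤n⇒m∸n≡0 (ℕₚ.<⇒≤ (ℕₚ.<-≤-trans X<v (m≤d*m v 1≤u)))))
        (solve 2 (λ r v → r :* r :* r :* (con 0ℚ :* con 0ℚ :* con 0ℚ) :- r :* (v :* v :* con 0ℚ) := con 0ℚ) refl (ι R) (ι v))))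
  where
  X<v = ℕₚ.≰⇒> v≰X
  zeros : ∀ j → 1 ℕ.≤ j → j ℕ.≤ R ℕ.* X → ι (j ℕ.∸ u ℕ.* R) * (ι v * ι v * ι (R ℕ.* X ℕ.∸ j ℕ.* v)) ≡ 0ℚ
  zeros j _ _ with j ℕ.≤? u ℕ.* R
  ... | yes j≤uR = 0* (ι v * ι v * ι (R ℕ.* X ℕ.∸ j ℕ.* v)) (cong ι (ℕₚ.m≤n⇒m∸n≡0 j≤uR))
  ... | no  j≰uR = *0 (ι (j ℕ.∸ u ℕ.* R)) (*0 (ι v * ι v) (cong ι (ℕₚ.m≤n⇒m∸n≡0
        (ℕₚ.*-mono-≤ (ℕₚ.≤-trans (m≤d*m R 1≤u) (ℕₚ.<⇒≤ (ℕₚ.≰⇒> j≰uR))) (ℕₚ.<⇒≤ X<v)))))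
... | yes v≤X with v∣R v≤X
... | ℕ∣.divides c R≡cv = begin
  6ℚ * ∑₁ N (λ j → ι (j ℕ.∸ a) * (ι v * ι v * ι (N ℕ.∸ j ℕ.* v)))
    ≡⟨ cong (6ℚ *_) (trans (∑₁-ext N λ j _ _ → trans (cong (λ m → ι (j ℕ.∸ a) * (ι v * ι v * ι m)) (scale j))
         (trans (cong (λ m → ι (j ℕ.∸ a) * (ι v * ι v * m)) (ι-* (B ℕ.∸ j) v))
           (solve 3 (λ x v y → x :* (v :* v :* (y :* v)) := v :* v :* v :* (x :* y)) refl (ι (j ℕ.∸ a)) (ι v) (ι (B ℕ.∸ j)))))
         (∑₁-*ˡ N (ι v * ι v * ι v) _)) ⟩
  6ℚ * (ι v * ι v * ι v * ∑₁ N (λ j → ι (j ℕ.∸ a) * ι (B ℕ.∸ j)))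
    ≡⟨ solve 3 (λ s v t → s :* (v :* v :* v :* t) := v :* v :* v :* (s :* t)) refl 6ℚ (ι v) (∑₁ N (λ j → ι (j ℕ.∸ a) * ι (B ℕ.∸ j))) ⟩
  ι v * ι v * ι v * (6ℚ * ∑₁ N (λ j → ι (j ℕ.∸ a) * ι (B ℕ.∸ j)))
    ≡⟨ cong (ι v * ι v * ι v *_) (∑-triangle N a B (subst (B ℕ.≤_) (sym N≡Bv) (ℕₚ.m≤m*n B v {{ℕ.>-nonZero 1≤v}}))) ⟩
  ι v * ι v * ι v * (ι d * ι d * ι d - ι d)
    ≡⟨ solve 2 (λ v d → v :* v :* v :* (d :* d :* d :- d) := (d :* v) :* (d :* v) :* (d :* v) :- v :* v :* (d :* v)) refl (ι v) (ι d) ⟩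
  ι d * ι v * (ι d * ι v) * (ι d * ι v) - ι v * ι v * (ι d * ι v)
    ≡⟨ cong (λ m → m * m * m - ι v * ι v * m) dv ⟩
  ι R * ι x * (ι R * ι x) * (ι R * ι x) - ι v * ι v * (ι R * ι x)
    ≡⟨ solve 3 (λ r x v → r :* x :* (r :* x) :* (r :* x) :- v :* v :* (r :* x) := r :* r :* r :* (x :* x :* x) :- r :* (v :* v :* x)) refl (ι R) (ι x) (ι v) ⟩
  ι R * ι R * ι R * (ι x * ι x * ι x) - ι R * (ι v * ι v * ι x) ∎
  where
  open ≡-Reasoning
  N = R ℕ.* X
  a = u ℕ.* R
  B = c ℕ.* X
  d = B ℕ.∸ a
  x = X ℕ.∸ u ℕ.* v
  N≡Bv : N ≡ B ℕ.* v
  N≡Bv = trans (cong (ℕ._* X) R≡cv) (solveℕ 3 (λ c v x → c ⊠ v ⊠ x ≜ c ⊠ x ⊠ v) refl c v X)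
  scale : ∀ j → N ℕ.∸ j ℕ.* v ≡ (B ℕ.∸ j) ℕ.* v
  scale j = trans (cong (ℕ._∸ j ℕ.* v) N≡Bv) (sym (ℕₚ.*-distribʳ-∸ v B j))
  dv : ι d * ι v ≡ ι R * ι x
  dv = trans (sym (ι-* d v)) (trans (cong ι (trans (sym (scale a)) (trans (cong (N ℕ.∸_) (solveℕ 3 (λ u r v → u ⊠ r ⊠ v ≜ r ⊠ (u ⊠ v)) refl u R v)) (sym (ℕₚ.*-distribˡ-∸ R X (u ℕ.* v)))))) (ι-* R x))

-- A ramp whose corner is a multiple of `R` is linear between consecutive multiples of `R`.
interpolate : ∀ R s r u → r ℕ.≤ R → ι (s ℕ.* R ℕ.+ r ℕ.∸ u ℕ.* R) ≡ (ι R - ι r) * ι (s ℕ.∸ u) + ι r * ι (suc s ℕ.∸ u)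
interpolate R s r u r≤R with u ℕ.≤? s
... | yes u≤s = begin
  ι (s ℕ.* R ℕ.+ r ℕ.∸ u ℕ.* R)              ≡⟨ ι-∸ (ℕₚ.≤-trans (ℕₚ.*-monoˡ-≤ R u≤s) (ℕₚ.m≤m+n (s ℕ.* R) r)) ⟩
  ι (s ℕ.* R ℕ.+ r) - ι (u ℕ.* R)            ≡⟨ cong₂ _-_ (trans (ι-+ (s ℕ.* R) r) (cong (_+ ι r) (ι-* s R))) (ι-* u R) ⟩
  ι s * ι R + ι r - ι u * ι R                ≡⟨ solve 4 (λ s u R r → s :* R :+ r :- u :* R := (R :- r) :* (s :- u) :+ r :* ((con 1ℚ :+ s) :- u)) refl (ι s) (ι u) (ι R) (ι r) ⟩
  (ι R - ι r) * (ι s - ι u) + ι r * (ι (suc s) - ι u)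
    ≡⟨ sym (cong₂ (λ x y → (ι R - ι r) * x + ι r * y) (ι-∸ u≤s) (ι-∸ (ℕₚ.≤-trans u≤s (ℕₚ.n≤1+n s)))) ⟩
  (ι R - ι r) * ι (s ℕ.∸ u) + ι r * ι (suc s ℕ.∸ u) ∎
  where open ≡-Reasoning
... | no u≰s = begin
  ι (s ℕ.* R ℕ.+ r ℕ.∸ u ℕ.* R)              ≡⟨ cong ι (ℕₚ.m≤n⇒m∸n≡0 (ℕₚ.≤-trans (ℕₚ.+-monoʳ-≤ (s ℕ.* R) r≤R) (ℕₚ.≤-trans (ℕₚ.≤-reflexive (ℕₚ.+-comm (s ℕ.* R) R)) (ℕₚ.*-monoˡ-≤ R s<u)))) ⟩
  0ℚ                                         ≡⟨ solve 2 (λ R r → con 0ℚ := (R :- r) :* con 0ℚ :+ r :* con 0ℚ) refl (ι R) (ι r) ⟩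
  (ι R - ι r) * 0ℚ + ι r * 0ℚ
    ≡⟨ sym (cong₂ (λ x y → (ι R - ι r) * ι x + ι r * ι y) (ℕₚ.m≤n⇒m∸n≡0 (ℕₚ.<⇒≤ s<u)) (ℕₚ.m≤n⇒m∸n≡0 s<u)) ⟩
  (ι R - ι r) * ι (s ℕ.∸ u) + ι r * ι (suc s ℕ.∸ u) ∎
  where
  open ≡-Reasoning
  s<u = ℕₚ.≰⇒> u≰s

p²≤0⇒p≡0 : ∀ p → p * p ≤ 0ℚ → p ≡ 0ℚ
p²≤0⇒p≡0 p p²≤0 with p ℚₚ.≟ 0ℚ
... | yes p≡0 = p≡0
... | no  p≢0 = ⊥-elim (ℚₚ.1≢0 (trans (sym (trans (cong₂ _*_ (*-inv p≢0) (*-inv p≢0)) (ℚₚ.*-identityˡ 1ℚ)))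
      (trans (solve 2 (λ p i → p :* i :* (p :* i) := (p :* p) :* (i :* i)) refl p (inv p)) (0* (inv p * inv p) (ℚₚ.≤-antisym p²≤0 (0≤p² p))))))

∑-progression : ∀ n I (f : ℕ → ℚ) → 1 ℕ.≤ n → (∀ k → 0ℚ ≤ f k) → ∑ I (λ i → f (n ℕ.* i)) ≤ ∑ (n ℕ.* I) f
∑-progression n zero    f 1≤n 0≤f = ≤-reflexive (cong (λ m → ∑ m f) (sym (ℕₚ.*-zeroʳ n)))
∑-progression n (suc I) f 1≤n 0≤f = subst (∑ I (λ i → f (n ℕ.* i)) + f (n ℕ.* I) ≤_)
  (trans (sym (∑-split (n ℕ.* I) n f)) (cong (λ m → ∑ m f) (trans (ℕₚ.+-comm (n ℕ.* I) n) (sym (ℕₚ.*-suc n I)))))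
  (ℚₚ.+-mono-≤ (∑-progression n I f 1≤n 0≤f)
    (subst (λ m → f m ≤ ∑ n (λ t → f (n ℕ.* I ℕ.+ t))) (ℕₚ.+-identityʳ (n ℕ.* I)) (term≤∑ n (λ t _ → 0≤f (n ℕ.* I ℕ.+ t)) 0 1≤n)))

n<2^n : ∀ n → suc n ℕ.≤ 2 ℕ.^ n
n<2^n zero    = s≤s z≤n
n<2^n (suc n) = ℕₚ.≤-trans (ℕₚ.+-mono-≤ (ℕₚ.m^n>0 2 n) (n<2^n n)) (ℕₚ.≤-reflexive (cong (2 ℕ.^ n ℕ.+_) (sym (ℕₚ.+-identityʳ (2 ℕ.^ n)))))

∑₁-+ : ∀ Z (f h : ℕ → ℚ) → ∑₁ Z (λ k → f k + h k) ≡ ∑₁ Z f + ∑₁ Z h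
∑₁-+ Z f h = trans (∑₁-∑ Z _) (trans (∑-+ Z (f ∘ suc) (h ∘ suc)) (sym (cong₂ _+_ (∑₁-∑ Z f) (∑₁-∑ Z h))))

∑₁-const : ∀ Z c → ∑₁ Z (λ _ → c) ≡ ι Z * c
∑₁-const Z c = trans (∑₁-∑ Z _) (∑-const Z c)

-- The nonvanishing argument.  Φ and Ω are two smoothed sums of the coefficients of ζ(s)L(s,χ);
-- their product, summed over j, is a sum of the nonnegative coefficients of ζ(s)²L(s,χ)L(s,χ̄).
module Nonvanishing (lam : ℕ → ℚ) (σ C₁ : ℚ) (0≤σ : 0ℚ ≤ σ)
  (lam-count : ∀ y → ∣ ∑ y (lam ∘ suc) - (σ + σ) * ι y ∣ ≤ C₁)
  (lam-0≤ : ∀ m → 0ℚ ≤ lam m) (lam-≤1 : ∀ m → lam m ≤ 1ℚ) (lam-1 : lam 1 ≡ 1ℚ)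
  (lam-* : ∀ m n → lam (m ℕ.* n) ≡ lam m * lam n) (lam-idem : ∀ m → lam m * lam m ≡ lam m)
  (g : ℕ) (b : ℕ → ℕ → ℚ) (b-lam : ∀ i m → b i m * lam m ≡ b i m) (C₂ C₃ : ℚ)
  (b-sum : ∀ i m → ∣ ∑ m (b i ∘ suc) ∣ ≤ C₂)
  (b-log : ∀ i m → ι m * ∣ ∑ m (λ k → b i (suc k) * rcp (suc k)) ∣ ≤ C₃) where

  open Riesz lam σ C₁ 0≤σ lam-count using (K; T-bound) renaming (T to Tsum; 0≤C to 0≤C)
  open RankinSelberg lam g b lam-0≤ lam-1 lam-* lam-idem b-lam using (E; Y; rankinSelberg-≥)

  0≤C₂ : 0ℚ ≤ C₂
  0≤C₂ = b-sum 0 0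

  0≤C₃ : 0ℚ ≤ C₃
  0≤C₃ = subst (_≤ C₃) (ℚₚ.*-zeroˡ 0ℚ) (b-log 0 0)

  𝓛 : ℕ → ℕ → (ℕ → ℚ) → ℚ
  𝓛 Z i ω = ∑₁ Z (λ k → ∑₁ Z (λ l → b i k * lam l * ω (k ℕ.* l)))

  𝓛-cong : ∀ Z i {ω ω′ : ℕ → ℚ} → (∀ u → 1 ℕ.≤ u → ω u ≡ ω′ u) → 𝓛 Z i ω ≡ 𝓛 Z i ω′
  𝓛-cong Z i ω≡ω′ = ∑₁-ext Z λ k 1≤k _ → ∑₁-ext Z λ l 1≤l _ → cong (b i k * lam l *_) (ω≡ω′ (k ℕ.* l) (ℕₚ.*-mono-≤ 1≤k 1≤l))

  𝓛-+ : ∀ Z i (ω ω′ : ℕ → ℚ) → 𝓛 Z i (λ u → ω u + ω′ u) ≡ 𝓛 Z i ω + 𝓛 Z i ω′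
  𝓛-+ Z i ω ω′ = trans (∑₁-ext Z λ k _ _ → trans (∑₁-ext Z λ l _ _ → ℚₚ.*-distribˡ-+ (b i k * lam l) (ω (k ℕ.* l)) (ω′ (k ℕ.* l)))
    (∑₁-+ Z (λ l → b i k * lam l * ω (k ℕ.* l)) (λ l → b i k * lam l * ω′ (k ℕ.* l))))
    (∑₁-+ Z (λ k → ∑₁ Z (λ l → b i k * lam l * ω (k ℕ.* l))) (λ k → ∑₁ Z (λ l → b i k * lam l * ω′ (k ℕ.* l))))

  𝓛-* : ∀ Z i c (ω : ℕ → ℚ) → 𝓛 Z i (λ u → c * ω u) ≡ c * 𝓛 Z i ω
  𝓛-* Z i c ω = trans (∑₁-ext Z λ k _ _ → trans (∑₁-ext Z λ l _ _ →
      solve 4 (λ b l c w → b :* l :* (c :* w) := c :* (b :* l :* w)) refl (b i k) (lam l) c (ω (k ℕ.* l)))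
    (∑₁-*ˡ Z c (λ l → b i k * lam l * ω (k ℕ.* l)))) (∑₁-*ˡ Z c (λ k → ∑₁ Z (λ l → b i k * lam l * ω (k ℕ.* l))))

  𝓛-∑ : ∀ Z i S (c : ℕ → ℚ) (ω : ℕ → ℕ → ℚ) → 𝓛 Z i (λ u → ∑ S (λ t → c t * ω t u)) ≡ ∑ S (λ t → c t * 𝓛 Z i (ω t))
  𝓛-∑ Z i zero    c ω = ∑₁-zero Z λ k _ _ → ∑₁-zero Z λ l _ _ → ℚₚ.*-zeroʳ (b i k * lam l)
  𝓛-∑ Z i (suc S) c ω = trans (𝓛-+ Z i (λ u → ∑ S (λ t → c t * ω t u)) (λ u → c S * ω S u))
    (cong₂ _+_ (𝓛-∑ Z i S c ω) (𝓛-* Z i (c S) (ω S)))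

  T : ℕ → ℕ → ℕ → ℚ
  T Z i s = 𝓛 Z i (λ u → ι (s ℕ.∸ u))

  -- `K` involves only the constants shared by the whole family, so the value formed with `b 0`
  -- serves every index.
  Kc : ℚ → ℚ
  Kc = K (b 0) C₂ C₃ (b-sum 0) (b-log 0)

  ∣T∣≤ : ∀ Z i s h → s ℕ.≤ Z → H Z ≤ h → ∣ T Z i s ∣ ≤ ι s * Kc h
  ∣T∣≤ Z i s h s≤Z HZ≤h = subst (λ x → ∣ x ∣ ≤ ι s * Kc h) (sym eq)
    (T-bound (b i) C₂ C₃ (b-sum i) (b-log i) Z s h s≤Z HZ≤h)
    where
    eq : T Z i s ≡ Tsum (b i) C₂ C₃ (b-sum i) (b-log i) Z s
    eq = trans (∑₁-∑ Z _) (∑-ext Z λ k → ∑₁-∑ Z _)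

  module _ (Z X R : ℕ) (h : ℚ) (1≤R : 1 ℕ.≤ R) (X<Z : X ℕ.< Z) (HZ≤h : H Z ≤ h) (0≤h : 0ℚ ≤ h) where

    private
      N : ℕ
      N = R ℕ.* X

      instance
        _ = ℕ.>-nonZero 1≤R

    -- `Φ` sees u < j/R and `Ω` sees v < N/j, so every product uv stays below N/R = X: `j` runs
    -- along the hyperbola. The factor v² in `Ω` is what lets `kernel` produce the cube of X - uv.
    Φ Ω : ℕ → ℕ → ℚ
    Φ i j = 𝓛 Z i (λ u → ι (j ℕ.∸ u ℕ.* R))
    Ω i j = 𝓛 Z i (λ v → ι v * ι v * ι (N ℕ.∸ j ℕ.* v))

    0≤Kc : 0ℚ ≤ Kc h
    0≤Kc = 0≤+ (0≤* 0≤σ 0≤C₃) (0≤* 0≤C₂ (0≤+ 0≤C (0≤* (0≤+ 0≤C 0≤C) 0≤h)))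

    ∣Φ∣≤ : ∀ i j → j ℕ.≤ N → ∣ Φ i j ∣ ≤ ι j * Kc h
    ∣Φ∣≤ i j j≤N = subst₂ (λ x y → ∣ x ∣ ≤ y) (sym eq) eq′
      (∣+∣≤ (∣*∣≤ {ι R - ι r} (≤-reflexive (ℚₚ.0≤p⇒∣p∣≡p (0≤-diff (ι-mono r≤R)))) (∣T∣≤ Z i s h (ℕₚ.≤-trans s≤X (ℕₚ.<⇒≤ X<Z)) HZ≤h))
            (∣*∣≤ {ι r} (≤-reflexive (∣ι∣ r)) (∣T∣≤ Z i (suc s) h (ℕₚ.≤-trans (s≤s s≤X) X<Z) HZ≤h)))
      where
      s = j ℕ./ R
      r = j ℕ.% R
      r≤R : r ℕ.≤ R
      r≤R = ℕₚ.<⇒≤ (ℕ.m%n<n j R)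
      s≤X : s ℕ.≤ X
      s≤X = subst (s ℕ.≤_) (trans (cong (ℕ._/ R) (ℕₚ.*-comm R X)) (ℕ.m*n/n≡m X R)) (ℕ./-monoˡ-≤ R j≤N)
      j≡ : j ≡ s ℕ.* R ℕ.+ r
      j≡ = trans (ℕ.m≡m%n+[m/n]*n j R) (ℕₚ.+-comm r (s ℕ.* R))
      eq : Φ i j ≡ (ι R - ι r) * T Z i s + ι r * T Z i (suc s)
      eq = trans (𝓛-cong Z i λ u _ → trans (cong (λ m → ι (m ℕ.∸ u ℕ.* R)) j≡) (interpolate R s r u r≤R))
        (trans (𝓛-+ Z i (λ u → (ι R - ι r) * ι (s ℕ.∸ u)) (λ u → ι r * ι (suc s ℕ.∸ u)))
          (cong₂ _+_ (𝓛-* Z i (ι R - ι r) (λ u → ι (s ℕ.∸ u))) (𝓛-* Z i (ι r) (λ u → ι (suc s ℕ.∸ u)))))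
      eq′ : (ι R - ι r) * (ι s * Kc h) + ι r * (ι (suc s) * Kc h) ≡ ι j * Kc h
      eq′ = trans (solve 4 (λ R r s k → (R :- r) :* (s :* k) :+ r :* ((con 1ℚ :+ s) :* k) := (s :* R :+ r) :* k) refl (ι R) (ι r) (ι s) (Kc h))
        (cong (_* Kc h) (sym (trans (cong ι j≡) (trans (ι-+ (s ℕ.* R) r) (cong (_+ ι r) (ι-* s R))))))

    Φ-small : ∀ i j → j ℕ.≤ R → Φ i j ≡ 0ℚ
    Φ-small i j j≤R = ∑₁-zero Z λ k 1≤k _ → ∑₁-zero Z λ l 1≤l _ → *0 (b i k * lam l)
      (cong ι (ℕₚ.m≤n⇒m∸n≡0 (ℕₚ.≤-trans j≤R (m≤d*m R (ℕₚ.*-mono-≤ 1≤k 1≤l)))))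

    module _ (j : ℕ) (R≤j : R ℕ.≤ j) (j≤N : j ℕ.≤ N) where

      private
        1≤j : 1 ℕ.≤ j
        1≤j = ℕₚ.≤-trans 1≤R R≤j
        instance _ = ℕ.>-nonZero 1≤j
        L : ℕ
        L = N ℕ./ j
        η : ℕ → ℚ
        η v = ι v * ι v * ι (N ℕ.∸ j ℕ.* v)
        η-0≤ : ∀ v → 0ℚ ≤ η v
        η-0≤ v = 0≤* (0≤p² (ι v)) (0≤ι (N ℕ.∸ j ℕ.* v))
        1≤L : 1 ℕ.≤ L
        1≤L = subst (ℕ._≤ L) (ℕ.n/n≡1 j) (ℕ./-monoˡ-≤ j j≤N)
        L≤X : L ℕ.≤ X
        L≤X = ℕₚ.≤-trans (ℕ./-monoʳ-≤ N {j} {R} R≤j) (ℕₚ.≤-reflexive (trans (cong (ℕ._/ R) (ℕₚ.*-comm R X)) (ℕ.m*n/n≡m X R)))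
        jL≤N : j ℕ.* L ℕ.≤ N
        jL≤N = subst (ℕ._≤ N) (ℕₚ.*-comm L j) (ℕ.m/n*n≤m N j)
        N<jL+j : N ℕ.< j ℕ.* suc L
        N<jL+j = subst₂ ℕ._<_ (sym (ℕ.m≡m%n+[m/n]*n N j)) (ℕₚ.*-comm (suc L) j) (ℕₚ.+-monoˡ-< (L ℕ.* j) (ℕ.m%n<n N j))
        η-big : ∀ m → suc L ℕ.≤ m → η m ≡ 0ℚ
        η-big m L<m = *0 (ι m * ι m) (cong ι (ℕₚ.m≤n⇒m∸n≡0 (ℕₚ.≤-trans (ℕₚ.<⇒≤ N<jL+j) (ℕₚ.*-monoʳ-≤ j L<m))))
        η-cubic : ∀ m → m ℕ.≤ L → η m ≡ ι m * ι m * (ι N - ι j * ι m)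
        η-cubic m m≤L = cong (ι m * ι m *_) (trans (ι-∸ (ℕₚ.≤-trans (ℕₚ.*-monoʳ-≤ j m≤L) jL≤N)) (cong (λ x → ι N - x) (ι-* j m)))
        ιjL≤ιN : ι j * ι L ≤ ι N
        ιjL≤ιN = subst (_≤ ι N) (ι-* j L) (ι-mono jL≤N)
        ιN≤ : ι N ≤ ι j * ι L + ι j
        ιN≤ = subst (ι N ≤_) (trans (ι-* j (suc L)) (solve 2 (λ j l → j :* (con 1ℚ :+ l) := j :* l :+ j) refl (ι j) (ι L))) (ι-mono (ℕₚ.<⇒≤ N<jL+j))

        -- s |Δ²η(s)| ≤ 4NL for s < L and ≤ 4NL² for s = L, L + 1
        interior : ∀ t → suc (suc t) ℕ.≤ L → ι (suc t) * ∣ Δ² η t ∣ ≤ ι 4 * (ι N * ι L)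
        interior t t+2≤L = ≤-trans (*-mono (0≤ι (suc t)) (0≤* (0≤ι 4) (0≤ι N)) (ι-mono (ℕₚ.≤-trans (ℕₚ.n≤1+n (suc t)) t+2≤L)) bnd)
          (≤-reflexive (solve 3 (λ f n l → l :* (f :* n) := f :* (n :* l)) refl (ι 4) (ι N) (ι L)))
          where
          s = ι t
          js = ι j * (1ℚ + ι t)
          -- At v = t + 1 the second difference of Nv² - jv³ is exactly 2N - 6jv, and 0 ≤ jv ≤ N
          -- puts it between -4N and 2N.
          Δ≡ : Δ² η t ≡ (ι N + ι N) - ι 6 * js
          Δ≡ = trans (cong₂ (λ x y → x - (y + y) + η t) (η-cubic (suc (suc t)) t+2≤L) (η-cubic (suc t) (ℕₚ.≤-trans (ℕₚ.n≤1+n (suc t)) t+2≤L)))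
            (trans (cong (λ x → ι (suc (suc t)) * ι (suc (suc t)) * (ι N - ι j * ι (suc (suc t))) - (y + y) + x) (η-cubic t (ℕₚ.≤-trans (ℕₚ.≤-trans (ℕₚ.n≤1+n t) (ℕₚ.n≤1+n (suc t))) t+2≤L)))
              (solve 3 (λ t n j → (con 1ℚ :+ (con 1ℚ :+ t)) :* (con 1ℚ :+ (con 1ℚ :+ t)) :* (n :- j :* (con 1ℚ :+ (con 1ℚ :+ t)))
                  :- ((con 1ℚ :+ t) :* (con 1ℚ :+ t) :* (n :- j :* (con 1ℚ :+ t)) :+ (con 1ℚ :+ t) :* (con 1ℚ :+ t) :* (n :- j :* (con 1ℚ :+ t)))
                  :+ t :* t :* (n :- j :* t) := (n :+ n) :- con (ι 6) :* (j :* (con 1ℚ :+ t))) refl s (ι N) (ι j)))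
            where y = ι (suc t) * ι (suc t) * (ι N - ι j * ι (suc t))
          0≤js : 0ℚ ≤ js
          0≤js = 0≤* (0≤ι j) (0≤ι (suc t))
          js≤N : 0ℚ ≤ ι N - js
          js≤N = 0≤-diff (≤-trans (*-monoˡ (0≤ι j) (ι-mono (ℕₚ.≤-trans (ℕₚ.n≤1+n (suc t)) t+2≤L))) ιjL≤ιN)
          bnd : ∣ Δ² η t ∣ ≤ ι 4 * ι N
          bnd = subst (λ x → ∣ x ∣ ≤ ι 4 * ι N) (sym Δ≡) (∣∣≤
            (≤-by (ι N + ι N + ι 6 * js) (0≤+ (0≤+ (0≤ι N) (0≤ι N)) (0≤* (0≤ι 6) 0≤js))
              (solve 2 (λ n x → con (ι 4) :* n := (n :+ n) :- con (ι 6) :* x :+ (n :+ n :+ con (ι 6) :* x)) refl (ι N) js))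
            (≤-by (ι 6 * (ι N - js)) (0≤* (0≤ι 6) js≤N)
              (solve 2 (λ n x → con (ι 4) :* n := (:- ((n :+ n) :- con (ι 6) :* x)) :+ con (ι 6) :* (n :- x)) refl (ι N) js)))

        ηL≤ : η L ≤ ι L * ι L * ι j
        ηL≤ = subst (_≤ ι L * ι L * ι j) (sym (η-cubic L ℕₚ.≤-refl)) (*-monoˡ (0≤p² (ι L))
          (≤-by (ι j * ι L + ι j - ι N) (0≤-diff ιN≤) (solve 3 (λ n j l → j := (n :- j :* l) :+ (j :* l :+ j :- n)) refl (ι N) (ι j) (ι L))))

        L³j≤ : ι L * (ι L * ι L * ι j) ≤ ι N * (ι L * ι L)
        L³j≤ = subst (_≤ ι N * (ι L * ι L)) (solve 2 (λ j l → j :* l :* (l :* l) := l :* (l :* l :* j)) refl (ι j) (ι L)) (*-monoʳ (0≤p² (ι L)) ιjL≤ιN)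

        last : ∣ Δ² η L ∣ ≤ ι L * ι L * ι j
        last = subst (λ x → ∣ x ∣ ≤ ι L * ι L * ι j) (sym eq) (subst (_≤ ι L * ι L * ι j) (sym (ℚₚ.0≤p⇒∣p∣≡p (η-0≤ L))) ηL≤)
          where
          eq : Δ² η L ≡ η L
          eq = trans (cong₂ (λ x y → x - (y + y) + η L) (η-big (suc (suc L)) (ℕₚ.n≤1+n (suc L))) (η-big (suc L) ℕₚ.≤-refl))
            (solve 1 (λ x → con 0ℚ :- (con 0ℚ :+ con 0ℚ) :+ x := x) refl (η L))

        lastBut : ∀ t → suc t ≡ L → ∣ Δ² η t ∣ ≤ ι 4 * (ι L * ι L * ι j)
        lastBut t t+1≡L = subst (λ x → ∣ x ∣ ≤ ι 4 * Q) (sym eq) (≤-trans (∣-∣≤ {η t} {η L + η L}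
            (subst (_≤ Q + Q) (sym (ℚₚ.0≤p⇒∣p∣≡p (η-0≤ t))) ηt≤)
            (subst (_≤ Q + Q) (sym (ℚₚ.0≤p⇒∣p∣≡p (0≤+ (η-0≤ L) (η-0≤ L)))) (ℚₚ.+-mono-≤ ηL≤ ηL≤)))
            (≤-reflexive (solve 1 (λ q → q :+ q :+ (q :+ q) := con (ι 4) :* q) refl Q)))
          where
          Q = ι L * ι L * ι j
          eq : Δ² η t ≡ η t - (η L + η L)
          eq = trans (cong₂ (λ x y → x - (y + y) + η t) (η-big (suc (suc t)) (ℕₚ.≤-reflexive (cong suc (sym t+1≡L)))) (cong η t+1≡L))
            (solve 2 (λ x y → con 0ℚ :- (y :+ y) :+ x := x :- (y :+ y)) refl (η t) (η L))
          ιL≡ : ι L ≡ 1ℚ + ι t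
          ιL≡ = cong ι (sym t+1≡L)
          t≤L : t ℕ.≤ L
          t≤L = subst (t ℕ.≤_) t+1≡L (ℕₚ.n≤1+n t)
          ηt≤ : η t ≤ Q + Q
          ηt≤ = subst (_≤ Q + Q) (sym (η-cubic t t≤L)) (≤-trans
            (*-mono (0≤p² (ι t)) (0≤+ (0≤ι j) (0≤ι j)) (*-mono (0≤ι t) (0≤ι L) (ι-mono t≤L) (ι-mono t≤L))
              (≤-by (ι j * ι L + ι j - ι N) (0≤-diff ιN≤) (trans (solve 3 (λ n j t → j :+ j := (n :- j :* t) :+ (j :* (con 1ℚ :+ t) :+ j :- n)) refl (ι N) (ι j) (ι t))
                 (cong (λ x → (ι N - ι j * ι t) + (ι j * x + ι j - ι N)) (sym ιL≡)))))
            (≤-reflexive (ℚₚ.*-distribˡ-+ (ι L * ι L) (ι j) (ι j))))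

        -- The interior contributes 4, the index L - 1 another 4, and the index L the last 2 because
        -- suc L ≤ 2L.
        total : ∑ (suc L) (λ t → ι (suc t) * ∣ Δ² η t ∣) ≤ ι 10 * (ι N * (ι L * ι L))
        total = total′ (ℕ.pred L) (ℕₚ.suc-pred L {{ℕ.>-nonZero 1≤L}})
          where
          f : ℕ → ℚ
          f t = ι (suc t) * ∣ Δ² η t ∣
          q = ι N * (ι L * ι L)
          total′ : ∀ M → suc M ≡ L → ∑ (suc L) f ≤ ι 10 * q
          total′ M M+1≡L = subst₂ _≤_ (cong (λ m → ∑ m f + f L) M+1≡L)
            (solve 1 (λ q → con (ι 4) :* q :+ con (ι 4) :* q :+ (q :+ q) := con (ι 10) :* q) refl q)
            (ℚₚ.+-mono-≤ (ℚₚ.+-mono-≤ inner outer₁) outer₂)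
            where
            inner : ∑ M f ≤ ι 4 * q
            inner = ≤-trans (∑-mono M λ t t<M → interior t (subst (suc (suc t) ℕ.≤_) M+1≡L (s≤s t<M)))
              (subst (_≤ ι 4 * q) (sym (∑-const M (ι 4 * (ι N * ι L))))
                (≤-trans (*-monoʳ (0≤* (0≤ι 4) (0≤* (0≤ι N) (0≤ι L))) (ι-mono (subst (M ℕ.≤_) M+1≡L (ℕₚ.n≤1+n M))))
                  (≤-reflexive (solve 2 (λ n l → l :* (con (ι 4) :* (n :* l)) := con (ι 4) :* (n :* (l :* l))) refl (ι N) (ι L)))))
            outer₁ : f M ≤ ι 4 * q
            outer₁ = ≤-trans (*-monoˡ (0≤ι (suc M)) (lastBut M M+1≡L)) (subst (_≤ ι 4 * q)
              (trans (solve 2 (λ l x → con (ι 4) :* (l :* x) := l :* (con (ι 4) :* x)) refl (ι L) (ι L * ι L * ι j)) (cong (λ x → ι x * (ι 4 * (ι L * ι L * ι j))) (sym M+1≡L)))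
              (*-monoˡ (0≤ι 4) L³j≤))
            outer₂ : f L ≤ q + q
            outer₂ = ≤-trans (*-monoˡ (0≤ι (suc L)) last) (≤-trans (*-monoʳ (0≤* (0≤p² (ι L)) (0≤ι j)) (ℚₚ.+-monoˡ-≤ (ι L) (1≤ι 1≤L)))
              (subst (_≤ q + q) (sym (ℚₚ.*-distribʳ-+ (ι L * ι L * ι j) (ι L) (ι L))) (ℚₚ.+-mono-≤ L³j≤ L³j≤)))

      -- `reproduce` expands the weight of `Ω` in ramps, each of which is bounded by `∣T∣≤`.
      ∣Ω∣≤ : ∀ i → ∣ Ω i j ∣ ≤ Kc h * (ι 10 * (ι N * (ι L * ι L)))
      ∣Ω∣≤ i = subst (λ x → ∣ x ∣ ≤ Kc h * (ι 10 * (ι N * (ι L * ι L)))) (sym eq)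
        (≤-trans (∣∑∣≤ (suc L) λ t t≤L → subst (∣ Δ² η t * T Z i (suc t) ∣ ≤_)
            (solve 3 (λ d s k → d :* (s :* k) := k :* (s :* d)) refl ∣ Δ² η t ∣ (ι (suc t)) (Kc h))
            (∣*∣≤ {Δ² η t} ≤-refl (∣T∣≤ Z i (suc t) h (ℕₚ.≤-trans (ℕₚ.≤-trans t≤L (s≤s L≤X)) X<Z) HZ≤h)))
          (subst (_≤ Kc h * (ι 10 * (ι N * (ι L * ι L)))) (sym (∑-*ˡ (suc L) (Kc h) _)) (*-monoˡ 0≤Kc total)))
        where
        eq : Ω i j ≡ ∑ (suc L) (λ t → Δ² η t * T Z i (suc t))
        eq = trans (𝓛-cong Z i λ v _ → sym (reproduce η (suc L) v η-big)) (𝓛-∑ Z i (suc L) (Δ² η) (λ t u → ι (suc t ℕ.∸ u)))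

      -- The bounds j for `Φ` and NL² for `Ω` combine through jL ≤ N into N³/j, and the sum of 1/j
      -- over R < j ≤ N costs only a logarithm of `X`.
      ∣ΦΩ∣≤ : ∀ i → ∣ Φ i j * Ω i j ∣ ≤ ι 10 * (Kc h * Kc h) * (ι N * ι N * ι N) * rcp j
      ∣ΦΩ∣≤ i = ≤-trans (∣*∣≤ (∣Φ∣≤ i j j≤N) (∣Ω∣≤ i)) (≤-*rcp 1≤j
        (subst (_≤ ι 10 * (Kc h * Kc h) * (ι N * ι N * ι N))
          (solve 5 (λ j k t n l → t :* (k :* k) :* (n :* ((j :* l) :* (j :* l))) := j :* (j :* k :* (k :* (t :* (n :* (l :* l)))))) refl (ι j) (Kc h) (ι 10) (ι N) (ι L))
          (*-monoˡ (0≤* (0≤ι 10) (0≤p² (Kc h))) (≤-trans (*-monoˡ (0≤ι N) (*-mono (0≤* (0≤ι j) (0≤ι L)) (0≤ι N) ιjL≤ιN ιjL≤ιN))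
            (≤-reflexive (sym (ℚₚ.*-assoc (ι N) (ι N) (ι N))))))))

    ∣∑ΦΩ∣≤ : ∀ i D → 1 ℕ.≤ X → H N ≤ H R + ι D →
             ∣ ∑₁ N (λ j → Φ i j * Ω i j) ∣ ≤ ι 10 * (Kc h * Kc h) * (ι N * ι N * ι N) * ι D
    ∣∑ΦΩ∣≤ i D 1≤X HN≤ = subst (λ x → ∣ x ∣ ≤ A * ι D) (sym eq) (≤-trans
      (∣∑∣≤ r λ t t<r → ∣ΦΩ∣≤ (suc (R ℕ.+ t)) (ℕₚ.≤-trans (ℕₚ.m≤m+n R t) (ℕₚ.n≤1+n _))
        (subst₂ ℕ._≤_ (ℕₚ.+-suc R t) R+r≡N (ℕₚ.+-monoʳ-≤ R t<r)) i)
      (subst (_≤ A * ι D) (sym (∑-*ˡ r A _)) (*-monoˡ 0≤A tail≤)))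
      where
      A = ι 10 * (Kc h * Kc h) * (ι N * ι N * ι N)
      0≤A : 0ℚ ≤ A
      0≤A = 0≤* (0≤* (0≤ι 10) (0≤p² (Kc h))) (0≤* (0≤p² (ι N)) (0≤ι N))
      r = N ℕ.∸ R
      R+r≡N : R ℕ.+ r ≡ N
      R+r≡N = ℕₚ.m+[n∸m]≡n (ℕₚ.m≤m*n R X {{ℕ.>-nonZero 1≤X}})
      f : ℕ → ℚ
      f t = Φ i (suc t) * Ω i (suc t)
      eq : ∑₁ N (λ j → Φ i j * Ω i j) ≡ ∑ r (λ t → f (R ℕ.+ t))
      eq = trans (∑₁-∑ N _) (trans (cong (λ m → ∑ m f) (sym R+r≡N)) (trans (∑-split R r f)
        (trans (cong (_+ ∑ r (λ t → f (R ℕ.+ t))) (∑-zero R λ t t<R → 0* (Ω i (suc t)) (Φ-small i (suc t) t<R)))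
          (ℚₚ.+-identityˡ (∑ r (λ t → f (R ℕ.+ t)))))))
      tail≤ : ∑ r (λ t → rcp (suc (R ℕ.+ t))) ≤ ι D
      tail≤ = ≤-by (H R + ι D - H N) (0≤-diff HN≤) (trans
        (solve 3 (λ a d t → d := t :+ (a :+ d :- (a :+ t))) refl (H R) (ι D) (∑ r (λ t → rcp (suc (R ℕ.+ t)))))
        (cong (λ x → ∑ r (λ t → rcp (suc (R ℕ.+ t))) + (H R + ι D - x)) (sym (trans (cong H (sym R+r≡N)) (∑-split R r (rcp ∘ suc))))))

    𝓑 : (ℕ → ℕ → ℚ) → ℚ
    𝓑 ψ = ∑₁ Z (λ k → ∑₁ Z (λ k′ → ∑₁ Z (λ l → ∑₁ Z (λ l′ → E k k′ * (lam l * lam l′ * ψ (k ℕ.* l) (k′ ℕ.* l′))))))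

    private
      ∑₄ : (ℕ → ℕ → ℕ → ℕ → ℚ) → ℚ
      ∑₄ f = ∑₁ Z (λ k → ∑₁ Z (λ k′ → ∑₁ Z (λ l → ∑₁ Z (λ l′ → f k k′ l l′))))

      ∑₄-ext : ∀ {f f′ : ℕ → ℕ → ℕ → ℕ → ℚ} → (∀ k k′ l l′ → 1 ℕ.≤ k → 1 ℕ.≤ k′ → 1 ℕ.≤ l → 1 ℕ.≤ l′ → f k k′ l l′ ≡ f′ k k′ l l′) → ∑₄ f ≡ ∑₄ f′
      ∑₄-ext f≡f′ = ∑₁-ext Z λ k p _ → ∑₁-ext Z λ k′ p′ _ → ∑₁-ext Z λ l q _ → ∑₁-ext Z λ l′ q′ _ → f≡f′ k k′ l l′ p p′ q q′

      ∑₄-swap : ∀ n (f : ℕ → ℕ → ℕ → ℕ → ℕ → ℚ) → ∑ n (λ i → ∑₄ (f i)) ≡ ∑₄ (λ k k′ l l′ → ∑ n (λ i → f i k k′ l l′))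
      ∑₄-swap n f = trans (sym (∑₁-∑-swap Z n (λ k i → ∑₁ Z (λ k′ → ∑₁ Z (λ l → ∑₁ Z (λ l′ → f i k k′ l l′))))))
        (∑₁-ext Z λ k _ _ → trans (sym (∑₁-∑-swap Z n (λ k′ i → ∑₁ Z (λ l → ∑₁ Z (λ l′ → f i k k′ l l′)))))
          (∑₁-ext Z λ k′ _ _ → trans (sym (∑₁-∑-swap Z n (λ l i → ∑₁ Z (λ l′ → f i k k′ l l′))))
            (∑₁-ext Z λ l _ _ → sym (∑₁-∑-swap Z n (λ l′ i → f i k k′ l l′)))))

      ∑₄-lin : ∀ c d (f f′ : ℕ → ℕ → ℕ → ℕ → ℚ) → ∑₄ (λ k k′ l l′ → c * f k k′ l l′ + d * f′ k k′ l l′) ≡ c * ∑₄ f + d * ∑₄ f′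
      ∑₄-lin c d f f′ = lin (λ k → lin (λ k′ → lin (λ l → lin (λ l′ → refl))))
        where
        lin : ∀ {u v w : ℕ → ℚ} → (∀ k → u k ≡ c * v k + d * w k) → ∑₁ Z u ≡ c * ∑₁ Z v + d * ∑₁ Z w
        lin {u} {v} {w} e = trans (∑₁-ext Z λ k _ _ → e k) (trans (∑₁-+ Z (λ k → c * v k) (λ k → d * w k)) (cong₂ _+_ (∑₁-*ˡ Z c v) (∑₁-*ˡ Z d w)))

      ∑₁-prod : ∀ (u v : ℕ → ℚ) → ∑₁ Z u * ∑₁ Z v ≡ ∑₁ Z (λ k → ∑₁ Z (λ k′ → u k * v k′))
      ∑₁-prod u v = trans (sym (∑₁-*ʳ Z (∑₁ Z v) u)) (∑₁-ext Z λ k _ _ → sym (∑₁-*ˡ Z (u k) v))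

      𝓛-prod : ∀ i (ω η : ℕ → ℚ) → 𝓛 Z i ω * 𝓛 Z i η ≡ ∑₄ (λ k k′ l l′ → b i k * lam l * ω (k ℕ.* l) * (b i k′ * lam l′ * η (k′ ℕ.* l′)))
      𝓛-prod i ω η = trans (∑₁-prod (λ k → ∑₁ Z (λ l → b i k * lam l * ω (k ℕ.* l))) (λ k′ → ∑₁ Z (λ l′ → b i k′ * lam l′ * η (k′ ℕ.* l′))))
        (∑₁-ext Z λ k _ _ → ∑₁-ext Z λ k′ _ _ → ∑₁-prod (λ l → b i k * lam l * ω (k ℕ.* l)) (λ l′ → b i k′ * lam l′ * η (k′ ℕ.* l′)))

    𝓑-𝓛 : ∀ J (ω η : ℕ → ℕ → ℚ) → ∑ g (λ i → ∑₁ J (λ j → 𝓛 Z i (ω j) * 𝓛 Z i (η j))) ≡ 𝓑 (λ u v → ∑₁ J (λ j → ω j u * η j v))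
    𝓑-𝓛 J ω η = begin
      ∑ g (λ i → ∑₁ J (λ j → 𝓛 Z i (ω j) * 𝓛 Z i (η j)))
        ≡⟨ ∑-ext g (λ i → trans (∑₁-∑ J _) (trans (∑-ext J λ j → 𝓛-prod i (ω (suc j)) (η (suc j))) (∑₄-swap J _))) ⟩
      ∑ g (λ i → ∑₄ (λ k k′ l l′ → ∑ J (λ j → term i j k k′ l l′)))
        ≡⟨ ∑₄-swap g _ ⟩
      ∑₄ (λ k k′ l l′ → ∑ g (λ i → ∑ J (λ j → term i j k k′ l l′)))
        ≡⟨ ∑₄-ext (λ k k′ l l′ _ _ _ _ → begin
             ∑ g (λ i → ∑ J (λ j → term i j k k′ l l′))
               ≡⟨ ∑-ext g (λ i → trans (∑-ext J λ j → solve 6 (λ b l w b′ l′ e → b :* l :* w :* (b′ :* l′ :* e) := b :* b′ :* (l :* l′) :* (w :* e)) refl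
                    (b i k) (lam l) (ω (suc j) (k ℕ.* l)) (b i k′) (lam l′) (η (suc j) (k′ ℕ.* l′)))
                    (∑-*ˡ J (b i k * b i k′ * (lam l * lam l′)) _)) ⟩
             ∑ g (λ i → b i k * b i k′ * (lam l * lam l′) * ψ k k′ l l′)
               ≡⟨ ∑-ext g (λ i → ℚₚ.*-assoc (b i k * b i k′) (lam l * lam l′) (ψ k k′ l l′)) ⟩
             ∑ g (λ i → b i k * b i k′ * (lam l * lam l′ * ψ k k′ l l′))
               ≡⟨ ∑-*ʳ g (lam l * lam l′ * ψ k k′ l l′) (λ i → b i k * b i k′) ⟩
             E k k′ * (lam l * lam l′ * ψ k k′ l l′)
               ≡⟨ cong (λ x → E k k′ * (lam l * lam l′ * x)) (sym (∑₁-∑ J _)) ⟩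
             E k k′ * (lam l * lam l′ * ∑₁ J (λ j → ω j (k ℕ.* l) * η j (k′ ℕ.* l′))) ∎) ⟩
      𝓑 (λ u v → ∑₁ J (λ j → ω j u * η j v)) ∎
      where
      open ≡-Reasoning
      term : ℕ → ℕ → ℕ → ℕ → ℕ → ℕ → ℚ
      term i j k k′ l l′ = b i k * lam l * ω (suc j) (k ℕ.* l) * (b i k′ * lam l′ * η (suc j) (k′ ℕ.* l′))
      ψ : ℕ → ℕ → ℕ → ℕ → ℚ
      ψ k k′ l l′ = ∑ J (λ j → ω (suc j) (k ℕ.* l) * η (suc j) (k′ ℕ.* l′))

    w : ℕ → ℚ
    w m = ι (X ℕ.∸ m) * ι (X ℕ.∸ m) * ι (X ℕ.∸ m)

    E* : ℚ
    E* = ι g * ((C₂ + C₂) * (C₂ + C₂))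

    ∣E∣≤ : ∀ k k′ → 1 ℕ.≤ k → 1 ℕ.≤ k′ → ∣ E k k′ ∣ ≤ E*
    ∣E∣≤ k k′ 1≤k 1≤k′ = subst (∣ E k k′ ∣ ≤_) (∑-const g _) (∣∑∣≤ g λ i _ → ∣*∣≤ (∣b∣≤ i k 1≤k) (∣b∣≤ i k′ 1≤k′))
      where
      ∣b∣≤ : ∀ i k → 1 ℕ.≤ k → ∣ b i k ∣ ≤ C₂ + C₂
      ∣b∣≤ i (suc m) _ = subst (λ x → ∣ x ∣ ≤ C₂ + C₂)
        (solve 2 (λ s x → (s :+ x) :- s := x) refl (∑ m (b i ∘ suc)) (b i (suc m))) (∣-∣≤ (b-sum i (suc m)) (b-sum i m))

    -- The lower-order term of `kernel`. It has one factor `R` against R³ in the main term, so the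
    -- crudest bound in `Z` and `X` is enough once `R` is large.
    error : ℚ
    error = 𝓑 (λ u v → ι v * ι v * ι (X ℕ.∸ u ℕ.* v))

    ∣error∣≤ : ∣ error ∣ ≤ ι Z * (ι Z * (ι Z * (ι Z * (E* * (ι X * ι X * ι X)))))
    ∣error∣≤ = bound λ k 1≤k → bound λ k′ 1≤k′ → bound λ l 1≤l → bound λ l′ 1≤l′ →
      ∣*∣≤ (∣E∣≤ k k′ 1≤k 1≤k′) (subst (∣ lam l * lam l′ * (ι (k′ ℕ.* l′) * ι (k′ ℕ.* l′) * ι (X ℕ.∸ k ℕ.* l ℕ.* (k′ ℕ.* l′))) ∣ ≤_) (ℚₚ.*-identityˡ (ι X * ι X * ι X))
        (∣*∣≤ {lam l * lam l′} (subst (∣ lam l * lam l′ ∣ ≤_) (ℚₚ.*-identityˡ 1ℚ) (∣*∣≤ (∣lam∣≤ l) (∣lam∣≤ l′)))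
          (small (k ℕ.* l) (k′ ℕ.* l′) (ℕₚ.*-mono-≤ 1≤k 1≤l))))
      where
      bound : ∀ {f : ℕ → ℚ} {c} → (∀ k → 1 ℕ.≤ k → ∣ f k ∣ ≤ c) → ∣ ∑₁ Z f ∣ ≤ ι Z * c
      bound {f} {c} f≤c = subst (∣ ∑₁ Z f ∣ ≤_) (∑₁-const Z c) (∣∑₁∣≤ Z λ k 1≤k _ → f≤c k 1≤k)
      ∣lam∣≤ : ∀ m → ∣ lam m ∣ ≤ 1ℚ
      ∣lam∣≤ m = subst (_≤ 1ℚ) (sym (ℚₚ.0≤p⇒∣p∣≡p (lam-0≤ m))) (lam-≤1 m)
      small : ∀ u v → 1 ℕ.≤ u → ∣ ι v * ι v * ι (X ℕ.∸ u ℕ.* v) ∣ ≤ ι X * ι X * ι X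
      small u v 1≤u = subst (_≤ ι X * ι X * ι X) (sym (ℚₚ.0≤p⇒∣p∣≡p (0≤* (0≤p² (ι v)) (0≤ι (X ℕ.∸ u ℕ.* v))))) (go (v ℕ.≤? X))
        where
        go : Dec (v ℕ.≤ X) → ι v * ι v * ι (X ℕ.∸ u ℕ.* v) ≤ ι X * ι X * ι X
        go (yes v≤X) = *-mono (0≤p² (ι v)) (0≤ι X) (*-mono (0≤ι v) (0≤ι X) (ι-mono v≤X) (ι-mono v≤X)) (ι-mono (ℕₚ.m∸n≤m X (u ℕ.* v)))
        go (no  v≰X) = subst (_≤ ι X * ι X * ι X) (sym (*0 (ι v * ι v) (cong ι (ℕₚ.m≤n⇒m∸n≡0 (ℕₚ.<⇒≤ (ℕₚ.<-≤-trans (ℕₚ.≰⇒> v≰X) (m≤d*m v 1≤u)))))))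
                         (0≤* (0≤p² (ι X)) (0≤ι X))

    mainInequality : (∀ d k k′ → E (d ℕ.* k) (d ℕ.* k′) ≡ lam d * E k k′) → (∀ v → 1 ℕ.≤ v → v ℕ.≤ X → v ∣ R) →
      ∀ D → 1 ℕ.≤ X → H N ≤ H R + ι D →
      ι R * ι R * ι R * (∑₁ Z (λ q → lam q * w (q ℕ.* q)) * E 1 1) ≤
      6ℚ * (ι g * (ι 10 * (Kc h * Kc h) * (ι N * ι N * ι N) * ι D)) + ι R * (ι Z * (ι Z * (ι Z * (ι Z * (E* * (ι X * ι X * ι X))))))
    mainInequality E-scale v∣R D 1≤X HN≤ = ≤-trans (*-monoˡ (0≤* (0≤p² (ι R)) (0≤ι R))
        (rankinSelberg-≥ E-scale Z (ℕₚ.≤-trans 1≤X (ℕₚ.<⇒≤ X<Z)) w (λ m → 0≤* (0≤p² (ι (X ℕ.∸ m))) (0≤ι (X ℕ.∸ m)))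
          (λ m Z<m → *0 (ι (X ℕ.∸ m) * ι (X ℕ.∸ m)) (cong ι (ℕₚ.m≤n⇒m∸n≡0 (ℕₚ.<⇒≤ (ℕₚ.<-trans X<Z Z<m)))))))
      (subst (_≤ 6ℚ * A + ι R * B) (trans (cong (_+ ι R * error) identity)
          (solve 3 (λ a r e → a :- r :* e :+ r :* e := a) refl (ι R * ι R * ι R * 𝓢) (ι R) error))
        (ℚₚ.+-mono-≤ (*-monoˡ (0≤ι 6) (≤-trans (p≤∣p∣ S) ∣S∣≤)) (*-monoˡ (0≤ι R) (≤-trans (p≤∣p∣ error) ∣error∣≤))))
      where
      A = ι g * (ι 10 * (Kc h * Kc h) * (ι N * ι N * ι N) * ι D)
      B = ι Z * (ι Z * (ι Z * (ι Z * (E* * (ι X * ι X * ι X)))))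
      𝓢 = ∑₁ Z (λ k → ∑₁ Z (λ k′ → E k k′ * Y E-scale Z (ℕₚ.≤-trans 1≤X (ℕₚ.<⇒≤ X<Z)) w
            (λ m → 0≤* (0≤p² (ι (X ℕ.∸ m))) (0≤ι (X ℕ.∸ m)))
            (λ m Z<m → *0 (ι (X ℕ.∸ m) * ι (X ℕ.∸ m)) (cong ι (ℕₚ.m≤n⇒m∸n≡0 (ℕₚ.<⇒≤ (ℕₚ.<-trans X<Z Z<m))))) (k ℕ.* k′)))
      S = ∑ g (λ i → ∑₁ N (λ j → Φ i j * Ω i j))
      ∣S∣≤ : ∣ S ∣ ≤ A
      ∣S∣≤ = subst (∣ S ∣ ≤_) (∑-const g _) (∣∑∣≤ g λ i _ → ∣∑ΦΩ∣≤ i D 1≤X HN≤)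
      open ≡-Reasoning
      ψ : ℕ → ℕ → ℚ
      ψ u v = ∑₁ N (λ j → ι (j ℕ.∸ u ℕ.* R) * (ι v * ι v * ι (N ℕ.∸ j ℕ.* v)))
      identity : 6ℚ * S ≡ ι R * ι R * ι R * 𝓢 - ι R * error
      identity = begin
        6ℚ * S
          ≡⟨ cong (6ℚ *_) (𝓑-𝓛 N (λ j u → ι (j ℕ.∸ u ℕ.* R)) (λ j v → ι v * ι v * ι (N ℕ.∸ j ℕ.* v))) ⟩
        6ℚ * 𝓑 ψ
          ≡⟨ trans (solve 2 (λ s x → s :* x := s :* x :+ con 0ℚ :* x) refl 6ℚ (𝓑 ψ)) (sym (∑₄-lin 6ℚ 0ℚ _ _)) ⟩
        ∑₄ (λ k k′ l l′ → 6ℚ * q k k′ l l′ (ψ (k ℕ.* l) (k′ ℕ.* l′)) + 0ℚ * q k k′ l l′ (ψ (k ℕ.* l) (k′ ℕ.* l′)))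
          ≡⟨ ∑₄-ext (λ k k′ l l′ 1≤k 1≤k′ 1≤l 1≤l′ → pointwise k k′ l l′ (ℕₚ.*-mono-≤ 1≤k 1≤l) (ℕₚ.*-mono-≤ 1≤k′ 1≤l′)) ⟩
        ∑₄ (λ k k′ l l′ → ι R * ι R * ι R * q k k′ l l′ (w (k ℕ.* k′ ℕ.* (l ℕ.* l′))) + (- ι R) * q k k′ l l′ (ε (k ℕ.* l) (k′ ℕ.* l′)))
          ≡⟨ ∑₄-lin (ι R * ι R * ι R) (- ι R) _ _ ⟩
        ι R * ι R * ι R * ∑₄ (λ k k′ l l′ → q k k′ l l′ (w (k ℕ.* k′ ℕ.* (l ℕ.* l′)))) + (- ι R) * error
          ≡⟨ cong₂ _+_ (cong (ι R * ι R * ι R *_) (∑₁-ext Z λ k _ _ → ∑₁-ext Z λ k′ _ _ → trans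
               (∑₁-ext Z λ l _ _ → ∑₁-*ˡ Z (E k k′) (λ l′ → lam l * lam l′ * w (k ℕ.* k′ ℕ.* (l ℕ.* l′))))
               (∑₁-*ˡ Z (E k k′) (λ l → ∑₁ Z (λ l′ → lam l * lam l′ * w (k ℕ.* k′ ℕ.* (l ℕ.* l′)))))))
             (sym (ℚₚ.neg-distribˡ-* (ι R) error)) ⟩
        ι R * ι R * ι R * 𝓢 - ι R * error ∎
        where
        ε : ℕ → ℕ → ℚ
        ε u v = ι v * ι v * ι (X ℕ.∸ u ℕ.* v)
        q : ℕ → ℕ → ℕ → ℕ → ℚ → ℚ
        q k k′ l l′ x = E k k′ * (lam l * lam l′ * x)
        pointwise : ∀ k k′ l l′ → 1 ℕ.≤ k ℕ.* l → 1 ℕ.≤ k′ ℕ.* l′ →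
          6ℚ * q k k′ l l′ (ψ (k ℕ.* l) (k′ ℕ.* l′)) + 0ℚ * q k k′ l l′ (ψ (k ℕ.* l) (k′ ℕ.* l′)) ≡
          ι R * ι R * ι R * q k k′ l l′ (w (k ℕ.* k′ ℕ.* (l ℕ.* l′))) + (- ι R) * q k k′ l l′ (ε (k ℕ.* l) (k′ ℕ.* l′))
        pointwise k k′ l l′ 1≤u 1≤v = begin
          6ℚ * (E k k′ * (lam l * lam l′ * ψ u v)) + 0ℚ * (E k k′ * (lam l * lam l′ * ψ u v))
            ≡⟨ solve 4 (λ s e l x → s :* (e :* (l :* x)) :+ con 0ℚ :* (e :* (l :* x)) := e :* (l :* (s :* x))) refl 6ℚ (E k k′) (lam l * lam l′) (ψ u v) ⟩
          E k k′ * (lam l * lam l′ * (6ℚ * ψ u v))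
            ≡⟨ cong (λ x → E k k′ * (lam l * lam l′ * x)) (kernel R X u v 1≤u 1≤v (v∣R v 1≤v)) ⟩
          E k k′ * (lam l * lam l′ * (ι R * ι R * ι R * w (u ℕ.* v) - ι R * ε u v))
            ≡⟨ cong (λ m → E k k′ * (lam l * lam l′ * (ι R * ι R * ι R * w m - ι R * ε u v)))
                 (solveℕ 4 (λ k l k′ l′ → k ⊠ l ⊠ (k′ ⊠ l′) ≜ k ⊠ k′ ⊠ (l ⊠ l′)) refl k l k′ l′) ⟩
          E k k′ * (lam l * lam l′ * (ι R * ι R * ι R * w (k ℕ.* k′ ℕ.* (l ℕ.* l′)) - ι R * ε u v))
            ≡⟨ solve 6 (λ e l c y r z → e :* (l :* (c :* y :- r :* z)) := c :* (e :* (l :* y)) :+ (:- r) :* (e :* (l :* z))) refl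
                 (E k k′) (lam l * lam l′) (ι R * ι R * ι R) (w (k ℕ.* k′ ℕ.* (l ℕ.* l′))) (ι R) (ε u v) ⟩
          ι R * ι R * ι R * (E k k′ * (lam l * lam l′ * w (k ℕ.* k′ ℕ.* (l ℕ.* l′)))) + (- ι R) * (E k k′ * (lam l * lam l′ * ε u v)) ∎
          where
          u = k ℕ.* l
          v = k′ ℕ.* l′

  module _ (n : ℕ) (1≤n : 1 ℕ.≤ n) (lam-prog : ∀ i → lam (suc (n ℕ.* i)) ≡ 1ℚ)
           (E-scale : ∀ d k k′ → E (d ℕ.* k) (d ℕ.* k′) ≡ lam d * E k k′) where

    private
      Cσ = C₁ + (σ + σ)
      M₁ = σ * C₃ + C₂ * Cσ + C₂ * (Cσ + Cσ)
      E₀ = ι g * ((C₂ + C₂) * (C₂ + C₂))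
      -- The factor 6 comes from `kernel`, 10 from the bound for `Ω`, and 4³ from X³ = (4V)³; the
      -- summand `E₀` absorbs the error term.
      M₂ = 6ℚ * ι 10 * (ι 4 * ι 4 * ι 4) * ι g * (M₁ * M₁) + E₀
      x = E 1 1

      0≤x : 0ℚ ≤ x
      0≤x = 0≤∑ g λ i _ → 0≤p² (b i 1)

      0≤M₁ : 0ℚ ≤ M₁
      0≤M₁ = 0≤+ (0≤+ (0≤* 0≤σ 0≤C₃) (0≤* 0≤C₂ 0≤C)) (0≤* 0≤C₂ (0≤+ 0≤C 0≤C))

      0≤E₀ : 0ℚ ≤ E₀
      0≤E₀ = 0≤* (0≤ι g) (0≤p² (C₂ + C₂))

      0≤M₂ : 0ℚ ≤ M₂
      0≤M₂ = 0≤+ (0≤* (0≤* (0≤* (0≤* (0≤ι 6) (0≤ι 10)) (0≤* (0≤p² (ι 4)) (0≤ι 4))) (0≤ι g)) (0≤p² M₁)) 0≤E₀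

    -- This is D + 2 for the exponent D chosen in `scaleBound`, and it bounds the harmonic sum up to
    -- Z = 2^(D + 1).
    growth : ℕ → ℕ
    growth ℓ = (ℓ ℕ.+ n) ℕ.+ (ℓ ℕ.+ n) ℕ.+ 4

    -- With X = 4V both sides scale like V³. At least 2^ℓ squares q² ≤ V contribute V³ each, whereas
    -- the upper bound exceeds V³ only by the logarithmic factor h³: two powers from the bound for
    -- `T`, one from the sum over j.
    scaleBound : ∀ ℓ → ι (2 ℕ.^ ℓ) * x ≤ M₂ * (ι (growth ℓ) * ι (growth ℓ) * ι (growth ℓ))
    scaleBound ℓ = *-cancelˡ 0<V³ (subst (_≤ (V * V * V) * (M₂ * (h * h * h))) eqL (≤-trans low (≤-trans dividedBound high)))
      where
      e = ℓ ℕ.+ n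
      D = e ℕ.+ e ℕ.+ 2
      X′ = 2 ℕ.^ e
      -- X = 4X′², so that X - q² is at least 3V for every q ≤ X′.
      X = 2 ℕ.^ D
      Z = X ℕ.+ X
      V = ι X′ * ι X′
      h = ι (growth ℓ)
      I = 2 ℕ.^ ℓ
      1≤X : 1 ℕ.≤ X
      1≤X = ℕₚ.m^n>0 2 D
      1≤X′ : 1 ℕ.≤ X′
      1≤X′ = ℕₚ.m^n>0 2 e
      -- The factorial makes every v ≤ X a divisor of `R`; the other factor gives R ≥ Z²X², and then
      -- R² outweighs the bound Z⁴X³ for the error.
      R = X ℕ.! ℕ.* (Z ℕ.* Z ℕ.* (X ℕ.* X))
      1≤Z : 1 ℕ.≤ Z
      1≤Z = ℕₚ.≤-trans 1≤X (ℕₚ.m≤m+n X X)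
      ZZXX≤R : Z ℕ.* Z ℕ.* (X ℕ.* X) ℕ.≤ R
      ZZXX≤R = m≤d*m _ (ℕₚ.1≤n! X)
      1≤R : 1 ℕ.≤ R
      1≤R = ℕₚ.≤-trans (ℕₚ.*-mono-≤ (ℕₚ.*-mono-≤ 1≤Z 1≤Z) (ℕₚ.*-mono-≤ 1≤X 1≤X)) ZZXX≤R
      v∣R : ∀ v → 1 ℕ.≤ v → v ℕ.≤ X → v ∣ R
      v∣R (suc v) _ v≤X = ℕ∣.∣-trans (ℕ∣.∣-trans (ℕ∣.m∣m*n (v ℕ.!)) (ℕ∣.m≤n⇒m!∣n! v≤X)) (ℕ∣.m∣m*n _)
      X<Z : X ℕ.< Z
      X<Z = subst (ℕ._≤ Z) (ℕₚ.+-comm X 1) (ℕₚ.+-monoʳ-≤ X 1≤X)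
      HZ≤h : H Z ≤ h
      HZ≤h = ≤-trans (subst (λ m → H m ≤ H 1 + ι (suc D)) (trans (ℕₚ.*-identityʳ _) (cong (X ℕ.+_) (ℕₚ.+-identityʳ X))) (H-dyadic (suc D) 1))
        (≤-reflexive (trans (cong (λ r → 0ℚ + r + ι (suc D)) (sym (rcp-unique {1} {1ℚ} refl))) (trans (cong (_+ ι (suc D)) (ℚₚ.+-identityˡ 1ℚ)) (cong ι 2+D≡))))
        where
        2+D≡ : suc (suc D) ≡ growth ℓ
        2+D≡ = sym (trans (ℕₚ.+-comm (e ℕ.+ e) 4) (cong (λ m → suc (suc m)) (ℕₚ.+-comm 2 (e ℕ.+ e))))
      D≤h : ι D ≤ h
      D≤h = ι-mono (ℕₚ.+-monoʳ-≤ (e ℕ.+ e) (s≤s (s≤s z≤n)))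
      1≤h : 1ℚ ≤ h
      1≤h = 1≤ι (ℕₚ.≤-trans (s≤s z≤n) (ℕₚ.m≤n+m 4 (e ℕ.+ e)))
      0≤h : 0ℚ ≤ h
      0≤h = 0≤ι (growth ℓ)
      N = R ℕ.* X
      HN≤ : H N ≤ H R + ι D
      HN≤ = subst (λ m → H m ≤ H R + ι D) (ℕₚ.*-comm X R) (H-dyadic D R)
      ιX≡ : ι X ≡ ι 4 * V
      ιX≡ = trans (cong ι (trans (ℕₚ.^-distribˡ-+-* 2 (e ℕ.+ e) 2) (trans (ℕₚ.*-comm (2 ℕ.^ (e ℕ.+ e)) 4) (cong (4 ℕ.*_) (ℕₚ.^-distribˡ-+-* 2 e e)))))
        (trans (ι-* 4 (X′ ℕ.* X′)) (cong (ι 4 *_) (ι-* X′ X′)))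
      r = ι R * ι R * ι R
      0<r : 0ℚ < r
      0<r = subst (0ℚ <_) (trans (ι-* (R ℕ.* R) R) (cong (_* ι R) (ι-* R R))) (0<ι (ℕₚ.*-mono-≤ (ℕₚ.*-mono-≤ 1≤R 1≤R) 1≤R))
      W = ∑₁ Z (λ q → lam q * w Z X R h 1≤R X<Z HZ≤h 0≤h (q ℕ.* q))
      k = Kc h
      ιX = ι X
      1≤V : 1ℚ ≤ V
      1≤V = subst (_≤ V) (ℚₚ.*-identityˡ 1ℚ) (*-mono 0≤1 (0≤ι X′) (1≤ι 1≤X′) (1≤ι 1≤X′))
      0≤V : 0ℚ ≤ V
      0≤V = 0≤p² (ι X′)
      1≤V³ : 1ℚ ≤ V * V * V
      1≤V³ = subst (_≤ V * V * V) refl (*-mono 0≤1 0≤V (*-mono 0≤1 0≤V 1≤V 1≤V) 1≤V)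
      0<V³ : 0ℚ < V * V * V
      0<V³ = ℚₚ.<-≤-trans 0<1 1≤V³
      errorBound : ι R * (ι Z * (ι Z * (ι Z * (ι Z * (E₀ * (ιX * ιX * ιX)))))) ≤ r * E₀
      errorBound = subst₂ _≤_
        (solve 4 (λ r z e y → r :* (e :* ((z :* z :* (y :* y)) :* (z :* z :* y))) := r :* (z :* (z :* (z :* (z :* (e :* (y :* y :* y))))))) refl (ι R) (ι Z) E₀ ιX)
        (solve 2 (λ r e → r :* (e :* (r :* r)) := r :* r :* r :* e) refl (ι R) E₀)
        (*-monoˡ (0≤ι R) (*-monoˡ 0≤E₀ (*-mono (0≤* (0≤p² (ι Z)) (0≤p² ιX)) (0≤ι R) big (≤-trans smaller big))))
        where
        big : ι Z * ι Z * (ιX * ιX) ≤ ι R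
        big = subst (_≤ ι R) (trans (ι-* (Z ℕ.* Z) (X ℕ.* X)) (cong₂ _*_ (ι-* Z Z) (ι-* X X))) (ι-mono ZZXX≤R)
        smaller : ι Z * ι Z * ιX ≤ ι Z * ι Z * (ιX * ιX)
        smaller = *-monoˡ (0≤p² (ι Z)) (subst (_≤ ιX * ιX) (ℚₚ.*-identityˡ ιX) (*-monoʳ (0≤ι X) (1≤ι 1≤X)))
      dividedBound : W * x ≤ 6ℚ * ι 10 * ι g * (k * k) * (ιX * ιX * ιX) * ι D + E₀
      dividedBound = *-cancelˡ 0<r (≤-trans (mainInequality Z X R h 1≤R X<Z HZ≤h 0≤h E-scale v∣R D 1≤X HN≤)
        (≤-trans (ℚₚ.+-monoʳ-≤ (6ℚ * (ι g * (ι 10 * (k * k) * (ι N * ι N * ι N) * ι D))) errorBound) (≤-reflexive (trans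
          (cong (λ m → 6ℚ * (ι g * (ι 10 * (k * k) * (m * m * m) * ι D)) + r * E₀) (ι-* R X))
          (solve 8 (λ s t g k r y d e → s :* (g :* (t :* (k :* k) :* (r :* y :* (r :* y) :* (r :* y)) :* d)) :+ r :* r :* r :* e
             := r :* r :* r :* (s :* t :* g :* (k :* k) :* (y :* y :* y) :* d :+ e)) refl 6ℚ (ι 10) (ι g) k (ι R) ιX (ι D) E₀)))))
      -- The summand `n` in the exponent `e` pays for the common difference of the progression 1 +
      -- ni of units, since n ≤ 2^n.
      nI≤X′ : n ℕ.* I ℕ.≤ X′
      nI≤X′ = ℕₚ.≤-trans (ℕₚ.*-monoˡ-≤ I (ℕₚ.≤-trans (ℕₚ.n≤1+n n) (n<2^n n))) (ℕₚ.≤-reflexive (trans (ℕₚ.*-comm (2 ℕ.^ n) I) (sym (ℕₚ.^-distribˡ-+-* 2 ℓ n))))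
      X′≤Z : X′ ℕ.≤ Z
      X′≤Z = ℕₚ.≤-trans (ℕₚ.^-monoʳ-≤ 2 (ℕₚ.≤-trans (ℕₚ.m≤m+n e e) (ℕₚ.m≤m+n (e ℕ.+ e) 2))) (ℕₚ.m≤m+n X X)
      wf : ℕ → ℚ
      wf q = lam (suc q) * w Z X R h 1≤R X<Z HZ≤h 0≤h (suc q ℕ.* suc q)
      0≤wf : ∀ q → 0ℚ ≤ wf q
      0≤wf q = 0≤* (lam-0≤ (suc q)) (0≤* (0≤p² (ι (X ℕ.∸ suc q ℕ.* suc q))) (0≤ι (X ℕ.∸ suc q ℕ.* suc q)))
      V³I≤W : ι I * (V * V * V) ≤ W
      V³I≤W = subst₂ _≤_ (∑-const I (V * V * V)) (sym (∑₁-∑ Z _))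
        (≤-trans (∑-mono I each) (≤-trans (∑-progression n I wf 1≤n 0≤wf) (∑-mono-len 0≤wf (ℕₚ.≤-trans nI≤X′ X′≤Z))))
        where
        each : ∀ i → i ℕ.< I → V * V * V ≤ wf (n ℕ.* i)
        each i i<I = subst (λ l → V * V * V ≤ l * (y * y * y)) (sym (lam-prog i)) (subst (V * V * V ≤_) (sym (ℚₚ.*-identityˡ (y * y * y)))
          (*-mono (0≤p² V) 0≤y (*-mono 0≤V 0≤y V≤y V≤y) V≤y))
          where
          q = suc (n ℕ.* i)
          y = ι (X ℕ.∸ q ℕ.* q)
          0≤y : 0ℚ ≤ y
          0≤y = 0≤ι (X ℕ.∸ q ℕ.* q)
          q≤X′ : q ℕ.≤ X′
          q≤X′ = ℕₚ.≤-trans (ℕₚ.≤-trans (ℕₚ.+-monoˡ-≤ (n ℕ.* i) 1≤n) (ℕₚ.≤-trans (ℕₚ.≤-reflexive (sym (ℕₚ.*-suc n i))) (ℕₚ.*-monoʳ-≤ n i<I))) nI≤X′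
          qq≤ : ι (q ℕ.* q) ≤ V
          qq≤ = subst (ι (q ℕ.* q) ≤_) (ι-* X′ X′) (ι-mono (ℕₚ.*-mono-≤ q≤X′ q≤X′))
          qq≤X : q ℕ.* q ℕ.≤ X
          qq≤X = ι-cancel (≤-trans qq≤ (subst (V ≤_) (sym ιX≡) (≤-by (ι 3 * V) (0≤* (0≤ι 3) 0≤V) (solve 1 (λ y → con (ι 4) :* y := y :+ con (ι 3) :* y) refl V))))
          V≤y : V ≤ y
          V≤y = subst (V ≤_) (sym (trans (ι-∸ qq≤X) (cong (_- ι (q ℕ.* q)) ιX≡)))
            (≤-by (V + V + (V - ι (q ℕ.* q))) (0≤+ (0≤+ 0≤V 0≤V) (0≤-diff qq≤)) (solve 2 (λ y q → con (ι 4) :* y :- q := y :+ (y :+ y :+ (y :- q))) refl V (ι (q ℕ.* q))))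
      low : ι I * (V * V * V) * x ≤ W * x
      low = *-monoʳ 0≤x V³I≤W
      k≤ : k ≤ M₁ * h
      k≤ = ≤-by ((σ * C₃ + C₂ * Cσ) * (h - 1ℚ)) (0≤* (0≤+ (0≤* 0≤σ 0≤C₃) (0≤* 0≤C₂ 0≤C)) (0≤-diff 1≤h))
        (solve 5 (λ s c₃ c₂ c h → (s :* c₃ :+ c₂ :* c :+ c₂ :* (c :+ c)) :* h := (s :* c₃ :+ c₂ :* (c :+ (c :+ c) :* h)) :+ (s :* c₃ :+ c₂ :* c) :* (h :- con 1ℚ)) refl σ C₃ C₂ Cσ h)
      high : 6ℚ * ι 10 * ι g * (k * k) * (ιX * ιX * ιX) * ι D + E₀ ≤ (V * V * V) * (M₂ * (h * h * h))
      high = ≤-trans (ℚₚ.+-mono-≤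
          (*-mono (0≤* (0≤* (0≤* (0≤* (0≤ι 6) (0≤ι 10)) (0≤ι g)) (0≤p² k)) (0≤* (0≤p² ιX) (0≤ι X))) 0≤h
            (*-monoʳ (0≤* (0≤p² ιX) (0≤ι X)) (*-monoˡ (0≤* (0≤* (0≤ι 6) (0≤ι 10)) (0≤ι g)) (*-mono 0≤k (0≤* 0≤M₁ 0≤h) k≤ k≤))) D≤h)
          (subst (_≤ E₀ * (V * V * V * (h * h * h))) (ℚₚ.*-identityʳ E₀) (*-monoˡ 0≤E₀
            (subst (_≤ V * V * V * (h * h * h)) (ℚₚ.*-identityˡ 1ℚ) (*-mono 0≤1 (0≤* (0≤p² h) 0≤h) 1≤V³ (*-mono 0≤1 0≤h (*-mono 0≤1 0≤h 1≤h 1≤h) 1≤h))))))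
        (≤-reflexive (trans (cong (λ m → 6ℚ * ι 10 * ι g * (M₁ * h * (M₁ * h)) * (m * m * m) * h + E₀ * (V * V * V * (h * h * h))) ιX≡)
          (solve 7 (λ s f g m y h e → s :* g :* (m :* h :* (m :* h)) :* (f :* y :* (f :* y) :* (f :* y)) :* h :+ e :* (y :* y :* y :* (h :* h :* h))
             := (y :* y :* y) :* ((s :* (f :* f :* f) :* g :* (m :* m) :+ e) :* (h :* h :* h))) refl (6ℚ * ι 10) (ι 4) (ι g) M₁ V h E₀)))
        where
        0≤k : 0ℚ ≤ k
        0≤k = 0≤Kc Z X R h 1≤R X<Z HZ≤h 0≤h
      eqL : ι I * (V * V * V) * x ≡ (V * V * V) * (ι I * x)
      eqL = solve 3 (λ i y x → i :* y :* x := y :* (i :* x)) refl (ι I) (V * V * V) x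

    -- `scaleBound` sets an exponential against a cube. For ℓ = 4p the left side is at least (p +
    -- 1)⁴ E(1,1), while the right side is at most a constant times (p + 1)³; hence E(1,1), the sum
    -- of the squares of all `b i 1`, is 0.
    vanishing : ∀ i → i ℕ.< g → b i 1 ≡ 0ℚ
    vanishing i i<g = p²≤0⇒p≡0 (b i 1) (≤-trans (term≤∑ g (λ j _ → 0≤p² (b j 1)) i i<g) (ι*-bounded⇒≤0 (M₂ * (c * c * c)) bounded))
      where
      c = ι (n ℕ.+ n ℕ.+ 8)
      bounded : ∀ p → ι (suc p) * x ≤ M₂ * (c * c * c)
      bounded p = *-cancelˡ 0<s³ (subst₂ _≤_ (solve 2 (λ s x → s :* s :* s :* s :* x := s :* s :* s :* (s :* x)) refl s x)
        (solve 3 (λ m c s → m :* (c :* s :* (c :* s) :* (c :* s)) := s :* s :* s :* (m :* (c :* c :* c))) refl M₂ c s)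
        (≤-trans (*-monoʳ 0≤x s⁴≤) (≤-trans (scaleBound ℓ) (*-monoˡ 0≤M₂ (*-mono (0≤p² (ι (growth ℓ))) 0≤cs (*-mono 0≤gr 0≤cs gr≤ gr≤) gr≤)))))
        where
        s = ι (suc p)
        ℓ = p ℕ.+ p ℕ.+ p ℕ.+ p
        0≤gr = 0≤ι (growth ℓ)
        0≤cs = 0≤* (0≤ι (n ℕ.+ n ℕ.+ 8)) (0≤ι (suc p))
        0<s³ : 0ℚ < s * s * s
        0<s³ = subst (0ℚ <_) (trans (ι-* (suc p ℕ.* suc p) (suc p)) (cong (_* s) (ι-* (suc p) (suc p)))) (0<ι {suc p ℕ.* suc p ℕ.* suc p} (s≤s z≤n))
        s≤2^p : s ≤ ι (2 ℕ.^ p)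
        s≤2^p = ι-mono (n<2^n p)
        0≤s : 0ℚ ≤ s
        0≤s = 0≤ι (suc p)
        0≤2^p = 0≤ι (2 ℕ.^ p)
        s⁴≤ : s * s * s * s ≤ ι (2 ℕ.^ ℓ)
        s⁴≤ = subst (s * s * s * s ≤_) (sym pow)
          (*-mono (0≤* (0≤p² s) 0≤s) 0≤2^p (*-mono (0≤p² s) 0≤2^p (*-mono 0≤s 0≤2^p s≤2^p s≤2^p) s≤2^p) s≤2^p)
          where
          t = ι (2 ℕ.^ p)
          step : ∀ m → ι (2 ℕ.^ (m ℕ.+ p)) ≡ ι (2 ℕ.^ m) * t
          step m = trans (cong ι (ℕₚ.^-distribˡ-+-* 2 m p)) (ι-* (2 ℕ.^ m) (2 ℕ.^ p))
          pow : ι (2 ℕ.^ ℓ) ≡ t * t * t * t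
          pow = trans (step (p ℕ.+ p ℕ.+ p)) (cong (_* t) (trans (step (p ℕ.+ p)) (cong (_* t) (step p))))
        gr≤ : ι (growth ℓ) ≤ c * s
        gr≤ = subst (ι (growth ℓ) ≤_) (ι-* (n ℕ.+ n ℕ.+ 8) (suc p)) (ι-mono (subst (growth ℓ ℕ.≤_) eq (ℕₚ.m≤m+n (growth ℓ) ((n ℕ.+ n) ℕ.* p ℕ.+ 4))))
          where
          eq : growth ℓ ℕ.+ ((n ℕ.+ n) ℕ.* p ℕ.+ 4) ≡ (n ℕ.+ n ℕ.+ 8) ℕ.* suc p
          eq = solveℕ 2 (λ n p → (p ⊹ p ⊹ p ⊹ p ⊹ n) ⊹ (p ⊹ p ⊹ p ⊹ p ⊹ n) ⊹ κℕ 4 ⊹ ((n ⊹ n) ⊠ p ⊹ κℕ 4) ≜ (n ⊹ n ⊹ κℕ 8) ⊠ (κℕ 1 ⊹ p)) refl n p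

-- Integers in ℚ

ιℤ : ℤ → ℚ
ιℤ (ℤ.+ m)      = ι m
ιℤ (ℤ.-[1+ m ]) = - ι (suc m)

ιℤ-⊖ : ∀ m n → ιℤ (m ℤ.⊖ n) ≡ ι m - ι n
ιℤ-⊖ m n with m ℕ.≤? n
... | yes m≤n = trans (cong ιℤ (ℤₚ.⊖-≤ m≤n)) (trans (ιℤ-neg⁺ (n ℕ.∸ m)) (trans (cong -_ (ι-∸ m≤n))
        (solve 2 (λ x y → :- (x :- y) := y :- x) refl (ι n) (ι m))))
  where
  ιℤ-neg⁺ : ∀ k → ιℤ (ℤ.- (ℤ.+ k)) ≡ - ι k
  ιℤ-neg⁺ zero    = refl
  ιℤ-neg⁺ (suc k) = refl
... | no  m≰n = trans (cong ιℤ (ℤₚ.⊖-≥ (ℕₚ.<⇒≤ (ℕₚ.≰⇒> m≰n)))) (ι-∸ (ℕₚ.<⇒≤ (ℕₚ.≰⇒> m≰n)))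

ιℤ-neg : ∀ i → ιℤ (ℤ.- i) ≡ - ιℤ i
ιℤ-neg (ℤ.+ zero)   = refl
ιℤ-neg (ℤ.+ suc m)  = refl
ιℤ-neg ℤ.-[1+ m ]   = solve 1 (λ x → x := :- (:- x)) refl (ι (suc m))

ιℤ-+ : ∀ i j → ιℤ (i ℤ.+ j) ≡ ιℤ i + ιℤ j
ιℤ-+ (ℤ.+ m)      (ℤ.+ k)      = ι-+ m k
ιℤ-+ (ℤ.+ m)      ℤ.-[1+ k ]   = ιℤ-⊖ m (suc k)
ιℤ-+ ℤ.-[1+ m ]   (ℤ.+ k)      = trans (ιℤ-⊖ k (suc m)) (ℚₚ.+-comm (ι k) (- ι (suc m)))
ιℤ-+ ℤ.-[1+ m ]   ℤ.-[1+ k ]   = trans (cong (λ x → - ι x) (cong suc (sym (ℕₚ.+-suc m k))))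
  (trans (cong -_ (ι-+ (suc m) (suc k))) (ℚₚ.neg-distrib-+ (ι (suc m)) (ι (suc k))))

ιℤ-*⁺ : ∀ n j → ιℤ (ℤ.+ n ℤ.* j) ≡ ι n * ιℤ j
ιℤ-*⁺ n (ℤ.+ k)    = trans (cong ιℤ (sym (ℤₚ.pos-* n k))) (ι-* n k)
ιℤ-*⁺ n ℤ.-[1+ k ] = trans (cong ιℤ (sym (ℤₚ.neg-distribʳ-* (ℤ.+ n) (ℤ.+ suc k)))) (trans (ιℤ-neg (ℤ.+ n ℤ.* ℤ.+ suc k))
  (trans (cong -_ (trans (cong ιℤ (sym (ℤₚ.pos-* n (suc k)))) (ι-* n (suc k)))) (ℚₚ.neg-distribʳ-* (ι n) (ι (suc k)))))

∣ιℤ∣ : ∀ i → ∣ ιℤ i ∣ ≡ ι ℤ.∣ i ∣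
∣ιℤ∣ (ℤ.+ m)    = ∣ι∣ m
∣ιℤ∣ ℤ.-[1+ m ] = trans (ℚₚ.∣-p∣≡∣p∣ (ι (suc m))) (∣ι∣ (suc m))

ιℤ≢0 : ∀ {i} → i ≢ ℤ.+ 0 → ιℤ i ≢ 0ℚ
ιℤ≢0 {i} i≢0 ιi≡0 = i≢0 (ℤₚ.∣i∣≡0⇒i≡0 (ℕₚ.n≤0⇒n≡0 (ι-cancel (≤-reflexive (trans (sym (∣ιℤ∣ i)) (cong ∣_∣ ιi≡0))))))

-- Symmetric sums over the integers of absolute value at most M

opaque
  ∑± : ℕ → (ℤ → ℚ) → ℚ
  ∑± M f = f (ℤ.+ 0) + ∑₁ M (λ j → f (ℤ.+ j) + f (ℤ.- (ℤ.+ j)))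

  ∑±-ext : ∀ M {f g : ℤ → ℚ} → (∀ t → f t ≡ g t) → ∑± M f ≡ ∑± M g
  ∑±-ext M e = cong₂ _+_ (e (ℤ.+ 0)) (∑₁-ext M λ j _ _ → cong₂ _+_ (e (ℤ.+ j)) (e (ℤ.- (ℤ.+ j))))

  ∑±-+ : ∀ M (f g : ℤ → ℚ) → ∑± M (λ t → f t + g t) ≡ ∑± M f + ∑± M g
  ∑±-+ M f g = trans (cong (f (ℤ.+ 0) + g (ℤ.+ 0) +_) (trans (∑₁-ext M λ j _ _ →
      solve 4 (λ a b c d → (a :+ b) :+ (c :+ d) := (a :+ c) :+ (b :+ d)) refl (f (ℤ.+ j)) (g (ℤ.+ j)) (f (ℤ.- (ℤ.+ j))) (g (ℤ.- (ℤ.+ j))))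
      (∑₁-+ M (λ j → f (ℤ.+ j) + f (ℤ.- (ℤ.+ j))) (λ j → g (ℤ.+ j) + g (ℤ.- (ℤ.+ j))))))
    (solve 4 (λ a b c d → (a :+ b) :+ (c :+ d) := (a :+ c) :+ (b :+ d)) refl (f (ℤ.+ 0)) (g (ℤ.+ 0)) _ _)

  ∑±-*ˡ : ∀ M c (f : ℤ → ℚ) → ∑± M (λ t → c * f t) ≡ c * ∑± M f
  ∑±-*ˡ M c f = trans (cong (c * f (ℤ.+ 0) +_) (trans (∑₁-ext M λ j _ _ → sym (ℚₚ.*-distribˡ-+ c (f (ℤ.+ j)) (f (ℤ.- (ℤ.+ j)))))
    (∑₁-*ˡ M c (λ j → f (ℤ.+ j) + f (ℤ.- (ℤ.+ j)))))) (sym (ℚₚ.*-distribˡ-+ c (f (ℤ.+ 0)) _))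

  ∑±-*ʳ : ∀ M c (f : ℤ → ℚ) → ∑± M (λ t → f t * c) ≡ ∑± M f * c
  ∑±-*ʳ M c f = trans (∑±-ext M λ t → ℚₚ.*-comm (f t) c) (trans (∑±-*ˡ M c f) (ℚₚ.*-comm c (∑± M f)))

  ∑±-zero : ∀ M {f : ℤ → ℚ} → (∀ t → f t ≡ 0ℚ) → ∑± M f ≡ 0ℚ
  ∑±-zero M {f} e = trans (∑±-ext M e) (trans (ℚₚ.+-identityˡ _) (∑₁-zero M λ _ _ _ → ℚₚ.+-identityˡ 0ℚ))

  ∑±-∑₁-swap : ∀ M Z (f : ℤ → ℕ → ℚ) → ∑± M (λ t → ∑₁ Z (f t)) ≡ ∑₁ Z (λ k → ∑± M (λ t → f t k))
  ∑±-∑₁-swap M Z f = trans (cong (∑₁ Z (f (ℤ.+ 0)) +_) (trans (∑₁-ext M λ j _ _ → sym (∑₁-+ Z (f (ℤ.+ j)) (f (ℤ.- (ℤ.+ j)))))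
    (∑₁-swap M Z (λ j k → f (ℤ.+ j) k + f (ℤ.- (ℤ.+ j)) k)))) (sym (∑₁-+ Z (f (ℤ.+ 0)) _))

  ∑±-swap : ∀ M (f : ℤ → ℤ → ℚ) → ∑± M (λ t → ∑± M (f t)) ≡ ∑± M (λ u → ∑± M (λ t → f t u))
  ∑±-swap M f = trans (∑±-+ M (λ t → f t (ℤ.+ 0)) (λ t → ∑₁ M (λ j → f t (ℤ.+ j) + f t (ℤ.- (ℤ.+ j)))))
    (cong (∑± M (λ t → f t (ℤ.+ 0)) +_) (trans (∑±-∑₁-swap M M (λ t j → f t (ℤ.+ j) + f t (ℤ.- (ℤ.+ j))))
      (∑₁-ext M λ j _ _ → ∑±-+ M (λ t → f t (ℤ.+ j)) (λ t → f t (ℤ.- (ℤ.+ j))))))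

  ∑±-prod : ∀ M (f g : ℤ → ℚ) → ∑± M f * ∑± M g ≡ ∑± M (λ t → ∑± M (λ u → f t * g u))
  ∑±-prod M f g = trans (sym (∑±-*ʳ M (∑± M g) f)) (∑±-ext M λ t → sym (∑±-*ˡ M (f t) g))

  ∑±-neg : ∀ M (f : ℤ → ℚ) → ∑± M (λ t → f (ℤ.- t)) ≡ ∑± M f
  ∑±-neg M f = cong (f (ℤ.+ 0) +_) (∑₁-ext M λ j _ _ → trans (ℚₚ.+-comm (f (ℤ.- (ℤ.+ j))) (f (ℤ.- (ℤ.- (ℤ.+ j)))))
    (cong (λ z → f z + f (ℤ.- (ℤ.+ j))) (ℤₚ.neg-involutive (ℤ.+ j))))

  ∑±-suc : ∀ M (f : ℤ → ℚ) → ∑± (suc M) f ≡ ∑± M f + (f (ℤ.+ suc M) + f ℤ.-[1+ M ])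
  ∑±-suc M f = trans (cong (f (ℤ.+ 0) +_) (trans (∑₁-∑ (suc M) _) (cong (_+ (f (ℤ.+ suc M) + f ℤ.-[1+ M ])) (sym (∑₁-∑ M _)))))
    (sym (ℚₚ.+-assoc (f (ℤ.+ 0)) _ _))

  ∑±-shift : ∀ M (f : ℤ → ℚ) → ∑± M (λ t → f (t ℤ.+ ℤ.+ 1)) ≡ ∑± M f + (f (ℤ.+ suc M) - f (ℤ.- (ℤ.+ M)))
  ∑±-shift zero    f = trans (cong (f (ℤ.+ 1) +_) (trans (∑₁-∑ 0 (λ j → f (ℤ.+ j ℤ.+ ℤ.+ 1) + f (ℤ.- (ℤ.+ j) ℤ.+ ℤ.+ 1))) (sym (∑₁-∑ 0 (λ j → f (ℤ.+ j) + f (ℤ.- (ℤ.+ j)))))))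
    (solve 3 (λ a b s → a :+ s := b :+ s :+ (a :- b)) refl (f (ℤ.+ 1)) (f (ℤ.+ 0)) _)
  ∑±-shift (suc M) f = begin
    ∑± (suc M) (λ t → f (t ℤ.+ ℤ.+ 1))
      ≡⟨ ∑±-suc M (λ t → f (t ℤ.+ ℤ.+ 1)) ⟩
    ∑± M (λ t → f (t ℤ.+ ℤ.+ 1)) + (f (ℤ.+ (suc M ℕ.+ 1)) + f (ℤ.-[1+ M ] ℤ.+ ℤ.+ 1))
      ≡⟨ cong₂ (λ x y → x + y) (∑±-shift M f) (cong₂ (λ x y → f x + f y) (cong ℤ.+_ (ℕₚ.+-comm (suc M) 1)) (neg M)) ⟩
    ∑± M f + (f (ℤ.+ suc M) - f (ℤ.- (ℤ.+ M))) + (f (ℤ.+ suc (suc M)) + f (ℤ.- (ℤ.+ M)))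
      ≡⟨ solve 5 (λ s a b c d → s :+ (a :- b) :+ (c :+ b) := s :+ (a :+ d) :+ (c :- d)) refl (∑± M f) (f (ℤ.+ suc M)) (f (ℤ.- (ℤ.+ M))) (f (ℤ.+ suc (suc M))) (f ℤ.-[1+ M ]) ⟩
    ∑± M f + (f (ℤ.+ suc M) + f ℤ.-[1+ M ]) + (f (ℤ.+ suc (suc M)) - f ℤ.-[1+ M ])
      ≡⟨ cong (_+ (f (ℤ.+ suc (suc M)) - f ℤ.-[1+ M ])) (sym (∑±-suc M f)) ⟩
    ∑± (suc M) f + (f (ℤ.+ suc (suc M)) - f ℤ.-[1+ M ]) ∎
    where
    open ≡-Reasoning
    neg : ∀ M → ℤ.-[1+ M ] ℤ.+ ℤ.+ 1 ≡ ℤ.- (ℤ.+ M)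
    neg zero    = refl
    neg (suc M) = refl

  -- Turns the constraint |s| ≤ M into a third summation variable w with s + w = 0, which makes the
  -- hexagon symmetric in its three variables.
  ∑±-𝟙 : ∀ M s → ∑± M (λ w → 𝟙 (s ℤ.+ w ℤ.≟ ℤ.+ 0)) ≡ 𝟙 (ℤ.∣ s ∣ ℕ.≤? M)
  ∑±-𝟙 M s = go s
    where
    χ : ℤ → ℤ → ℚ
    χ s w = 𝟙 (s ℤ.+ w ℤ.≟ ℤ.+ 0)
    unique : ∀ s w → s ℤ.+ w ≡ ℤ.+ 0 → w ≡ ℤ.- s
    unique s w e = trans (solveℤ 2 (λ s w → w ≐ ⊟ s ⊞ (s ⊞ w)) refl s w) (trans (cong (λ x → ℤ.- s ℤ.+ x) e) (ℤₚ.+-identityʳ (ℤ.- s)))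
    no-hit : ∀ s w → w ≢ ℤ.- s → χ s w ≡ 0ℚ
    no-hit s w w≢ = 𝟙-no (s ℤ.+ w ℤ.≟ ℤ.+ 0) (w≢ ∘ unique s w)
    single : ∀ m (f : ℕ → ℚ) → 1 ℕ.≤ m → (∀ j → 1 ℕ.≤ j → f j ≡ 𝟙 (j ℕ.≟ m)) → ∑₁ M f ≡ 𝟙 (m ℕ.≤? M)
    single m f 1≤m e with m ℕ.≤? M
    ... | yes m≤M = trans (∑₁-ext M λ j 1≤j _ → trans (e j 1≤j) (sym (ℚₚ.*-identityʳ _))) (∑₁-pick M (ℕ._≟ m) (λ _ → 1ℚ) m 1≤m m≤M refl (λ _ e → e))
    ... | no  m≰M = ∑₁-zero M λ j 1≤j j≤M → trans (e j 1≤j) (𝟙-no (j ℕ.≟ m) λ j≡m → m≰M (subst (ℕ._≤ M) j≡m j≤M))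
    go : ∀ s → ∑± M (χ s) ≡ 𝟙 (ℤ.∣ s ∣ ℕ.≤? M)
    go (ℤ.+ zero) = trans (cong (1ℚ +_) (∑₁-zero M λ j 1≤j _ → trans (cong₂ _+_
        (no-hit (ℤ.+ 0) (ℤ.+ j) (λ e → ℕₚ.<⇒≢ 1≤j (sym (ℤₚ.+-injective e))))
        (no-hit (ℤ.+ 0) (ℤ.- (ℤ.+ j)) (λ e → ℕₚ.<⇒≢ 1≤j (sym (ℤₚ.+-injective (ℤₚ.neg-injective e)))))) (ℚₚ.+-identityˡ 0ℚ)))
      (trans (ℚₚ.+-identityʳ 1ℚ) (sym (𝟙-yes (0 ℕ.≤? M) z≤n)))
    go s@(ℤ.+ suc m) = trans (cong₂ _+_ (no-hit s (ℤ.+ 0) (λ ())) (single (suc m) _ (s≤s z≤n) λ j 1≤j → trans (cong₂ _+_ (no-hit s (ℤ.+ j) (λ ()))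
        (𝟙-⇔ (s ℤ.+ ℤ.- (ℤ.+ j) ℤ.≟ ℤ.+ 0) (j ℕ.≟ suc m) (λ e → ℤₚ.+-injective (ℤₚ.neg-injective (unique s (ℤ.- (ℤ.+ j)) e)))
          (λ e → trans (cong (λ k → s ℤ.+ ℤ.- (ℤ.+ k)) e) (ℤₚ.+-inverseʳ s)))) (ℚₚ.+-identityˡ _))) (ℚₚ.+-identityˡ _)
    go s@(ℤ.-[1+ m ]) = trans (cong₂ _+_ (no-hit s (ℤ.+ 0) (λ ())) (single (suc m) _ (s≤s z≤n) λ j 1≤j → trans (cong₂ _+_
        (𝟙-⇔ (s ℤ.+ ℤ.+ j ℤ.≟ ℤ.+ 0) (j ℕ.≟ suc m) (λ e → ℤₚ.+-injective (unique s (ℤ.+ j) e))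
          (λ e → trans (cong (λ k → s ℤ.+ ℤ.+ k) e) (ℤₚ.+-inverseˡ (ℤ.+ suc m))))
        (no-hit s (ℤ.- (ℤ.+ j)) (neg≢ j))) (ℚₚ.+-identityʳ _))) (ℚₚ.+-identityˡ _)
      where
      neg≢ : ∀ j → ℤ.- (ℤ.+ j) ≢ ℤ.+ suc m
      neg≢ zero    ()
      neg≢ (suc j) ()

  ∑±-expand : ∀ M (f : ℤ → ℚ) → ∑± M f ≡ f (ℤ.+ 0) + ∑₁ M (λ j → f (ℤ.+ j) + f (ℤ.- (ℤ.+ j)))
  ∑±-expand M f = refl

-- The two regions where t and u have equal sign and |t + u| > M. For opposite signs |t + u| ≤ M
-- holds throughout the square.
corner : ℕ → (ℤ → ℚ) → (ℤ → ℚ) → ℚ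
corner M φ ψ = ∑₁ M (λ j → ∑₁ M (λ k → 𝟙 (M ℕ.<? j ℕ.+ k) * (φ (ℤ.+ j) * ψ (ℤ.+ k) + φ (ℤ.- (ℤ.+ j)) * ψ (ℤ.- (ℤ.+ k)))))

-- The square |t|, |u| ≤ M is the hexagon |t|, |u|, |t + u| ≤ M together with two opposite corners.
square-hexagon : ∀ M φ ψ → ∑± M φ * ∑± M ψ ≡
  ∑± M (λ t → ∑± M (λ u → ∑± M (λ w → 𝟙 (t ℤ.+ u ℤ.+ w ℤ.≟ ℤ.+ 0)) * (φ t * ψ u))) + corner M φ ψ
square-hexagon M φ ψ = sym (begin
  ∑± M (λ t → ∑± M (λ u → ∑± M (λ w → 𝟙 (t ℤ.+ u ℤ.+ w ℤ.≟ ℤ.+ 0)) * (φ t * ψ u))) + corner M φ ψ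
    ≡⟨ cong₂ _+_ (∑±-ext M λ t → ∑±-ext M λ u → cong (_* (φ t * ψ u)) (∑±-𝟙 M (t ℤ.+ u))) (sym outer) ⟩
  ∑± M (λ t → ∑± M (λ u → in? t u * (φ t * ψ u))) + ∑± M (λ t → ∑± M (λ u → (1ℚ - in? t u) * (φ t * ψ u)))
    ≡⟨ sym (∑±-+ M _ _) ⟩
  ∑± M (λ t → ∑± M (λ u → in? t u * (φ t * ψ u)) + ∑± M (λ u → (1ℚ - in? t u) * (φ t * ψ u)))
    ≡⟨ ∑±-ext M (λ t → trans (sym (∑±-+ M _ _)) (∑±-ext M λ u → solve 2 (λ i x → i :* x :+ (con 1ℚ :- i) :* x := x) refl (in? t u) (φ t * ψ u))) ⟩
  ∑± M (λ t → ∑± M (λ u → φ t * ψ u))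
    ≡⟨ sym (∑±-prod M φ ψ) ⟩
  ∑± M φ * ∑± M ψ ∎)
  where
  open ≡-Reasoning
  in? out : ℤ → ℤ → ℚ
  in? t u = 𝟙 (ℤ.∣ t ℤ.+ u ∣ ℕ.≤? M)
  out t u = (1ℚ - in? t u) * (φ t * ψ u)
  out-0 : ∀ t u → ℤ.∣ t ℤ.+ u ∣ ℕ.≤ M → out t u ≡ 0ℚ
  out-0 t u le = trans (cong (λ i → (1ℚ - i) * (φ t * ψ u)) (𝟙-yes (ℤ.∣ t ℤ.+ u ∣ ℕ.≤? M) le)) (0* (φ t * ψ u) (ℚₚ.+-inverseʳ 1ℚ))
  out-same : ∀ t u m → ℤ.∣ t ℤ.+ u ∣ ≡ m → out t u ≡ 𝟙 (M ℕ.<? m) * (φ t * ψ u)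
  out-same t u m e = cong (_* (φ t * ψ u)) (trans (cong (λ m → 1ℚ - 𝟙 (m ℕ.≤? M)) e) (flip m))
    where
    flip : ∀ m → 1ℚ - 𝟙 (m ℕ.≤? M) ≡ 𝟙 (M ℕ.<? m)
    flip m with m ℕ.≤? M
    ... | yes m≤M = trans (ℚₚ.+-inverseʳ 1ℚ) (sym (𝟙-no (M ℕ.<? m) (ℕₚ.≤⇒≯ m≤M)))
    ... | no  m≰M = trans refl (sym (𝟙-yes (M ℕ.<? m) (ℕₚ.≰⇒> m≰M)))
  ∣j-k∣≤ : ∀ j k → j ℕ.≤ M → k ℕ.≤ M → ℤ.∣ ℤ.+ j ℤ.+ ℤ.- (ℤ.+ k) ∣ ℕ.≤ M
  ∣j-k∣≤ j k j≤M k≤M = ℕₚ.≤-trans (ℕₚ.≤-reflexive (cong ℤ.∣_∣ (ℤₚ.m-n≡m⊖n j k))) (ℕₚ.≤-trans (ℤₚ.∣m⊝n∣≤m⊔n j k) (ℕₚ.⊔-lub j≤M k≤M))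
  ∣-k+j∣≤ : ∀ j k → j ℕ.≤ M → k ℕ.≤ M → ℤ.∣ ℤ.- (ℤ.+ k) ℤ.+ ℤ.+ j ∣ ℕ.≤ M
  ∣-k+j∣≤ j k j≤M k≤M = subst (λ z → ℤ.∣ z ∣ ℕ.≤ M) (ℤₚ.+-comm (ℤ.+ j) (ℤ.- (ℤ.+ k))) (∣j-k∣≤ j k j≤M k≤M)
  pos : ∀ j → j ℕ.≤ M → ∑± M (out (ℤ.+ j)) ≡ ∑₁ M (λ k → 𝟙 (M ℕ.<? j ℕ.+ k) * (φ (ℤ.+ j) * ψ (ℤ.+ k)))
  pos j j≤M = trans (∑±-expand M (out (ℤ.+ j))) $ trans (cong₂ _+_ (out-0 (ℤ.+ j) (ℤ.+ 0) (subst (ℕ._≤ M) (sym (ℕₚ.+-identityʳ j)) j≤M))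
    (∑₁-ext M λ k _ k≤M → trans (cong₂ _+_ (out-same (ℤ.+ j) (ℤ.+ k) (j ℕ.+ k) refl) (out-0 (ℤ.+ j) (ℤ.- (ℤ.+ k)) (∣j-k∣≤ j k j≤M k≤M))) (ℚₚ.+-identityʳ _))) (ℚₚ.+-identityˡ _)
  neg : ∀ j → j ℕ.≤ M → ∑± M (out (ℤ.- (ℤ.+ j))) ≡ ∑₁ M (λ k → 𝟙 (M ℕ.<? j ℕ.+ k) * (φ (ℤ.- (ℤ.+ j)) * ψ (ℤ.- (ℤ.+ k))))
  neg j j≤M = trans (∑±-expand M (out (ℤ.- (ℤ.+ j)))) $ trans (cong₂ _+_ (out-0 (ℤ.- (ℤ.+ j)) (ℤ.+ 0) (∣-k+j∣≤ 0 j z≤n j≤M))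
    (∑₁-ext M λ k _ k≤M → trans (cong₂ _+_ (out-0 (ℤ.- (ℤ.+ j)) (ℤ.+ k) (∣-k+j∣≤ k j k≤M j≤M))
      (out-same (ℤ.- (ℤ.+ j)) (ℤ.- (ℤ.+ k)) (j ℕ.+ k) (trans (cong ℤ.∣_∣ (sym (ℤₚ.neg-distrib-+ (ℤ.+ j) (ℤ.+ k)))) (ℤₚ.∣-i∣≡∣i∣ (ℤ.+ (j ℕ.+ k)))))) (ℚₚ.+-identityˡ _))) (ℚₚ.+-identityˡ _)
  outer : ∑± M (λ t → ∑± M (out t)) ≡ corner M φ ψ
  outer = trans (∑±-expand M (λ t → ∑± M (out t))) $ trans (cong₂ _+_ zeroRow (∑₁-ext M λ j _ j≤M → trans (cong₂ _+_ (pos j j≤M) (neg j j≤M)) (trans (sym (∑₁-+ M _ _))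
    (∑₁-ext M λ k _ _ → sym (ℚₚ.*-distribˡ-+ (𝟙 (M ℕ.<? j ℕ.+ k)) _ _))))) (ℚₚ.+-identityˡ _)
    where
    zeroRow : ∑± M (out (ℤ.+ 0)) ≡ 0ℚ
    zeroRow = trans (pos 0 z≤n) (∑₁-zero M λ k _ k≤M → 0* (φ (ℤ.+ 0) * ψ (ℤ.+ k)) (𝟙-no (M ℕ.<? k) (ℕₚ.≤⇒≯ k≤M)))

-- The partial fraction expansion of the cotangent

rcp-rcp : ∀ x y → 1 ℕ.≤ x → 1 ℕ.≤ y → rcp x * rcp y ≡ rcp (x ℕ.+ y) * (rcp x + rcp y)
rcp-rcp x y 1≤x 1≤y = sym (begin
  z * (rcp x + rcp y)
    ≡⟨ cong₂ (λ a b → z * (a + b)) (trans (sym (ℚₚ.*-identityʳ (rcp x))) (cong (rcp x *_) (sym (ι*rcp 1≤y)))) (trans (sym (ℚₚ.*-identityʳ (rcp y))) (cong (rcp y *_) (sym (ι*rcp 1≤x)))) ⟩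
  z * (rcp x * (ι y * rcp y) + rcp y * (ι x * rcp x))
    ≡⟨ solve 5 (λ z a b x y → z :* (a :* (y :* b) :+ b :* (x :* a)) := ((x :+ y) :* z) :* (a :* b)) refl z (rcp x) (rcp y) (ι x) (ι y) ⟩
  (ι x + ι y) * z * (rcp x * rcp y)
    ≡⟨ cong (λ s → s * z * (rcp x * rcp y)) (sym (ι-+ x y)) ⟩
  ι (x ℕ.+ y) * z * (rcp x * rcp y)
    ≡⟨ trans (cong (_* (rcp x * rcp y)) (ι*rcp (ℕₚ.≤-trans 1≤x (ℕₚ.m≤m+n x y)))) (ℚₚ.*-identityˡ (rcp x * rcp y)) ⟩
  rcp x * rcp y ∎)
  where
  open ≡-Reasoning
  z = rcp (x ℕ.+ y)

∑-reverse : ∀ M (g : ℕ → ℚ) → ∑ M (λ i → g (M ℕ.∸ suc i)) ≡ ∑ M g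
∑-reverse zero    g = refl
∑-reverse (suc M) g = trans (∑-head M (λ i → g (M ℕ.∸ i))) (trans (cong (g M +_) (∑-reverse M g)) (ℚₚ.+-comm (g M) (∑ M g)))

∑₁-tail : ∀ M j (f : ℕ → ℚ) → j ℕ.≤ M → ∑₁ M (λ k → 𝟙 (M ℕ.<? j ℕ.+ k) * f k) ≡ ∑ j (λ i → f (suc (M ℕ.∸ j ℕ.+ i)))
∑₁-tail M j f j≤M = begin
  ∑₁ M (λ k → 𝟙 (M ℕ.<? j ℕ.+ k) * f k)              ≡⟨ ∑₁-∑ M (λ k → 𝟙 (M ℕ.<? j ℕ.+ k) * f k) ⟩
  ∑ M t                                               ≡⟨ cong (λ m → ∑ m t) (sym (ℕₚ.m∸n+n≡m j≤M)) ⟩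
  ∑ (M ℕ.∸ j ℕ.+ j) t                                 ≡⟨ ∑-split (M ℕ.∸ j) j t ⟩
  ∑ (M ℕ.∸ j) t + ∑ j (λ i → t (M ℕ.∸ j ℕ.+ i))       ≡⟨ cong₂ _+_ (∑-zero (M ℕ.∸ j) low) (∑-ext j high) ⟩
  0ℚ + ∑ j (λ i → f (suc (M ℕ.∸ j ℕ.+ i)))            ≡⟨ ℚₚ.+-identityˡ (∑ j (λ i → f (suc (M ℕ.∸ j ℕ.+ i)))) ⟩
  ∑ j (λ i → f (suc (M ℕ.∸ j ℕ.+ i)))                 ∎
  where
  open ≡-Reasoning
  t : ℕ → ℚ
  t i = 𝟙 (M ℕ.<? j ℕ.+ suc i) * f (suc i)
  low : ∀ i → i ℕ.< M ℕ.∸ j → t i ≡ 0ℚ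
  low i i< = 0* (f (suc i)) (𝟙-no (M ℕ.<? j ℕ.+ suc i) (ℕₚ.≤⇒≯ (ℕₚ.≤-trans (ℕₚ.+-monoʳ-≤ j i<) (ℕₚ.≤-reflexive (ℕₚ.m+[n∸m]≡n j≤M)))))
  high : ∀ i → t (M ℕ.∸ j ℕ.+ i) ≡ f (suc (M ℕ.∸ j ℕ.+ i))
  high i = trans (cong (_* f (suc (M ℕ.∸ j ℕ.+ i))) (𝟙-yes (M ℕ.<? j ℕ.+ suc (M ℕ.∸ j ℕ.+ i))
    (subst (M ℕ.<_) (sym (trans (ℕₚ.+-suc j (M ℕ.∸ j ℕ.+ i)) (cong suc (trans (sym (ℕₚ.+-assoc j (M ℕ.∸ j) i)) (cong (ℕ._+ i) (ℕₚ.m+[n∸m]≡n j≤M)))))) (s≤s (ℕₚ.m≤m+n M i)))))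
    (ℚₚ.*-identityˡ _)

-- `ζ′ M` is a Riemann sum of 1/(xy) over the triangle x, y ≤ 1 < x + y and tends to π²/6; the proof
-- works with the bounds 1 and 2 in place of the limit. `κ₂₁` collects the errors made in the
-- corners.
ζ′ κ₂₁ : ℕ → ℚ
ζ′ M = ∑₁ M (λ j → ∑₁ M (λ k → 𝟙 (M ℕ.<? j ℕ.+ k) * (rcp j * rcp k)))
κ₂₁ M = ∑₁ M (λ j → ∑₁ M (λ k → 𝟙 (M ℕ.<? j ℕ.+ k) * (rcp j * rcp j * rcp k)))

corner-row : ∀ M j c (f : ℕ → ℚ) → j ℕ.≤ M → ∑₁ M (λ k → 𝟙 (M ℕ.<? j ℕ.+ k) * (c * f k)) ≡ c * ∑ j (λ i → f (suc (M ℕ.∸ j ℕ.+ i)))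
corner-row M j c f j≤M = trans (∑₁-ext M λ k _ _ → solve 3 (λ i c x → i :* (c :* x) := c :* (i :* x)) refl (𝟙 (M ℕ.<? j ℕ.+ k)) c (f k))
  (trans (∑₁-*ˡ M c (λ k → 𝟙 (M ℕ.<? j ℕ.+ k) * f k)) (cong (c *_) (∑₁-tail M j f j≤M)))

rcp*ι : ∀ j c → 1 ℕ.≤ j → rcp j * (ι j * c) ≡ c
rcp*ι j c 1≤j = trans (solve 3 (λ r j c → r :* (j :* c) := (j :* r) :* c) refl (rcp j) (ι j) c) (trans (cong (_* c) (ι*rcp 1≤j)) (ℚₚ.*-identityˡ c))

-- Row j consists of j terms with k > M - j, so it is at most 1/(j(M + 1 - j)). Partial fractions
-- split this into two harmonic sums.
κ₂₁≤ : ∀ M → κ₂₁ M ≤ rcp (suc M) * (H M + H M)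
κ₂₁≤ M = ≤-trans (∑₁-mono M row) (≤-reflexive total)
  where
  row : ∀ j → 1 ℕ.≤ j → j ℕ.≤ M → ∑₁ M (λ k → 𝟙 (M ℕ.<? j ℕ.+ k) * (rcp j * rcp j * rcp k)) ≤ rcp (suc M) * (rcp j + rcp (suc (M ℕ.∸ j)))
  row j 1≤j j≤M = subst₂ _≤_ (sym (corner-row M j (rcp j * rcp j) rcp j≤M)) eq
    (*-monoˡ (0≤p² (rcp j)) (subst (∑ j (λ i → rcp (suc (M ℕ.∸ j ℕ.+ i))) ≤_) (∑-const j (rcp (suc (M ℕ.∸ j))))
      (∑-mono j λ i _ → rcp-anti (s≤s z≤n) (s≤s (ℕₚ.m≤m+n (M ℕ.∸ j) i)))))
    where
    eq : rcp j * rcp j * (ι j * rcp (suc (M ℕ.∸ j))) ≡ rcp (suc M) * (rcp j + rcp (suc (M ℕ.∸ j)))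
    eq = trans (ℚₚ.*-assoc (rcp j) (rcp j) _) (trans (cong (rcp j *_) (rcp*ι j (rcp (suc (M ℕ.∸ j))) 1≤j))
      (trans (rcp-rcp j (suc (M ℕ.∸ j)) 1≤j (s≤s z≤n)) (cong (λ m → rcp m * (rcp j + rcp (suc (M ℕ.∸ j)))) (trans (ℕₚ.+-suc j (M ℕ.∸ j)) (cong suc (ℕₚ.m+[n∸m]≡n j≤M))))))
  total : ∑₁ M (λ j → rcp (suc M) * (rcp j + rcp (suc (M ℕ.∸ j)))) ≡ rcp (suc M) * (H M + H M)
  total = trans (∑₁-*ˡ M (rcp (suc M)) (λ j → rcp j + rcp (suc (M ℕ.∸ j)))) (cong (rcp (suc M) *_) (trans (∑₁-+ M rcp (λ j → rcp (suc (M ℕ.∸ j))))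
    (cong₂ _+_ (∑₁-∑ M rcp) (trans (∑₁-∑ M (λ j → rcp (suc (M ℕ.∸ j)))) (∑-reverse M (rcp ∘ suc))))))

-- Row j contains exactly j values of k, each with 1/k ≥ 1/M, so every row contributes at least 1/M.
1≤ζ′ : ∀ M → 1 ℕ.≤ M → 1ℚ ≤ ζ′ M
1≤ζ′ M 1≤M = subst (_≤ ζ′ M) (trans (∑₁-const M (rcp M)) (ι*rcp 1≤M)) (∑₁-mono M λ j 1≤j j≤M →
  subst₂ _≤_ (rcp*ι j (rcp M) 1≤j) (sym (corner-row M j (rcp j) rcp j≤M))
    (*-monoˡ (0≤rcp j) (subst (_≤ ∑ j (λ i → rcp (suc (M ℕ.∸ j ℕ.+ i)))) (∑-const j (rcp M)) (∑-mono j λ i i<j → rcp-anti (s≤s z≤n)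
      (ℕₚ.≤-trans (ℕₚ.≤-reflexive (sym (ℕₚ.+-suc (M ℕ.∸ j) i))) (ℕₚ.≤-trans (ℕₚ.+-monoʳ-≤ (M ℕ.∸ j) i<j) (ℕₚ.≤-reflexive (ℕₚ.m∸n+n≡m j≤M))))))))

-- By partial fractions and j + k ≥ M + 1, the term 1/(jk) is at most (1/j + 1/k)/(M + 1), and a row
-- with index j has j entries.
ζ′≤2 : ∀ M → ζ′ M ≤ 1ℚ + 1ℚ
ζ′≤2 M = begin
  ζ′ M
    ≤⟨ ∑₁-mono M (λ j 1≤j _ → ∑₁-mono M λ k 1≤k _ → bound j k 1≤j 1≤k) ⟩
  ∑₁ M (λ j → ∑₁ M (λ k → z * (𝟙 (M ℕ.<? j ℕ.+ k) * (rcp j * 1ℚ)) + z * (𝟙 (M ℕ.<? k ℕ.+ j) * (rcp k * 1ℚ))))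
    ≡⟨ trans (∑₁-ext M λ j _ _ → ∑₁-+ M _ _) (∑₁-+ M _ _) ⟩
  ∑₁ M (λ j → ∑₁ M (λ k → z * (𝟙 (M ℕ.<? j ℕ.+ k) * (rcp j * 1ℚ)))) + ∑₁ M (λ j → ∑₁ M (λ k → z * (𝟙 (M ℕ.<? k ℕ.+ j) * (rcp k * 1ℚ))))
    ≡⟨ cong (∑₁ M (λ j → ∑₁ M (λ k → z * (𝟙 (M ℕ.<? j ℕ.+ k) * (rcp j * 1ℚ)))) +_) (∑₁-swap M M (λ j k → z * (𝟙 (M ℕ.<? k ℕ.+ j) * (rcp k * 1ℚ)))) ⟩
  ∑₁ M (λ j → ∑₁ M (λ k → z * (𝟙 (M ℕ.<? j ℕ.+ k) * (rcp j * 1ℚ)))) + ∑₁ M (λ j → ∑₁ M (λ k → z * (𝟙 (M ℕ.<? j ℕ.+ k) * (rcp j * 1ℚ))))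
    ≤⟨ ℚₚ.+-mono-≤ half half ⟩
  1ℚ + 1ℚ ∎
  where
  open ℚₚ.≤-Reasoning
  z = rcp (suc M)
  bound : ∀ j k → 1 ℕ.≤ j → 1 ℕ.≤ k → 𝟙 (M ℕ.<? j ℕ.+ k) * (rcp j * rcp k) ≤
          z * (𝟙 (M ℕ.<? j ℕ.+ k) * (rcp j * 1ℚ)) + z * (𝟙 (M ℕ.<? k ℕ.+ j) * (rcp k * 1ℚ))
  bound j k 1≤j 1≤k = subst (𝟙 (M ℕ.<? j ℕ.+ k) * (rcp j * rcp k) ≤_)
    (trans (solve 4 (λ i z a b → i :* (z :* (a :+ b)) := z :* (i :* (a :* con 1ℚ)) :+ z :* (i :* (b :* con 1ℚ))) refl (𝟙 (M ℕ.<? j ℕ.+ k)) z (rcp j) (rcp k))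
      (cong (λ m → z * (𝟙 (M ℕ.<? j ℕ.+ k) * (rcp j * 1ℚ)) + z * (𝟙 (M ℕ.<? m) * (rcp k * 1ℚ))) (ℕₚ.+-comm j k)))
    go
    where
    go : 𝟙 (M ℕ.<? j ℕ.+ k) * (rcp j * rcp k) ≤ 𝟙 (M ℕ.<? j ℕ.+ k) * (z * (rcp j + rcp k))
    go with M ℕ.<? j ℕ.+ k
    ... | yes M<j+k = *-monoˡ 0≤1 (subst (_≤ z * (rcp j + rcp k)) (sym (rcp-rcp j k 1≤j 1≤k)) (*-monoʳ (0≤+ (0≤rcp j) (0≤rcp k)) (rcp-anti (s≤s z≤n) M<j+k)))
    ... | no _ = ≤-reflexive (trans (ℚₚ.*-zeroˡ (rcp j * rcp k)) (sym (ℚₚ.*-zeroˡ (z * (rcp j + rcp k)))))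
  half : ∑₁ M (λ j → ∑₁ M (λ k → z * (𝟙 (M ℕ.<? j ℕ.+ k) * (rcp j * 1ℚ)))) ≤ 1ℚ
  half = subst (_≤ 1ℚ) (sym (trans (∑₁-ext M λ j 1≤j j≤M → trans (∑₁-*ˡ M z (λ k → 𝟙 (M ℕ.<? j ℕ.+ k) * (rcp j * 1ℚ)))
      (cong (z *_) (trans (corner-row M j (rcp j) (λ _ → 1ℚ) j≤M) (trans (cong (rcp j *_) (∑-const j 1ℚ)) (rcp*ι j 1ℚ 1≤j)))))
      (trans (∑₁-const M (z * 1ℚ)) (solve 2 (λ m z → m :* (z :* con 1ℚ) := m :* z) refl (ι M) z))))
    (*rcp-≤ {suc M} (s≤s z≤n) (subst (ι M ≤_) (sym (ℚₚ.*-identityʳ (ι (suc M)))) (ι-mono (ℕₚ.n≤1+n M))))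

-- Null sequences (at the rate δ of the cotangent expansion)

δ : ℕ → ℚ
δ m = rcp (suc (suc m)) * (1ℚ + H (suc m))

0≤δ : ∀ m → 0ℚ ≤ δ m
0≤δ m = 0≤* (0≤rcp (suc (suc m))) (0≤+ 0≤1 (0≤H (suc m)))

Null Bounded : (ℕ → ℚ) → Set
Null x = ∃ λ C → ∀ m → ∣ x m ∣ ≤ C * δ m
Bounded x = ∃ λ C → ∀ m → ∣ x m ∣ ≤ C

Null-resp : ∀ {x y : ℕ → ℚ} → (∀ m → x m ≡ y m) → Null x → Null y
Null-resp e (C , bd) = C , λ m → subst (λ z → ∣ z ∣ ≤ C * δ m) (e m) (bd m)

Null-0 : Null (λ _ → 0ℚ)
Null-0 = 0ℚ , λ m → ≤-reflexive (sym (ℚₚ.*-zeroˡ (δ m)))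

Null-+ : ∀ {x y : ℕ → ℚ} → Null x → Null y → Null (λ m → x m + y m)
Null-+ {x} {y} (C , bx) (D , by) = C + D , λ m → subst (∣ x m + y m ∣ ≤_) (sym (ℚₚ.*-distribʳ-+ (δ m) C D)) (∣+∣≤ (bx m) (by m))

Null-neg : ∀ {x : ℕ → ℚ} → Null x → Null (λ m → - x m)
Null-neg {x} (C , bx) = C , λ m → subst (_≤ C * δ m) (sym (ℚₚ.∣-p∣≡∣p∣ (x m))) (bx m)

Null-* : ∀ {y x : ℕ → ℚ} → Bounded y → Null x → Null (λ m → y m * x m)
Null-* {y} {x} (B , by) (C , bx) = B * C , λ m → subst (∣ y m * x m ∣ ≤_) (sym (ℚₚ.*-assoc B C (δ m))) (∣*∣≤ (by m) (bx m))

Null-∑ : ∀ k {x : ℕ → ℕ → ℚ} → (∀ i → i ℕ.< k → Null (x i)) → Null (λ m → ∑ k (λ i → x i m))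
Null-∑ zero    nx = Null-0
Null-∑ (suc k) nx = Null-+ (Null-∑ k λ i i<k → nx i (ℕₚ.m<n⇒m<1+n i<k)) (nx k (ℕₚ.n<1+n k))

Bounded-const : ∀ c → Bounded (λ _ → c)
Bounded-const c = ∣ c ∣ , λ _ → ≤-refl

Bounded-+ : ∀ {x y : ℕ → ℚ} → Bounded x → Bounded y → Bounded (λ m → x m + y m)
Bounded-+ (C , bx) (D , by) = C + D , λ m → ∣+∣≤ (bx m) (by m)

Bounded-* : ∀ {x y : ℕ → ℚ} → Bounded x → Bounded y → Bounded (λ m → x m * y m)
Bounded-* (C , bx) (D , by) = C * D , λ m → ∣*∣≤ (bx m) (by m)

Bounded-neg : ∀ {x : ℕ → ℚ} → Bounded x → Bounded (λ m → - x m)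
Bounded-neg {x} (C , bx) = C , λ m → subst (_≤ C) (sym (ℚₚ.∣-p∣≡∣p∣ (x m))) (bx m)

rcp≤2δ : ∀ m → rcp (suc m) ≤ (1ℚ + 1ℚ) * δ m
rcp≤2δ m = ≤-trans (subst (_≤ (1ℚ + 1ℚ) * rcp (suc (suc m))) (ℚₚ.*-identityˡ (rcp (suc m))) (*rcp-≤ {suc m} (s≤s z≤n)
    (subst (1ℚ ≤_) (solve 3 (λ m r t → (con 1ℚ :+ (con 1ℚ :+ m)) :* r :+ m :* r := (con 1ℚ :+ m) :* ((con 1ℚ :+ con 1ℚ) :* r)) refl (ι m) (rcp (suc (suc m))) 1ℚ)
      (≤-by (ι m * rcp (suc (suc m))) (0≤* (0≤ι m) (0≤rcp (suc (suc m)))) (cong (_+ ι m * rcp (suc (suc m))) (ι*rcp {suc (suc m)} (s≤s z≤n)))))))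
  (*-monoˡ (0≤+ 0≤1 0≤1) (subst (_≤ δ m) (ℚₚ.*-identityʳ (rcp (suc (suc m)))) (*-monoˡ (0≤rcp (suc (suc m))) (≤-by (H (suc m)) (0≤H (suc m)) refl))))

∑rcp²≤2 : ∀ M → ∑ (suc M) (λ i → rcp (suc i) * rcp (suc i)) ≤ (1ℚ + 1ℚ) - rcp (suc M)
∑rcp²≤2 zero    = ≤-reflexive (cong (λ r → 0ℚ + r * r) rcp1 ⟨trans⟩ cong (λ r → 1ℚ + 1ℚ - r) (sym rcp1))
  where
  _⟨trans⟩_ = trans
  rcp1 : rcp 1 ≡ 1ℚ
  rcp1 = sym (rcp-unique {1} {1ℚ} refl)
∑rcp²≤2 (suc M) = ≤-trans (ℚₚ.+-mono-≤ (∑rcp²≤2 M) (*-monoʳ (0≤rcp s) (rcp-anti (s≤s z≤n) (ℕₚ.n≤1+n t))))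
  (≤-reflexive (trans (cong (λ x → 1ℚ + 1ℚ - rcp t + x) telescope) (solve 3 (λ c x y → c :- x :+ (x :- y) := c :- y) refl (1ℚ + 1ℚ) (rcp t) (rcp s))))
  where
  t = suc M
  s = suc t
  telescope : rcp t * rcp s ≡ rcp t - rcp s
  telescope = sym (trans (cong₂ _-_ (trans (sym (ℚₚ.*-identityʳ (rcp t))) (cong (rcp t *_) (sym (ι*rcp {s} (s≤s z≤n))))) (trans (sym (ℚₚ.*-identityʳ (rcp s))) (cong (rcp s *_) (sym (ι*rcp {t} (s≤s z≤n))))))
    (solve 3 (λ x y t → x :* ((con 1ℚ :+ t) :* y) :- y :* (t :* x) := x :* y) refl (rcp t) (rcp s) (ι t)))

-- h M a is the symmetric partial sum of ∑_j 1/(a + nj), that is, of (π/n) cot(πa/n).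
module Cotangent (n : ℕ) (1≤n : 1 ℕ.≤ n) where

  den : ℤ → ℤ → ℤ
  den a j = a ℤ.+ ℤ.+ n ℤ.* j

  opaque
    P : ℤ → ℤ → ℚ
    P a j = inv (ιℤ (den a j))

    P-unique : ∀ a j {p} → ιℤ (den a j) * p ≡ 1ℚ → p ≡ P a j
    P-unique a j = inv-unique {ιℤ (den a j)}

    P-inv : ∀ a j → den a j ≢ ℤ.+ 0 → ιℤ (den a j) * P a j ≡ 1ℚ
    P-inv a j d≢0 = *-inv (ιℤ≢0 d≢0)

  h : ℕ → ℤ → ℚ
  h M a = ∑± M (P a)

  Reg : ℤ → Set
  Reg a = ¬ (n ∣ ℤ.∣ a ∣)

  Reg-neg : ∀ a → Reg a → Reg (ℤ.- a)
  Reg-neg a ra n∣a = ra (subst (n ∣_) (ℤₚ.∣-i∣≡∣i∣ a) n∣a)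

  den≢0 : ∀ a j → Reg a → den a j ≢ ℤ.+ 0
  den≢0 a j ra e = ra (subst (n ∣_) (sym eq) (ℕ∣.m∣m*n ℤ.∣ j ∣))
    where
    eq : ℤ.∣ a ∣ ≡ n ℕ.* ℤ.∣ j ∣
    eq = trans (cong ℤ.∣_∣ (trans (solveℤ 2 (λ a x → a ≐ (a ⊞ x) ⊞ ⊟ x) refl a (ℤ.+ n ℤ.* j)) (trans (cong (λ z → z ℤ.+ ℤ.- (ℤ.+ n ℤ.* j)) e) (ℤₚ.+-identityˡ (ℤ.- (ℤ.+ n ℤ.* j))))))
      (trans (ℤₚ.∣-i∣≡∣i∣ (ℤ.+ n ℤ.* j)) (ℤₚ.∣i*j∣≡∣i∣*∣j∣ (ℤ.+ n) j))

  P-neg : ∀ a j → Reg a → P (ℤ.- a) (ℤ.- j) ≡ - P a j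
  P-neg a j ra = sym (P-unique (ℤ.- a) (ℤ.- j) (begin
    ιℤ (den (ℤ.- a) (ℤ.- j)) * (- P a j)
      ≡⟨ cong (λ z → ιℤ z * (- P a j)) (solveℤ 3 (λ a n j → (⊟ a) ⊞ n ⊡ (⊟ j) ≐ ⊟ (a ⊞ n ⊡ j)) refl a (ℤ.+ n) j) ⟩
    ιℤ (ℤ.- den a j) * (- P a j)
      ≡⟨ cong (_* (- P a j)) (ιℤ-neg (den a j)) ⟩
    (- ιℤ (den a j)) * (- P a j)
      ≡⟨ solve 2 (λ x y → (:- x) :* (:- y) := x :* y) refl (ιℤ (den a j)) (P a j) ⟩
    ιℤ (den a j) * P a j
      ≡⟨ P-inv a j (den≢0 a j ra) ⟩
    1ℚ ∎))
    where open ≡-Reasoning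

  h-neg : ∀ M a → Reg a → h M (ℤ.- a) ≡ - h M a
  h-neg M a ra = trans (sym (∑±-neg M (P (ℤ.- a)))) (trans (∑±-ext M λ t → trans (P-neg a t ra) (solve 1 (λ x → :- x := con (- 1ℚ) :* x) refl (P a t)))
    (trans (∑±-*ˡ M (- 1ℚ) (P a)) (solve 1 (λ x → con (- 1ℚ) :* x := :- x) refl (h M a))))

  opaque
    unfolding P
    P-shift : ∀ a j → P (a ℤ.+ ℤ.+ n) j ≡ P a (j ℤ.+ ℤ.+ 1)
    P-shift a j = cong (λ z → inv (ιℤ z)) (solveℤ 3 (λ a n j → a ⊞ n ⊞ n ⊡ j ≐ a ⊞ n ⊡ (j ⊞ κℤ (ℤ.+ 1))) refl a (ℤ.+ n) j)

  A : ℤ → ℕ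
  A a = ℤ.∣ a ∣ ℕ.+ ℤ.∣ a ∣

  -- For large |j| the summand nj dominates `a`; for small |j| it is enough that the denominator is
  -- a nonzero integer. The factor 2|a| covers both cases.
  ∣j∣≤A∣den∣ : ∀ a j → Reg a → ℤ.∣ j ∣ ℕ.≤ A a ℕ.* ℤ.∣ den a j ∣
  ∣j∣≤A∣den∣ a j ra with ℤ.∣ j ∣ ℕ.≤? A a
  ... | yes j≤A = ℕₚ.≤-trans j≤A (ℕₚ.m≤m*n (A a) D {{ℕ.>-nonZero 1≤D}})
    where
    D = ℤ.∣ den a j ∣
    1≤D : 1 ℕ.≤ D
    1≤D = ℕₚ.n≢0⇒n>0 (den≢0 a j ra ∘ ℤₚ.∣i∣≡0⇒i≡0 {den a j})
  ... | no j≰A = ℕₚ.+-cancelʳ-≤ k k (A a ℕ.* D) (ℕₚ.≤-trans 2k≤ (ℕₚ.≤-trans (ℕₚ.+-monoʳ-≤ (D ℕ.+ D) (ℕₚ.<⇒≤ (ℕₚ.≰⇒> j≰A)))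
      (ℕₚ.+-monoˡ-≤ k (subst₂ ℕ._≤_ (cong (D ℕ.+_) (ℕₚ.+-identityʳ D)) refl (ℕₚ.*-monoˡ-≤ D 2≤A)))))
    where
    D = ℤ.∣ den a j ∣
    k = ℤ.∣ j ∣
    1≤a : 1 ℕ.≤ ℤ.∣ a ∣
    1≤a = ℕₚ.n≢0⇒n>0 λ e → ra (subst (n ∣_) (sym e) (n ℕ∣.∣0))
    2≤A : 2 ℕ.≤ A a
    2≤A = ℕₚ.+-mono-≤ 1≤a 1≤a
    k≤ : k ℕ.≤ D ℕ.+ ℤ.∣ a ∣
    k≤ = ℕₚ.≤-trans (m≤d*m k 1≤n) (subst (ℕ._≤ D ℕ.+ ℤ.∣ a ∣) (ℤₚ.∣i*j∣≡∣i∣*∣j∣ (ℤ.+ n) j)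
      (ℕₚ.≤-trans (ℕₚ.≤-reflexive (cong ℤ.∣_∣ (solveℤ 2 (λ a x → x ≐ (a ⊞ x) ⊞ ⊟ a) refl a (ℤ.+ n ℤ.* j))))
        (ℕₚ.≤-trans (ℤₚ.∣i+j∣≤∣i∣+∣j∣ (den a j) (ℤ.- a)) (ℕₚ.≤-reflexive (cong (D ℕ.+_) (ℤₚ.∣-i∣≡∣i∣ a))))))
    2k≤ : k ℕ.+ k ℕ.≤ D ℕ.+ D ℕ.+ A a
    2k≤ = ℕₚ.≤-trans (ℕₚ.+-mono-≤ k≤ k≤) (ℕₚ.≤-reflexive (interchange D ℤ.∣ a ∣))
      where
      interchange : ∀ d a → d ℕ.+ a ℕ.+ (d ℕ.+ a) ≡ d ℕ.+ d ℕ.+ (a ℕ.+ a)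
      interchange d a = trans (ℕₚ.+-assoc d a (d ℕ.+ a)) (trans (cong (d ℕ.+_) (trans (sym (ℕₚ.+-assoc a d a)) (trans (cong (ℕ._+ a) (ℕₚ.+-comm a d)) (ℕₚ.+-assoc d a a)))) (sym (ℕₚ.+-assoc d d (a ℕ.+ a))))

  P-bound : ∀ a j → Reg a → ι ℤ.∣ j ∣ * ∣ P a j ∣ ≤ ι (A a)
  P-bound a j ra = subst (ι ℤ.∣ j ∣ * ∣ P a j ∣ ≤_) eq (*-monoʳ (ℚₚ.0≤∣p∣ (P a j)) (ι-mono (∣j∣≤A∣den∣ a j ra)))
    where
    open ≡-Reasoning
    eq : ι (A a ℕ.* ℤ.∣ den a j ∣) * ∣ P a j ∣ ≡ ι (A a)
    eq = begin
      ι (A a ℕ.* ℤ.∣ den a j ∣) * ∣ P a j ∣       ≡⟨ cong (_* ∣ P a j ∣) (ι-* (A a) ℤ.∣ den a j ∣) ⟩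
      ι (A a) * ι ℤ.∣ den a j ∣ * ∣ P a j ∣       ≡⟨ ℚₚ.*-assoc (ι (A a)) _ _ ⟩
      ι (A a) * (ι ℤ.∣ den a j ∣ * ∣ P a j ∣)     ≡⟨ cong (λ z → ι (A a) * (z * ∣ P a j ∣)) (sym (∣ιℤ∣ (den a j))) ⟩
      ι (A a) * (∣ ιℤ (den a j) ∣ * ∣ P a j ∣)    ≡⟨ cong (ι (A a) *_) (trans (sym (ℚₚ.∣p*q∣≡∣p∣*∣q∣ (ιℤ (den a j)) (P a j))) (cong ∣_∣ (P-inv a j (den≢0 a j ra)))) ⟩
      ι (A a) * 1ℚ                                ≡⟨ ℚₚ.*-identityʳ (ι (A a)) ⟩
      ι (A a)                                     ∎

  ∣P⁺∣≤ : ∀ a j → Reg a → 1 ℕ.≤ j → ∣ P a (ℤ.+ j) ∣ ≤ ι (A a) * rcp j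
  ∣P⁺∣≤ a j ra 1≤j = ≤-*rcp 1≤j (P-bound a (ℤ.+ j) ra)

  ∣P⁻∣≤ : ∀ a j → Reg a → 1 ℕ.≤ j → ∣ P a (ℤ.- (ℤ.+ j)) ∣ ≤ ι (A a) * rcp j
  ∣P⁻∣≤ a j ra 1≤j = ≤-*rcp 1≤j (subst (λ m → ι m * ∣ P a (ℤ.- (ℤ.+ j)) ∣ ≤ ι (A a)) (ℤₚ.∣-i∣≡∣i∣ (ℤ.+ j)) (P-bound a (ℤ.- (ℤ.+ j)) ra))

  rn : ℕ → ℚ
  rn j = rcp (n ℕ.* j)

  rn≤ : ∀ j → 1 ℕ.≤ j → rn j ≤ rcp j
  rn≤ j 1≤j = rcp-anti 1≤j (m≤d*m j 1≤n)

  c : ℤ → ℚ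
  c a = ι ℤ.∣ a ∣ * ι (A a)

  0≤c : ∀ a → 0ℚ ≤ c a
  0≤c a = 0≤* (0≤ι ℤ.∣ a ∣) (0≤ι (A a))

  -- The difference of 1/(a + nj) and 1/(nj) is -a times the product of the two.
  P⁺-approx : ∀ a j → Reg a → 1 ℕ.≤ j → ∣ P a (ℤ.+ j) - rn j ∣ ≤ c a * (rcp j * rcp j)
  P⁺-approx a j ra 1≤j = subst₂ (λ x y → ∣ x ∣ ≤ y) (sym eq)
    (solve 4 (λ a b r s → a :* (b :* r) :* r := a :* b :* (r :* r)) refl (ι ℤ.∣ a ∣) (ι (A a)) (rcp j) 1ℚ)
    (∣*∣≤ {ιℤ (ℤ.- a) * p} (∣*∣≤ (≤-reflexive (trans (∣ιℤ∣ (ℤ.- a)) (cong ι (ℤₚ.∣-i∣≡∣i∣ a)))) (∣P⁺∣≤ a j ra 1≤j))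
      (subst (_≤ rcp j) (sym (∣rcp∣ (n ℕ.* j))) (rn≤ j 1≤j)))
    where
    open ≡-Reasoning
    p = P a (ℤ.+ j)
    x = ιℤ (den a (ℤ.+ j))
    nj = ι (n ℕ.* j)
    x≡ : x ≡ ιℤ a + nj
    x≡ = trans (ιℤ-+ a (ℤ.+ n ℤ.* ℤ.+ j)) (cong (λ z → ιℤ a + ιℤ z) (sym (ℤₚ.pos-* n j)))
    eq : p - rn j ≡ ιℤ (ℤ.- a) * p * rn j
    eq = begin
      p - rn j
        ≡⟨ cong₂ _-_ (trans (sym (ℚₚ.*-identityʳ p)) (cong (p *_) (sym (ι*rcp (ℕₚ.*-mono-≤ 1≤n 1≤j))))) (trans (sym (ℚₚ.*-identityˡ (rn j))) (cong (_* rn j) (sym (P-inv a (ℤ.+ j) (den≢0 a (ℤ.+ j) ra))))) ⟩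
      p * (nj * rn j) - x * p * rn j
        ≡⟨ cong (λ z → p * (nj * rn j) - z * p * rn j) x≡ ⟩
      p * (nj * rn j) - (ιℤ a + nj) * p * rn j
        ≡⟨ solve 4 (λ p m r a → p :* (m :* r) :- (a :+ m) :* p :* r := (:- a) :* p :* r) refl p nj (rn j) (ιℤ a) ⟩
      (- ιℤ a) * p * rn j
        ≡⟨ cong (λ z → z * p * rn j) (sym (ιℤ-neg a)) ⟩
      ιℤ (ℤ.- a) * p * rn j ∎

  P⁻-approx : ∀ a j → Reg a → 1 ℕ.≤ j → ∣ P a (ℤ.- (ℤ.+ j)) + rn j ∣ ≤ c a * (rcp j * rcp j)
  P⁻-approx a j ra 1≤j = subst₂ _≤_ eq (cong (λ m → ι m * ι (m ℕ.+ m) * (rcp j * rcp j)) (ℤₚ.∣-i∣≡∣i∣ a)) (P⁺-approx (ℤ.- a) j (Reg-neg a ra) 1≤j)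
    where
    eq : ∣ P (ℤ.- a) (ℤ.+ j) - rn j ∣ ≡ ∣ P a (ℤ.- (ℤ.+ j)) + rn j ∣
    eq = trans (sym (ℚₚ.∣-p∣≡∣p∣ (P (ℤ.- a) (ℤ.+ j) - rn j))) (cong ∣_∣ (trans (solve 2 (λ x r → :- (x :- r) := :- x :+ r) refl (P (ℤ.- a) (ℤ.+ j)) (rn j))
      (cong (_+ rn j) (trans (sym (P-neg (ℤ.- a) (ℤ.+ j) (Reg-neg a ra))) (cong (λ z → P z (ℤ.- (ℤ.+ j))) (ℤₚ.neg-involutive a))))))

  -- Passing from a to a + n moves the window of summation by one step, so only two end terms
  -- change, each of order 1/m.
  h-shift : ∀ a → Reg a → Null (λ m → h (suc m) (a ℤ.+ ℤ.+ n) - h (suc m) a)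
  h-shift a ra = ι (A a) * (1ℚ + 1ℚ) + ι (A a) * (1ℚ + 1ℚ) , λ m → subst₂ (λ x y → ∣ x ∣ ≤ y)
    (sym (trans (cong (_- h (suc m) a) (trans (∑±-ext (suc m) (P-shift a)) (∑±-shift (suc m) (P a))))
      (solve 3 (λ h x y → h :+ (x :- y) :- h := x :- y) refl (h (suc m) a) (P a (ℤ.+ suc (suc m))) (P a (ℤ.- (ℤ.+ suc m))))))
    (solve 2 (λ a d → a :* ((con 1ℚ :+ con 1ℚ) :* d) :+ a :* ((con 1ℚ :+ con 1ℚ) :* d) := (a :* (con 1ℚ :+ con 1ℚ) :+ a :* (con 1ℚ :+ con 1ℚ)) :* d) refl (ι (A a)) (δ m))
    (∣-∣≤ (≤-trans (∣P⁺∣≤ a (suc (suc m)) ra (s≤s z≤n)) (*-monoˡ (0≤ι (A a)) (≤-trans (rcp-anti (s≤s z≤n) (ℕₚ.n≤1+n (suc m))) (rcp≤2δ m))))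
          (≤-trans (∣P⁻∣≤ a (suc m) ra (s≤s z≤n)) (*-monoˡ (0≤ι (A a)) (rcp≤2δ m))))

  -- The terms at j and -j cancel up to order 1/j².
  h-bounded : ∀ a → Reg a → Bounded (λ m → h (suc m) a)
  h-bounded a ra = ∣ P a (ℤ.+ 0) ∣ + (c a + c a) * (1ℚ + 1ℚ) , λ m → subst (λ x → ∣ x ∣ ≤ ∣ P a (ℤ.+ 0) ∣ + (c a + c a) * (1ℚ + 1ℚ)) (sym (∑±-expand (suc m) (P a)))
    (∣+∣≤ {P a (ℤ.+ 0)} ≤-refl (≤-trans (∣∑₁∣≤ (suc m) λ j 1≤j _ → subst₂ (λ x y → ∣ x ∣ ≤ y)
        (solve 3 (λ x y r → x :- r :+ (y :+ r) := x :+ y) refl (P a (ℤ.+ j)) (P a (ℤ.- (ℤ.+ j))) (rn j))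
        (sym (ℚₚ.*-distribʳ-+ (rcp j * rcp j) (c a) (c a)))
        (∣+∣≤ (P⁺-approx a j ra 1≤j) (P⁻-approx a j ra 1≤j)))
      (subst (_≤ (c a + c a) * (1ℚ + 1ℚ)) (sym (∑₁-*ˡ (suc m) (c a + c a) (λ j → rcp j * rcp j)))
        (*-monoˡ (0≤+ (0≤c a) (0≤c a)) (subst (_≤ 1ℚ + 1ℚ) (sym (∑₁-∑ (suc m) (λ j → rcp j * rcp j))) (≤-trans (∑rcp²≤2 m)
          (≤-by (rcp (suc m)) (0≤rcp (suc m)) (solve 1 (λ r → con 1ℚ :+ con 1ℚ := con 1ℚ :+ con 1ℚ :- r :+ r) refl (rcp (suc m)))))))))) 

  -- In each corner both indices have the same sign, so replacing the factors by ±1/(nj) and ±1/(nk)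
  -- gives 1/(n²jk) twice. The errors of relative order 1/j and 1/k add up to multiples of `κ₂₁`.
  corner-approx : ∀ M a b → Reg a → Reg b →
    ∣ corner M (P a) (P b) - (1ℚ + 1ℚ) * (rcp n * rcp n) * ζ′ M ∣ ≤ (c a * ι (A b) + c b) * (1ℚ + 1ℚ) * (κ₂₁ M + κ₂₁ M)
  corner-approx M a b ra rb = subst₂ (λ x y → ∣ x ∣ ≤ y) (sym eq) eq′ (∣∑₁∣≤ M λ j 1≤j _ → ∣∑₁∣≤ M λ k 1≤k _ → term j k 1≤j 1≤k)
    where
    open ≡-Reasoning
    C₀ = c a * ι (A b) + c b
    I : ℕ → ℕ → ℚ
    I j k = 𝟙 (M ℕ.<? j ℕ.+ k)
    p q : ℤ → ℚ
    p = P a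
    q = P b
    X : ℕ → ℕ → ℚ
    X j k = (p (ℤ.+ j) * q (ℤ.+ k) - rn j * rn k) + (p (ℤ.- (ℤ.+ j)) * q (ℤ.- (ℤ.+ k)) - rn j * rn k)
    B : ℕ → ℕ → ℚ
    B j k = rcp j * rcp j * rcp k + rcp k * rcp k * rcp j
    eq : corner M p q - (1ℚ + 1ℚ) * (rcp n * rcp n) * ζ′ M ≡ ∑₁ M (λ j → ∑₁ M (λ k → I j k * X j k))
    eq = begin
      corner M p q - (1ℚ + 1ℚ) * (rcp n * rcp n) * ζ′ M
        ≡⟨ solve 2 (λ x y → x :- y := x :+ con (- 1ℚ) :* y) refl (corner M p q) ((1ℚ + 1ℚ) * (rcp n * rcp n) * ζ′ M) ⟩
      corner M p q + - 1ℚ * ((1ℚ + 1ℚ) * (rcp n * rcp n) * ζ′ M)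
        ≡⟨ cong (corner M p q +_) (trans (sym (ℚₚ.*-assoc (- 1ℚ) ((1ℚ + 1ℚ) * (rcp n * rcp n)) (ζ′ M)))
             (trans (sym (∑₁-*ˡ M z _)) (∑₁-ext M λ j _ _ → sym (∑₁-*ˡ M z _)))) ⟩
      corner M p q + ∑₁ M (λ j → ∑₁ M (λ k → z * (I j k * (rcp j * rcp k))))
        ≡⟨ trans (sym (∑₁-+ M _ _)) (∑₁-ext M λ j 1≤j _ → trans (sym (∑₁-+ M _ _)) (∑₁-ext M λ k 1≤k _ → pointwise j k 1≤j 1≤k)) ⟩
      ∑₁ M (λ j → ∑₁ M (λ k → I j k * X j k)) ∎
      where
      z = - 1ℚ * ((1ℚ + 1ℚ) * (rcp n * rcp n))
      pointwise : ∀ j k → 1 ℕ.≤ j → 1 ℕ.≤ k →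
        I j k * (p (ℤ.+ j) * q (ℤ.+ k) + p (ℤ.- (ℤ.+ j)) * q (ℤ.- (ℤ.+ k))) + z * (I j k * (rcp j * rcp k)) ≡ I j k * X j k
      pointwise j k 1≤j 1≤k = trans
        (solve 6 (λ i u v r x y → i :* (u :+ v) :+ con (- 1ℚ) :* ((con 1ℚ :+ con 1ℚ) :* (r :* r)) :* (i :* (x :* y)) := i :* ((u :- (r :* x) :* (r :* y)) :+ (v :- (r :* x) :* (r :* y)))) refl
          (I j k) (p (ℤ.+ j) * q (ℤ.+ k)) (p (ℤ.- (ℤ.+ j)) * q (ℤ.- (ℤ.+ k))) (rcp n) (rcp j) (rcp k))
        (cong₂ (λ x y → I j k * ((p (ℤ.+ j) * q (ℤ.+ k) - x * y) + (p (ℤ.- (ℤ.+ j)) * q (ℤ.- (ℤ.+ k)) - x * y))) (sym (rcp-* n j 1≤n 1≤j)) (sym (rcp-* n k 1≤n 1≤k)))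
    product : ∀ j k x y r s → 1 ℕ.≤ j → 1 ℕ.≤ k → ∣ x - r ∣ ≤ c a * (rcp j * rcp j) → ∣ y - s ∣ ≤ c b * (rcp k * rcp k) →
              ∣ y ∣ ≤ ι (A b) * rcp k → ∣ r ∣ ≤ rcp j → ∣ x * y - r * s ∣ ≤ C₀ * B j k
    product j k x y r s 1≤j 1≤k dx dy by br = ≤-trans (subst (λ u → ∣ u ∣ ≤ c a * (rcp j * rcp j) * (ι (A b) * rcp k) + rcp j * (c b * (rcp k * rcp k)))
        (solve 4 (λ x y r s → (x :- r) :* y :+ r :* (y :- s) := x :* y :- r :* s) refl x y r s) (∣+∣≤ (∣*∣≤ {x - r} dx by) (∣*∣≤ br dy)))
      (≤-by (c b * (rcp j * rcp j * rcp k) + c a * ι (A b) * (rcp k * rcp k * rcp j))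
        (0≤+ (0≤* (0≤c b) (0≤* (0≤p² (rcp j)) (0≤rcp k))) (0≤* (0≤* (0≤c a) (0≤ι (A b))) (0≤* (0≤p² (rcp k)) (0≤rcp j))))
        (solve 5 (λ ca ab cb x y → (ca :* ab :+ cb) :* (x :* x :* y :+ y :* y :* x) := ca :* (x :* x) :* (ab :* y) :+ x :* (cb :* (y :* y)) :+ (cb :* (x :* x :* y) :+ ca :* ab :* (y :* y :* x))) refl
          (c a) (ι (A b)) (c b) (rcp j) (rcp k)))
    term : ∀ j k → 1 ℕ.≤ j → 1 ℕ.≤ k → ∣ I j k * X j k ∣ ≤ I j k * (C₀ * B j k + C₀ * B j k)
    term j k 1≤j 1≤k = ∣*∣≤ {I j k} (≤-reflexive (ℚₚ.0≤p⇒∣p∣≡p (0≤𝟙 (M ℕ.<? j ℕ.+ k)))) (∣+∣≤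
      (product j k (p (ℤ.+ j)) (q (ℤ.+ k)) (rn j) (rn k) 1≤j 1≤k (P⁺-approx a j ra 1≤j) (P⁺-approx b k rb 1≤k) (∣P⁺∣≤ b k rb 1≤k)
        (subst (_≤ rcp j) (sym (∣rcp∣ (n ℕ.* j))) (rn≤ j 1≤j)))
      (subst (λ u → ∣ p (ℤ.- (ℤ.+ j)) * q (ℤ.- (ℤ.+ k)) - u ∣ ≤ C₀ * B j k) (solve 2 (λ r s → (:- r) :* (:- s) := r :* s) refl (rn j) (rn k))
        (product j k (p (ℤ.- (ℤ.+ j))) (q (ℤ.- (ℤ.+ k))) (- rn j) (- rn k) 1≤j 1≤k
          (subst (λ u → ∣ p (ℤ.- (ℤ.+ j)) + u ∣ ≤ c a * (rcp j * rcp j)) (solve 1 (λ r → r := :- (:- r)) refl (rn j)) (P⁻-approx a j ra 1≤j))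
          (subst (λ u → ∣ q (ℤ.- (ℤ.+ k)) + u ∣ ≤ c b * (rcp k * rcp k)) (solve 1 (λ r → r := :- (:- r)) refl (rn k)) (P⁻-approx b k rb 1≤k))
          (∣P⁻∣≤ b k rb 1≤k) (subst (_≤ rcp j) (sym (trans (ℚₚ.∣-p∣≡∣p∣ (rn j)) (∣rcp∣ (n ℕ.* j)))) (rn≤ j 1≤j)))))
    eq′ : ∑₁ M (λ j → ∑₁ M (λ k → I j k * (C₀ * B j k + C₀ * B j k))) ≡ C₀ * (1ℚ + 1ℚ) * (κ₂₁ M + κ₂₁ M)
    eq′ = begin
      ∑₁ M (λ j → ∑₁ M (λ k → I j k * (C₀ * B j k + C₀ * B j k)))
        ≡⟨ ∑₁-ext M (λ j _ _ → trans (∑₁-ext M λ k _ _ → solve 4 (λ i c u v → i :* (c :* (u :+ v) :+ c :* (u :+ v)) := c :* (con 1ℚ :+ con 1ℚ) :* (i :* u :+ i :* v)) refl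
               (I j k) C₀ (rcp j * rcp j * rcp k) (rcp k * rcp k * rcp j)) (∑₁-*ˡ M (C₀ * (1ℚ + 1ℚ)) _)) ⟩
      ∑₁ M (λ j → C₀ * (1ℚ + 1ℚ) * ∑₁ M (λ k → I j k * (rcp j * rcp j * rcp k) + I j k * (rcp k * rcp k * rcp j)))
        ≡⟨ ∑₁-*ˡ M (C₀ * (1ℚ + 1ℚ)) _ ⟩
      C₀ * (1ℚ + 1ℚ) * ∑₁ M (λ j → ∑₁ M (λ k → I j k * (rcp j * rcp j * rcp k) + I j k * (rcp k * rcp k * rcp j)))
        ≡⟨ cong (C₀ * (1ℚ + 1ℚ) *_) (trans (trans (∑₁-ext M λ j _ _ → ∑₁-+ M (λ k → I j k * (rcp j * rcp j * rcp k)) (λ k → I j k * (rcp k * rcp k * rcp j))) (∑₁-+ M _ _))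
             (cong (κ₂₁ M +_) (trans (∑₁-swap M M (λ j k → I j k * (rcp k * rcp k * rcp j))) (∑₁-ext M λ k _ _ → ∑₁-ext M λ j _ _ →
               cong (λ m → 𝟙 (M ℕ.<? m) * (rcp k * rcp k * rcp j)) (ℕₚ.+-comm j k))))) ⟩
      C₀ * (1ℚ + 1ℚ) * (κ₂₁ M + κ₂₁ M) ∎

  -- Approximates (π/n)²: three products of cotangents, each with corners worth 2ζ′/n², where ζ′
  -- tends to π²/6.
  qₙ : ℕ → ℚ
  qₙ m = (1ℚ + 1ℚ + 1ℚ) * ((1ℚ + 1ℚ) * (rcp n * rcp n) * ζ′ (suc m))

  corner-null : ∀ a b → Reg a → Reg b → Null (λ m → corner (suc m) (P a) (P b) - (1ℚ + 1ℚ) * (rcp n * rcp n) * ζ′ (suc m))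
  corner-null a b ra rb = C′ * (1ℚ + 1ℚ + (1ℚ + 1ℚ)) , λ m → ≤-trans (corner-approx (suc m) a b ra rb)
    (≤-trans (*-monoˡ 0≤C′ (≤-trans (ℚₚ.+-mono-≤ (κ≤ m) (κ≤ m)) (≤-reflexive (sym (ℚₚ.*-distribʳ-+ (δ m) (1ℚ + 1ℚ) (1ℚ + 1ℚ)))))) (≤-reflexive (sym (ℚₚ.*-assoc C′ (1ℚ + 1ℚ + (1ℚ + 1ℚ)) (δ m)))))
    where
    C′ = (c a * ι (A b) + c b) * (1ℚ + 1ℚ)
    0≤C′ : 0ℚ ≤ C′
    0≤C′ = 0≤* (0≤+ (0≤* (0≤c a) (0≤ι (A b))) (0≤c b)) (0≤+ 0≤1 0≤1)
    κ≤ : ∀ m → κ₂₁ (suc m) ≤ (1ℚ + 1ℚ) * δ m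
    κ≤ m = ≤-trans (κ₂₁≤ (suc m)) (≤-by (rcp (suc (suc m)) * (1ℚ + 1ℚ)) (0≤* (0≤rcp (suc (suc m))) (0≤+ 0≤1 0≤1))
      (solve 2 (λ r h → (con 1ℚ :+ con 1ℚ) :* (r :* (con 1ℚ :+ h)) := r :* (h :+ h) :+ r :* (con 1ℚ :+ con 1ℚ)) refl (rcp (suc (suc m))) (H (suc m))))

-- The addition law of the cotangent, and the sine and cosine built from it.

module Addition (n : ℕ) (1≤n : 1 ℕ.≤ n) where
  open Cotangent n 1≤n

  private
    instance
      _ = ℕ.>-nonZero 1≤n

    𝕀 : ℤ → ℤ → ℤ → ℚ
    𝕀 t u w = 𝟙 (t ℤ.+ u ℤ.+ w ℤ.≟ ℤ.+ 0)

    𝕀-rotate : ∀ t u w → 𝕀 u w t ≡ 𝕀 t u w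
    𝕀-rotate t u w = cong (λ z → 𝟙 (z ℤ.≟ ℤ.+ 0)) (solveℤ 3 (λ t u w → u ⊞ w ⊞ t ≐ t ⊞ u ⊞ w) refl t u w)

    hexagon : ℕ → (ℤ → ℤ → ℤ → ℚ) → ℚ
    hexagon M f = ∑± M (λ t → ∑± M (λ u → ∑± M (λ w → 𝕀 t u w * f t u w)))

    hex : ℕ → (ℤ → ℚ) → (ℤ → ℚ) → ℚ
    hex M φ ψ = ∑± M (λ t → ∑± M (λ u → ∑± M (λ w → 𝕀 t u w) * (φ t * ψ u)))

    -- `hex₁`, `hex₂` and `hex₃` read one hexagon with (t, u), (u, w) and (w, t) as the pair
    -- carrying the functions, so that the three products can be added termwise.
    hex₁ : ∀ M φ ψ → hex M φ ψ ≡ hexagon M (λ t u w → φ t * ψ u)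
    hex₁ M φ ψ = ∑±-ext M λ t → ∑±-ext M λ u → sym (∑±-*ʳ M (φ t * ψ u) (𝕀 t u))

    hex₂ : ∀ M φ ψ → hex M φ ψ ≡ hexagon M (λ t u w → φ u * ψ w)
    hex₂ M φ ψ = trans (hex₁ M φ ψ) (trans (∑±-ext M λ u → ∑±-swap M (λ w t → 𝕀 u w t * (φ u * ψ w)))
      (trans (∑±-swap M (λ u t → ∑± M (λ w → 𝕀 u w t * (φ u * ψ w)))) (∑±-ext M λ t → ∑±-ext M λ u → ∑±-ext M λ w → cong (_* (φ u * ψ w)) (𝕀-rotate t u w))))

    hex₃ : ∀ M φ ψ → hex M φ ψ ≡ hexagon M (λ t u w → φ w * ψ t)
    hex₃ M φ ψ = trans (hex₁ M φ ψ) (trans (∑±-swap M (λ w t → ∑± M (λ u → 𝕀 w t u * (φ w * ψ t))))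
      (∑±-ext M λ t → trans (∑±-swap M (λ w u → 𝕀 w t u * (φ w * ψ t))) (∑±-ext M λ u → ∑±-ext M λ w →
        cong (_* (φ w * ψ t)) (trans (sym (𝕀-rotate w t u)) refl))))

    zero-sum : ∀ x y z p q r → x * p ≡ 1ℚ → y * q ≡ 1ℚ → z * r ≡ 1ℚ → x + y + z ≡ 0ℚ → p * q + q * r + r * p ≡ 0ℚ
    zero-sum x y z p q r xp yq zr s = begin
      p * q + q * r + r * p
        ≡⟨ cong₂ (λ a b → a + b + r * p) (one (p * q) (z * r) zr) (one (q * r) (x * p) xp) ⟩
      p * q * (z * r) + q * r * (x * p) + r * p
        ≡⟨ cong (λ a → p * q * (z * r) + q * r * (x * p) + a) (one (r * p) (y * q) yq) ⟩
      p * q * (z * r) + q * r * (x * p) + r * p * (y * q)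
        ≡⟨ solve 6 (λ x y z p q r → p :* q :* (z :* r) :+ q :* r :* (x :* p) :+ r :* p :* (y :* q) := (x :+ y :+ z) :* (p :* q :* r)) refl x y z p q r ⟩
      (x + y + z) * (p * q * r)
        ≡⟨ 0* (p * q * r) s ⟩
      0ℚ ∎
      where
      open ≡-Reasoning
      one : ∀ a b → b ≡ 1ℚ → a ≡ a * b
      one a b e = trans (sym (ℚₚ.*-identityʳ a)) (cong (a *_) (sym e))

  -- On the hexagon the denominators add up to (a + b + c) + n(t + u + w) = 0, so `zero-sum` cancels
  -- every summand and only the corners of the three squares survive.
  product-law : ∀ M a b c → Reg a → Reg b → Reg c → a ℤ.+ b ℤ.+ c ≡ ℤ.+ 0 →
    h M a * h M b + h M b * h M c + h M c * h M a ≡ corner M (P a) (P b) + corner M (P b) (P c) + corner M (P c) (P a)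
  product-law M a b c ra rb rc a+b+c≡0 = begin
    h M a * h M b + h M b * h M c + h M c * h M a
      ≡⟨ cong₂ _+_ (cong₂ _+_ (square-hexagon M (P a) (P b)) (square-hexagon M (P b) (P c))) (square-hexagon M (P c) (P a)) ⟩
    (hex M (P a) (P b) + k₁) + (hex M (P b) (P c) + k₂) + (hex M (P c) (P a) + k₃)
      ≡⟨ solve 6 (λ x a y b z c → (x :+ a) :+ (y :+ b) :+ (z :+ c) := (x :+ y :+ z) :+ (a :+ b :+ c)) refl (hex M (P a) (P b)) k₁ (hex M (P b) (P c)) k₂ (hex M (P c) (P a)) k₃ ⟩
    (hex M (P a) (P b) + hex M (P b) (P c) + hex M (P c) (P a)) + (k₁ + k₂ + k₃)
      ≡⟨ cong (_+ (k₁ + k₂ + k₃)) (trans (cong₂ _+_ (cong₂ _+_ (hex₁ M (P a) (P b)) (hex₂ M (P b) (P c))) (hex₃ M (P c) (P a))) vanish) ⟩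
    0ℚ + (k₁ + k₂ + k₃)
      ≡⟨ ℚₚ.+-identityˡ (k₁ + k₂ + k₃) ⟩
    k₁ + k₂ + k₃ ∎
    where
    open ≡-Reasoning
    k₁ = corner M (P a) (P b)
    k₂ = corner M (P b) (P c)
    k₃ = corner M (P c) (P a)
    f₁ f₂ f₃ : ℤ → ℤ → ℤ → ℚ
    f₁ t u w = P a t * P b u
    f₂ t u w = P b u * P c w
    f₃ t u w = P c w * P a t
    hexagon-+ : ∀ f g → hexagon M f + hexagon M g ≡ hexagon M (λ t u w → f t u w + g t u w)
    hexagon-+ f g = trans (sym (∑±-+ M _ _)) (∑±-ext M λ t → trans (sym (∑±-+ M _ _)) (∑±-ext M λ u → trans (sym (∑±-+ M _ _))
      (∑±-ext M λ w → sym (ℚₚ.*-distribˡ-+ (𝕀 t u w) (f t u w) (g t u w)))))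
    term : ∀ t u w → 𝕀 t u w * (f₁ t u w + f₂ t u w + f₃ t u w) ≡ 0ℚ
    term t u w with t ℤ.+ u ℤ.+ w ℤ.≟ ℤ.+ 0
    ... | no _ = ℚₚ.*-zeroˡ (f₁ t u w + f₂ t u w + f₃ t u w)
    ... | yes e = *0 1ℚ (zero-sum (ιℤ (den a t)) (ιℤ (den b u)) (ιℤ (den c w)) (P a t) (P b u) (P c w)
          (P-inv a t (den≢0 a t ra)) (P-inv b u (den≢0 b u rb)) (P-inv c w (den≢0 c w rc))
          (trans (trans (cong (_+ ιℤ (den c w)) (sym (ιℤ-+ (den a t) (den b u)))) (sym (ιℤ-+ (den a t ℤ.+ den b u) (den c w))))
            (cong ιℤ (trans (solveℤ 7 (λ a b c n t u w → (a ⊞ n ⊡ t) ⊞ (b ⊞ n ⊡ u) ⊞ (c ⊞ n ⊡ w) ≐ (a ⊞ b ⊞ c) ⊞ n ⊡ (t ⊞ u ⊞ w)) refl a b c (ℤ.+ n) t u w)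
              (trans (cong₂ (λ x y → x ℤ.+ ℤ.+ n ℤ.* y) a+b+c≡0 e) (trans (ℤₚ.+-identityˡ _) (ℤₚ.*-zeroʳ (ℤ.+ n))))))))
    vanish : hexagon M f₁ + hexagon M f₂ + hexagon M f₃ ≡ 0ℚ
    vanish = trans (cong (_+ hexagon M f₃) (hexagon-+ f₁ f₂)) (trans (hexagon-+ (λ t u w → f₁ t u w + f₂ t u w) f₃)
      (∑±-zero M λ t → ∑±-zero M λ u → ∑±-zero M λ w → term t u w))

  cyclic-law : ∀ a b c → Reg a → Reg b → Reg c → a ℤ.+ b ℤ.+ c ≡ ℤ.+ 0 →
    Null (λ m → h (suc m) a * h (suc m) b + h (suc m) b * h (suc m) c + h (suc m) c * h (suc m) a - qₙ m)
  cyclic-law a b c ra rb rc s = Null-resp (λ m → sym (trans (cong (_- qₙ m) (product-law (suc m) a b c ra rb rc s))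
      (solve 4 (λ x y z t → x :+ y :+ z :- (con 1ℚ :+ con 1ℚ :+ con 1ℚ) :* t := (x :- t) :+ (y :- t) :+ (z :- t)) refl
        (corner (suc m) (P a) (P b)) (corner (suc m) (P b) (P c)) (corner (suc m) (P c) (P a)) ((1ℚ + 1ℚ) * (rcp n * rcp n) * ζ′ (suc m)))))
    (Null-+ (Null-+ (corner-null a b ra rb) (corner-null b c rb rc)) (corner-null c a rc ra))

  -- The partial sums `h` are periodic only up to null sequences; evaluating them at the least
  -- residue makes `hbar` exactly periodic.
  hbar : ℕ → ℕ → ℚ
  hbar x m = h (suc m) (ℤ.+ (x ℕ.% n))

  Reg-% : ∀ x → x ℕ.% n ≢ 0 → Reg (ℤ.+ (x ℕ.% n))
  Reg-% x x≢0 = ℕ∣.>⇒∤ {{ℕ.≢-nonZero x≢0}} (ℕ.m%n<n x n)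

  hbar-bounded : ∀ x → x ℕ.% n ≢ 0 → Bounded (hbar x)
  hbar-bounded x x≢0 = h-bounded (ℤ.+ (x ℕ.% n)) (Reg-% x x≢0)

  private
    reduce : ∀ s → s ℕ.< n ℕ.+ n → s ℕ.% n ≢ 0 → Null (λ m → h (suc m) (ℤ.+ s) - h (suc m) (ℤ.+ (s ℕ.% n)))
    reduce s s<2n s≢0 with s ℕ.<? n
    ... | yes s<n = Null-resp (λ m → sym (trans (cong (λ z → h (suc m) (ℤ.+ s) - h (suc m) (ℤ.+ z)) (ℕ.m<n⇒m%n≡m s<n)) (ℚₚ.+-inverseʳ (h (suc m) (ℤ.+ s))))) Null-0
    ... | no  s≮n = Null-resp (λ m → cong (λ z → h (suc m) z - h (suc m) (ℤ.+ (s ℕ.% n))) (cong ℤ.+_ s≡)) (h-shift (ℤ.+ (s ℕ.% n)) (Reg-% s s≢0))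
      where
      n≤s = ℕₚ.≮⇒≥ s≮n
      s≡ : s ℕ.% n ℕ.+ n ≡ s
      s≡ = trans (cong (ℕ._+ n) (trans (sym (ℕ.m≤n⇒[n∸m]%m≡n%m n≤s)) (ℕ.m<n⇒m%n≡m (ℕₚ.+-cancelʳ-< n (s ℕ.∸ n) n (subst (ℕ._< n ℕ.+ n) (sym (ℕₚ.m∸n+n≡m n≤s)) s<2n))))) (ℕₚ.m∸n+n≡m n≤s)

    sum<2n : ∀ x r → x ℕ.% n ℕ.+ r ℕ.% n ℕ.< n ℕ.+ n
    sum<2n x r = ℕₚ.+-mono-< (ℕ.m%n<n x n) (ℕ.m%n<n r n)

  -- The cyclic law at x, r and -(x + r), with one `h-shift` if the residues of x and r add up
  -- beyond n. It is cot x cot r - 1 = cot(x + r)(cot x + cot r), scaled by (π/n)².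
  addition-law : ∀ x r → x ℕ.% n ≢ 0 → r ℕ.% n ≢ 0 → (x ℕ.+ r) ℕ.% n ≢ 0 →
    Null (λ m → hbar x m * hbar r m - hbar (x ℕ.+ r) m * (hbar x m + hbar r m) - qₙ m)
  addition-law x r x≢0 r≢0 s≢0 = Null-resp (λ m → trans
      (cong (λ z → (hbar x m * hbar r m + hbar r m * z + z * hbar x m - qₙ m) + (hbar x m + hbar r m) * (h (suc m) (ℤ.+ s) - h (suc m) (ℤ.+ (s ℕ.% n)))) (h-neg (suc m) (ℤ.+ s) rs))
      (trans (solve 5 (λ a b z w q → (a :* b :+ b :* (:- z) :+ (:- z) :* a :- q) :+ (a :+ b) :* (z :- w) := a :* b :- w :* (a :+ b) :- q) refl
        (hbar x m) (hbar r m) (h (suc m) (ℤ.+ s)) (h (suc m) (ℤ.+ (s ℕ.% n))) (qₙ m))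
        (cong (λ y → hbar x m * hbar r m - h (suc m) (ℤ.+ y) * (hbar x m + hbar r m) - qₙ m) s%≡)))
    (Null-+ (cyclic-law (ℤ.+ x′) (ℤ.+ r′) (ℤ.- (ℤ.+ s)) (Reg-% x x≢0) (Reg-% r r≢0) (Reg-neg (ℤ.+ s) rs) (ℤₚ.+-inverseʳ (ℤ.+ s)))
      (Null-* (Bounded-+ (hbar-bounded x x≢0) (hbar-bounded r r≢0)) (reduce s (sum<2n x r) s%≢0)))
    where
    x′ = x ℕ.% n
    r′ = r ℕ.% n
    s = x′ ℕ.+ r′
    s%≡ : s ℕ.% n ≡ (x ℕ.+ r) ℕ.% n
    s%≡ = sym (ℕ.%-distribˡ-+ x r n)
    s%≢0 : s ℕ.% n ≢ 0
    s%≢0 e = s≢0 (trans (sym s%≡) e)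
    rs : Reg (ℤ.+ s)
    rs n∣s = s%≢0 (ℕ∣.n∣m⇒m%n≡0 s n n∣s)

  -- The substitute for the addition law at its pole: here the residue of r is that of x negated and
  -- shifted once by n.
  opposite-law : ∀ x r → x ℕ.% n ≢ 0 → r ℕ.% n ≢ 0 → (x ℕ.+ r) ℕ.% n ≡ 0 → Null (λ m → hbar x m + hbar r m)
  opposite-law x r x≢0 r≢0 s≡0 = Null-resp (λ m → trans (cong₂ (λ y z → h (suc m) y - z) r≡ (h-neg (suc m) (ℤ.+ x′) (Reg-% x x≢0)))
      (solve 2 (λ a b → b :- (:- a) := a :+ b) refl (hbar x m) (hbar r m)))
    (h-shift (ℤ.- (ℤ.+ x′)) (Reg-neg (ℤ.+ x′) (Reg-% x x≢0)))
    where
    x′ = x ℕ.% n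
    r′ = r ℕ.% n
    s = x′ ℕ.+ r′
    n∣s : n ∣ s
    n∣s = ℕ∣.m%n≡0⇒n∣m s n (trans (sym (ℕ.%-distribˡ-+ x r n)) s≡0)
    s≡n : s ≡ n
    s≡n with n∣s
    ... | ℕ∣.divides zero    e = ⊥-elim (x≢0 (ℕₚ.m+n≡0⇒m≡0 x′ e))
    ... | ℕ∣.divides 1       e = trans e (ℕₚ.+-identityʳ n)
    ... | ℕ∣.divides (suc (suc k)) e = ⊥-elim (ℕₚ.<⇒≱ (sum<2n x r) (subst (n ℕ.+ n ℕ.≤_) (sym e) (ℕₚ.+-monoʳ-≤ n (ℕₚ.m≤m+n n (k ℕ.* n)))))
    r≡ : ℤ.- (ℤ.+ x′) ℤ.+ ℤ.+ n ≡ ℤ.+ r′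
    r≡ = trans (cong (λ z → ℤ.- (ℤ.+ x′) ℤ.+ ℤ.+ z) (sym s≡n)) (solveℤ 2 (λ x r → (⊟ x) ⊞ (x ⊞ r) ≐ r) refl (ℤ.+ x′) (ℤ.+ r′))

  private
    select : ∀ {A : Set} → Dec A → ℚ → ℚ → ℚ
    select (yes _) p q = p
    select (no  _) p q = q

    select-yes : ∀ {A : Set} (d : Dec A) {p q} → A → select d p q ≡ p
    select-yes (yes _) a = refl
    select-yes (no ¬a) a = ⊥-elim (¬a a)

    select-no : ∀ {A : Set} (d : Dec A) {p q} → ¬ A → select d p q ≡ q
    select-no (yes a) ¬a = ⊥-elim (¬a a)
    select-no (no _)  ¬a = refl

    q₀ : ℚ
    q₀ = rcp n * rcp n

    0<q₀ : 0ℚ < q₀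
    0<q₀ = ℚₚ.positive⁻¹ q₀ {{ℚₚ.pos*pos⇒pos (rcp n) {{ℚ.positive 0<rcp}} (rcp n) {{ℚ.positive 0<rcp}}}}
      where
      0<rcp : 0ℚ < rcp n
      0<rcp with 0ℚ ℚₚ.<? rcp n
      ... | yes p = p
      ... | no ¬p = ⊥-elim (ℚₚ.1≢0 (trans (sym (ι*rcp 1≤n)) (*0 (ι n) (ℚₚ.≤-antisym (ℚₚ.≮⇒≥ ¬p) (0≤rcp n)))))

  -- Keeps h² + q away from 0 uniformly in `m`, which makes `D` a genuine and bounded reciprocal.
  q₀≤q : ∀ m → q₀ ≤ qₙ m
  q₀≤q m = ≤-by (q₀ * (ι 6 * (ζ′ (suc m) - 1ℚ)) + q₀ * ι 5) (0≤+ (0≤* 0≤q₀ (0≤* (0≤ι 6) (0≤-diff (1≤ζ′ (suc m) (s≤s z≤n))))) (0≤* 0≤q₀ (0≤ι 5)))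
    (solve 2 (λ q z → (con 1ℚ :+ con 1ℚ :+ con 1ℚ) :* ((con 1ℚ :+ con 1ℚ) :* q :* z) := q :+ (q :* (con (ι 6) :* (z :- con 1ℚ)) :+ q :* con (ι 5))) refl q₀ (ζ′ (suc m)))
    where 0≤q₀ = ℚₚ.<⇒≤ 0<q₀

  q-bounded : Bounded qₙ
  q-bounded = ι 12 * q₀ , λ m → subst (_≤ ι 12 * q₀) (sym (ℚₚ.0≤p⇒∣p∣≡p (≤-trans (ℚₚ.<⇒≤ 0<q₀) (q₀≤q m))))
    (≤-by (q₀ * ι 6 * (1ℚ + 1ℚ - ζ′ (suc m))) (0≤* (0≤* (ℚₚ.<⇒≤ 0<q₀) (0≤ι 6)) (0≤-diff (ζ′≤2 (suc m))))
      (solve 2 (λ q z → con (ι 12) :* q := (con 1ℚ :+ con 1ℚ :+ con 1ℚ) :* ((con 1ℚ :+ con 1ℚ) :* q :* z) :+ q :* con (ι 6) :* (con 1ℚ :+ con 1ℚ :- z)) refl q₀ (ζ′ (suc m))))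

  -- Away from x ≡ 0 this approximates sin²(πx/n) divided by (π/n)².
  D : ℕ → ℕ → ℚ
  D x m = inv (hbar x m * hbar x m + qₙ m)

  private
    0<h²+q : ∀ x m → 0ℚ < hbar x m * hbar x m + qₙ m
    0<h²+q x m = ℚₚ.<-≤-trans 0<q₀ (≤-trans (q₀≤q m) (≤-by (hbar x m * hbar x m) (0≤p² (hbar x m)) (ℚₚ.+-comm (hbar x m * hbar x m) (qₙ m))))

  D-inv : ∀ x m → (hbar x m * hbar x m + qₙ m) * D x m ≡ 1ℚ
  D-inv x m = *-inv (<⇒≢0 (0<h²+q x m))

  D-bounded : ∀ x → Bounded (D x)
  D-bounded x = inv q₀ , λ m → let d = D x m; 0≤d = ℚₚ.<⇒≤ (inv-pos (0<h²+q x m)) in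
    subst (_≤ inv q₀) (sym (ℚₚ.0≤p⇒∣p∣≡p 0≤d)) (*-cancelˡ 0<q₀ (subst (q₀ * d ≤_) (trans (D-inv x m) (sym (*-inv (<⇒≢0 0<q₀))))
      (*-monoʳ 0≤d (≤-trans (q₀≤q m) (≤-by (hbar x m * hbar x m) (0≤p² (hbar x m)) (ℚₚ.+-comm (hbar x m * hbar x m) (qₙ m)))))))

  -- S and C are the sine (divided by π/n) and the cosine of 2πx/n, up to null sequences.
  S C : ℕ → ℕ → ℚ
  S x m = select (x ℕ.% n ℕ.≟ 0) 0ℚ ((hbar x m + hbar x m) * D x m)
  C x m = select (x ℕ.% n ℕ.≟ 0) 1ℚ ((hbar x m * hbar x m - qₙ m) * D x m)

  S-0 : ∀ x m → x ℕ.% n ≡ 0 → S x m ≡ 0ℚ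
  S-0 x m = select-yes (x ℕ.% n ℕ.≟ 0)

  C-0 : ∀ x m → x ℕ.% n ≡ 0 → C x m ≡ 1ℚ
  C-0 x m = select-yes (x ℕ.% n ℕ.≟ 0)

  S-periodic : ∀ x y m → x ℕ.% n ≡ y ℕ.% n → S x m ≡ S y m
  S-periodic x y m e = cong (λ z → select (z ℕ.≟ 0) 0ℚ ((h (suc m) (ℤ.+ z) + h (suc m) (ℤ.+ z)) * inv (h (suc m) (ℤ.+ z) * h (suc m) (ℤ.+ z) + qₙ m))) e

  S-≢ : ∀ x m → x ℕ.% n ≢ 0 → S x m ≡ (hbar x m + hbar x m) * D x m
  S-≢ x m = select-no (x ℕ.% n ℕ.≟ 0)

  C-≢ : ∀ x m → x ℕ.% n ≢ 0 → C x m ≡ (hbar x m * hbar x m - qₙ m) * D x m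
  C-≢ x m = select-no (x ℕ.% n ℕ.≟ 0)

  -- With A = 2π(x + r)/n and B = 2πx/n, these are the defects of cos A + cos B = cot((A - B)/2)(sin
  -- A - sin B) and of sin A + sin B = -cot((A - B)/2)(cos A - cos B). The factor `qₙ` matches the
  -- scaling of `S`.
  e₁ e₂ : ℕ → ℕ → ℕ → ℚ
  e₁ r x m = C (x ℕ.+ r) m + C x m - hbar r m * (S (x ℕ.+ r) m - S x m)
  e₂ r x m = qₙ m * (S (x ℕ.+ r) m + S x m) + hbar r m * (C (x ℕ.+ r) m - C x m)

  private
    two : ℚ
    two = 1ℚ + 1ℚ

    one* : ∀ {u} p → u ≡ 1ℚ → p ≡ p * u
    one* p e = trans (sym (ℚₚ.*-identityʳ p)) (cong (p *_) (sym e))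

    hbar-cong : ∀ x y m → x ℕ.% n ≡ y ℕ.% n → hbar x m ≡ hbar y m
    hbar-cong x y m e = cong (λ z → h (suc m) (ℤ.+ z)) e

    [x+r]%≡r% : ∀ x r → x ℕ.% n ≡ 0 → (x ℕ.+ r) ℕ.% n ≡ r ℕ.% n
    [x+r]%≡r% x r e = trans (ℕ.%-distribˡ-+ x r n) (trans (cong (λ z → (z ℕ.+ r ℕ.% n) ℕ.% n) e) (ℕ.m%n%n≡m%n r n))

  -- Away from the poles both defects are bounded multiples of the defect of `addition-law`. At x ≡
  -- 0 they vanish identically, and at x + r ≡ 0 they are multiples of the defect of `opposite-law`.
  e-null′ : ∀ r x → r ℕ.% n ≢ 0 → Dec (x ℕ.% n ≡ 0) → Dec ((x ℕ.+ r) ℕ.% n ≡ 0) → Null (e₁ r x) × Null (e₂ r x)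
  e-null′ r x r≢0 (yes x≡0) (yes s≡0) = ⊥-elim (r≢0 (trans (sym ([x+r]%≡r% x r x≡0)) s≡0))
  e-null′ r x r≢0 (yes x≡0) (no s≢0) = Null-resp (λ m → sym (exact₁ m)) Null-0 , Null-resp (λ m → sym (exact₂ m)) Null-0
    where
    open ≡-Reasoning
    hs≡ : ∀ m → hbar (x ℕ.+ r) m ≡ hbar r m
    hs≡ m = hbar-cong (x ℕ.+ r) r m ([x+r]%≡r% x r x≡0)
    u : ℕ → ℚ
    u m = (hbar (x ℕ.+ r) m * hbar (x ℕ.+ r) m + qₙ m) * D (x ℕ.+ r) m
    exact₁ : ∀ m → e₁ r x m ≡ 0ℚ
    exact₁ m = begin
      e₁ r x m
        ≡⟨ cong₂ (λ c s → c - hbar r m * s) (cong₂ _+_ (C-≢ (x ℕ.+ r) m s≢0) (C-0 x m x≡0)) (cong₂ _-_ (S-≢ (x ℕ.+ r) m s≢0) (S-0 x m x≡0)) ⟩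
      (hs * hs - qₙ m) * d + 1ℚ - hbar r m * ((hs + hs) * d - 0ℚ)
        ≡⟨ cong (λ z → (hs * hs - qₙ m) * d + 1ℚ - z * ((hs + hs) * d - 0ℚ)) (sym (hs≡ m)) ⟩
      (hs * hs - qₙ m) * d + 1ℚ - hs * ((hs + hs) * d - 0ℚ)
        ≡⟨ solve 3 (λ y q d → (y :* y :- q) :* d :+ con 1ℚ :- y :* ((y :+ y) :* d :- con 0ℚ) := con 1ℚ :- (y :* y :+ q) :* d) refl hs (qₙ m) d ⟩
      1ℚ - u m
        ≡⟨ cong (λ z → 1ℚ - z) (D-inv (x ℕ.+ r) m) ⟩
      0ℚ ∎
      where
      hs = hbar (x ℕ.+ r) m
      d = D (x ℕ.+ r) m
    exact₂ : ∀ m → e₂ r x m ≡ 0ℚ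
    exact₂ m = begin
      e₂ r x m
        ≡⟨ cong₂ (λ s c → qₙ m * s + hbar r m * c) (cong₂ _+_ (S-≢ (x ℕ.+ r) m s≢0) (S-0 x m x≡0)) (cong₂ _-_ (C-≢ (x ℕ.+ r) m s≢0) (C-0 x m x≡0)) ⟩
      qₙ m * ((hs + hs) * d + 0ℚ) + hbar r m * ((hs * hs - qₙ m) * d - 1ℚ)
        ≡⟨ cong (λ z → qₙ m * ((hs + hs) * d + 0ℚ) + z * ((hs * hs - qₙ m) * d - 1ℚ)) (sym (hs≡ m)) ⟩
      qₙ m * ((hs + hs) * d + 0ℚ) + hs * ((hs * hs - qₙ m) * d - 1ℚ)
        ≡⟨ solve 3 (λ y q d → q :* ((y :+ y) :* d :+ con 0ℚ) :+ y :* ((y :* y :- q) :* d :- con 1ℚ) := y :* ((y :* y :+ q) :* d :- con 1ℚ)) refl hs (qₙ m) d ⟩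
      hs * (u m - 1ℚ)
        ≡⟨ *0 hs (cong (_- 1ℚ) (D-inv (x ℕ.+ r) m)) ⟩
      0ℚ ∎
      where
      hs = hbar (x ℕ.+ r) m
      d = D (x ℕ.+ r) m
  e-null′ r x r≢0 (no x≢0) (yes s≡0) = Null-resp (λ m → sym (id₁ m)) (Null-* (Bounded-* (Bounded-* (Bounded-const two) (hbar-bounded x x≢0)) (D-bounded x)) ν)
                         , Null-resp (λ m → sym (id₂ m)) (Null-* (Bounded-* (Bounded-* (Bounded-const two) q-bounded) (D-bounded x)) ν)
    where
    open ≡-Reasoning
    ν = opposite-law x r x≢0 r≢0 s≡0
    id₁ : ∀ m → e₁ r x m ≡ two * hbar x m * D x m * (hbar x m + hbar r m)
    id₁ m = begin
      e₁ r x m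
        ≡⟨ cong₂ (λ c s → c - hbar r m * s) (cong₂ _+_ (trans (C-0 (x ℕ.+ r) m s≡0) (sym (D-inv x m))) (C-≢ x m x≢0)) (cong₂ _-_ (S-0 (x ℕ.+ r) m s≡0) (S-≢ x m x≢0)) ⟩
      (hx * hx + qₙ m) * d + (hx * hx - qₙ m) * d - hbar r m * (0ℚ - (hx + hx) * d)
        ≡⟨ solve 4 (λ a b q d → (a :* a :+ q) :* d :+ (a :* a :- q) :* d :- b :* (con 0ℚ :- (a :+ a) :* d) := (con 1ℚ :+ con 1ℚ) :* a :* d :* (a :+ b)) refl hx (hbar r m) (qₙ m) d ⟩
      two * hx * d * (hx + hbar r m) ∎
      where
      hx = hbar x m
      d = D x m
    id₂ : ∀ m → e₂ r x m ≡ two * qₙ m * D x m * (hbar x m + hbar r m)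
    id₂ m = begin
      e₂ r x m
        ≡⟨ cong₂ (λ s c → qₙ m * s + hbar r m * c) (cong₂ _+_ (S-0 (x ℕ.+ r) m s≡0) (S-≢ x m x≢0)) (cong₂ _-_ (trans (C-0 (x ℕ.+ r) m s≡0) (sym (D-inv x m))) (C-≢ x m x≢0)) ⟩
      qₙ m * (0ℚ + (hx + hx) * d) + hbar r m * ((hx * hx + qₙ m) * d - (hx * hx - qₙ m) * d)
        ≡⟨ solve 4 (λ a b q d → q :* (con 0ℚ :+ (a :+ a) :* d) :+ b :* ((a :* a :+ q) :* d :- (a :* a :- q) :* d) := (con 1ℚ :+ con 1ℚ) :* q :* d :* (a :+ b)) refl hx (hbar r m) (qₙ m) d ⟩
      two * qₙ m * d * (hx + hbar r m) ∎
      where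
      hx = hbar x m
      d = D x m
  e-null′ r x r≢0 (no x≢0) (no s≢0) = Null-resp (λ m → sym (id₁ m)) (Null-* bd₁ ε) , Null-resp (λ m → sym (id₂ m)) (Null-* bd₂ ε)
    where
    open ≡-Reasoning
    s = x ℕ.+ r
    ε = addition-law x r x≢0 r≢0 s≢0
    bx = hbar-bounded x x≢0
    bs = hbar-bounded s s≢0
    bDD = Bounded-* (D-bounded x) (D-bounded s)
    bd₁ : Bounded (λ m → (- two) * (D x m * D s m) * (hbar x m * hbar s m + - qₙ m))
    bd₁ = Bounded-* (Bounded-* (Bounded-const (- two)) bDD) (Bounded-+ (Bounded-* bx bs) (Bounded-neg q-bounded))
    bd₂ : Bounded (λ m → (- two) * (D x m * D s m) * (qₙ m * (hbar x m + hbar s m)))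
    bd₂ = Bounded-* (Bounded-* (Bounded-const (- two)) bDD) (Bounded-* q-bounded (Bounded-+ bx bs))
    module _ (m : ℕ) where
      hx = hbar x m
      hr = hbar r m
      hs = hbar s m
      q = qₙ m
      d = D x m
      d′ = D s m
      -- Both equal 1; inserting them brings all terms over the common denominator, after which the
      -- claims are polynomial identities.
      U V : ℚ
      U = (hx * hx + q) * d
      V = (hs * hs + q) * d′
      Cs≡ : C s m ≡ (hs * hs - q) * d′ * U
      Cs≡ = trans (C-≢ s m s≢0) (one* _ (D-inv x m))
      Cx≡ : C x m ≡ (hx * hx - q) * d * V
      Cx≡ = trans (C-≢ x m x≢0) (one* _ (D-inv s m))
      Ss≡ : S s m ≡ (hs + hs) * d′ * U
      Ss≡ = trans (S-≢ s m s≢0) (one* _ (D-inv x m))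
      Sx≡ : S x m ≡ (hx + hx) * d * V
      Sx≡ = trans (S-≢ x m x≢0) (one* _ (D-inv s m))
      id₁ : e₁ r x m ≡ (- two) * (d * d′) * (hx * hs + - q) * (hx * hr - hs * (hx + hr) - q)
      id₁ = trans (cong₂ (λ c t → c - hr * t) (cong₂ _+_ Cs≡ Cx≡) (cong₂ _-_ Ss≡ Sx≡))
        (solve 6 (λ a b y q d e → ((y :* y :- q) :* e :* ((a :* a :+ q) :* d) :+ (a :* a :- q) :* d :* ((y :* y :+ q) :* e)) :- b :* ((y :+ y) :* e :* ((a :* a :+ q) :* d) :- (a :+ a) :* d :* ((y :* y :+ q) :* e))
           := (:- (con 1ℚ :+ con 1ℚ)) :* (d :* e) :* (a :* y :+ :- q) :* (a :* b :- y :* (a :+ b) :- q)) refl hx hr hs q d d′)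
      id₂ : e₂ r x m ≡ (- two) * (d * d′) * (q * (hx + hs)) * (hx * hr - hs * (hx + hr) - q)
      id₂ = trans (cong₂ (λ t c → q * t + hr * c) (cong₂ _+_ Ss≡ Sx≡) (cong₂ _-_ Cs≡ Cx≡))
        (solve 6 (λ a b y q d e → q :* ((y :+ y) :* e :* ((a :* a :+ q) :* d) :+ (a :+ a) :* d :* ((y :* y :+ q) :* e)) :+ b :* ((y :* y :- q) :* e :* ((a :* a :+ q) :* d) :- (a :* a :- q) :* d :* ((y :* y :+ q) :* e))
           := (:- (con 1ℚ :+ con 1ℚ)) :* (d :* e) :* (q :* (a :+ y)) :* (a :* b :- y :* (a :+ b) :- q)) refl hx hr hs q d d′)

  e-null : ∀ r x → r ℕ.% n ≢ 0 → Null (e₁ r x) × Null (e₂ r x)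
  e-null r x r≢0 = e-null′ r x r≢0 (x ℕ.% n ℕ.≟ 0) ((x ℕ.+ r) ℕ.% n ℕ.≟ 0)

-- Summation of the addition formulas over a period

private
  2ℚ : ℚ
  2ℚ = 1ℚ + 1ℚ

-- The weights 2t + 1 are chosen because neighbours add up to 4t and differ by 2. Summation by parts
-- thus extracts ∑ t s(t) from the sums and a plain sum from the differences.
∑-odd-+ : ∀ k (s : ℕ → ℚ) → ∑ k (λ t → (ι t + ι t + 1ℚ) * (s (suc t) + s t)) ≡
          (2ℚ + 2ℚ) * ∑ k (λ t → ι t * s t) + (ι k + ι k - 1ℚ) * s k + s 0
∑-odd-+ zero    s = solve 1 (λ x → con 0ℚ := (con 2ℚ :+ con 2ℚ) :* con 0ℚ :+ (con 0ℚ :+ con 0ℚ :- con 1ℚ) :* x :+ x) refl (s 0)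
∑-odd-+ (suc k) s = trans (cong (_+ (ι k + ι k + 1ℚ) * (s (suc k) + s k)) (∑-odd-+ k s))
  (solve 5 (λ T k a b z → (con 2ℚ :+ con 2ℚ) :* T :+ (k :+ k :- con 1ℚ) :* a :+ z :+ (k :+ k :+ con 1ℚ) :* (b :+ a)
     := (con 2ℚ :+ con 2ℚ) :* (T :+ k :* a) :+ ((con 1ℚ :+ k) :+ (con 1ℚ :+ k) :- con 1ℚ) :* b :+ z) refl (∑ k (λ t → ι t * s t)) (ι k) (s k) (s (suc k)) (s 0))

∑-odd-- : ∀ k (c : ℕ → ℚ) → ∑ k (λ t → (ι t + ι t + 1ℚ) * (c (suc t) - c t)) ≡ (ι k + ι k - 1ℚ) * c k - 2ℚ * ∑ k c + c 0
∑-odd-- zero    c = solve 1 (λ x → con 0ℚ := (con 0ℚ :+ con 0ℚ :- con 1ℚ) :* x :- con 2ℚ :* con 0ℚ :+ x) refl (c 0)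
∑-odd-- (suc k) c = trans (cong (_+ (ι k + ι k + 1ℚ) * (c (suc k) - c k)) (∑-odd-- k c))
  (solve 5 (λ T k a b z → (k :+ k :- con 1ℚ) :* a :- con 2ℚ :* T :+ z :+ (k :+ k :+ con 1ℚ) :* (b :- a)
     := ((con 1ℚ :+ k) :+ (con 1ℚ :+ k) :- con 1ℚ) :* b :- con 2ℚ :* (T :+ a) :+ z) refl (∑ k c) (ι k) (c k) (c (suc k)) (c 0))

∑-pair : ∀ k (c : ℕ → ℚ) → ∑ k (λ t → c (suc t) + c t) ≡ 2ℚ * ∑ k c + c k - c 0
∑-pair zero    c = solve 1 (λ x → con 0ℚ := con 2ℚ :* con 0ℚ :+ x :- x) refl (c 0)
∑-pair (suc k) c = trans (cong (_+ (c (suc k) + c k)) (∑-pair k c))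
  (solve 4 (λ T a b z → con 2ℚ :* T :+ a :- z :+ (b :+ a) := con 2ℚ :* (T :+ a) :+ b :- z) refl (∑ k c) (c k) (c (suc k)) (c 0))

∑-telescope : ∀ k (s : ℕ → ℚ) → ∑ k (λ t → s (suc t) - s t) ≡ s k - s 0
∑-telescope zero    s = sym (ℚₚ.+-inverseʳ (s 0))
∑-telescope (suc k) s = trans (cong (_+ (s (suc k) - s k)) (∑-telescope k s)) (solve 3 (λ a b z → a :- z :+ (b :- a) := b :- z) refl (s k) (s (suc k)) (s 0))

∑-blocks : ∀ n K (f : ℕ → ℚ) → ∑ (n ℕ.* K) f ≡ ∑ K (λ j → ∑ n (λ x → f (n ℕ.* j ℕ.+ x)))
∑-blocks n zero    f = cong (λ m → ∑ m f) (ℕₚ.*-zeroʳ n)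
∑-blocks n (suc K) f = trans (cong (λ m → ∑ m f) (trans (ℕₚ.*-suc n K) (ℕₚ.+-comm n (n ℕ.* K)))) (trans (∑-split (n ℕ.* K) n f) (cong (_+ ∑ n (λ x → f (n ℕ.* K ℕ.+ x))) (∑-blocks n K f)))

-- At powers of two the harmonic sum is linear in the exponent: for m + 1 = 4^e with e = p + N, the
-- rate `δ m` is at most 2/(e + 1).
δ-small : ∀ N p → ∃ λ m → (N ℕ.≤ m) × (ι (suc p) * δ m ≤ 2ℚ)
δ-small N p = m , N≤m , ≤-trans (*-monoʳ (0≤δ m) (ι-mono (s≤s (ℕₚ.m≤m+n p N))))
    (≤-trans (*-monoˡ (0≤ι (suc e)) δ≤) (≤-reflexive eq))
  where
  e = p ℕ.+ N
  i = e ℕ.+ e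
  m = ℕ.pred (2 ℕ.^ i)
  1+m≡ : suc m ≡ 2 ℕ.^ i
  1+m≡ = ℕₚ.suc-pred (2 ℕ.^ i) {{ℕ.>-nonZero (ℕₚ.m^n>0 2 i)}}
  square : suc e ℕ.* suc e ℕ.≤ 2 ℕ.^ i
  square = subst (suc e ℕ.* suc e ℕ.≤_) (sym (ℕₚ.^-distribˡ-+-* 2 e e)) (ℕₚ.*-mono-≤ (n<2^n e) (n<2^n e))
  N≤m : N ℕ.≤ m
  N≤m = ℕₚ.≤-pred (subst (suc N ℕ.≤_) (sym 1+m≡) (ℕₚ.≤-trans (s≤s (ℕₚ.m≤n+m N p)) (ℕₚ.≤-trans (ℕₚ.m≤m*n (suc e) (suc e)) square)))
  H≤ : H (suc m) ≤ 1ℚ + ι i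
  H≤ = subst (λ k → H k ≤ 1ℚ + ι i) (trans (ℕₚ.*-identityʳ (2 ℕ.^ i)) (sym 1+m≡))
    (≤-trans (H-dyadic i 1) (≤-reflexive (cong (_+ ι i) (trans (ℚₚ.+-identityˡ (rcp 1)) (sym (rcp-unique {1} {1ℚ} refl))))))
  δ≤ : δ m ≤ rcp (suc e ℕ.* suc e) * (1ℚ + (1ℚ + ι i))
  δ≤ = *-mono (0≤rcp (suc (suc m))) (0≤+ 0≤1 (0≤ι (suc i))) (rcp-anti (s≤s z≤n) (ℕₚ.≤-trans square (subst (ℕ._≤ suc (suc m)) 1+m≡ (ℕₚ.n≤1+n (suc m))))) (ℚₚ.+-monoʳ-≤ 1ℚ H≤)
  eq : ι (suc e) * (rcp (suc e ℕ.* suc e) * (1ℚ + (1ℚ + ι i))) ≡ 2ℚ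
  eq = trans (cong₂ (λ x y → ι (suc e) * (x * (1ℚ + (1ℚ + y)))) (rcp-* (suc e) (suc e) (s≤s z≤n) (s≤s z≤n)) (ι-+ e e))
    (trans (solve 2 (λ e r → (con 1ℚ :+ e) :* (r :* r :* (con 1ℚ :+ (con 1ℚ :+ (e :+ e)))) := con 2ℚ :* (((con 1ℚ :+ e) :* r) :* ((con 1ℚ :+ e) :* r))) refl (ι e) (rcp (suc e)))
      (trans (cong (λ x → 2ℚ * (x * x)) (ι*rcp {suc e} (s≤s z≤n))) refl))

module Period (n : ℕ) (1≤n : 1 ℕ.≤ n) where
  open Cotangent n 1≤n using (qₙ)
  open Addition n 1≤n

  private
    instance
      _ = ℕ.>-nonZero 1≤n

  module _ (r : ℕ) (r≢0 : r ℕ.% n ≢ 0) where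
    private
      s c : ℕ → ℕ → ℚ
      s m t = S (t ℕ.* r) m
      c m t = C (t ℕ.* r) m

      nr% : (n ℕ.* r) ℕ.% n ≡ 0
      nr% = trans (cong (ℕ._% n) (ℕₚ.*-comm n r)) (ℕ.m*n%n≡0 r n)

      s-n : ∀ m → s m n ≡ 0ℚ
      s-n m = S-0 (n ℕ.* r) m nr%
      s-0 : ∀ m → s m 0 ≡ 0ℚ
      s-0 m = S-0 0 m (ℕ.m<n⇒m%n≡m 1≤n)
      c-n : ∀ m → c m n ≡ 1ℚ
      c-n m = C-0 (n ℕ.* r) m nr%
      c-0 : ∀ m → c m 0 ≡ 1ℚ
      c-0 m = C-0 0 m (ℕ.m<n⇒m%n≡m 1≤n)

      e₁≡ : ∀ m t → e₁ r (t ℕ.* r) m ≡ (c m (suc t) + c m t) - hbar r m * (s m (suc t) - s m t)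
      e₁≡ m t = cong (λ z → C z m + c m t - hbar r m * (S z m - s m t)) (ℕₚ.+-comm (t ℕ.* r) r)

      e₂≡ : ∀ m t → e₂ r (t ℕ.* r) m ≡ qₙ m * (s m (suc t) + s m t) + hbar r m * (c m (suc t) - c m t)
      e₂≡ m t = cong (λ z → qₙ m * (S z m + s m t) + hbar r m * (C z m - c m t)) (ℕₚ.+-comm (t ℕ.* r) r)

      ∑e₁ : ∀ m → ∑ n (λ t → e₁ r (t ℕ.* r) m) ≡ 2ℚ * ∑ n (c m)
      ∑e₁ m = begin
        ∑ n (λ t → e₁ r (t ℕ.* r) m)
          ≡⟨ trans (∑-ext n (e₁≡ m)) (trans (∑-- n (λ t → c m (suc t) + c m t) (λ t → hbar r m * (s m (suc t) - s m t)))
               (cong (λ z → ∑ n (λ t → c m (suc t) + c m t) - z) (∑-*ˡ n (hbar r m) (λ t → s m (suc t) - s m t)))) ⟩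
        ∑ n (λ t → c m (suc t) + c m t) - hbar r m * ∑ n (λ t → s m (suc t) - s m t)
          ≡⟨ cong₂ (λ x y → x - hbar r m * y) (∑-pair n (c m)) (∑-telescope n (s m)) ⟩
        2ℚ * ∑ n (c m) + c m n - c m 0 - hbar r m * (s m n - s m 0)
          ≡⟨ cong₂ (λ x y → 2ℚ * ∑ n (c m) + x - c m 0 - hbar r m * (y - s m 0)) (c-n m) (s-n m) ⟩
        2ℚ * ∑ n (c m) + 1ℚ - c m 0 - hbar r m * (0ℚ - s m 0)
          ≡⟨ cong₂ (λ x y → 2ℚ * ∑ n (c m) + 1ℚ - x - hbar r m * (0ℚ - y)) (c-0 m) (s-0 m) ⟩
        2ℚ * ∑ n (c m) + 1ℚ - 1ℚ - hbar r m * (0ℚ - 0ℚ)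
          ≡⟨ solve 2 (λ x h → x :+ con 1ℚ :- con 1ℚ :- h :* (con 0ℚ :- con 0ℚ) := x) refl (2ℚ * ∑ n (c m)) (hbar r m) ⟩
        2ℚ * ∑ n (c m) ∎
        where open ≡-Reasoning

      ∑e₂ : ∀ m → ∑ n (λ t → e₂ r (t ℕ.* r) m) ≡ 2ℚ * (qₙ m * ∑ n (s m))
      ∑e₂ m = begin
        ∑ n (λ t → e₂ r (t ℕ.* r) m)
          ≡⟨ trans (∑-ext n (e₂≡ m)) (trans (∑-+ n (λ t → qₙ m * (s m (suc t) + s m t)) (λ t → hbar r m * (c m (suc t) - c m t)))
               (cong₂ _+_ (∑-*ˡ n (qₙ m) (λ t → s m (suc t) + s m t)) (∑-*ˡ n (hbar r m) (λ t → c m (suc t) - c m t)))) ⟩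
        qₙ m * ∑ n (λ t → s m (suc t) + s m t) + hbar r m * ∑ n (λ t → c m (suc t) - c m t)
          ≡⟨ cong₂ (λ x y → qₙ m * x + hbar r m * y) (∑-pair n (s m)) (∑-telescope n (c m)) ⟩
        qₙ m * (2ℚ * ∑ n (s m) + s m n - s m 0) + hbar r m * (c m n - c m 0)
          ≡⟨ cong₂ (λ x y → qₙ m * (2ℚ * ∑ n (s m) + x - s m 0) + hbar r m * (y - c m 0)) (s-n m) (c-n m) ⟩
        qₙ m * (2ℚ * ∑ n (s m) + 0ℚ - s m 0) + hbar r m * (1ℚ - c m 0)
          ≡⟨ cong₂ (λ x y → qₙ m * (2ℚ * ∑ n (s m) + 0ℚ - x) + hbar r m * (1ℚ - y)) (s-0 m) (c-0 m) ⟩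
        qₙ m * (2ℚ * ∑ n (s m) + 0ℚ - 0ℚ) + hbar r m * (1ℚ - 1ℚ)
          ≡⟨ solve 3 (λ q x h → q :* (con 2ℚ :* x :+ con 0ℚ :- con 0ℚ) :+ h :* (con 1ℚ :- con 1ℚ) := con 2ℚ :* (q :* x)) refl (qₙ m) (∑ n (s m)) (hbar r m) ⟩
        2ℚ * (qₙ m * ∑ n (s m)) ∎
        where open ≡-Reasoning

      odd : ℕ → ℚ
      odd t = ι t + ι t + 1ℚ

      ∑odd-e₂ : ∀ m → ∑ n (λ t → odd t * e₂ r (t ℕ.* r) m) ≡ (2ℚ + 2ℚ) * (qₙ m * ∑ n (λ t → ι t * s m t)) + hbar r m * (ι n + ι n - 2ℚ * ∑ n (c m))
      ∑odd-e₂ m = begin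
        ∑ n (λ t → odd t * e₂ r (t ℕ.* r) m)
          ≡⟨ trans (∑-ext n (λ t → trans (cong (odd t *_) (e₂≡ m t)) (solve 5 (λ o q x h y → o :* (q :* x :+ h :* y) := q :* (o :* x) :+ h :* (o :* y)) refl (odd t) (qₙ m) (s m (suc t) + s m t) (hbar r m) (c m (suc t) - c m t))))
               (trans (∑-+ n (λ t → qₙ m * (odd t * (s m (suc t) + s m t))) (λ t → hbar r m * (odd t * (c m (suc t) - c m t))))
               (cong₂ _+_ (∑-*ˡ n (qₙ m) (λ t → odd t * (s m (suc t) + s m t))) (∑-*ˡ n (hbar r m) (λ t → odd t * (c m (suc t) - c m t))))) ⟩
        qₙ m * ∑ n (λ t → odd t * (s m (suc t) + s m t)) + hbar r m * ∑ n (λ t → odd t * (c m (suc t) - c m t))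
          ≡⟨ cong₂ (λ x y → qₙ m * x + hbar r m * y) (∑-odd-+ n (s m)) (∑-odd-- n (c m)) ⟩
        qₙ m * ((2ℚ + 2ℚ) * T + (ι n + ι n - 1ℚ) * s m n + s m 0) + hbar r m * ((ι n + ι n - 1ℚ) * c m n - 2ℚ * ∑ n (c m) + c m 0)
          ≡⟨ cong₂ (λ x y → qₙ m * ((2ℚ + 2ℚ) * T + (ι n + ι n - 1ℚ) * x + s m 0) + hbar r m * ((ι n + ι n - 1ℚ) * y - 2ℚ * ∑ n (c m) + c m 0)) (s-n m) (c-n m) ⟩
        qₙ m * ((2ℚ + 2ℚ) * T + (ι n + ι n - 1ℚ) * 0ℚ + s m 0) + hbar r m * ((ι n + ι n - 1ℚ) * 1ℚ - 2ℚ * ∑ n (c m) + c m 0)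
          ≡⟨ cong₂ (λ x y → qₙ m * ((2ℚ + 2ℚ) * T + (ι n + ι n - 1ℚ) * 0ℚ + x) + hbar r m * ((ι n + ι n - 1ℚ) * 1ℚ - 2ℚ * ∑ n (c m) + y)) (s-0 m) (c-0 m) ⟩
        qₙ m * ((2ℚ + 2ℚ) * T + (ι n + ι n - 1ℚ) * 0ℚ + 0ℚ) + hbar r m * ((ι n + ι n - 1ℚ) * 1ℚ - 2ℚ * ∑ n (c m) + 1ℚ)
          ≡⟨ solve 5 (λ q T n h c → q :* ((con 2ℚ :+ con 2ℚ) :* T :+ (n :+ n :- con 1ℚ) :* con 0ℚ :+ con 0ℚ) :+ h :* ((n :+ n :- con 1ℚ) :* con 1ℚ :- con 2ℚ :* c :+ con 1ℚ)
               := (con 2ℚ :+ con 2ℚ) :* (q :* T) :+ h :* (n :+ n :- con 2ℚ :* c)) refl (qₙ m) T (ι n) (hbar r m) (∑ n (c m)) ⟩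
        (2ℚ + 2ℚ) * (qₙ m * T) + hbar r m * (ι n + ι n - 2ℚ * ∑ n (c m)) ∎
        where
        open ≡-Reasoning
        T = ∑ n (λ t → ι t * s m t)

    -- The finite Fourier expansion of the cotangent in terms of the sawtooth t ↦ t/n.
    fourier-null : Null (λ m → (2ℚ + 2ℚ) * (qₙ m * ∑ n (λ t → ι t * S (t ℕ.* r) m)) + (ι n + ι n) * hbar r m)
    fourier-null = Null-resp (λ m → trans (cong₂ (λ x y → x + hbar r m * y) (∑odd-e₂ m) (∑e₁ m))
        (solve 4 (λ x h n c → x :+ h :* (n :- c) :+ h :* c := x :+ n :* h) refl ((2ℚ + 2ℚ) * (qₙ m * ∑ n (λ t → ι t * s m t))) (hbar r m) (ι n + ι n) (2ℚ * ∑ n (c m))))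
      (Null-+ (Null-∑ n (λ t _ → Null-* (Bounded-const (odd t)) (proj₂ (e-null r (t ℕ.* r) r≢0))))
              (Null-* (hbar-bounded r r≢0) (Null-∑ n (λ t _ → proj₁ (e-null r (t ℕ.* r) r≢0)))))

    sine-sum-null : Null (λ m → 2ℚ * (qₙ m * ∑ n (λ t → S (t ℕ.* r) m)))
    sine-sum-null = Null-resp ∑e₂ (Null-∑ n (λ t _ → proj₂ (e-null r (t ℕ.* r) r≢0)))

-- Periodic functions

module Congruence (n : ℕ) .{{_ : ℕ.NonZero n}} where

  infix 4 _≈_
  _≈_ : ℕ → ℕ → Set
  x ≈ y = x ℕ.% n ≡ y ℕ.% n

  ≈-* : ∀ {x x′ y y′} → x ≈ x′ → y ≈ y′ → x ℕ.* y ≈ x′ ℕ.* y′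
  ≈-* {x} {x′} {y} {y′} e f = trans (ℕ.%-distribˡ-* x y n) (trans (cong₂ (λ a b → (a ℕ.* b) ℕ.% n) e f) (sym (ℕ.%-distribˡ-* x′ y′ n)))

  %-≈ : ∀ x → x ℕ.% n ≈ x
  %-≈ x = ℕ.m%n%n≡m%n x n

  *-inverse-cancel : ∀ α β x → α ℕ.* β ≈ 1 → α ℕ.* (x ℕ.* β) ≈ x
  *-inverse-cancel α β x αβ≈1 = trans (cong (ℕ._% n) (trans (cong (α ℕ.*_) (ℕₚ.*-comm x β)) (sym (ℕₚ.*-assoc α β x))))
    (trans (≈-* {α ℕ.* β} {1} {x} {x} αβ≈1 refl) (cong (ℕ._% n) (ℕₚ.*-identityˡ x)))

  -- Whole periods contribute 0, so only the last incomplete period counts.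
  ∑-periodic-bounded : ∀ (f : ℕ → ℚ) c → (∀ m → f m ≡ f (m ℕ.% n)) → (∀ m → ∣ f m ∣ ≤ c) → ∑ n f ≡ 0ℚ → ∀ i → ∣ ∑ i f ∣ ≤ ι n * c
  ∑-periodic-bounded f c per f≤c sum≡0 i = subst (λ x → ∣ x ∣ ≤ ι n * c) (sym eq)
    (≤-trans (∣∑∣≤ (i ℕ.% n) λ x _ → f≤c x) (subst (_≤ ι n * c) (sym (∑-const (i ℕ.% n) c))
      (*-monoʳ (≤-trans (ℚₚ.0≤∣p∣ (f 0)) (f≤c 0)) (ι-mono (ℕₚ.<⇒≤ (ℕ.m%n<n i n))))))
    where
    open ≡-Reasoning
    shift : ∀ j x → f (n ℕ.* j ℕ.+ x) ≡ f x
    shift j x = trans (per (n ℕ.* j ℕ.+ x)) (trans (cong f (trans (cong (ℕ._% n) (trans (ℕₚ.+-comm (n ℕ.* j) x) (cong (x ℕ.+_) (ℕₚ.*-comm n j)))) (ℕ.[m+kn]%n≡m%n x j n))) (sym (per x)))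
    eq : ∑ i f ≡ ∑ (i ℕ.% n) f
    eq = begin
      ∑ i f
        ≡⟨ cong (λ m → ∑ m f) (trans (ℕ.m≡m%n+[m/n]*n i n) (trans (ℕₚ.+-comm (i ℕ.% n) _) (cong (ℕ._+ i ℕ.% n) (ℕₚ.*-comm (i ℕ./ n) n)))) ⟩
      ∑ (n ℕ.* (i ℕ./ n) ℕ.+ i ℕ.% n) f
        ≡⟨ ∑-split (n ℕ.* (i ℕ./ n)) (i ℕ.% n) f ⟩
      ∑ (n ℕ.* (i ℕ./ n)) f + ∑ (i ℕ.% n) (λ x → f (n ℕ.* (i ℕ./ n) ℕ.+ x))
        ≡⟨ cong₂ _+_ (trans (∑-blocks n (i ℕ./ n) f) (∑-zero (i ℕ./ n) λ j _ → trans (∑-ext n (shift j)) sum≡0)) (∑-ext (i ℕ.% n) (shift (i ℕ./ n))) ⟩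
      0ℚ + ∑ (i ℕ.% n) f
        ≡⟨ ℚₚ.+-identityˡ (∑ (i ℕ.% n) f) ⟩
      ∑ (i ℕ.% n) f ∎

-- Summation by parts against decreasing weights, whose variation together with the last weight
-- telescopes to the first weight.
∑-tail-bound : ∀ (f : ℕ → ℚ) C → (∀ i → ∣ ∑ i f ∣ ≤ C) → ∀ N t →
  ∣ ∑ (N ℕ.+ t) (λ k → f k * rcp (suc k)) - ∑ N (λ k → f k * rcp (suc k)) ∣ ≤ (C + C) * rcp (suc N)
∑-tail-bound f C bd N t = subst₂ (λ x y → ∣ x ∣ ≤ (C + C) * y) (sym eq) variation
  (∣∑-abel∣≤ t (λ k → f (N ℕ.+ k)) w (C + C) (λ i → subst (λ x → ∣ x ∣ ≤ C + C)
    (trans (cong (_- ∑ N f) (∑-split N i f)) (solve 2 (λ a b → a :+ b :- a := b) refl (∑ N f) (∑ i (λ k → f (N ℕ.+ k))))) (∣-∣≤ (bd (N ℕ.+ i)) (bd N))))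
  where
  w : ℕ → ℚ
  w k = rcp (suc (N ℕ.+ k))
  eq : ∑ (N ℕ.+ t) (λ k → f k * rcp (suc k)) - ∑ N (λ k → f k * rcp (suc k)) ≡ ∑ t (λ k → f (N ℕ.+ k) * w k)
  eq = trans (cong (_- ∑ N (λ k → f k * rcp (suc k))) (∑-split N t (λ k → f k * rcp (suc k))))
    (solve 2 (λ a b → a :+ b :- a := b) refl (∑ N (λ k → f k * rcp (suc k))) (∑ t (λ k → f (N ℕ.+ k) * w k)))
  variation : ∣ w t ∣ + ∑ t (λ i → ∣ w i - w (suc i) ∣) ≡ rcp (suc N)
  variation = trans (cong₂ _+_ (∣rcp∣ (suc (N ℕ.+ t))) (trans (∑-ext t λ i → trans (ℚₚ.0≤p⇒∣p∣≡p (0≤-diff (rcp-anti (s≤s z≤n) (s≤s (ℕₚ.+-monoʳ-≤ N (ℕₚ.n≤1+n i))))))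
      (solve 2 (λ a b → a :- b := :- (b :- a)) refl (w i) (w (suc i)))) (trans (∑-neg t (λ i → w (suc i) - w i)) (cong -_ (∑-telescope t w)))))
    (trans (solve 2 (λ a b → a :+ :- (a :- b) := b) refl (w t) (w 0)) (cong (λ m → rcp (suc m)) (ℕₚ.+-identityʳ N)))

-- From a constant sawtooth sum to a vanishing series with partial sums O(1/N).

module Transfer (n : ℕ) (1≤n : 1 ℕ.≤ n) (k : ℕ) (α β : ℕ → ℕ) (K : ℚ) where

  private
    instance
      n≢0 : ℕ.NonZero n
      n≢0 = ℕ.>-nonZero 1≤n

  open Cotangent n 1≤n using (P; h; qₙ; den; P-unique)
  open Addition n 1≤n
  open Period n 1≤n
  open Congruence n

  module _ (αβ : ∀ i → α i ℕ.* β i ≈ 1)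
           (sawtooth : ∀ z → z ℕ.% n ≢ 0 → ∑ k (λ i → ι ((α i ℕ.* z) ℕ.% n)) ≡ K) where

    -- Multiplication by β permutes the residues with inverse α; the substitution z = tβ moves the
    -- unit from the sine onto the sawtooth.
    reindex : ∀ i g m → ∑ n (λ t → ι t * S (t ℕ.* (β i ℕ.* g)) m) ≡ ∑ n (λ z → ι ((α i ℕ.* z) ℕ.% n) * S (z ℕ.* g) m)
    reindex i g m = begin
      ∑ n (λ t → ι t * S (t ℕ.* (β i ℕ.* g)) m)
        ≡⟨ ∑-ext n (λ t → trans (cong (ι t *_) (S-periodic (t ℕ.* (β i ℕ.* g)) ((t ℕ.* β i) ℕ.% n ℕ.* g) m
             (trans (cong (ℕ._% n) (sym (ℕₚ.*-assoc t (β i) g))) (sym (≈-* {(t ℕ.* β i) ℕ.% n} {t ℕ.* β i} {g} {g} (%-≈ (t ℕ.* β i)) refl)))))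
             (sym (∑-pick n (λ z → z ℕ.≟ (t ℕ.* β i) ℕ.% n) (λ z → ι t * S (z ℕ.* g) m) ((t ℕ.* β i) ℕ.% n) (ℕ.m%n<n (t ℕ.* β i) n) refl (λ _ _ e → e)))) ⟩
      ∑ n (λ t → ∑ n (λ z → 𝟙 (z ℕ.≟ (t ℕ.* β i) ℕ.% n) * (ι t * S (z ℕ.* g) m)))
        ≡⟨ ∑-swap n n (λ t z → 𝟙 (z ℕ.≟ (t ℕ.* β i) ℕ.% n) * (ι t * S (z ℕ.* g) m)) ⟩
      ∑ n (λ z → ∑ n (λ t → 𝟙 (z ℕ.≟ (t ℕ.* β i) ℕ.% n) * (ι t * S (z ℕ.* g) m)))
        ≡⟨ ∑-cong n (λ z z<n → ∑-pick n (λ t → z ℕ.≟ (t ℕ.* β i) ℕ.% n) (λ t → ι t * S (z ℕ.* g) m) ((α i ℕ.* z) ℕ.% n) (ℕ.m%n<n (α i ℕ.* z) n)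
             (sym (trans (≈-* {(α i ℕ.* z) ℕ.% n} {α i ℕ.* z} {β i} {β i} (%-≈ (α i ℕ.* z)) refl)
               (trans (cong (ℕ._% n) (ℕₚ.*-assoc (α i) z (β i))) (trans (*-inverse-cancel (α i) (β i) z (αβ i)) (ℕ.m<n⇒m%n≡m z<n)))))
             (λ t t<n e → sym (trans (cong (λ y → (α i ℕ.* y) ℕ.% n) e) (trans (≈-* {α i} {α i} {(t ℕ.* β i) ℕ.% n} {t ℕ.* β i} refl (%-≈ (t ℕ.* β i)))
               (trans (*-inverse-cancel (α i) (β i) t (αβ i)) (ℕ.m<n⇒m%n≡m t<n)))))) ⟩
      ∑ n (λ z → ι ((α i ℕ.* z) ℕ.% n) * S (z ℕ.* g) m) ∎
      where open ≡-Reasoning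

    -- After reindexing, the sum over i acts on the sawtooth alone and is the constant `K`, except
    -- at z = 0, where `S` vanishes.
    ∑-sawtooth : ∀ g m → ∑ k (λ i → ∑ n (λ t → ι t * S (t ℕ.* (β i ℕ.* g)) m)) ≡ K * ∑ n (λ z → S (z ℕ.* g) m)
    ∑-sawtooth g m = begin
      ∑ k (λ i → ∑ n (λ t → ι t * S (t ℕ.* (β i ℕ.* g)) m))          ≡⟨ ∑-ext k (λ i → reindex i g m) ⟩
      ∑ k (λ i → ∑ n (λ z → ι ((α i ℕ.* z) ℕ.% n) * S (z ℕ.* g) m))  ≡⟨ ∑-swap k n (λ i z → ι ((α i ℕ.* z) ℕ.% n) * S (z ℕ.* g) m) ⟩
      ∑ n (λ z → ∑ k (λ i → ι ((α i ℕ.* z) ℕ.% n) * S (z ℕ.* g) m))  ≡⟨ ∑-cong n (λ z z<n → trans (∑-*ʳ k (S (z ℕ.* g) m) (λ i → ι ((α i ℕ.* z) ℕ.% n))) (level z z<n)) ⟩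
      ∑ n (λ z → K * S (z ℕ.* g) m)                                  ≡⟨ ∑-*ˡ n K (λ z → S (z ℕ.* g) m) ⟩
      K * ∑ n (λ z → S (z ℕ.* g) m)                                  ∎
      where
      open ≡-Reasoning
      level : ∀ z → z ℕ.< n → ∑ k (λ i → ι ((α i ℕ.* z) ℕ.% n)) * S (z ℕ.* g) m ≡ K * S (z ℕ.* g) m
      level zero    _   = trans (*0 (∑ k (λ i → ι ((α i ℕ.* 0) ℕ.% n))) S0) (sym (*0 K S0))
        where S0 = S-0 0 m (ℕ.m<n⇒m%n≡m 1≤n)
      level (suc z) z<n = cong (_* S (suc z ℕ.* g) m) (sawtooth (suc z) λ e → ℕₚ.1+n≢0 (trans (sym (ℕ.m<n⇒m%n≡m z<n)) e))

    -- Each cotangent is replaced by its Fourier expansion; the sum over i leaves `K` times a full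
    -- sum of sines, which is null.
    ∑hbar-null : ∀ g → g ℕ.% n ≢ 0 → (∀ i → (β i ℕ.* g) ℕ.% n ≢ 0) → Null (λ m → ∑ k (λ i → hbar (β i ℕ.* g) m))
    ∑hbar-null g g≢0 βg≢0 = Null-resp cancel (Null-* (Bounded-const (rcp (n ℕ.+ n)))
      (Null-+ (Null-∑ k λ i _ → fourier-null (β i ℕ.* g) (βg≢0 i)) (Null-* (Bounded-const (- (K + K))) (sine-sum-null g g≢0))))
      where
      open ≡-Reasoning
      cancel : ∀ m → rcp (n ℕ.+ n) * (∑ k (λ i → (1ℚ + 1ℚ + (1ℚ + 1ℚ)) * (qₙ m * ∑ n (λ t → ι t * S (t ℕ.* (β i ℕ.* g)) m)) + (ι n + ι n) * hbar (β i ℕ.* g) m)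
                 + - (K + K) * ((1ℚ + 1ℚ) * (qₙ m * ∑ n (λ t → S (t ℕ.* g) m)))) ≡ ∑ k (λ i → hbar (β i ℕ.* g) m)
      cancel m = begin
        rcp (n ℕ.+ n) * (∑ k (λ i → f * (q * U i) + (ι n + ι n) * hbar (β i ℕ.* g) m) + - (K + K) * ((1ℚ + 1ℚ) * (q * V)))
          ≡⟨ cong (λ z → rcp (n ℕ.+ n) * (z + - (K + K) * ((1ℚ + 1ℚ) * (q * V)))) (trans (∑-+ k (λ i → f * (q * U i)) (λ i → (ι n + ι n) * hbar (β i ℕ.* g) m))
               (cong₂ _+_ (trans (∑-*ˡ k f (λ i → q * U i)) (cong (f *_) (trans (∑-*ˡ k q U) (cong (q *_) (∑-sawtooth g m))))) (∑-*ˡ k (ι n + ι n) (λ i → hbar (β i ℕ.* g) m)))) ⟩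
        rcp (n ℕ.+ n) * (f * (q * (K * V)) + (ι n + ι n) * W + - (K + K) * ((1ℚ + 1ℚ) * (q * V)))
          ≡⟨ solve 6 (λ r q k v w n → r :* ((con 1ℚ :+ con 1ℚ :+ (con 1ℚ :+ con 1ℚ)) :* (q :* (k :* v)) :+ n :* w :+ :- (k :+ k) :* ((con 1ℚ :+ con 1ℚ) :* (q :* v))) := (n :* r) :* w) refl
               (rcp (n ℕ.+ n)) q K V W (ι n + ι n) ⟩
        (ι n + ι n) * rcp (n ℕ.+ n) * W
          ≡⟨ cong (_* W) (trans (cong (_* rcp (n ℕ.+ n)) (sym (ι-+ n n))) (ι*rcp (ℕₚ.≤-trans 1≤n (ℕₚ.m≤m+n n n)))) ⟩
        1ℚ * W
          ≡⟨ ℚₚ.*-identityˡ W ⟩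
        W ∎
        where
        f = 1ℚ + 1ℚ + (1ℚ + 1ℚ)
        q = qₙ m
        U : ℕ → ℚ
        U i = ∑ n (λ t → ι t * S (t ℕ.* (β i ℕ.* g)) m)
        V = ∑ n (λ t → S (t ℕ.* g) m)
        W = ∑ k (λ i → hbar (β i ℕ.* g) m)

  -- The index -1 - j contributes -1/(nj + (n - y)) and is paired with the index j, which leaves the
  -- index M unpaired.
  h-residues : ∀ M y → 1 ℕ.≤ y → y ℕ.≤ n → ¬ (n ∣ y) → h M (ℤ.+ y) ≡ ∑ M (λ j → rcp (n ℕ.* j ℕ.+ y) - rcp (n ℕ.* j ℕ.+ (n ℕ.∸ y))) + rcp (n ℕ.* M ℕ.+ y)
  h-residues M y 1≤y y≤n n∤y = go M
    where
    P⁺≡ : ∀ j → P (ℤ.+ y) (ℤ.+ j) ≡ rcp (n ℕ.* j ℕ.+ y)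
    P⁺≡ j = sym (P-unique (ℤ.+ y) (ℤ.+ j) (trans (cong (_* rcp (n ℕ.* j ℕ.+ y)) (trans (cong (λ z → ιℤ (ℤ.+ y ℤ.+ z)) (sym (ℤₚ.pos-* n j))) (cong ι (ℕₚ.+-comm y (n ℕ.* j)))))
      (ι*rcp (ℕₚ.≤-trans 1≤y (ℕₚ.m≤n+m y (n ℕ.* j))))))
    P⁻≡ : ∀ M → P (ℤ.+ y) ℤ.-[1+ M ] ≡ - rcp (n ℕ.* M ℕ.+ (n ℕ.∸ y))
    P⁻≡ M = sym (P-unique (ℤ.+ y) ℤ.-[1+ M ] (trans (cong (_* (- rcp D′)) d≡) (trans (solve 2 (λ x r → (:- x) :* (:- r) := x :* r) refl (ι D′) (rcp D′))
      (ι*rcp (ℕₚ.≤-trans (ℕₚ.m<n⇒0<n∸m (ℕₚ.≤∧≢⇒< y≤n λ e → n∤y (subst (n ∣_) (sym e) ℕ∣.∣-refl))) (ℕₚ.m≤n+m (n ℕ.∸ y) (n ℕ.* M)))))))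
      where
      open ≡-Reasoning
      D′ = n ℕ.* M ℕ.+ (n ℕ.∸ y)
      d≡ : ιℤ (den (ℤ.+ y) ℤ.-[1+ M ]) ≡ - ι D′
      d≡ = begin
        ιℤ (den (ℤ.+ y) ℤ.-[1+ M ])          ≡⟨ trans (ιℤ-+ (ℤ.+ y) (ℤ.+ n ℤ.* ℤ.-[1+ M ])) (cong (ι y +_) (ιℤ-*⁺ n ℤ.-[1+ M ])) ⟩
        ι y + ι n * (- (1ℚ + ι M))           ≡⟨ solve 3 (λ y n m → y :+ n :* (:- (con 1ℚ :+ m)) := :- (n :* m :+ (n :- y))) refl (ι y) (ι n) (ι M) ⟩
        - (ι n * ι M + (ι n - ι y))          ≡⟨ cong -_ (sym (trans (ι-+ (n ℕ.* M) (n ℕ.∸ y)) (cong₂ _+_ (ι-* n M) (ι-∸ y≤n)))) ⟩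
        - ι D′                               ∎
    go : ∀ M → h M (ℤ.+ y) ≡ ∑ M (λ j → rcp (n ℕ.* j ℕ.+ y) - rcp (n ℕ.* j ℕ.+ (n ℕ.∸ y))) + rcp (n ℕ.* M ℕ.+ y)
    go zero    = trans (∑±-expand 0 (P (ℤ.+ y))) (trans (cong₂ _+_ (P⁺≡ 0) (∑₁-∑ 0 (λ j → P (ℤ.+ y) (ℤ.+ j) + P (ℤ.+ y) (ℤ.- (ℤ.+ j))))) (ℚₚ.+-comm (rcp (n ℕ.* 0 ℕ.+ y)) 0ℚ))
    go (suc M) = trans (∑±-suc M (P (ℤ.+ y))) (trans (cong₂ _+_ (go M) (cong₂ _+_ (P⁺≡ (suc M)) (P⁻≡ M)))
      (solve 4 (λ s a b c → (s :+ a) :+ (b :+ :- c) := (s :+ (a :- c)) :+ b) refl (∑ M (λ j → rcp (n ℕ.* j ℕ.+ y) - rcp (n ℕ.* j ℕ.+ (n ℕ.∸ y)))) (rcp (n ℕ.* M ℕ.+ y)) (rcp (n ℕ.* suc M ℕ.+ y)) (rcp (n ℕ.* M ℕ.+ (n ℕ.∸ y)))))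

  module _ (y : ℕ → ℕ) (0<y : ∀ i → 1 ℕ.≤ y i) (y<n : ∀ i → y i ℕ.< n) (null : Null (λ m → ∑ k (λ i → h (suc m) (ℤ.+ y i)))) where

    v : ℕ → ℚ
    v m = ∑ k (λ i → 𝟙 (m ℕ.% n ℕ.≟ y i) - 𝟙 (m ℕ.% n ℕ.≟ n ℕ.∸ y i))

    private
      y⁻<n : ∀ i → n ℕ.∸ y i ℕ.< n
      y⁻<n i = ℕₚ.∸-monoʳ-< {n} {y i} {0} (0<y i) (ℕₚ.<⇒≤ (y<n i))

      n∤y : ∀ i → ¬ (n ∣ y i)
      n∤y i = ℕ∣.>⇒∤ {{ℕ.>-nonZero (0<y i)}} (y<n i)

    ∣v∣≤ : ∀ m → ∣ v m ∣ ≤ ι k * (1ℚ + 1ℚ)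
    ∣v∣≤ m = subst (∣ v m ∣ ≤_) (∑-const k (1ℚ + 1ℚ)) (∣∑∣≤ k λ i _ → ∣-∣≤ (le (m ℕ.% n ℕ.≟ y i)) (le (m ℕ.% n ℕ.≟ n ℕ.∸ y i)))
      where
      le : ∀ {A : Set} (d : Dec A) → ∣ 𝟙 d ∣ ≤ 1ℚ
      le d = subst (_≤ 1ℚ) (sym (ℚₚ.0≤p⇒∣p∣≡p (0≤𝟙 d))) (𝟙≤1 d)

    v-0 : v 0 ≡ 0ℚ
    v-0 = ∑-zero k λ i _ → trans (cong₂ _-_ (𝟙-no (0 ℕ.% n ℕ.≟ y i) λ e → ℕₚ.<⇒≢ (0<y i) (trans (sym (ℕ.m<n⇒m%n≡m 1≤n)) e))
      (𝟙-no (0 ℕ.% n ℕ.≟ n ℕ.∸ y i) λ e → ℕₚ.<⇒≢ (ℕₚ.m<n⇒0<n∸m (y<n i)) (trans (sym (ℕ.m<n⇒m%n≡m 1≤n)) e))) refl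

    ∑-v : ∀ (w : ℕ → ℚ) j → ∑ n (λ x → v (n ℕ.* j ℕ.+ x) * w x) ≡ ∑ k (λ i → w (y i) - w (n ℕ.∸ y i))
    ∑-v w j = begin
      ∑ n (λ x → v (n ℕ.* j ℕ.+ x) * w x)
        ≡⟨ ∑-cong n (λ x x<n → trans (sym (∑-*ʳ k (w x) _)) (∑-ext k λ i → trans
             (cong (λ z → (𝟙 (z ℕ.≟ y i) - 𝟙 (z ℕ.≟ n ℕ.∸ y i)) * w x) (red x x<n))
             (solve 3 (λ a b c → (a :- b) :* c := a :* c :- b :* c) refl (𝟙 (x ℕ.≟ y i)) (𝟙 (x ℕ.≟ n ℕ.∸ y i)) (w x)))) ⟩
      ∑ n (λ x → ∑ k (λ i → 𝟙 (x ℕ.≟ y i) * w x - 𝟙 (x ℕ.≟ n ℕ.∸ y i) * w x))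
        ≡⟨ ∑-swap n k (λ x i → 𝟙 (x ℕ.≟ y i) * w x - 𝟙 (x ℕ.≟ n ℕ.∸ y i) * w x) ⟩
      ∑ k (λ i → ∑ n (λ x → 𝟙 (x ℕ.≟ y i) * w x - 𝟙 (x ℕ.≟ n ℕ.∸ y i) * w x))
        ≡⟨ ∑-ext k (λ i → trans (∑-- n (λ x → 𝟙 (x ℕ.≟ y i) * w x) (λ x → 𝟙 (x ℕ.≟ n ℕ.∸ y i) * w x))
             (cong₂ _-_ (∑-pick n (ℕ._≟ y i) w (y i) (y<n i) refl (λ _ _ e → e)) (∑-pick n (ℕ._≟ n ℕ.∸ y i) w (n ℕ.∸ y i) (y⁻<n i) refl (λ _ _ e → e)))) ⟩
      ∑ k (λ i → w (y i) - w (n ℕ.∸ y i)) ∎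
      where
      open ≡-Reasoning
      red : ∀ x → x ℕ.< n → (n ℕ.* j ℕ.+ x) ℕ.% n ≡ x
      red x x<n = trans (cong (ℕ._% n) (trans (ℕₚ.+-comm (n ℕ.* j) x) (cong (x ℕ.+_) (ℕₚ.*-comm n j)))) (trans (ℕ.[m+kn]%n≡m%n x j n) (ℕ.m<n⇒m%n≡m x<n))

    C₂ : ℚ
    C₂ = ι n * (ι k * (1ℚ + 1ℚ))

    v-sum : ∀ i → ∣ ∑ i (v ∘ suc) ∣ ≤ C₂
    v-sum i = subst (λ x → ∣ x ∣ ≤ C₂) (trans (∑-head i v) (trans (cong (_+ ∑ i (v ∘ suc)) v-0) (ℚₚ.+-identityˡ (∑ i (v ∘ suc)))))
      (∑-periodic-bounded v (ι k * (1ℚ + 1ℚ)) (λ m → ∑-ext k λ i → cong (λ z → 𝟙 (z ℕ.≟ y i) - 𝟙 (z ℕ.≟ n ℕ.∸ y i)) (sym (%-≈ m))) ∣v∣≤ total (suc i))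
      where
      total : ∑ n v ≡ 0ℚ
      total = trans (∑-ext n λ x → trans (sym (ℚₚ.*-identityʳ (v x))) (cong (λ z → v z * 1ℚ) (sym (cong (ℕ._+ x) (ℕₚ.*-zeroʳ n)))))
        (trans (∑-v (λ _ → 1ℚ) 0) (∑-zero k λ _ _ → ℚₚ.+-inverseʳ 1ℚ))

    L : ℕ → ℚ
    L N = ∑ N (λ m → v (suc m) * rcp (suc m))

    private
      -- Cut just before a multiple of n, the series regroups by residues into symmetric partial
      -- sums of cotangents, less the unpaired end term of each.
      L-block : ∀ m → L (ℕ.pred (n ℕ.* suc m)) ≡ ∑ k (λ i → h (suc m) (ℤ.+ y i) - rcp (n ℕ.* suc m ℕ.+ y i))
      L-block m = begin
        L N′
          ≡⟨ sym (trans (∑-head N′ V) (trans (cong (_+ L N′) (0* (rcp 0) v-0)) (ℚₚ.+-identityˡ (L N′)))) ⟩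
        ∑ (suc N′) V
          ≡⟨ cong (λ z → ∑ z V) (ℕₚ.suc-pred (n ℕ.* suc m) {{ℕ.>-nonZero (ℕₚ.*-mono-≤ 1≤n (s≤s {n = m} z≤n))}}) ⟩
        ∑ (n ℕ.* suc m) V
          ≡⟨ trans (∑-blocks n (suc m) V) (∑-ext (suc m) λ j → ∑-v (λ x → rcp (n ℕ.* j ℕ.+ x)) j) ⟩
        ∑ (suc m) (λ j → ∑ k (λ i → rcp (n ℕ.* j ℕ.+ y i) - rcp (n ℕ.* j ℕ.+ (n ℕ.∸ y i))))
          ≡⟨ ∑-swap (suc m) k (λ j i → rcp (n ℕ.* j ℕ.+ y i) - rcp (n ℕ.* j ℕ.+ (n ℕ.∸ y i))) ⟩
        ∑ k (λ i → ∑ (suc m) (λ j → rcp (n ℕ.* j ℕ.+ y i) - rcp (n ℕ.* j ℕ.+ (n ℕ.∸ y i))))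
          ≡⟨ ∑-ext k (λ i → sym (trans (cong (_- rcp (n ℕ.* suc m ℕ.+ y i)) (h-residues (suc m) (y i) (0<y i) (ℕₚ.<⇒≤ (y<n i)) (n∤y i)))
               (solve 2 (λ s r → s :+ r :- r := s) refl (∑ (suc m) (λ j → rcp (n ℕ.* j ℕ.+ y i) - rcp (n ℕ.* j ℕ.+ (n ℕ.∸ y i)))) (rcp (n ℕ.* suc m ℕ.+ y i))))) ⟩
        ∑ k (λ i → h (suc m) (ℤ.+ y i) - rcp (n ℕ.* suc m ℕ.+ y i)) ∎
        where
        open ≡-Reasoning
        N′ = ℕ.pred (n ℕ.* suc m)
        V : ℕ → ℚ
        V x = v x * rcp x

      L-null : Null (λ m → L (ℕ.pred (n ℕ.* suc m)))
      L-null = Null-resp (λ m → trans (sym (∑-- k (λ i → h (suc m) (ℤ.+ y i)) (λ i → rcp (n ℕ.* suc m ℕ.+ y i)))) (sym (L-block m)))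
        (Null-+ null (Null-neg (Null-∑ k λ i _ → 1ℚ + 1ℚ , λ m → subst (_≤ (1ℚ + 1ℚ) * δ m) (sym (∣rcp∣ (n ℕ.* suc m ℕ.+ y i)))
          (≤-trans (rcp-anti (s≤s z≤n) (ℕₚ.≤-trans (m≤d*m (suc m) 1≤n) (ℕₚ.m≤m+n (n ℕ.* suc m) (y i)))) (rcp≤2δ m)))))

    private
      -- `L` tends to 0 along the cuts, so `L N` is the negative of a tail, and by `∑-tail-bound` a
      -- tail is at most 2C₂/(N + 1). The null remainder is removed by letting m grow along
      -- `δ-small`.
      v-log′ : Null (λ m → L (ℕ.pred (n ℕ.* suc m))) → ∀ N → ι N * ∣ L N ∣ ≤ C₂ + C₂
      v-log′ (CL , L-bd) N = ≤-by (- X) (subst (0ℚ ≤_) (ℚₚ.+-identityˡ (- X)) (0≤-diff (ι*-bounded⇒≤0 (ι N * (B * (1ℚ + 1ℚ))) bounded)))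
          (solve 2 (λ c x → c := x :+ :- (x :- c)) refl (C₂ + C₂) (ι N * ∣ L N ∣))
        where
        X = ι N * ∣ L N ∣ - (C₂ + C₂)
        B = ∣ CL ∣
        L≤ : ∀ m → N ℕ.≤ m → ∣ L N ∣ ≤ (C₂ + C₂) * rcp (suc N) + B * δ m
        L≤ m N≤m = subst (λ x → ∣ x ∣ ≤ (C₂ + C₂) * rcp (suc N) + B * δ m) (solve 2 (λ a b → :- (a :- b) :+ a := b) refl (L N′) (L N))
          (∣+∣≤ (subst (_≤ (C₂ + C₂) * rcp (suc N)) (sym (ℚₚ.∣-p∣≡∣p∣ (L N′ - L N)))
            (subst (λ z → ∣ L z - L N ∣ ≤ (C₂ + C₂) * rcp (suc N)) (ℕₚ.m+[n∸m]≡n N≤N′) (∑-tail-bound (v ∘ suc) C₂ v-sum N (N′ ℕ.∸ N))))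
            (≤-trans (L-bd m) (*-monoʳ (0≤δ m) (p≤∣p∣ (CL)))))
          where
          N′ = ℕ.pred (n ℕ.* suc m)
          N≤N′ : N ℕ.≤ N′
          N≤N′ = ℕₚ.≤-trans N≤m (ℕₚ.≤-pred (subst (suc m ℕ.≤_) (sym (ℕₚ.suc-pred (n ℕ.* suc m) {{ℕ.>-nonZero (ℕₚ.*-mono-≤ 1≤n (s≤s {n = m} z≤n))}})) (m≤d*m (suc m) 1≤n)))
        0≤C₂ : 0ℚ ≤ C₂ + C₂
        0≤C₂ = 0≤+ (v-sum 0) (v-sum 0)
        bounded : ∀ p → ι (suc p) * X ≤ ι N * (B * (1ℚ + 1ℚ))
        bounded p = bounded′ (δ-small N p)
          where
          bounded′ : (∃ λ m → (N ℕ.≤ m) × (ι (suc p) * δ m ≤ 1ℚ + 1ℚ)) → ι (suc p) * X ≤ ι N * (B * (1ℚ + 1ℚ))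
          bounded′ (m , N≤m , δ≤) = ≤-trans (*-monoˡ (0≤ι (suc p)) X≤) (subst (_≤ ι N * (B * (1ℚ + 1ℚ)))
                (solve 4 (λ n b p d → n :* (b :* (p :* d)) := p :* (n :* (b :* d))) refl (ι N) B (ι (suc p)) (δ m)) (*-monoˡ (0≤ι N) (*-monoˡ (ℚₚ.0≤∣p∣ (CL)) δ≤)))
            where
            X≤ : X ≤ ι N * (B * δ m)
            X≤ = ≤-trans (ℚₚ.+-monoˡ-≤ (- (C₂ + C₂)) (*-monoˡ (0≤ι N) (L≤ m N≤m))) (≤-by ((C₂ + C₂) * rcp (suc N)) (0≤* 0≤C₂ (0≤rcp (suc N)))
              (sym (trans (solve 5 (λ n b d c r → (n :* (c :* r :+ b :* d) :+ :- c) :+ c :* r := n :* (b :* d) :+ c :* ((con 1ℚ :+ n) :* r) :- c) refl (ι N) B (δ m) (C₂ + C₂) (rcp (suc N)))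
                (trans (cong (λ z → ι N * (B * δ m) + (C₂ + C₂) * z - (C₂ + C₂)) (ι*rcp {suc N} (s≤s z≤n)))
                  (solve 2 (λ x c → x :+ c :* con 1ℚ :- c := x) refl (ι N * (B * δ m)) (C₂ + C₂))))))

    v-log : ∀ N → ι N * ∣ L N ∣ ≤ C₂ + C₂
    v-log = v-log′ L-null

-- Units modulo n

coprime-* : ∀ {m k n} → Coprime m n → Coprime k n → Coprime (m ℕ.* k) n
coprime-* {m} {k} {n} cm ck {d} (d∣mk , d∣n) = ck (Cop.coprime-divisor (λ (e∣d , e∣m) → cm (e∣m , ℕ∣.∣-trans e∣d d∣n)) d∣mk , d∣n)

coprime-*ˡ : ∀ {m k n} → Coprime (m ℕ.* k) n → Coprime m n
coprime-*ˡ {k = k} c (d∣m , d∣n) = c (ℕ∣.∣m⇒∣m*n k d∣m , d∣n)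

coprime-*ʳ : ∀ {m k n} → Coprime (m ℕ.* k) n → Coprime k n
coprime-*ʳ {m} c (d∣k , d∣n) = c (ℕ∣.∣n⇒∣m*n m d∣k , d∣n)

module Units (n : ℕ) .{{_ : ℕ.NonZero n}} where
  open Congruence n

  coprime-≈ : ∀ {x y} → x ≈ y → Coprime x n → Coprime y n
  coprime-≈ {x} {y} e c (d∣y , d∣n) = c (ℕ∣.∣n∣m%n⇒∣m d∣n (subst (_ ∣_) (sym e) (ℕ∣.%-presˡ-∣ d∣y d∣n)) , d∣n)

  unit-inverse : ∀ {x} → Coprime x n → ∃ λ y → x ℕ.* y ≈ 1
  unit-inverse {x} c with Cop.coprime-Bézout c
  ... | GCD.Bézout.+- a b e = a , trans (cong (ℕ._% n) (trans (ℕₚ.*-comm x a) (sym e))) (ℕ.[m+kn]%n≡m%n 1 b n)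
  ... | GCD.Bézout.-+ a b e = ℕ.pred n ℕ.* a , trans (sym (ℕ.[m+kn]%n≡m%n (x ℕ.* (ℕ.pred n ℕ.* a)) b n))
        (trans (cong (ℕ._% n) eq) (ℕ.[m+kn]%n≡m%n 1 (x ℕ.* a) n))
    where
    eq : x ℕ.* (ℕ.pred n ℕ.* a) ℕ.+ b ℕ.* n ≡ 1 ℕ.+ (x ℕ.* a) ℕ.* n
    eq = trans (cong₂ ℕ._+_ (trans (sym (ℕₚ.*-assoc x (ℕ.pred n) a)) (trans (cong (ℕ._* a) (ℕₚ.*-comm x (ℕ.pred n))) (ℕₚ.*-assoc (ℕ.pred n) x a))) (sym e))
      (trans (ℕₚ.+-suc (ℕ.pred n ℕ.* (x ℕ.* a)) (a ℕ.* x)) (cong suc (trans (cong (ℕ.pred n ℕ.* (x ℕ.* a) ℕ.+_) (ℕₚ.*-comm a x))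
        (trans (ℕₚ.+-comm (ℕ.pred n ℕ.* (x ℕ.* a)) (x ℕ.* a)) (trans (cong (ℕ._* (x ℕ.* a)) (ℕₚ.suc-pred n)) (ℕₚ.*-comm n (x ℕ.* a)))))))

  cancel-unit : ∀ {x a b} → Coprime x n → x ℕ.* a ≈ x ℕ.* b → a ≈ b
  cancel-unit {x} {a} {b} c e with unit-inverse c
  ... | y , xy≈1 = trans (sym (unfold a)) (trans (≈-* {y} {y} refl e) (unfold b))
    where
    unfold : ∀ a → y ℕ.* (x ℕ.* a) ≈ a
    unfold a = trans (cong (ℕ._% n) (trans (sym (ℕₚ.*-assoc y x a)) (cong (ℕ._* a) (ℕₚ.*-comm y x)))) (trans (≈-* {x ℕ.* y} {1} {a} {a} xy≈1 refl) (cong (ℕ._% n) (ℕₚ.*-identityˡ a)))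

  ∑-unit : ∀ d (F : ℕ → ℚ) → Coprime d n → ∑ n F ≡ ∑ n (λ x → F ((d ℕ.* x) ℕ.% n))
  ∑-unit d F c = begin
    ∑ n F
      ≡⟨ ∑-cong n (λ g g<n → sym (∑-pick n (λ x → g ℕ.≟ (d ℕ.* x) ℕ.% n) (λ _ → F g) (x₀ g) (ℕ.m%n<n (y ℕ.* g) n) (hit g g<n) (λ x x<n e → sym (unique g x x<n e)))) ⟩
    ∑ n (λ g → ∑ n (λ x → 𝟙 (g ℕ.≟ (d ℕ.* x) ℕ.% n) * F g))
      ≡⟨ ∑-swap n n (λ g x → 𝟙 (g ℕ.≟ (d ℕ.* x) ℕ.% n) * F g) ⟩
    ∑ n (λ x → ∑ n (λ g → 𝟙 (g ℕ.≟ (d ℕ.* x) ℕ.% n) * F g))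
      ≡⟨ ∑-ext n (λ x → ∑-pick n (λ g → g ℕ.≟ (d ℕ.* x) ℕ.% n) F ((d ℕ.* x) ℕ.% n) (ℕ.m%n<n (d ℕ.* x) n) refl (λ _ _ e → e)) ⟩
    ∑ n (λ x → F ((d ℕ.* x) ℕ.% n)) ∎
    where
    open ≡-Reasoning
    y = proj₁ (unit-inverse c)
    dy≈1 = proj₂ (unit-inverse c)
    x₀ : ℕ → ℕ
    x₀ g = (y ℕ.* g) ℕ.% n
    hit : ∀ g → g ℕ.< n → g ≡ (d ℕ.* x₀ g) ℕ.% n
    hit g g<n = sym (trans (≈-* {d} {d} {x₀ g} {y ℕ.* g} refl (%-≈ (y ℕ.* g))) (trans (cong (λ z → (d ℕ.* z) ℕ.% n) (ℕₚ.*-comm y g)) (trans (*-inverse-cancel d y g dy≈1) (ℕ.m<n⇒m%n≡m g<n))))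
    unique : ∀ g x → x ℕ.< n → g ≡ (d ℕ.* x) ℕ.% n → x₀ g ≡ x
    unique g x x<n e = trans (cong (λ z → (y ℕ.* z) ℕ.% n) e) (trans (≈-* {y} {y} {(d ℕ.* x) ℕ.% n} {d ℕ.* x} refl (%-≈ (d ℕ.* x)))
      (trans (cong (λ z → (y ℕ.* z) ℕ.% n) (ℕₚ.*-comm d x)) (trans (*-inverse-cancel y d x (trans (cong (ℕ._% n) (ℕₚ.*-comm y d)) dy≈1)) (ℕ.m<n⇒m%n≡m x<n))))

  lam : ℕ → ℚ
  lam m = 𝟙 (coprime? m n)

  lam-≈ : ∀ {x y} → x ≈ y → lam x ≡ lam y
  lam-≈ {x} {y} e = 𝟙-⇔ (coprime? x n) (coprime? y n) (coprime-≈ e) (coprime-≈ (sym e))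

  lam-* : ∀ a b → lam (a ℕ.* b) ≡ lam a * lam b
  lam-* a b = sym (𝟙-× (coprime? a n) (coprime? b n) (coprime? (a ℕ.* b) n) coprime-* (λ c → coprime-*ˡ {a} {b} c , coprime-*ʳ {a} {b} c))

  lam-idem : ∀ m → lam m * lam m ≡ lam m
  lam-idem m = 𝟙-× (coprime? m n) (coprime? m n) (coprime? m n) (λ c _ → c) (λ c → c , c)

  lam-prog : ∀ i → lam (suc (n ℕ.* i)) ≡ 1ℚ
  lam-prog i = 𝟙-yes (coprime? (suc (n ℕ.* i)) n) (λ {d} (d∣1+ni , d∣n) → ℕ∣.∣1⇒≡1 (ℕ∣.∣m+n∣m⇒∣n (subst (d ∣_) (ℕₚ.+-comm 1 (n ℕ.* i)) d∣1+ni) (ℕ∣.∣m⇒∣m*n i d∣n)))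

  lam-1 : lam 1 ≡ 1ℚ
  lam-1 = trans (cong (λ z → lam (suc z)) (sym (ℕₚ.*-zeroʳ n))) (lam-prog 0)

  -- Half of the density φ(n)/n of the units, matching the slope σ + σ in `Riesz`.
  σ : ℚ
  σ = ∑ n lam * rcp (n ℕ.+ n)

  0≤σ : 0ℚ ≤ σ
  0≤σ = 0≤* (0≤∑ n λ i _ → 0≤𝟙 (coprime? i n)) (0≤rcp (n ℕ.+ n))

  private
    f : ℕ → ℚ
    f m = lam m - (σ + σ)
    Cf = 1ℚ + (σ + σ)

    ∣f∣≤ : ∀ m → ∣ f m ∣ ≤ Cf
    ∣f∣≤ m = ∣-∣≤ {lam m} (subst (_≤ 1ℚ) (sym (ℚₚ.0≤p⇒∣p∣≡p (0≤𝟙 (coprime? m n)))) (𝟙≤1 (coprime? m n))) (≤-reflexive (ℚₚ.0≤p⇒∣p∣≡p (0≤+ 0≤σ 0≤σ)))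

    ∑f : ∑ n f ≡ 0ℚ
    ∑f = trans (∑-- n lam (λ _ → σ + σ)) (trans (cong (λ z → ∑ n lam - z) (∑-const n (σ + σ)))
      (trans (solve 3 (λ n l r → l :- n :* (l :* r :+ l :* r) := l :- (n :+ n) :* r :* l) refl (ι n) (∑ n lam) (rcp (n ℕ.+ n)))
        (trans (cong (λ z → ∑ n lam - z * ∑ n lam) (trans (cong (_* rcp (n ℕ.+ n)) (sym (ι-+ n n))) (ι*rcp (ℕₚ.≤-trans (ℕ.>-nonZero⁻¹ n) (ℕₚ.m≤m+n n n)))))
          (solve 1 (λ l → l :- con 1ℚ :* l := con 0ℚ) refl (∑ n lam)))))

  C₁ : ℚ
  C₁ = ι n * Cf + Cf

  lam-count : ∀ y → ∣ ∑ y (lam ∘ suc) - (σ + σ) * ι y ∣ ≤ C₁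
  -- Subtracting its density from `lam` gives a periodic function of mean 0. The count starts at 1,
  -- so the value at 0 is taken off again.
  lam-count y = subst (λ z → ∣ z ∣ ≤ C₁) eq (∣-∣≤ (∑-periodic-bounded f Cf (λ m → cong (_- (σ + σ)) (lam-≈ (sym (%-≈ m)))) ∣f∣≤ ∑f (suc y)) (∣f∣≤ 0))
    where
    eq : ∑ (suc y) f - f 0 ≡ ∑ y (lam ∘ suc) - (σ + σ) * ι y
    eq = trans (cong (_- f 0) (∑-head y f)) (trans (solve 2 (λ a b → a :+ b :- a := b) refl (f 0) (∑ y (f ∘ suc)))
      (trans (∑-- y (lam ∘ suc) (λ _ → σ + σ)) (cong (λ z → ∑ y (lam ∘ suc) - z) (trans (∑-const y (σ + σ)) (ℚₚ.*-comm (ι y) (σ + σ))))))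

-- Every unit residue and its negative occur equally often among the weights.

module Symmetry (n : ℕ) (2≤n : 2 ℕ.≤ n) (k : ℕ) (α : ℕ → ℕ) (α-unit : ∀ i → Coprime (α i) n) (κ : ℚ) where

  private
    1≤n : 1 ℕ.≤ n
    1≤n = ℕₚ.≤-trans (s≤s z≤n) 2≤n

    instance
      n≢0 : ℕ.NonZero n
      n≢0 = ℕ.>-nonZero 1≤n

  open Congruence n
  open Units n

  u : ℕ → ℕ → ℚ
  u g m = ∑ k (λ i → 𝟙 ((α i ℕ.* m) ℕ.% n ℕ.≟ g ℕ.% n) - 𝟙 ((α i ℕ.* m ℕ.+ g) ℕ.% n ℕ.≟ 0))

  -- Indexed by all residues g but set to 0 off the units. A unit d permutes this family by b(dg,
  -- dm) = b(g, m), the symmetry that replaces the characters.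
  b : ℕ → ℕ → ℚ
  b g m = lam g * u g m

  private
    unit≢0 : ∀ {x} → Coprime x n → x ℕ.% n ≢ 0
    unit≢0 {x} c e = ℕₚ.<⇒≢ 2≤n (sym (c (ℕ∣.m%n≡0⇒n∣m x n e , ℕ∣.∣-refl)))

    opposite-unit : ∀ {x g} → (x ℕ.+ g) ℕ.% n ≡ 0 → Coprime g n → Coprime x n
    opposite-unit {x} {g} e c (d∣x , d∣n) = c (ℕ∣.∣m+n∣m⇒∣n (ℕ∣.∣-trans d∣n (ℕ∣.m%n≡0⇒n∣m (x ℕ.+ g) n e)) d∣x , d∣n)

    u-nonunit : ∀ g m → Coprime g n → ¬ Coprime m n → u g m ≡ 0ℚ
    u-nonunit g m cg ¬cm = ∑-zero k λ i _ → cong₂ _-_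
      (𝟙-no ((α i ℕ.* m) ℕ.% n ℕ.≟ g ℕ.% n) λ e → ¬cm (coprime-*ʳ {α i} (coprime-≈ {g} {α i ℕ.* m} (sym e) cg)))
      (𝟙-no ((α i ℕ.* m ℕ.+ g) ℕ.% n ℕ.≟ 0) λ e → ¬cm (coprime-*ʳ {α i} (opposite-unit {α i ℕ.* m} {g} e cg)))

    b-lam : ∀ g m → b g m * lam m ≡ b g m
    b-lam g m with coprime? g n | coprime? m n
    ... | no _   | c      = trans (0* (𝟙 c) (ℚₚ.*-zeroˡ (u g m))) (sym (ℚₚ.*-zeroˡ (u g m)))
    ... | yes _  | yes _  = ℚₚ.*-identityʳ (1ℚ * u g m)
    ... | yes cg | no ¬cm = trans (ℚₚ.*-zeroʳ (1ℚ * u g m)) (sym (*0 1ℚ (u-nonunit g m cg ¬cm)))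

    u-scale : ∀ d g m → Coprime d n → u ((d ℕ.* g) ℕ.% n) (d ℕ.* m) ≡ u g m
    u-scale d g m cd = ∑-ext k λ i → cong₂ _-_
      (𝟙-⇔ ((α i ℕ.* (d ℕ.* m)) ℕ.% n ℕ.≟ (d ℕ.* g) ℕ.% n ℕ.% n) ((α i ℕ.* m) ℕ.% n ℕ.≟ g ℕ.% n)
        (λ e → cancel-unit {d} {α i ℕ.* m} {g} cd (trans (cong (ℕ._% n) (swap i)) (trans e (%-≈ (d ℕ.* g)))))
        (λ e → trans (cong (ℕ._% n) (sym (swap i))) (trans (≈-* {d} {d} {α i ℕ.* m} {g} refl e) (sym (%-≈ (d ℕ.* g))))))
      (𝟙-⇔ ((α i ℕ.* (d ℕ.* m) ℕ.+ (d ℕ.* g) ℕ.% n) ℕ.% n ℕ.≟ 0) ((α i ℕ.* m ℕ.+ g) ℕ.% n ℕ.≟ 0)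
        (λ e → trans (cancel-unit {d} {α i ℕ.* m ℕ.+ g} {0} cd (trans (sym (d*sum i)) (trans e (sym (trans (cong (ℕ._% n) (ℕₚ.*-zeroʳ d)) 0%))))) 0%)
        (λ e → trans (d*sum i) (trans (≈-* {d} {d} {α i ℕ.* m ℕ.+ g} {0} refl (trans e (sym 0%))) (trans (cong (ℕ._% n) (ℕₚ.*-zeroʳ d)) 0%))))
      where
      0% : 0 ℕ.% n ≡ 0
      0% = ℕ.m<n⇒m%n≡m 1≤n
      swap : ∀ i → d ℕ.* (α i ℕ.* m) ≡ α i ℕ.* (d ℕ.* m)
      swap i = trans (sym (ℕₚ.*-assoc d (α i) m)) (trans (cong (ℕ._* m) (ℕₚ.*-comm d (α i))) (ℕₚ.*-assoc (α i) d m))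
      d*sum : ∀ i → α i ℕ.* (d ℕ.* m) ℕ.+ (d ℕ.* g) ℕ.% n ≈ d ℕ.* (α i ℕ.* m ℕ.+ g)
      d*sum i = trans (ℕ.%-distribˡ-+ (α i ℕ.* (d ℕ.* m)) ((d ℕ.* g) ℕ.% n) n) (trans (cong (λ z → ((α i ℕ.* (d ℕ.* m)) ℕ.% n ℕ.+ z) ℕ.% n) (%-≈ (d ℕ.* g)))
        (trans (sym (ℕ.%-distribˡ-+ (α i ℕ.* (d ℕ.* m)) (d ℕ.* g) n)) (cong (ℕ._% n) (trans (cong (ℕ._+ d ℕ.* g) (sym (swap i))) (sym (ℕₚ.*-distribˡ-+ d (α i ℕ.* m) g))))))

    E : ℕ → ℕ → ℚ
    E m m′ = ∑ n (λ g → b g m * b g m′)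

    -- For a unit d the substitution g ↦ dg permutes the family; for any other d every
    -- `b g (d ℕ.* m)` vanishes, as does `lam d`.
    E-scale : ∀ d m m′ → E (d ℕ.* m) (d ℕ.* m′) ≡ lam d * E m m′
    E-scale d m m′ = go (coprime? d n)
      where
      go : (c : Dec (Coprime d n)) → E (d ℕ.* m) (d ℕ.* m′) ≡ 𝟙 c * E m m′
      go (yes cd) = trans (∑-unit d (λ g → b g (d ℕ.* m) * b g (d ℕ.* m′)) cd) (trans (∑-ext n λ g → cong₂ _*_ (b-scale g m) (b-scale g m′)) (sym (ℚₚ.*-identityˡ (E m m′))))
        where
        b-scale : ∀ g m → b ((d ℕ.* g) ℕ.% n) (d ℕ.* m) ≡ b g m
        b-scale g m = cong₂ _*_ (trans (lam-≈ (%-≈ (d ℕ.* g))) (trans (lam-* d g) (trans (cong (_* lam g) (𝟙-yes (coprime? d n) cd)) (ℚₚ.*-identityˡ (lam g))))) (u-scale d g m cd)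
      go (no ¬cd) = trans (∑-zero n λ g _ → 0* (b g (d ℕ.* m′)) (trans (sym (b-lam g (d ℕ.* m))) (*0 (b g (d ℕ.* m)) (trans (lam-* d m) (0* (lam m) (𝟙-no (coprime? d n) ¬cd)))))) (sym (ℚₚ.*-zeroˡ (E m m′)))

    β : ℕ → ℕ
    β i = proj₁ (unit-inverse (α-unit i))

    αβ : ∀ i → α i ℕ.* β i ≈ 1
    αβ i = proj₂ (unit-inverse (α-unit i))

  module _ (sawtooth : ∀ z → z ℕ.% n ≢ 0 → ∑ k (λ i → ι ((α i ℕ.* z) ℕ.% n)) ≡ κ) where

    private
      module 𝕋 = Transfer n 1≤n k α β κ

      C₂ = ι n * (ι k * (1ℚ + 1ℚ))

      module Unit (g : ℕ) (cg : Coprime g n) where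
        y : ℕ → ℕ
        y i = (β i ℕ.* g) ℕ.% n

        β-unit : ∀ i → Coprime (β i) n
        β-unit i = coprime-*ʳ {α i} (coprime-≈ {1} {α i ℕ.* β i} (sym (αβ i)) (λ (d∣1 , _) → ℕ∣.∣1⇒≡1 d∣1))

        y≢0 : ∀ i → y i ≢ 0
        y≢0 i = unit≢0 (coprime-* (β-unit i) cg)

        0<y : ∀ i → 1 ℕ.≤ y i
        0<y i = ℕₚ.n≢0⇒n>0 (y≢0 i)

        y<n : ∀ i → y i ℕ.< n
        y<n i = ℕ.m%n<n (β i ℕ.* g) n

        null : Null (λ m → ∑ k (λ i → Cotangent.h n 1≤n (suc m) (ℤ.+ y i)))
        null = 𝕋.∑hbar-null αβ sawtooth g (unit≢0 cg) y≢0

        v : ℕ → ℚ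
        v = 𝕋.v y 0<y y<n null

        αy≈g : ∀ i → α i ℕ.* y i ≈ g
        αy≈g i = trans (≈-* {α i} {α i} {y i} {β i ℕ.* g} refl (%-≈ (β i ℕ.* g))) (trans (cong (ℕ._% n) (sym (ℕₚ.*-assoc (α i) (β i) g))) (trans (≈-* {α i ℕ.* β i} {1} {g} {g} (αβ i) refl) (cong (ℕ._% n) (ℕₚ.*-identityˡ g))))

        -- Since α is a unit and αy ≡ g, the congruences αm ≡ g and αm ≡ -g can be solved for m,
        -- with solutions y and n - y.
        b≡v : ∀ m → b g m ≡ v m
        b≡v m = trans (cong (_* u g m) (𝟙-yes (coprime? g n) cg)) (trans (ℚₚ.*-identityˡ (u g m)) (∑-ext k λ i → cong₂ _-_ (plus i) (minus i)))
          where
          plus : ∀ i → 𝟙 ((α i ℕ.* m) ℕ.% n ℕ.≟ g ℕ.% n) ≡ 𝟙 (m ℕ.% n ℕ.≟ y i)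
          plus i = 𝟙-⇔ ((α i ℕ.* m) ℕ.% n ℕ.≟ g ℕ.% n) (m ℕ.% n ℕ.≟ y i)
            (λ e → trans (cancel-unit {α i} {m} {y i} (α-unit i) (trans e (sym (αy≈g i)))) (ℕ.m<n⇒m%n≡m (y<n i)))
            (λ e → trans (≈-* {α i} {α i} {m} {y i} refl (trans e (sym (ℕ.m<n⇒m%n≡m (y<n i))))) (αy≈g i))
          minus : ∀ i → 𝟙 ((α i ℕ.* m ℕ.+ g) ℕ.% n ℕ.≟ 0) ≡ 𝟙 (m ℕ.% n ℕ.≟ n ℕ.∸ y i)
          minus i = 𝟙-⇔ ((α i ℕ.* m ℕ.+ g) ℕ.% n ℕ.≟ 0) (m ℕ.% n ℕ.≟ n ℕ.∸ y i) to from
            where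
            sum≈ : α i ℕ.* m ℕ.+ g ≈ α i ℕ.* (m ℕ.+ y i)
            sum≈ = trans (ℕ.%-distribˡ-+ (α i ℕ.* m) g n) (trans (cong (λ z → ((α i ℕ.* m) ℕ.% n ℕ.+ z) ℕ.% n) (sym (αy≈g i)))
              (trans (sym (ℕ.%-distribˡ-+ (α i ℕ.* m) (α i ℕ.* y i) n)) (cong (ℕ._% n) (sym (ℕₚ.*-distribˡ-+ (α i) m (y i))))))
            0% : 0 ℕ.% n ≡ 0
            0% = ℕ.m<n⇒m%n≡m 1≤n
            m+y : (m ℕ.+ y i) ℕ.% n ≡ (m ℕ.% n ℕ.+ y i) ℕ.% n
            m+y = trans (ℕ.%-distribˡ-+ m (y i) n) (cong (λ z → (m ℕ.% n ℕ.+ z) ℕ.% n) (ℕ.m<n⇒m%n≡m (y<n i)))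
            to : (α i ℕ.* m ℕ.+ g) ℕ.% n ≡ 0 → m ℕ.% n ≡ n ℕ.∸ y i
            to e = ℕₚ.+-cancelʳ-≡ (y i) (m ℕ.% n) (n ℕ.∸ y i) (trans s≡n (sym (ℕₚ.m∸n+n≡m (ℕₚ.<⇒≤ (y<n i)))))
              where
              s%≡0 : (m ℕ.% n ℕ.+ y i) ℕ.% n ≡ 0
              s%≡0 = trans (sym m+y) (trans (cancel-unit {α i} {m ℕ.+ y i} {0} (α-unit i) (trans (sym sum≈) (trans e (sym (trans (cong (ℕ._% n) (ℕₚ.*-zeroʳ (α i))) 0%))))) 0%)
              s≡n : m ℕ.% n ℕ.+ y i ≡ n
              s≡n with ℕ∣.m%n≡0⇒n∣m (m ℕ.% n ℕ.+ y i) n s%≡0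
              ... | ℕ∣.divides zero    e = ⊥-elim (y≢0 i (ℕₚ.m+n≡0⇒n≡0 (m ℕ.% n) e))
              ... | ℕ∣.divides 1       e = trans e (ℕₚ.+-identityʳ n)
              ... | ℕ∣.divides (suc (suc j)) e = ⊥-elim (ℕₚ.<⇒≱ (ℕₚ.+-mono-< (ℕ.m%n<n m n) (y<n i)) (subst (n ℕ.+ n ℕ.≤_) (sym e) (ℕₚ.+-monoʳ-≤ n (ℕₚ.m≤m+n n (j ℕ.* n)))))
            from : m ℕ.% n ≡ n ℕ.∸ y i → (α i ℕ.* m ℕ.+ g) ℕ.% n ≡ 0
            from e = trans sum≈ (trans (≈-* {α i} {α i} {m ℕ.+ y i} {0} refl (trans m+y (trans (cong (λ z → (z ℕ.+ y i) ℕ.% n) e)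
              (trans (cong (ℕ._% n) (ℕₚ.m∸n+n≡m (ℕₚ.<⇒≤ (y<n i)))) (trans (ℕ.n%n≡0 n) (sym 0%)))))) (trans (cong (ℕ._% n) (ℕₚ.*-zeroʳ (α i))) 0%))

        b-sum : ∀ i → ∣ ∑ i (b g ∘ suc) ∣ ≤ C₂
        b-sum i = subst (λ z → ∣ z ∣ ≤ C₂) (sym (∑-ext i λ m → b≡v (suc m))) (𝕋.v-sum y 0<y y<n null i)

        b-log : ∀ i → ι i * ∣ ∑ i (λ m → b g (suc m) * rcp (suc m)) ∣ ≤ C₂ + C₂
        b-log i = subst (λ z → ι i * ∣ z ∣ ≤ C₂ + C₂) (sym (∑-ext i λ m → cong (_* rcp (suc m)) (b≡v (suc m)))) (𝕋.v-log y 0<y y<n null i)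

      0≤C₂ : 0ℚ ≤ C₂
      0≤C₂ = 0≤* (0≤ι n) (0≤* (0≤ι k) (0≤+ 0≤1 0≤1))

      b-nonunit : ∀ g m → ¬ Coprime g n → b g m ≡ 0ℚ
      b-nonunit g m ¬cg = 0* (u g m) (𝟙-no (coprime? g n) ¬cg)

      b-sum : ∀ g i → ∣ ∑ i (b g ∘ suc) ∣ ≤ C₂
      b-sum g i = go (coprime? g n)
        where
        go : Dec (Coprime g n) → ∣ ∑ i (b g ∘ suc) ∣ ≤ C₂
        go (yes cg) = Unit.b-sum g cg i
        go (no ¬cg) = subst (λ z → ∣ z ∣ ≤ C₂) (sym (∑-zero i λ m _ → b-nonunit g (suc m) ¬cg)) 0≤C₂

      b-log : ∀ g i → ι i * ∣ ∑ i (λ m → b g (suc m) * rcp (suc m)) ∣ ≤ C₂ + C₂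
      b-log g i = go (coprime? g n)
        where
        go : Dec (Coprime g n) → ι i * ∣ ∑ i (λ m → b g (suc m) * rcp (suc m)) ∣ ≤ C₂ + C₂
        go (yes cg) = Unit.b-log g cg i
        go (no ¬cg) = subst (λ z → ι i * ∣ z ∣ ≤ C₂ + C₂) (sym (∑-zero i λ m _ → 0* (rcp (suc m)) (b-nonunit g (suc m) ¬cg)))
          (subst (_≤ C₂ + C₂) (sym (ℚₚ.*-zeroʳ (ι i))) (0≤+ 0≤C₂ 0≤C₂))

    symmetric : ∀ g → g ℕ.< n → Coprime g n → u g 1 ≡ 0ℚ
    symmetric g g<n cg = trans (sym (trans (cong (_* u g 1) (𝟙-yes (coprime? g n) cg)) (ℚₚ.*-identityˡ (u g 1))))
      (Nonvanishing.vanishing lam σ C₁ 0≤σ lam-count (λ m → 0≤𝟙 (coprime? m n)) (λ m → 𝟙≤1 (coprime? m n)) lam-1 lam-* lam-idem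
        n b b-lam C₂ (C₂ + C₂) b-sum b-log n 1≤n lam-prog E-scale g g<n)

-- Sums over Fin

sumFin≡sum : ∀ m (f : Fin m → ℚ) → sumFin m f ≡ sum f
sumFin≡sum zero    f = refl
sumFin≡sum (suc m) f = cong (f zero +_) (trans (cong (List.foldr _+_ 0ℚ)
  (trans (Listₚ.map-tabulate suc f) (sym (Listₚ.map-tabulate (λ i → i) (f ∘ suc))))) (sumFin≡sum m (f ∘ suc)))

-- Passes from a family on `Fin m` to a sequence. Sums see only the first `m` values, but pointwise
-- hypotheses must also hold for the default; it is taken to be 1 later, a unit modulo every n.
extend : ∀ {A : Set} {m} → A → (Fin m → A) → ℕ → A
extend {m = zero}  a₀ a _       = a₀
extend {m = suc m} a₀ a zero    = a zero
extend {m = suc m} a₀ a (suc i) = extend a₀ (a ∘ suc) i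

extend-all : ∀ {A : Set} {m} (Q : A → Set) {a₀ : A} {a : Fin m → A} → Q a₀ → (∀ i → Q (a i)) → ∀ i → Q (extend a₀ a i)
extend-all {m = zero}  Q q₀ q _       = q₀
extend-all {m = suc m} Q q₀ q zero    = q zero
extend-all {m = suc m} Q q₀ q (suc i) = extend-all Q q₀ (q ∘ suc) i

∑-extend : ∀ {A : Set} m (φ : A → ℚ) a₀ (a : Fin m → A) → ∑ m (λ i → φ (extend a₀ a i)) ≡ sum (φ ∘ a)
∑-extend zero    φ a₀ a = refl
∑-extend (suc m) φ a₀ a = trans (∑-head m (λ i → φ (extend a₀ a i))) (cong (φ (a zero) +_) (∑-extend m φ a₀ (a ∘ suc)))

sum-ext : ∀ {m} {f g : Fin m → ℚ} → (∀ i → f i ≡ g i) → sum f ≡ sum g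
sum-ext {zero}  e = refl
sum-ext {suc m} e = cong₂ _+_ (e zero) (sum-ext (e ∘ suc))

sum-*ʳ : ∀ {m} c (f : Fin m → ℚ) → sum (λ i → f i * c) ≡ sum f * c
sum-*ʳ {zero}  c f = sym (ℚₚ.*-zeroˡ c)
sum-*ʳ {suc m} c f = trans (cong (f zero * c +_) (sum-*ʳ c (f ∘ suc))) (sym (ℚₚ.*-distribʳ-+ c (f zero) (sum (f ∘ suc))))

sum-+ : ∀ {m} (f g : Fin m → ℚ) → sum (λ i → f i + g i) ≡ sum f + sum g
sum-+ {zero}  f g = refl
sum-+ {suc m} f g = trans (cong (f zero + g zero +_) (sum-+ (f ∘ suc) (g ∘ suc)))
  (solve 4 (λ a b c d → (a :+ b) :+ (c :+ d) := (a :+ c) :+ (b :+ d)) refl (f zero) (g zero) (sum (f ∘ suc)) (sum (g ∘ suc)))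

sum-const : ∀ m c → sum {m} (λ _ → c) ≡ ι m * c
sum-const zero    c = sym (ℚₚ.*-zeroˡ c)
sum-const (suc m) c = trans (cong (c +_) (sum-const m c)) (solve 2 (λ m c → c :+ m :* c := (con 1ℚ :+ m) :* c) refl (ι m) c)

0≤sum : ∀ {m} {f : Fin m → ℚ} → (∀ i → 0ℚ ≤ f i) → 0ℚ ≤ sum f
0≤sum {zero}  0≤f = ≤-refl
0≤sum {suc m} 0≤f = 0≤+ (0≤f zero) (0≤sum (0≤f ∘ suc))

left right : ∀ {d} → Fin d → Fin (d ℕ.* 2)
left  {d} i = combine {d} {2} i zero
right {d} i = combine {d} {2} i (suc zero)

sum-pairs : ∀ d (G : Fin (d ℕ.* 2) → ℚ) c → (∀ i → G (left {d} i) + G (right {d} i) ≡ c) → sum G ≡ ι d * c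
sum-pairs zero    G c e = sym (ℚₚ.*-zeroˡ c)
sum-pairs (suc d) G c e = begin
  G zero + (G (suc zero) + sum tail)   ≡⟨ sym (ℚₚ.+-assoc (G zero) (G (suc zero)) (sum tail)) ⟩
  G zero + G (suc zero) + sum tail     ≡⟨ cong₂ _+_ (e zero) (sum-pairs d tail c λ i → e (suc i)) ⟩
  c + ι d * c                          ≡⟨ solve 2 (λ d c → c :+ d :* c := (con 1ℚ :+ d) :* c) refl (ι d) c ⟩
  (1ℚ + ι d) * c                       ∎
  where
  open ≡-Reasoning
  tail : Fin (d ℕ.* 2) → ℚ
  tail i = G (suc (suc i))

-- Fractional parts

toℚᵘ-ιℤ : ∀ z → ℚ.toℚᵘ (ιℤ z) ℚᵘ.≃ ℚᵘ.mkℚᵘ z 0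
toℚᵘ-ιℤ (ℤ.+ m)    = toℚᵘ-ι m
toℚᵘ-ιℤ ℤ.-[1+ m ] = ℚᵘₚ.≃-trans (ℚₚ.toℚᵘ-homo‿- (ι (suc m))) (ℚᵘₚ.-‿cong (toℚᵘ-ι (suc m)))

/-*-ι : ∀ z n .{{_ : ℕ.NonZero n}} → (z ℚ./ n) * ι n ≡ ιℤ z
/-*-ι z n@(suc m) = ℚₚ.toℚᵘ-injective (ℚᵘₚ.≃-trans (ℚₚ.toℚᵘ-homo-* (z ℚ./ n) (ι n))
  (ℚᵘₚ.≃-trans (ℚᵘₚ.*-cong (ℚₚ.toℚᵘ-fromℚᵘ (ℚᵘ.mkℚᵘ z m)) (toℚᵘ-ι n)) (ℚᵘₚ.≃-trans (ℚᵘ.*≡* eq) (ℚᵘₚ.≃-sym (toℚᵘ-ιℤ z)))))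
  where
  eq : z ℤ.* ℤ.+ n ℤ.* ℤ.+ 1 ≡ z ℤ.* ℤ.+ (n ℕ.* 1)
  eq = trans (ℤₚ.*-identityʳ (z ℤ.* ℤ.+ n)) (cong (λ x → z ℤ.* ℤ.+ x) (sym (ℕₚ.*-identityʳ n)))

/≡*rcp : ∀ z n .{{_ : ℕ.NonZero n}} → z ℚ./ n ≡ ιℤ z * rcp n
/≡*rcp z n = begin
  z ℚ./ n                      ≡⟨ sym (ℚₚ.*-identityʳ (z ℚ./ n)) ⟩
  (z ℚ./ n) * 1ℚ               ≡⟨ cong ((z ℚ./ n) *_) (sym (ι*rcp (ℕ.>-nonZero⁻¹ n))) ⟩
  (z ℚ./ n) * (ι n * rcp n)    ≡⟨ sym (ℚₚ.*-assoc (z ℚ./ n) (ι n) (rcp n)) ⟩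
  (z ℚ./ n) * ι n * rcp n      ≡⟨ cong (_* rcp n) (/-*-ι z n) ⟩
  ιℤ z * rcp n                 ∎
  where open ≡-Reasoning

/1≡ιℤ : ∀ z → z ℚ./ 1 ≡ ιℤ z
/1≡ιℤ z = trans (sym (ℚₚ.*-identityʳ (z ℚ./ 1))) (/-*-ι z 1)

ιℤ-euclid : ∀ z n .{{_ : ℕ.NonZero n}} r q → z ≡ ℤ.+ r ℤ.+ q ℤ.* ℤ.+ n → ιℤ z * rcp n ≡ ι r * rcp n + ιℤ q
ιℤ-euclid z n r q e = begin
  ιℤ z * rcp n                       ≡⟨ cong (λ x → ιℤ x * rcp n) (trans e (cong (λ x → ℤ.+ r ℤ.+ x) (ℤₚ.*-comm q (ℤ.+ n)))) ⟩
  ιℤ (ℤ.+ r ℤ.+ ℤ.+ n ℤ.* q) * rcp n  ≡⟨ cong (_* rcp n) (trans (ιℤ-+ (ℤ.+ r) (ℤ.+ n ℤ.* q)) (cong (ι r +_) (ιℤ-*⁺ n q))) ⟩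
  (ι r + ι n * ιℤ q) * rcp n         ≡⟨ solve 4 (λ r n q x → (r :+ n :* q) :* x := r :* x :+ (n :* x) :* q) refl (ι r) (ι n) (ιℤ q) (rcp n) ⟩
  ι r * rcp n + ι n * rcp n * ιℤ q   ≡⟨ cong (ι r * rcp n +_) (trans (cong (_* ιℤ q) (ι*rcp (ℕ.>-nonZero⁻¹ n))) (ℚₚ.*-identityˡ (ιℤ q))) ⟩
  ι r * rcp n + ιℤ q                 ∎
  where open ≡-Reasoning

-- `floor` divides by the denominator of the reduced fraction, which need not be n. This is why
-- `frac-/` goes through `fraction-unique`.
frac-euclid : ∀ p → ∃ λ r → ∃ λ d → (r ℕ.< d) × (frac p ≡ ι r * rcp d)
frac-euclid p@(ℚ.mkℚ z d-1 _) = z ℤ.% ℤ.+ d , d , ℤD.n%d<d z (ℤ.+ d) , (begin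
  p - (ℚ.floor p ℚ./ 1)                       ≡⟨ cong₂ _-_ (trans (sym (ℚₚ.↥p/↧p≡p p)) (/≡*rcp z d)) (/1≡ιℤ q) ⟩
  ιℤ z * rcp d - ιℤ q                         ≡⟨ cong (_- ιℤ q) (ιℤ-euclid z d (z ℤ.% ℤ.+ d) q (ℤD.a≡a%n+[a/n]*n z (ℤ.+ d))) ⟩
  ι (z ℤ.% ℤ.+ d) * rcp d + ιℤ q - ιℤ q       ≡⟨ solve 2 (λ x q → x :+ q :- q := x) refl (ι (z ℤ.% ℤ.+ d) * rcp d) (ιℤ q) ⟩
  ι (z ℤ.% ℤ.+ d) * rcp d                     ∎)
  where
  open ≡-Reasoning
  d = suc d-1
  q = z ℤ./ ℤ.+ d

fraction<1 : ∀ {r d} → r ℕ.< d → ι r * rcp d + rcp d ≤ 1ℚ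
fraction<1 {r} {d} r<d = subst (_≤ 1ℚ) (solve 2 (λ r x → (con 1ℚ :+ r) :* x := r :* x :+ x) refl (ι r) (rcp d))
  (*rcp-≤ {d} {ι (suc r)} (ℕₚ.≤-trans (s≤s z≤n) r<d) (subst (ι (suc r) ≤_) (sym (ℚₚ.*-identityʳ (ι d))) (ι-mono r<d)))

0<rcp : ∀ {d} → 1 ℕ.≤ d → 0ℚ < rcp d
0<rcp {d} 1≤d = ℚₚ.≰⇒> λ r≤0 → 1≰0 (subst₂ _≤_ (ι*rcp 1≤d) (ℚₚ.*-zeroʳ (ι d)) (*-monoˡ (0≤ι d) r≤0))

-- Two numbers in [0, 1) cannot differ by a nonzero integer; strictness at 1 is carried by the
-- margin `rcp d` of `fraction<1`.
fraction-unique : ∀ {r d r′ d′} k → r ℕ.< d → r′ ℕ.< d′ → ι r * rcp d + ιℤ k ≡ ι r′ * rcp d′ → ι r * rcp d ≡ ι r′ * rcp d′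
fraction-unique {r} {d} {r′} {d′} k r<d r′<d′ e = trans (trans (sym (ℚₚ.+-identityʳ (ι r * rcp d))) (cong (λ z → ι r * rcp d + ιℤ z) (sym k≡0))) e
  where
  big : ∀ {a b x y} → 0ℚ ≤ a → b + y ≤ 1ℚ → 0ℚ < y → ¬ (a + (1ℚ + x) ≡ b × 0ℚ ≤ x)
  big {a} {b} {x} {y} 0≤a b<1 0<y (e , 0≤x) = ℚₚ.<-irrefl refl $ ℚₚ.<-≤-trans 0<y (≤-by (a + x + (1ℚ - (b + y))) (0≤+ (0≤+ 0≤a 0≤x) (0≤-diff b<1))
    (trans (solve 4 (λ a b x y → con 0ℚ := y :+ (a :+ x :+ (con 1ℚ :- ((a :+ (con 1ℚ :+ x)) :+ y)))) refl a b x y) (cong (λ z → y + (a + x + (1ℚ - (z + y)))) e)))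
  k≡0 : k ≡ ℤ.+ 0
  k≡0 = go k e
    where
    go : ∀ k → ι r * rcp d + ιℤ k ≡ ι r′ * rcp d′ → k ≡ ℤ.+ 0
    go (ℤ.+ zero)  e = refl
    go (ℤ.+ suc m) e = ⊥-elim (big (0≤* (0≤ι r) (0≤rcp d)) (fraction<1 r′<d′) (0<rcp (ℕₚ.≤-trans (s≤s z≤n) r′<d′)) (e , 0≤ι m))
    go ℤ.-[1+ m ]  e = ⊥-elim (big (0≤* (0≤ι r′) (0≤rcp d′)) (fraction<1 r<d) (0<rcp (ℕₚ.≤-trans (s≤s z≤n) r<d))
      (trans (cong (_+ (1ℚ + ι m)) (sym e)) (solve 2 (λ x m → x :+ :- (con 1ℚ :+ m) :+ (con 1ℚ :+ m) := x) refl (ι r * rcp d) (ι m)) , 0≤ι m))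

frac-/ : ∀ z n .{{_ : ℕ.NonZero n}} r q → r ℕ.< n → z ≡ ℤ.+ r ℤ.+ q ℤ.* ℤ.+ n → frac (z ℚ./ n) ≡ ι r * rcp n
frac-/ z n r q r<n e = go (frac-euclid (z ℚ./ n))
  where
  fl = ℚ.floor (z ℚ./ n)
  go : (∃ λ r′ → ∃ λ d → (r′ ℕ.< d) × (frac (z ℚ./ n) ≡ ι r′ * rcp d)) → frac (z ℚ./ n) ≡ ι r * rcp n
  go (r′ , d , r′<d , e′) = trans e′ (sym (fraction-unique {r} {n} {r′} {d} (q ℤ.+ ℤ.- fl) r<n r′<d (trans
    (trans (cong (ι r * rcp n +_) (trans (ιℤ-+ q (ℤ.- fl)) (cong (ιℤ q +_) (ιℤ-neg fl)))) (trans (sym (ℚₚ.+-assoc (ι r * rcp n) (ιℤ q) (- ιℤ fl)))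
      (cong₂ _-_ (sym (trans (/≡*rcp z n) (ιℤ-euclid z n r q e))) (sym (/1≡ιℤ fl))))) e′)))

-- Residues

module Residue (n : ℕ) .{{_ : ℕ.NonZero n}} where

  residue : ℤ → ℕ
  residue a = a ℤ.%ℕ n

  private
    quot : ℤ → ℤ
    quot a = a ℤ./ℕ n

    euclid : ∀ a → a ≡ ℤ.+ residue a ℤ.+ quot a ℤ.* ℤ.+ n
    euclid a = ℤD.a≡a%ℕn+[a/ℕn]*n a n

  residue<n : ∀ a → residue a ℕ.< n
  residue<n a = ℤD.n%ℕd<d a n

  frac-residue : ∀ t a → frac ((ℤ.+ t ℤ.* a) ℚ./ n) ≡ ι ((residue a ℕ.* t) ℕ.% n) * rcp n
  frac-residue t a = frac-/ (ℤ.+ t ℤ.* a) n ((residue a ℕ.* t) ℕ.% n) (ℤ.+ ((residue a ℕ.* t) ℕ./ n) ℤ.+ ℤ.+ t ℤ.* quot a) (ℕ.m%n<n (residue a ℕ.* t) n) (begin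
    ℤ.+ t ℤ.* a
      ≡⟨ cong (λ x → ℤ.+ t ℤ.* x) (euclid a) ⟩
    ℤ.+ t ℤ.* (ℤ.+ residue a ℤ.+ quot a ℤ.* ℤ.+ n)
      ≡⟨ solveℤ 4 (λ t r q n → t ⊡ (r ⊞ q ⊡ n) ≐ r ⊡ t ⊞ t ⊡ q ⊡ n) refl (ℤ.+ t) (ℤ.+ residue a) (quot a) (ℤ.+ n) ⟩
    ℤ.+ residue a ℤ.* ℤ.+ t ℤ.+ ℤ.+ t ℤ.* quot a ℤ.* ℤ.+ n
      ≡⟨ cong (ℤ._+ ℤ.+ t ℤ.* quot a ℤ.* ℤ.+ n) (trans (sym (ℤₚ.pos-* (residue a) t)) (trans (cong ℤ.+_ (ℕ.m≡m%n+[m/n]*n (residue a ℕ.* t) n)) (cong (λ x → ℤ.+ ((residue a ℕ.* t) ℕ.% n) ℤ.+ x) (ℤₚ.pos-* ((residue a ℕ.* t) ℕ./ n) n)))) ⟩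
    ℤ.+ ((residue a ℕ.* t) ℕ.% n) ℤ.+ ℤ.+ ((residue a ℕ.* t) ℕ./ n) ℤ.* ℤ.+ n ℤ.+ ℤ.+ t ℤ.* quot a ℤ.* ℤ.+ n
      ≡⟨ solveℤ 5 (λ r q t p n → r ⊞ q ⊡ n ⊞ t ⊡ p ⊡ n ≐ r ⊞ (q ⊞ t ⊡ p) ⊡ n) refl (ℤ.+ ((residue a ℕ.* t) ℕ.% n)) (ℤ.+ ((residue a ℕ.* t) ℕ./ n)) (ℤ.+ t) (quot a) (ℤ.+ n) ⟩
    ℤ.+ ((residue a ℕ.* t) ℕ.% n) ℤ.+ (ℤ.+ ((residue a ℕ.* t) ℕ./ n) ℤ.+ ℤ.+ t ℤ.* quot a) ℤ.* ℤ.+ n ∎)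
    where open ≡-Reasoning

  private
    +-residue : ∀ a a′ → a ℤ.+ a′ ≡ ℤ.+ (residue a ℕ.+ residue a′) ℤ.+ (quot a ℤ.+ quot a′) ℤ.* ℤ.+ n
    +-residue a a′ = trans (cong₂ ℤ._+_ (euclid a) (euclid a′)) (solveℤ 5 (λ r r′ q q′ n → (r ⊞ q ⊡ n) ⊞ (r′ ⊞ q′ ⊡ n) ≐ (r ⊞ r′) ⊞ (q ⊞ q′) ⊡ n) refl
      (ℤ.+ residue a) (ℤ.+ residue a′) (quot a) (quot a′) (ℤ.+ n))

    ∣-+-multiple : ∀ {d} r q → d ∣ n → d ∣ r → ℤ.+ d ℤ∣.∣ ℤ.+ r ℤ.+ q ℤ.* ℤ.+ n
    ∣-+-multiple {d} r q d∣n d∣r = ℤ∣ₛ.∣⇒∣ᵤ (ℤ∣ₛ.∣m∣n⇒∣m+n (ℤ∣ₛ.∣ᵤ⇒∣ {ℤ.+ d} {ℤ.+ r} d∣r) (ℤ∣ₛ.∣n⇒∣m*n q (ℤ∣ₛ.∣ᵤ⇒∣ {ℤ.+ d} {ℤ.+ n} d∣n)))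

    multiple-∣-cancel : ∀ {d} r q → d ∣ n → ℤ.+ d ℤ∣.∣ ℤ.+ r ℤ.+ q ℤ.* ℤ.+ n → d ∣ r
    multiple-∣-cancel {d} r q d∣n div = ℤ∣ₛ.∣⇒∣ᵤ {ℤ.+ d} {ℤ.+ r} (ℤ∣ₛ.∣m+n∣m⇒∣n {m = q ℤ.* ℤ.+ n}
      (subst (ℤ.+ d ℤ∣ₛ.∣_) (ℤₚ.+-comm (ℤ.+ r) (q ℤ.* ℤ.+ n)) (ℤ∣ₛ.∣ᵤ⇒∣ div)) (ℤ∣ₛ.∣n⇒∣m*n q (ℤ∣ₛ.∣ᵤ⇒∣ {ℤ.+ d} {ℤ.+ n} d∣n)))

  ∣-from-residues : ∀ a a′ → (residue a ℕ.+ residue a′) ℕ.% n ≡ 0 → ℤ.+ n ℤ∣.∣ a ℤ.+ a′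
  ∣-from-residues a a′ e = subst (ℤ.+ n ℤ∣.∣_) (sym (+-residue a a′))
    (∣-+-multiple (residue a ℕ.+ residue a′) (quot a ℤ.+ quot a′) ℕ∣.∣-refl (ℕ∣.m%n≡0⇒n∣m _ n e))

  ∣-to-residues : ∀ a a′ → ℤ.+ n ℤ∣.∣ a ℤ.+ a′ → (residue a ℕ.+ residue a′) ℕ.% n ≡ 0
  ∣-to-residues a a′ div = ℕ∣.n∣m⇒m%n≡0 _ n (multiple-∣-cancel (residue a ℕ.+ residue a′) (quot a ℤ.+ quot a′) ℕ∣.∣-refl
    (subst (ℤ.+ n ℤ∣.∣_) (+-residue a a′) div))

  residue-coprime : ∀ a → Coprime ℤ.∣ a ∣ n → Coprime (residue a) n
  residue-coprime a c {d} (d∣r , d∣n) = c (subst (ℤ.+ d ℤ∣.∣_) (sym (euclid a))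
    (∣-+-multiple (residue a) (quot a) d∣n d∣r) , d∣n)

-- A balanced family splits into opposite pairs

module Pairing {A : Set} (_≟_ : (x y : A) → Dec (x ≡ y)) (_⋈_ : A → A → Set) (_⋈?_ : (x y : A) → Dec (x ⋈ y)) (U : A → Set)
  (⋈-sym : ∀ {x y} → x ⋈ y → y ⋈ x) (⋈-unique : ∀ {x y z} → U x → U z → x ⋈ y → z ⋈ y → x ≡ z) (⋈-irrefl : ∀ {x} → U x → ¬ (x ⋈ x)) where

  balance : A → A → ℚ
  balance g x = 𝟙 (x ≟ g) - 𝟙 (x ⋈? g)

  balance-opposite : ∀ {x y} g → U x → U y → U g → x ⋈ y → balance g x + balance g y ≡ 0ℚ
  balance-opposite {x} {y} g Ux Uy Ug x⋈y = trans
    (cong₂ (λ a b → 𝟙 (x ≟ g) - a + (𝟙 (y ≟ g) - b))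
      (𝟙-⇔ (x ⋈? g) (y ≟ g) (λ x⋈g → ⋈-unique Uy Ug (⋈-sym x⋈y) (⋈-sym x⋈g)) (λ y≡g → subst (x ⋈_) y≡g x⋈y))
      (𝟙-⇔ (y ⋈? g) (x ≟ g) (λ y⋈g → ⋈-unique Ux Ug x⋈y (⋈-sym y⋈g)) (λ x≡g → subst (y ⋈_) x≡g (⋈-sym x⋈y))))
    (solve 2 (λ a b → a :- b :+ (b :- a) := con 0ℚ) refl (𝟙 (x ≟ g)) (𝟙 (y ≟ g)))

  Paired : ∀ d → (Fin (d ℕ.* 2) → A) → Set
  Paired d α = ∃ λ (π : Permutation′ (d ℕ.* 2)) → ∀ (i : Fin d) → α (π ⟨$⟩ʳ left {d} i) ⋈ α (π ⟨$⟩ʳ right {d} i)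

  -- If the first entry had no opposite, its own balance would be at least 1, as it is not opposite
  -- to itself. Removing an opposite pair changes no balance by `balance-opposite`, and induction
  -- applies to the rest.
  pairing : ∀ d (α : Fin (d ℕ.* 2) → A) → (∀ i → U (α i)) → (∀ g → U g → sum (λ i → balance g (α i)) ≡ 0ℚ) → Paired d α
  pairing zero    α αU bal = Perm.id , λ ()
  pairing (suc d) α αU bal = go (Finₚ.any? (λ j → α (suc j) ⋈? α zero))
    where
    none : ¬ (∃ λ j → α (suc j) ⋈ α zero) → ⊥
    none unpaired = 1≰0 (subst (1ℚ ≤_) (bal (α zero) (αU zero)) (≤-by (sum rest) (0≤sum 0≤rest) (cong (_+ sum rest) head≡1)))
      where
      rest : Fin (suc (d ℕ.* 2)) → ℚ
      rest j = balance (α zero) (α (suc j))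
      0≤rest : ∀ j → 0ℚ ≤ rest j
      0≤rest j = subst (0ℚ ≤_) (sym (trans (cong (λ z → 𝟙 (α (suc j) ≟ α zero) - z) (𝟙-no (α (suc j) ⋈? α zero) λ e → unpaired (j , e)))
        (ℚₚ.+-identityʳ (𝟙 (α (suc j) ≟ α zero))))) (0≤𝟙 (α (suc j) ≟ α zero))
      head≡1 : balance (α zero) (α zero) ≡ 1ℚ
      head≡1 = cong₂ _-_ (𝟙-yes (α zero ≟ α zero) refl) (𝟙-no (α zero ⋈? α zero) (⋈-irrefl (αU zero)))

    module _ (j : Fin (suc (d ℕ.* 2))) (opp : α (suc j) ⋈ α zero) where
      α′ : Fin (d ℕ.* 2) → A
      α′ i = α (suc (punchIn j i))

      bal′ : ∀ g → U g → sum (λ i → balance g (α′ i)) ≡ 0ℚ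
      bal′ g Ug = begin
        sum rest                                                 ≡⟨ sym (ℚₚ.+-identityˡ (sum rest)) ⟩
        0ℚ + sum rest                                            ≡⟨ cong (_+ sum rest) (sym (balance-opposite g (αU zero) (αU (suc j)) Ug (⋈-sym opp))) ⟩
        balance g (α zero) + balance g (α (suc j)) + sum rest    ≡⟨ ℚₚ.+-assoc (balance g (α zero)) (balance g (α (suc j))) (sum rest) ⟩
        balance g (α zero) + (balance g (α (suc j)) + sum rest)  ≡⟨ cong (balance g (α zero) +_) (sym (sum-remove {i = j} (λ i → balance g (α (suc i))))) ⟩
        sum (λ i → balance g (α i))                              ≡⟨ bal g Ug ⟩
        0ℚ                                                       ∎
        where
        open ≡-Reasoning
        rest : Fin (d ℕ.* 2) → ℚ
        rest i = balance g (α′ i)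

      extendPairing : Paired d α′ → Paired (suc d) α
      -- Position 0 keeps the head, position 1 receives its partner at `suc j`, and `π` acts on the
      -- remaining entries.
      extendPairing (π , paired) = Perm.lift₀ (Perm.insert zero j π) , λ
        { zero    → ⋈-sym opp
        ; (suc i) → subst₂ (λ x y → α (suc x) ⋈ α (suc y)) (sym (Perm.insert-punchIn zero j π (left {d} i))) (sym (Perm.insert-punchIn zero j π (right {d} i))) (paired i) }

    go : Dec (∃ λ j → α (suc j) ⋈ α zero) → Paired (suc d) α
    go (no unpaired)   = ⊥-elim (none unpaired)
    go (yes (j , opp)) = extendPairing j opp (pairing d (α′ j opp) (λ i → αU (suc (punchIn j i))) (bal′ j opp))

-- The two implications of the equivalence.

module Main (d n : ℕ) .{{_ : ℕ.NonZero n}} (a : Fin (d ℕ.* 2) → ℤ) (isolated : Isolated (d ℕ.* 2) n a) where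
  open Congruence n
  open Residue n

  α : Fin (d ℕ.* 2) → ℕ
  α i = residue (a i)

  α<n : ∀ i → α i ℕ.< n
  α<n i = residue<n (a i)

  α-unit : ∀ i → Coprime (α i) n
  α-unit i = residue-coprime (a i) (isolated i)

  1≤n : 1 ℕ.≤ n
  1≤n = ℕ.>-nonZero⁻¹ n

  unit*≢0 : ∀ {x t} → Coprime x n → t ℕ.% n ≢ 0 → (x ℕ.* t) ℕ.% n ≢ 0
  unit*≢0 {x} {t} c t≢0 e = t≢0 (ℕ∣.n∣m⇒m%n≡0 t n (Cop.coprime-divisor (Cop.sym c) (ℕ∣.m%n≡0⇒n∣m (x ℕ.* t) n e)))

  <⇒%≢0 : ∀ {t} → 1 ℕ.≤ t → t ℕ.< n → t ℕ.% n ≢ 0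
  <⇒%≢0 1≤t t<n e = ℕₚ.<⇒≢ 1≤t (sym (trans (sym (ℕ.m<n⇒m%n≡m t<n)) e))

  complement : ∀ x y → (x ℕ.+ y) ℕ.% n ≡ 0 → x ℕ.% n ≢ 0 → x ℕ.% n ℕ.+ y ℕ.% n ≡ n
  complement x y e x≢0 with ℕ∣.m%n≡0⇒n∣m (x ℕ.% n ℕ.+ y ℕ.% n) n (trans (sym (ℕ.%-distribˡ-+ x y n)) e)
  ... | ℕ∣.divides zero          f = ⊥-elim (x≢0 (ℕₚ.m+n≡0⇒m≡0 (x ℕ.% n) f))
  ... | ℕ∣.divides 1             f = trans f (ℕₚ.+-identityʳ n)
  ... | ℕ∣.divides (suc (suc j)) f = ⊥-elim (ℕₚ.<⇒≱ (ℕₚ.+-mono-< (ℕ.m%n<n x n) (ℕ.m%n<n y n)) (subst (n ℕ.+ n ℕ.≤_) (sym f) (ℕₚ.+-monoʳ-≤ n (ℕₚ.m≤m+n n (j ℕ.* n)))))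

  _⋈_ : ℕ → ℕ → Set
  x ⋈ y = (x ℕ.+ y) ℕ.% n ≡ 0

  _⋈?_ : ∀ x y → Dec (x ⋈ y)
  x ⋈? y = (x ℕ.+ y) ℕ.% n ℕ.≟ 0

  ⋈-sym : ∀ {x y} → x ⋈ y → y ⋈ x
  ⋈-sym {x} {y} e = trans (cong (ℕ._% n) (ℕₚ.+-comm y x)) e

  ⋈-unique : ∀ {x y z} → x ℕ.< n → z ℕ.< n → x ⋈ y → z ⋈ y → x ≡ z
  ⋈-unique {x} {y} {z} x<n z<n e f = trans (sym (ℕ.m<n⇒m%n≡m x<n)) (trans
    (trans (sym (shift x z f)) (trans (cong (ℕ._% n) (trans (cong (x ℕ.+_) (ℕₚ.+-comm z y)) (trans (sym (ℕₚ.+-assoc x y z)) (ℕₚ.+-comm (x ℕ.+ y) z)))) (shift z x e)))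
    (ℕ.m<n⇒m%n≡m z<n))
    where
    shift : ∀ a b → b ⋈ y → (a ℕ.+ (b ℕ.+ y)) ℕ.% n ≡ a ℕ.% n
    shift a b e = trans (ℕ.%-distribˡ-+ a (b ℕ.+ y) n) (trans (cong (λ w → (a ℕ.% n ℕ.+ w) ℕ.% n) e) (trans (cong (ℕ._% n) (ℕₚ.+-identityʳ (a ℕ.% n))) (ℕ.m%n%n≡m%n a n)))

  Σ% : ℕ → ℚ
  Σ% t = sum (λ i → ι ((α i ℕ.* t) ℕ.% n))

  fracSum≡ : ∀ t → fracSum (d ℕ.* 2) n a t ≡ Σ% t * rcp n
  fracSum≡ t = trans (sumFin≡sum (d ℕ.* 2) _) (trans (sum-ext λ i → frac-residue t (a i)) (sum-*ʳ (rcp n) (λ i → ι ((α i ℕ.* t) ℕ.% n))))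

  module Forward (mld : MLD≥ (d ℕ.* 2) n a d) where

    lower : ∀ t → 1 ℕ.≤ t → t ℕ.< n → ι d * ι n ≤ Σ% t
    lower t 1≤t t<n = subst (ι d * ι n ≤_) (trans (ℚₚ.*-assoc (Σ% t) (rcp n) (ι n)) (trans (cong (Σ% t *_) (trans (ℚₚ.*-comm (rcp n) (ι n)) (ι*rcp 1≤n))) (ℚₚ.*-identityʳ (Σ% t))))
      (*-monoʳ (0≤ι n) (subst₂ _≤_ (/1≡ιℤ (ℤ.+ d)) (fracSum≡ t) (mld t 1≤t t<n)))

    reflection : ∀ t → 1 ℕ.≤ t → t ℕ.< n → Σ% t + Σ% (n ℕ.∸ t) ≡ ι d * ι n + ι d * ι n
    reflection t 1≤t t<n = begin
      Σ% t + Σ% (n ℕ.∸ t)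
        ≡⟨ sym (sum-+ (λ i → ι ((α i ℕ.* t) ℕ.% n)) (λ i → ι ((α i ℕ.* (n ℕ.∸ t)) ℕ.% n))) ⟩
      sum (λ i → ι ((α i ℕ.* t) ℕ.% n) + ι ((α i ℕ.* (n ℕ.∸ t)) ℕ.% n))
        ≡⟨ sum-ext (λ i → trans (sym (ι-+ ((α i ℕ.* t) ℕ.% n) ((α i ℕ.* (n ℕ.∸ t)) ℕ.% n))) (cong ι (complement (α i ℕ.* t) (α i ℕ.* (n ℕ.∸ t))
             (trans (cong (ℕ._% n) (trans (sym (ℕₚ.*-distribˡ-+ (α i) t (n ℕ.∸ t))) (cong (α i ℕ.*_) (ℕₚ.m+[n∸m]≡n (ℕₚ.<⇒≤ t<n))))) (ℕ.m*n%n≡0 (α i) n))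
             (unit*≢0 (α-unit i) (<⇒%≢0 1≤t t<n))))) ⟩
      sum {d ℕ.* 2} (λ _ → ι n)
        ≡⟨ trans (sum-const (d ℕ.* 2) (ι n)) (cong (_* ι n) (ι-* d 2)) ⟩
      ι d * ι 2 * ι n
        ≡⟨ solve 2 (λ d n → d :* con (ι 2) :* n := d :* n :+ d :* n) refl (ι d) (ι n) ⟩
      ι d * ι n + ι d * ι n ∎
      where open ≡-Reasoning

    exact : ∀ t → 1 ℕ.≤ t → t ℕ.< n → Σ% t ≡ ι d * ι n
    exact t 1≤t t<n = ℚₚ.≤-antisym (≤-by (Σ% (n ℕ.∸ t) - ι d * ι n) (0≤-diff (lower (n ℕ.∸ t) (ℕₚ.m<n⇒0<n∸m t<n) (ℕₚ.∸-monoʳ-< {n} {t} {0} 1≤t (ℕₚ.<⇒≤ t<n))))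
        (trans (solve 1 (λ x → x := x :+ x :- x) refl (ι d * ι n)) (trans (cong (_- ι d * ι n) (sym (reflection t 1≤t t<n))) (ℚₚ.+-assoc (Σ% t) (Σ% (n ℕ.∸ t)) (- (ι d * ι n))))))
      (lower t 1≤t t<n)

    sawtooth : ∀ z → z ℕ.% n ≢ 0 → ∑ (d ℕ.* 2) (λ i → ι ((extend 1 α i ℕ.* z) ℕ.% n)) ≡ ι d * ι n
    sawtooth z z≢0 = trans (∑-extend (d ℕ.* 2) (λ x → ι ((x ℕ.* z) ℕ.% n)) 1 α)
      (trans (sum-ext λ i → cong ι (≈-* {α i} {α i} {z} {z ℕ.% n} refl (sym (%-≈ z)))) (exact (z ℕ.% n) (ℕₚ.n≢0⇒n>0 z≢0) (ℕ.m%n<n z n)))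

    balanced : 2 ℕ.≤ n → ∀ g → g ℕ.< n → Coprime g n → sum (λ i → 𝟙 (α i ℕ.≟ g) - 𝟙 (α i ⋈? g)) ≡ 0ℚ
    balanced 2≤n g g<n cg = trans (sum-ext λ i → cong₂ _-_
        (cong₂ (λ x y → 𝟙 (x ℕ.≟ y)) (sym (trans (cong (ℕ._% n) (ℕₚ.*-identityʳ (α i))) (ℕ.m<n⇒m%n≡m (α<n i)))) (sym (ℕ.m<n⇒m%n≡m g<n)))
        (cong (λ x → 𝟙 ((x ℕ.+ g) ℕ.% n ℕ.≟ 0)) (sym (ℕₚ.*-identityʳ (α i)))))
      (trans (sym (∑-extend (d ℕ.* 2) φ 1 α))
        (Symmetry.symmetric n 2≤n (d ℕ.* 2) (extend 1 α) (extend-all (λ x → Coprime x n) (Cop.1-coprimeTo n) α-unit) (ι d * ι n) sawtooth g g<n cg))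
      where
      φ : ℕ → ℚ
      φ x = 𝟙 ((x ℕ.* 1) ℕ.% n ℕ.≟ g ℕ.% n) - 𝟙 ((x ℕ.* 1 ℕ.+ g) ℕ.% n ℕ.≟ 0)

    -- For n ≤ 2 every unit is its own opposite, so `⋈-irrefl` fails and the balances are 0 whatever
    -- the weights. But then all weights have residue n - 1, and any order pairs them.
    small : n ℕ.≤ 2 → ∀ i j → (α i ℕ.+ α j) ℕ.% n ≡ 0
    small n≤2 i j = ℕ∣.n∣m⇒m%n≡0 _ n (subst (n ∣_) (sym (cong₂ ℕ._+_ (α≡ i) (α≡ j))) n∣2m)
      where
      m = n ℕ.∸ 1
      α≡ : ∀ i → α i ≡ m
      α≡ i = ℕₚ.≤-antisym (ℕₚ.≤-pred (subst (suc (α i) ℕ.≤_) (sym (ℕₚ.m+[n∸m]≡n 1≤n)) (α<n i))) (ge (α i) (α-unit i))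
        where
        ge : ∀ x → Coprime x n → m ℕ.≤ x
        ge zero    c = ℕₚ.≤-reflexive (cong (ℕ._∸ 1) (Cop.0-coprimeTo-m⇒m≡1 c))
        ge (suc x) c = ℕₚ.≤-trans (ℕₚ.∸-monoˡ-≤ 1 n≤2) (s≤s z≤n)
      n∣2m : n ∣ m ℕ.+ m
      n∣2m = go n 1≤n n≤2
        where
        go : ∀ k → 1 ℕ.≤ k → k ℕ.≤ 2 → k ∣ (k ℕ.∸ 1) ℕ.+ (k ℕ.∸ 1)
        go 1 _ _ = 1 ℕ∣.∣0
        go 2 _ _ = ℕ∣.∣-refl
        go (suc (suc (suc _))) _ (s≤s (s≤s ()))

    pairsUp : PairsUp d n a
    pairsUp = go (n ℕ.≤? 2)
      where
      finish : (∃ λ (π : Permutation′ (d ℕ.* 2)) → ∀ (i : Fin d) → α (π ⟨$⟩ʳ left {d} i) ⋈ α (π ⟨$⟩ʳ right {d} i)) → PairsUp d n a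
      finish (π , paired) = π , λ i → ∣-from-residues (a (π ⟨$⟩ʳ left {d} i)) (a (π ⟨$⟩ʳ right {d} i)) (paired i)
      large : 3 ℕ.≤ n → PairsUp d n a
      large 3≤n = finish (Pairing.pairing ℕ._≟_ _⋈_ _⋈?_ (λ x → x ℕ.< n × Coprime x n) (λ {x} {y} → ⋈-sym {x} {y})
        (λ {x} {y} {z} (x<n , _) (z<n , _) → ⋈-unique {x} {y} {z} x<n z<n) (λ {x} (_ , c) → 2x≢0 x c) d α (λ i → α<n i , α-unit i)
        (λ g (g<n , c) → balanced (ℕₚ.≤-trans (ℕₚ.n≤1+n 2) 3≤n) g g<n c))
        where
        2x≢0 : ∀ x → Coprime x n → (x ℕ.+ x) ℕ.% n ≢ 0
        2x≢0 x c e = unit*≢0 {x} {2} c (<⇒%≢0 (s≤s z≤n) 3≤n) (trans (cong (ℕ._% n) (trans (ℕₚ.*-comm x 2) (cong (x ℕ.+_) (ℕₚ.+-identityʳ x)))) e)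
      go : Dec (n ℕ.≤ 2) → PairsUp d n a
      go (yes n≤2) = finish (Perm.id , λ i → small n≤2 (left {d} i) (right {d} i))
      go (no  n≰2) = large (ℕₚ.≰⇒> n≰2)

  -- The residues of xt and yt for a pair are nonzero and add up to n, so each pair contributes
  -- exactly 1 and the bound is attained at every t.
  backward : PairsUp d n a → MLD≥ (d ℕ.* 2) n a d
  backward (π , paired) t 1≤t t<n = ≤-reflexive (sym (begin
    fracSum (d ℕ.* 2) n a t                                   ≡⟨ fracSum≡ t ⟩
    Σ% t * rcp n                                              ≡⟨ cong (_* rcp n) (trans (sum-permute G π) (sum-pairs d (G ∘ (π ⟨$⟩ʳ_)) (ι n) pair)) ⟩
    ι d * ι n * rcp n                                         ≡⟨ trans (ℚₚ.*-assoc (ι d) (ι n) (rcp n)) (trans (cong (ι d *_) (ι*rcp 1≤n)) (ℚₚ.*-identityʳ (ι d))) ⟩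
    ι d                                                       ≡⟨ sym (/1≡ιℤ (ℤ.+ d)) ⟩
    (ℤ.+ d) ℚ./ 1                                             ∎))
    where
    open ≡-Reasoning
    G : Fin (d ℕ.* 2) → ℚ
    G i = ι ((α i ℕ.* t) ℕ.% n)
    pair : ∀ i → G (π ⟨$⟩ʳ left {d} i) + G (π ⟨$⟩ʳ right {d} i) ≡ ι n
    pair i = trans (sym (ι-+ ((x ℕ.* t) ℕ.% n) ((y ℕ.* t) ℕ.% n))) (cong ι (complement (x ℕ.* t) (y ℕ.* t)
      (trans (cong (ℕ._% n) (sym (ℕₚ.*-distribʳ-+ t x y))) (trans (ℕ.%-distribˡ-* (x ℕ.+ y) t n)
        (trans (cong (λ z → (z ℕ.* (t ℕ.% n)) ℕ.% n) (∣-to-residues (a (π ⟨$⟩ʳ left {d} i)) (a (π ⟨$⟩ʳ right {d} i)) (paired i))) (ℕ.m<n⇒m%n≡m 1≤n))))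
      (unit*≢0 (α-unit (π ⟨$⟩ʳ left {d} i)) (<⇒%≢0 1≤t t<n))))
      where
      x = α (π ⟨$⟩ʳ left {d} i)
      y = α (π ⟨$⟩ʳ right {d} i)

theorem1p12 : (d n : ℕ) → 1 ℕ.≤ d → .{{_ : ℕ.NonZero n}} → (a : Fin (d Data.Nat.* 2) → ℤ) →
    Isolated (d Data.Nat.* 2) n a → Gorenstein (d Data.Nat.* 2) n a →
    (MLD≥ (d Data.Nat.* 2) n a d → PairsUp d n a) × (PairsUp d n a → MLD≥ (d Data.Nat.* 2) n a d)
theorem1p12 d n _ a isolated _ = Main.Forward.pairsUp d n a isolated , Main.backward d n a isolated
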